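{- The product version of Milliken's tree theorem for height $2$ ($\mathsf{PMT}^2$) admits cone avoidance: for all sets $A,C$ with $C\not\le_T A$, every $A$-computable instance of $\mathsf{PMT}^2$ has a solution $Y$ with $C\not\le_T A\oplus Y$.
   Context: Trees. A tree is a nonempty $T\subseteq\omega^{<\omega}$ with a root $\rho\preceq\sigma$ for all $\sigma\in T$, closed under meets $\sigma\wedge\tau$, with finitely many direct extensions in $T$ of each node (not necessarily downward closed). Level of $\sigma$: $|\{\tau\in T:\tau\prec\sigma\}|$; $T(m)$: nodes at level $m$; height: least ordinal exceeding all levels; $k$-branching: exactly $k$ direct extensions; leaf: $0$-branching. A tree $S$ of height $\alpha\le\omega$ is a strong subtree of $T$ if $S\subseteq T$, some $g:\alpha\to\omega$ has $S(m)\subseteq T(g(m))$ for $m<\alpha$, and nodes of $S$ not at level $\alpha-1$ are $k$-branching in $S$ iff in $T$. $\mathcal S_\alpha(T_0,\dots,T_{d-1})$: tuples of strong subtrees of height $\alpha$ of the $T_i$ with a common level function. $T$ is $b$-bounded if $\sigma(i)<b(i)$ for all $\sigma\in T$, $i<|\sigma|$. $\mathsf{PMT}^n$ as a problem: an instance is $\langle d,T_0,\dots,T_{d-1},b,f,k\rangle$ with $d,k\ge1$, the $T_i$ infinite $b$-bounded trees with no leaves, $f:\mathcal S_n(T_0,\dots,T_{d-1})\to k$; a solution is $(S_0,\dots,S_{d-1})\in\mathcal S_\omega(T_0,\dots,T_{d-1})$ with $f$ constant on $\mathcal S_n(S_0,\dots,S_{d-1})$. -}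

module Defs where

open import Data.Bool.Base using (if_then_else_)
open import Data.Fin.Base using (Fin; toℕ)
open import Data.List.Base using (List; []; _∷_; length; lookup)
import Data.List.Membership.Propositional as List
open import Data.List.Relation.Binary.Prefix.Heterogeneous using (Prefix)
open import Data.List.Relation.Unary.Unique.Propositional using (Unique)
open import Data.Nat.Base using (ℕ; zero; suc; _+_; _*_; _^_; _≤_; _<_; _/_; _%_; _≡ᵇ_)
open import Data.Nat.Properties using (m^n≢0)
open import Data.Product.Base using (Σ; ∃; ∃-syntax; _×_; _,_; proj₁; proj₂)
open import Data.Sum.Base using (_⊎_)
open import Data.Vec.Base as Vec using (Vec; []; _∷_; toList)
open import Data.Vec.Relation.Binary.Pointwise.Inductive using (Pointwise)
open import Function.Base using (_∘_)
open import Function.Bundles using (Func; _⇔_)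
open import Function.Construct.Composition using (_⇔-∘_)
open import Level using (Level; 0ℓ) renaming (suc to lsuc)
open import Relation.Binary.Bundles using (Setoid)
open import Relation.Binary.PropositionalEquality using (_≡_; _≢_; setoid)
open import Relation.Nullary.Construct.Add.Supremum using (_⁺; [_]; ⊤⁺)
open import Relation.Nullary.Negation.Core using (¬_)
open import Relation.Unary using (Pred; _∈_; _∉_; _⊆_; _≐_; ｛_｝)
open import Relation.Unary.Properties using (≐-refl; ≐-sym; ≐-trans)
open import Relation.Binary.Construct.Add.Supremum.Strict _<_ using (_<⁺_; [_]; [_]<⊤⁺)
open import Relation.Binary.Construct.Add.Supremum.NonStrict _≤_ using (_≤⁺_)

private variable
  n m : ℕ

------------------------------------------------------------------------
-- Turing reducibility, by partial recursive functions with an oracle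

data Rec : ℕ → Set where
  zer   : Rec n
  succ  : Rec 1
  proj  : Fin n → Rec n
  query : Rec 1
  comp  : Rec m → Vec (Rec n) m → Rec n
  prec  : Rec n → Rec (suc (suc n)) → Rec (suc n)
  mu    : Rec (suc n) → Rec n

infix 4 _⊢_⟨_⟩⇓_

-- A ⊢ e ⟨ xs ⟩⇓ y : with oracle A, the function e converges on xs to y.
data _⊢_⟨_⟩⇓_ (A : Pred ℕ 0ℓ) : Rec n → Vec ℕ n → ℕ → Set where
  zer⇓   : ∀ {xs : Vec ℕ n} → A ⊢ zer ⟨ xs ⟩⇓ 0
  succ⇓  : ∀ {x} → A ⊢ succ ⟨ x ∷ [] ⟩⇓ suc x
  proj⇓  : ∀ {i} {xs : Vec ℕ n} → A ⊢ proj i ⟨ xs ⟩⇓ Vec.lookup xs i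
  yes⇓   : ∀ {x} → x ∈ A → A ⊢ query ⟨ x ∷ [] ⟩⇓ 1
  no⇓    : ∀ {x} → x ∉ A → A ⊢ query ⟨ x ∷ [] ⟩⇓ 0
  comp⇓  : ∀ {e : Rec m} {es} {xs : Vec ℕ n} {ys y} →
           Pointwise (λ e′ y′ → A ⊢ e′ ⟨ xs ⟩⇓ y′) es ys →
           A ⊢ e ⟨ ys ⟩⇓ y → A ⊢ comp e es ⟨ xs ⟩⇓ y
  prec0⇓ : ∀ {e : Rec n} {e′ xs y} →
           A ⊢ e ⟨ xs ⟩⇓ y → A ⊢ prec e e′ ⟨ 0 ∷ xs ⟩⇓ y
  prec+⇓ : ∀ {e : Rec n} {e′ xs x y z} →
           A ⊢ prec e e′ ⟨ x ∷ xs ⟩⇓ y → A ⊢ e′ ⟨ x ∷ y ∷ xs ⟩⇓ z →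
           A ⊢ prec e e′ ⟨ suc x ∷ xs ⟩⇓ z
  mu⇓    : ∀ {e : Rec (suc n)} {xs y} →
           A ⊢ e ⟨ y ∷ xs ⟩⇓ 0 →
           (∀ {z} → z < y → ∃[ w ] A ⊢ e ⟨ z ∷ xs ⟩⇓ suc w) →
           A ⊢ mu e ⟨ xs ⟩⇓ y

infix 4 _≤T_

_≤T_ : Pred ℕ 0ℓ → Pred ℕ 0ℓ → Set
C ≤T A = ∃[ e ] ∀ x → (x ∈ C → A ⊢ e ⟨ x ∷ [] ⟩⇓ 1) × (x ∉ C → A ⊢ e ⟨ x ∷ [] ⟩⇓ 0)

infixl 6 _⊕_

_⊕_ : Pred ℕ 0ℓ → Pred ℕ 0ℓ → Pred ℕ 0ℓ
(A ⊕ B) x = (∃[ y ] x ≡ 2 * y × y ∈ A) ⊎ (∃[ y ] x ≡ suc (2 * y) × y ∈ B)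

------------------------------------------------------------------------
-- Trees

Str : Set
Str = List ℕ

infix 4 _⪯_ _≺_

_⪯_ _≺_ : Str → Str → Set
_⪯_ = Prefix _≡_
σ ≺ τ = σ ⪯ τ × σ ≢ τ

infixr 6 _∧_

_∧_ : Str → Str → Str
[]      ∧ τ       = []
(x ∷ σ) ∧ []      = []
(x ∷ σ) ∧ (y ∷ τ) = if x ≡ᵇ y then x ∷ (σ ∧ τ) else []

Finite : Pred Str 0ℓ → Set
Finite X = ∃[ σs ] X ⊆ (List._∈ σs)

HasSize : ℕ → Pred Str 0ℓ → Set
HasSize k X = ∃[ σs ] Unique σs × length σs ≡ k × X ≐ (List._∈ σs)

DirectExtensions : Pred Str 0ℓ → Str → Pred Str 0ℓ
DirectExtensions T σ τ = τ ∈ T × σ ≺ τ × (∀ {υ} → υ ∈ T → σ ≺ υ → ¬ υ ≺ τ)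

record IsTree (T : Pred Str 0ℓ) : Set where
  field
    root        : Str
    root∈       : root ∈ T
    root⪯       : ∀ {σ} → σ ∈ T → root ⪯ σ
    meet-closed : ∀ {σ τ} → σ ∈ T → τ ∈ T → σ ∧ τ ∈ T
    finite-ext  : ∀ {σ} → σ ∈ T → Finite (DirectExtensions T σ)

AtLevel : Pred Str 0ℓ → ℕ → Pred Str 0ℓ
AtLevel T m σ = σ ∈ T × HasSize m (λ τ → τ ∈ T × τ ≺ σ)

Branching : ℕ → Pred Str 0ℓ → Pred Str 0ℓ
Branching k T σ = HasSize k (DirectExtensions T σ)

-- The ordinals up to and including ω, which is ⊤⁺.
Height : Set
Height = ℕ ⁺

pattern ω = ⊤⁺

ExceedsLevels : Pred Str 0ℓ → Pred Height 0ℓ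
ExceedsLevels T α = ∀ {m σ} → σ ∈ AtLevel T m → [ m ] <⁺ α

HasHeight : Pred Str 0ℓ → Pred Height 0ℓ
HasHeight T α = α ∈ ExceedsLevels T × (∀ {β} → β ∈ ExceedsLevels T → α ≤⁺ β)

-- Only the values of the level function g below α matter.
record IsStrongSubtree (α : Height) (g : ℕ → ℕ) (S T : Pred Str 0ℓ) : Set where
  field
    isTree    : IsTree S
    height    : HasHeight S α
    ⊆T        : S ⊆ T
    levels    : ∀ {m} → [ m ] <⁺ α → AtLevel S m ⊆ AtLevel T (g m)
    branching : ∀ {m σ} → σ ∈ AtLevel S m → [ suc m ] ≢ α →
                ∀ k → Branching k S σ ⇔ Branching k T σ

Trees : ℕ → Set₁
Trees d = Fin d → Pred Str 0ℓ

AreStrongSubtrees : ∀ {d} → Height → Trees d → Trees d → Set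
AreStrongSubtrees α T S = ∃[ g ] ∀ i → IsStrongSubtree α g (S i) (T i)

-- A setoid, so that a function on 𝒮 α T depends only on the tuple of sets
-- and not on how its membership in 𝒮 α T is witnessed.
𝒮 : ∀ {d} → Height → Trees d → Setoid (lsuc 0ℓ) 0ℓ
𝒮 {d} α T = record
  { Carrier       = Σ (Trees d) (AreStrongSubtrees α T)
  ; _≈_           = λ S S′ → ∀ i → proj₁ S i ≐ proj₁ S′ i
  ; isEquivalence = record
    { refl  = λ i → ≐-refl
    ; sym   = λ p i → ≐-sym (p i)
    ; trans = λ p q i → ≐-trans (p i) (q i)
    }
  }

∣𝒮∣ : ∀ {d} → Height → Trees d → Set₁
∣𝒮∣ α T = Setoid.Carrier (𝒮 α T)

include : ∀ {d α} {T : Trees d} (S : ∣𝒮∣ ω T) → ∣𝒮∣ α (proj₁ S) → ∣𝒮∣ α T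
include (S , g , s) (U , h , u) = U , g ∘ h , λ i →
  let module S = IsStrongSubtree (s i)
      module U = IsStrongSubtree (u i)
  in record
    { isTree    = U.isTree
    ; height    = U.height
    ; ⊆T        = S.⊆T ∘ U.⊆T
    ; levels    = λ m<α σ∈ → S.levels [ _ ]<⊤⁺ (U.levels m<α σ∈)
    ; branching = λ σ∈ m≢ k →
        S.branching (U.levels (proj₁ U.height σ∈) σ∈) (λ ()) k
          ⇔-∘ U.branching σ∈ m≢ k
    }

Bounded : (ℕ → ℕ) → Pred Str 0ℓ → Set
Bounded b T = ∀ {σ} → σ ∈ T → ∀ i → lookup σ i < b (toℕ i)

------------------------------------------------------------------------
-- The product version of Milliken's tree theorem, as a problem

record Instance (n : ℕ) : Set₁ where
  field
    d k      : ℕ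
    1≤d      : 1 ≤ d
    1≤k      : 1 ≤ k
    T        : Trees d
    b        : ℕ → ℕ
    isTree   : ∀ i → IsTree (T i)
    infinite : ∀ i → ¬ Finite (T i)
    bounded  : ∀ i → Bounded b (T i)
    leafless : ∀ i {σ} → σ ∈ T i → ¬ Branching 0 (T i) σ
    f        : Func (𝒮 [ n ] T) (setoid (Fin k))

record Solution {n : ℕ} (I : Instance n) : Set₁ where
  open Instance I
  field
    S        : ∣𝒮∣ ω T
    color    : Fin k
    constant : (U : ∣𝒮∣ [ n ] (proj₁ S)) → Func.to f (include S U) ≡ color

------------------------------------------------------------------------
-- Instances and solutions as sets of natural numbers

-- Cantor's pairing function.
pair : ℕ → ℕ → ℕ
pair x y = ((x + y) * suc (x + y)) / 2 + y

encode : List ℕ → ℕ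
encode []       = 0
encode (x ∷ xs) = suc (pair x (encode xs))

codeTrees : ∀ {d} → Trees d → Pred ℕ 0ℓ
codeTrees T x = ∃[ i ] ∃[ σ ] σ ∈ T i × x ≡ pair (toℕ i) (encode σ)

codeSequence : (ℕ → ℕ) → Pred ℕ 0ℓ
codeSequence b x = ∃[ i ] x ≡ pair i (b i)

-- The finite set of strings whose canonical index is u, where the canonical
-- index of X is the sum of 2 ^ encode σ over σ ∈ X.
finiteSet : ℕ → Pred Str 0ℓ
finiteSet u σ = (_/_ u (2 ^ encode σ) {{m^n≢0 2 (encode σ)}}) % 2 ≡ 1

finiteTrees : ∀ {d} → Vec ℕ d → Trees d
finiteTrees us i = finiteSet (Vec.lookup us i)

-- The graph of f, each argument being given by the canonical indices of its
-- members.  A set computing this graph decides membership in the domain of f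
-- too, as it must when f is identified with its graph.
codeColoring : ∀ {d k n} {T : Trees d} → Func (𝒮 [ n ] T) (setoid (Fin k)) → Pred ℕ 0ℓ
codeColoring {d = d} {n = n} {T = T} f x =
  Σ (Vec ℕ d) λ us →
  Σ (AreStrongSubtrees [ n ] T (finiteTrees us)) λ p →
  x ≡ pair (encode (toList us)) (toℕ (Func.to f (finiteTrees us , p)))

codeInstance : Instance n → Pred ℕ 0ℓ
codeInstance I = ｛ pair d k ｝ ⊕ codeTrees T ⊕ codeSequence b ⊕ codeColoring f
  where open Instance I

codeSolution : {I : Instance n} → Solution I → Pred ℕ 0ℓ
codeSolution Y = codeTrees (proj₁ (Solution.S Y))

{-# OPTIONS --safe #-}
-- Nodes of the trees T 0, …, T (d - 1) are coded by numbers, which turns an instance into a forest whose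
-- branching is computable from the graph of f: the canonical index of a height-2 strong subtree with a given
-- root bounds the direct extensions of that root. A height-2 tuple is then a tuple of nodes on one level
-- together with one leaf above each of their direct extensions, all on one level.
--
-- Two forcing constructions, both with finite chains of levels and a reservoir of extensions as conditions,
-- produce strong subforests that do not help to compute C. The first makes f(x⃗, ·) eventually constant on each
-- tuple x⃗ of roots. The second is strong cone avoidance for the Halpern–Läuchli theorem, applied to the limit
-- colour, which need not be computable. A computable thinning then makes f constant.
--
-- To decide whether a finite extension can force a wrong value of a computation, one asks whether every
-- colouring admits one. A negative answer is a Π⁰₁ class of colourings, and the cone avoidance basis theorem
-- supplies a member that does not help to compute C, along which the reservoir is homogenized. Homogenization
-- is the Halpern–Läuchli theorem for level-uniform sections, proved by induction on the number of trees.
module Submission where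

open import Defs
open import Axiom.ExcludedMiddle using (ExcludedMiddle)
open import Data.Nat.Base using (ℕ)
open import Data.Product.Base using (Σ)
open import Level using (0ℓ)
open import Relation.Nullary.Negation.Core using (¬_)
open import Relation.Unary using (Pred)

open import Data.Bool.Base using (Bool; false; true)
open import Data.Empty using (⊥; ⊥-elim)
open import Data.List.Base
  using (List; []; _++_; _∷_; allFin; cartesianProduct; concat; concatMap; foldl; foldr; length; map;
    reverse; upTo)
open import Data.List.Membership.Propositional using (_∈_)
open import Data.List.Membership.Propositional.Properties
  using (∈-++⁺ʳ; ∈-++⁺ˡ; ∈-++⁻; ∈-allFin; ∈-cartesianProduct⁺; ∈-cartesianProduct⁻; ∈-concatMap⁺;
    ∈-concatMap⁻; ∈-concat⁺′; ∈-concat⁻′; ∈-map⁺; ∈-map⁻; ∈-upTo⁺; ∈-upTo⁻; ∈-∃++)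
open import Data.List.Properties
  using (++-assoc; ++-identityʳ; concat-map-[_]; concatMap-++; length-++; length-map; map-id; map-∘;
    reverse-foldl)
open import Data.List.Relation.Unary.Any using (Any; here; there)
open import Data.List.Relation.Unary.Unique.Propositional using (Unique)
open import Data.Nat.Base
  using (>-nonZero; _%_; _*_; _+_; _/_; _<_; _^_; _∸_; _≡ᵇ_; _≤_; _⊔_; pred; suc; s≤s; zero; z≤n)
open import Data.Nat.Properties
open import Data.Product.Base using (_,_; _×_; ∃; ∃-syntax) renaming (proj₁ to fst; proj₂ to snd)
open import Data.Sum.Base using ([_,_]′; _⊎_; inj₁; inj₂)
open import Data.Unit.Base using (tt; ⊤)
open import Function.Base using (_∘_; id)
open import Relation.Binary.PropositionalEquality hiding (J)
open import Relation.Nullary using (Dec; no; yes)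
open import Relation.Unary using (_≐_)

-- A limit colour may be far from computable, so no question asked during the construction may refer
-- to it. The questions range over all colourings instead, and the given one enters only when every
-- colouring answers positively; in the negative case a join with one tame colouring is the whole
-- cost. Strong subtrees share a level function. Hence reservoirs consist of sections of uniform
-- height, one for each level, and the Halpern-Läuchli theorem is needed for colourings that may
-- change with the level. Its sections carry no computability, but homogeneity on one level concerns
-- finitely many nodes, so a section that works there is a finite list and is found by search.
-- Finite computations survive because codes increase along descents: once all further nodes lie
-- deep enough, they cannot affect the oracle below a given use. For pairs, adding a level commits
-- the colours of its tuples with all later leaves. Such a commitment needs a homogenization that is
-- fixed only up to a bound, and this bound comes from the compactness of the question, before the
-- homogenization is chosen.

module ListLemmas where
 open import Data.List.Relation.Binary.Pointwise.Base using (Pointwise; []; _∷_)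
 open import Data.List.Relation.Unary.All using (All; []; _∷_)
 open import Data.List.Relation.Unary.AllPairs using ([]; _∷_)
 import Data.List.Relation.Unary.Any as Any

 by-contra : ExcludedMiddle 0ℓ → {P : Set} → ¬ ¬ P → P
 by-contra em {P} h with em {P}
 ... | yes p = p
 ... | no ¬p = ⊥-elim (h ¬p)

 pw-map : ∀ {A B A′ B′ : Set} {R : A → B → Set} {S : A′ → B′ → Set} {f : A → A′} {g : B → B′} →
  (∀ {x y} → R x y → S (f x) (g y)) → ∀ {xs ys} → Pointwise R xs ys → Pointwise S (map f xs) (map g ys)
 pw-map h [] = []
 pw-map h (r ∷ rs) = h r ∷ pw-map h rs

 pw-trans : ∀ {A B C : Set} {R : A → B → Set} {S : B → C → Set} {T : A → C → Set} →
  (∀ {x y z} → R x y → S y z → T x z) →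
  ∀ {xs ys zs} → Pointwise R xs ys → Pointwise S ys zs → Pointwise T xs zs
 pw-trans h []       [] = []
 pw-trans h (r ∷ rs) (s ∷ ss) = h r s ∷ pw-trans h rs ss

 pw-graph : ∀ {A B : Set} {R : A → B → Set} {f : A → B} → (∀ x → R x (f x)) →
  ∀ xs → Pointwise R xs (map f xs)
 pw-graph h [] = []
 pw-graph h (x ∷ xs) = h x ∷ pw-graph h xs

 pw-length : ∀ {A B : Set} {R : A → B → Set} {xs ys} → Pointwise R xs ys → length xs ≡ length ys
 pw-length [] = refl
 pw-length (r ∷ rs) = cong suc (pw-length rs)

 pw-∈ˡ : ∀ {A B : Set} {R : A → B → Set} {xs ys} → Pointwise R xs ys → ∀ {x} → x ∈ xs →
  ∃[ y ] y ∈ ys × R x y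
 pw-∈ˡ (r ∷ rs) (here refl) = _ , here refl , r
 pw-∈ˡ (r ∷ rs) (there x∈) = let y , y∈ , s = pw-∈ˡ rs x∈ in y , there y∈ , s

 pw-∈ʳ : ∀ {A B : Set} {R : A → B → Set} {xs ys} → Pointwise R xs ys → ∀ {y} → y ∈ ys →
  ∃[ x ] x ∈ xs × R x y
 pw-∈ʳ (r ∷ rs) (here refl) = _ , here refl , r
 pw-∈ʳ (r ∷ rs) (there x∈) = let y , y∈ , s = pw-∈ʳ rs x∈ in y , there y∈ , s

 pw-imp : ∀ {A B : Set} {R S : A → B → Set} → (∀ {x y} → R x y → S x y) →
  ∀ {xs ys} → Pointwise R xs ys → Pointwise S xs ys
 pw-imp h [] = []
 pw-imp h (r ∷ rs) = h r ∷ pw-imp h rs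

 pw-imp∈ : ∀ {A B : Set} {R S : A → B → Set} {xs} → (∀ {x y} → x ∈ xs → R x y → S x y) →
  ∀ {ys} → Pointwise R xs ys → Pointwise S xs ys
 pw-imp∈ h [] = []
 pw-imp∈ h (r ∷ rs) = h (here refl) r ∷ pw-imp∈ (h ∘ there) rs

 map-cong∈ : ∀ {A B : Set} {f g : A → B} (xs : List A) → (∀ {x} → x ∈ xs → f x ≡ g x) →
  map f xs ≡ map g xs
 map-cong∈ []       h = refl
 map-cong∈ (x ∷ xs) h = cong₂ _∷_ (h (here refl)) (map-cong∈ xs (h ∘ there))

 prod : ∀ {A : Set} → List (List A) → List (List A)
 prod [] = [] ∷ []
 prod (xs ∷ xss) = concatMap (λ x → map (x ∷_) (prod xss)) xs

 ∈-prod⁺ : ∀ {A : Set} {xss : List (List A)} {ys} → Pointwise (λ xs y → y ∈ xs) xss ys → ys ∈ prod xss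
 ∈-prod⁺ [] = here refl
 ∈-prod⁺ {xss = xs ∷ xss} {y ∷ ys} (r ∷ rs) =
  ∈-concatMap⁺ (λ x → map (x ∷_) (prod xss)) (Any.map (λ { refl → ∈-map⁺ (y ∷_) (∈-prod⁺ rs) }) r)

 ∈-prod⁻ : ∀ {A : Set} (xss : List (List A)) {ys} → ys ∈ prod xss → Pointwise (λ xs y → y ∈ xs) xss ys
 ∈-prod⁻ []         (here refl) = []
 ∈-prod⁻ (xs ∷ xss) ys∈ with ∈-concatMap⁻ (λ x → map (x ∷_) (prod xss)) {xs = xs} ys∈
 ... | p = go p
  where
  go : ∀ {xs′ ys} → Any (λ x → ys ∈ map (x ∷_) (prod xss)) xs′ → Pointwise (λ xs y → y ∈ xs) (xs′ ∷ xss) ys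
  go (here q) with ∈-map⁻ (_ ∷_) q
  ... | _ , q′ , refl = here refl ∷ ∈-prod⁻ xss q′
  go (there q) with go q
  ... | r ∷ rs = there r ∷ rs

 ∈-concatMap : ∀ {A B : Set} {f : A → List B} {x y} {xs : List A} → x ∈ xs → y ∈ f x → y ∈ concatMap f xs
 ∈-concatMap {f = f} x∈ y∈ = ∈-concatMap⁺ f (Any.map (λ { refl → y∈ }) x∈)

 ∈-concatMap′ : ∀ {A B : Set} {f : A → List B} {y} (xs : List A) → y ∈ concatMap f xs →
  ∃[ x ] x ∈ xs × y ∈ f x
 ∈-concatMap′ {f = f} xs y∈ = find (∈-concatMap⁻ f {xs = xs} y∈)
  where
  find : ∀ {xs′ y} → Any (λ x → y ∈ f x) xs′ → ∃[ x ] x ∈ xs′ × y ∈ f x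
  find (here q) = _ , here refl , q
  find (there q) = let x , x∈ , r = find q in x , there x∈ , r

 bounded-∀ : ∀ {A : Set} {P : A → ℕ → Set} → (∀ {a m n} → m ≤ n → P a m → P a n) →
  ∀ xs → (∀ {a} → a ∈ xs → ∃[ n ] P a n) → ∃[ n ] ∀ {a} → a ∈ xs → P a n
 bounded-∀ mono []       h = 0 , λ ()
 bounded-∀ mono (x ∷ xs) h =
  let m , p = h (here refl)
      n , q = bounded-∀ mono xs (h ∘ there)
  in m ⊔ n , λ { (here refl) → mono (m≤m⊔n m n) p ; (there a∈) → mono (m≤n⊔m m n) (q a∈) }

 -- The finite step of the density arguments below: each requirement is dense below `t` and persists
 -- under `≤′`, so the requirements on the list are met one after another.
 meet-all : ∀ {S A : Set} {_≤′_ : S → S → Set} {P : A → S → Set} →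
  (∀ {s} → s ≤′ s) → (∀ {s t u} → s ≤′ t → t ≤′ u → s ≤′ u) →
  (∀ {a s t} → s ≤′ t → P a t → P a s) →
  ∀ xs → ∀ t → (∀ {a} → a ∈ xs → ∀ s → s ≤′ t → ∃[ s′ ] s′ ≤′ s × P a s′) →
  ∃[ s ] s ≤′ t × (∀ {a} → a ∈ xs → P a s)
 meet-all r tr her []       t h = t , r , λ ()
 meet-all r tr her (x ∷ xs) t h =
  let s , s≤t , p = h (here refl) t r
      u , u≤s , q = meet-all r tr her xs s (λ a∈ v v≤s → h (there a∈) v (tr v≤s s≤t))
  in u , tr u≤s s≤t , λ { (here refl) → her u≤s p ; (there a∈) → q a∈ }

 update : ∀ {A B : Set} (em : ExcludedMiddle 0ℓ) → A → B → (A → B) → A → B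
 update em a b f x with em {x ≡ a}
 ... | yes _ = b
 ... | no _ = f x

 -- Turns a tuple of targets into one function on all nodes, as sections have to be total.
 -- Distinctness of `xs` keeps the updates from overwriting one another.
 realize : ∀ {A B : Set} (em : ExcludedMiddle 0ℓ) {R : A → B → Set} {xs ys} → Unique xs →
  Pointwise R xs ys → (f : A → B) → (∀ x → R x (f x)) →
  ∃[ g ] (∀ x → R x (g x)) × map g xs ≡ ys
 realize em []        []       f h = f , h , refl
 realize {A} {B} em {R} {x ∷ xs} {y ∷ ys} (x∉ ∷ u) (r ∷ rs) f h =
  let g , hg , e = realize em u rs f h
  in update em x y g , (λ z → lem g hg z) , cong₂ _∷_ (same g) (trans (map-cong∈ xs (other g x∉)) e)
  where
  lem : ∀ g → (∀ z → R z (g z)) → ∀ z → R z (update em x y g z)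
  lem g hg z with em {z ≡ x}
  ... | yes refl = r
  ... | no _ = hg z
  same : ∀ g → update em x y g x ≡ y
  same g with em {x ≡ x}
  ... | yes _ = refl
  ... | no ¬p = ⊥-elim (¬p refl)
  other : ∀ g {zs} → All (λ w → ¬ x ≡ w) zs → ∀ {z} → z ∈ zs → update em x y g z ≡ g z
  other g (p ∷ _) {z} (here refl) with em {z ≡ x}
  ... | yes q = ⊥-elim (p (sym q))
  ... | no _ = refl
  other g (_ ∷ ps) (there z∈) = other g ps z∈

-- Oracle computability of numerical functions and Cantor's pairing

module Programs where
 open import Data.Fin.Base using (Fin; zero; suc)
 open import Data.Nat.DivMod using (m*n/n≡m)
 open import Data.Nat.Tactic.RingSolver using (solve-∀)
 open import Data.Vec.Base using (Vec; []; _∷_; head; tail; tabulate; lookup)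
 open import Data.Vec.Properties using (tabulate∘lookup)
 open import Data.Vec.Relation.Binary.Pointwise.Inductive using (Pointwise; []; _∷_)

 -- Oracles are Boolean-valued, so that they form a small set.
 Orc : Set
 Orc = ℕ → Bool

 ⌞_⌟ : Orc → Pred ℕ 0ℓ
 ⌞ X ⌟ n = X n ≡ true

 record V (X : Orc) (n : ℕ) (f : Vec ℕ n → ℕ) : Set where
  constructor mkV
  field
   prog : Rec n
   runs : ∀ xs → ⌞ X ⌟ ⊢ prog ⟨ xs ⟩⇓ f xs
 open V

 record Vs (X : Orc) (n m : ℕ) (F : Vec ℕ n → Vec ℕ m) : Set where
  constructor mkVs
  field
   progs : Vec (Rec n) m
   run : ∀ xs → Pointwise (λ e y → ⌞ X ⌟ ⊢ e ⟨ xs ⟩⇓ y) progs (F xs)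
 open Vs

 -- Records instead of synonyms, because unification cannot recover `f` from `f (head xs)`.
 record V1 (X : Orc) (f : ℕ → ℕ) : Set where
  constructor mk1
  field v : V X 1 (λ xs → f (head xs))

 record V2 (X : Orc) (f : ℕ → ℕ → ℕ) : Set where
  constructor mk2
  field v : V X 2 (λ xs → f (head xs) (head (tail xs)))

 record V3 (X : Orc) (f : ℕ → ℕ → ℕ → ℕ) : Set where
  constructor mk3
  field v : V X 3 (λ xs → f (head xs) (head (tail xs)) (head (tail (tail xs))))

 nrec : ∀ {A : Set} → A → (ℕ → A → A) → ℕ → A
 nrec z s zero = z
 nrec z s (suc n) = s n (nrec z s n)

 ifz : ℕ → ℕ → ℕ → ℕ
 ifz zero    a b = a
 ifz (suc _) a b = b

 false≢true : ¬ false ≡ true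
 false≢true ()

 bit : Bool → ℕ
 bit true = 1
 bit false = 0

 module _ {X : Orc} where

  v-cast : ∀ {n f g} → (∀ xs → f xs ≡ g xs) → V X n f → V X n g
  v-cast h (mkV p r) = mkV p λ xs → subst (λ y → ⌞ X ⌟ ⊢ p ⟨ xs ⟩⇓ y) (h xs) (r xs)

  vs-cast : ∀ {n m F G} → (∀ xs → F xs ≡ G xs) → Vs X n m F → Vs X n m G
  vs-cast h (mkVs p r) = mkVs p λ xs → subst (Pointwise _ p) (h xs) (r xs)

  v-proj : ∀ {n} (i : Fin n) → V X n (λ v → lookup v i)
  v-proj i = mkV (proj i) λ xs → proj⇓

  v0 : ∀ {n} → V X (suc n) head
  v0 = mkV (proj zero) λ { (x ∷ xs) → proj⇓ }
  v1 : ∀ {n} → V X (suc (suc n)) (λ v → head (tail v))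
  v1 = mkV (proj (suc zero)) λ { (x ∷ y ∷ xs) → proj⇓ }
  v2 : ∀ {n} → V X (suc (suc (suc n))) (λ v → head (tail (tail v)))
  v2 = mkV (proj (suc (suc zero))) λ { (x ∷ y ∷ z ∷ xs) → proj⇓ }
  v3 : ∀ {n} → V X (suc (suc (suc (suc n)))) (λ v → head (tail (tail (tail v))))
  v3 = mkV (proj (suc (suc (suc zero)))) λ { (x ∷ y ∷ z ∷ w ∷ xs) → proj⇓ }

  vs-nil : ∀ {n} → Vs X n 0 (λ _ → [])
  vs-nil = mkVs [] λ _ → []

  infixr 5 _∷ᵥ_
  _∷ᵥ_ : ∀ {n m f F} → V X n f → Vs X n m F → Vs X n (suc m) (λ v → f v ∷ F v)
  mkV p r ∷ᵥ mkVs ps rs = mkVs (p ∷ ps) λ xs → r xs ∷ rs xs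

  vs-proj : ∀ {n m} (g : Fin m → Fin n) → Vs X n m (λ v → tabulate (lookup v ∘ g))
  vs-proj {n} {m} g = mkVs (tabulate (proj ∘ g)) (λ xs → go xs g)
   where
   go : ∀ {m} xs (g : Fin m → Fin n) →
    Pointwise (λ e y → ⌞ X ⌟ ⊢ e ⟨ xs ⟩⇓ y) (tabulate (proj ∘ g)) (tabulate (lookup xs ∘ g))
   go {zero}  xs g = []
   go {suc m} xs g = proj⇓ ∷ go xs (g ∘ suc)

  vs-tail2 : ∀ {n} → Vs X (suc (suc n)) n (λ v → tail (tail v))
  vs-tail2 = vs-cast (λ { (x ∷ y ∷ xs) → tabulate∘lookup xs }) (vs-proj (λ i → suc (suc i)))

  vs-tail3 : ∀ {n} → Vs X (suc (suc (suc n))) n (λ v → tail (tail (tail v)))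
  vs-tail3 = vs-cast (λ { (x ∷ y ∷ z ∷ xs) → tabulate∘lookup xs }) (vs-proj (λ i → suc (suc (suc i))))

  vs-tail4 : ∀ {n} → Vs X (suc (suc (suc (suc n)))) n (λ v → tail (tail (tail (tail v))))
  vs-tail4 = vs-cast (λ { (x ∷ y ∷ z ∷ w ∷ xs) → tabulate∘lookup xs }) (vs-proj (λ i → suc (suc (suc (suc i)))))

  v-comp : ∀ {n m g F} → V X m g → Vs X n m F → V X n (λ v → g (F v))
  v-comp (mkV p r) (mkVs ps rs) = mkV (comp p ps) λ xs → comp⇓ (rs xs) (r _)

  c1 : ∀ {n g f} → V1 X g → V X n f → V X n (λ v → g (f v))
  c1 (mk1 g) f = v-comp g (f ∷ᵥ vs-nil)

  c2 : ∀ {n g f h} → V2 X g → V X n f → V X n h → V X n (λ v → g (f v) (h v))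
  c2 (mk2 g) f h = v-comp g (f ∷ᵥ h ∷ᵥ vs-nil)

  c3 : ∀ {n g f h k} → V3 X g → V X n f → V X n h → V X n k → V X n (λ v → g (f v) (h v) (k v))
  c3 (mk3 g) f h k = v-comp g (f ∷ᵥ h ∷ᵥ k ∷ᵥ vs-nil)

  v-zero : ∀ {n} → V X n (λ _ → 0)
  v-zero = mkV zer λ _ → zer⇓

  v-suc : V1 X suc
  v-suc = mk1 (mkV succ λ { (x ∷ []) → succ⇓ })

  v-const : ∀ {n} k → V X n (λ _ → k)
  v-const zero = v-zero
  v-const (suc k) = c1 v-suc (v-const k)

  v-rec : ∀ {n f h} → V X n f → V X (suc (suc n)) h →
   V X (suc n) (λ v → nrec (f (tail v)) (λ i a → h (i ∷ a ∷ tail v)) (head v))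
  v-rec {n} {f} {h} (mkV p r) (mkV p′ r′) = mkV (prec p p′) λ { (k ∷ xs) → go k xs }
   where
   go : ∀ k xs → ⌞ X ⌟ ⊢ prec p p′ ⟨ k ∷ xs ⟩⇓ nrec (f xs) (λ i a → h (i ∷ a ∷ xs)) k
   go zero    xs = prec0⇓ (r xs)
   go (suc k) xs = prec+⇓ (go k xs) (r′ _)

  v-add : V2 X _+_
  v-add = mk2 (v-cast (λ { (x ∷ y ∷ []) → lem x y }) (v-rec v0 (c1 v-suc v1)))
   where
   lem : ∀ x y → nrec y (λ _ a → suc a) x ≡ x + y
   lem zero    y = refl
   lem (suc x) y = cong suc (lem x y)

  v-pred : V1 X pred
  v-pred = mk1 (v-cast (λ { (zero ∷ []) → refl ; (suc x ∷ []) → refl }) (v-rec v-zero v0))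

  v-sub : V2 X _∸_
  v-sub = mk2 (v-cast (λ { (x ∷ y ∷ []) → lem x y }) (v-comp (v-rec v0 (c1 v-pred v1)) (v1 ∷ᵥ v0 ∷ᵥ vs-nil)))
   where
   lem : ∀ x y → nrec x (λ _ a → pred a) y ≡ x ∸ y
   lem x zero = refl
   lem x (suc y) = trans (cong pred (lem x y)) (pred[m∸n]≡m∸[1+n] x y)

  v-ifz : V3 X ifz
  v-ifz = mk3 (v-cast (λ { (zero ∷ a ∷ b ∷ []) → refl ; (suc c ∷ a ∷ b ∷ []) → refl }) (v-rec v0 v3))

 tri : ℕ → ℕ
 tri zero = 0
 tri (suc n) = suc (n + tri n)

 -- The largest `d` with `tri d ≤ n`, that is, the antidiagonal of Cantor's pairing on which `n`
 -- lies, computed without division.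
 diag : ℕ → ℕ
 diag zero = 0
 diag (suc n) = ifz (tri (suc (diag n)) ∸ suc n) (suc (diag n)) (diag n)

 π₂ π₁ : ℕ → ℕ
 π₂ n = n ∸ tri (diag n)
 π₁ n = diag n ∸ π₂ n

 tri-double : ∀ n → n * suc n ≡ tri n * 2
 tri-double zero = refl
 tri-double (suc n) = trans (lem n) (trans (cong (λ z → 2 * suc n + z) (tri-double n)) (lem′ n (tri n)))
  where
  lem : ∀ n → suc n * suc (suc n) ≡ 2 * suc n + n * suc n
  lem = solve-∀
  lem′ : ∀ n t → 2 * suc n + t * 2 ≡ suc (n + t) * 2
  lem′ = solve-∀

 pair-tri : ∀ x y → pair x y ≡ tri (x + y) + y
 pair-tri x y = cong (_+ y) (trans (cong (_/ 2) (tri-double (x + y))) (m*n/n≡m (tri (x + y)) 2))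

 diag-tri : ∀ d y → y ≤ d → diag (tri d + y) ≡ d
 diag-tri zero    zero    _ = refl
 diag-tri (suc d) zero    _ = trans (cong diag (trans (+-identityʳ _) (cong suc (+-comm d (tri d)))))
  (trans (cong (λ e → ifz (tri (suc e) ∸ suc (tri d + d)) (suc e) e) (diag-tri d d ≤-refl))
   (cong (λ e → ifz e (suc d) d) (m≤n⇒m∸n≡0 (s≤s (≤-reflexive (+-comm d (tri d)))))))
 diag-tri d       (suc y) y<d = trans (cong diag (+-suc (tri d) y))
  (trans (cong (λ e → ifz (tri (suc e) ∸ suc (tri d + y)) (suc e) e) (diag-tri d y (<⇒≤ y<d))) (lem d y y<d))
  where
  lem : ∀ d y → y < d → ifz (tri (suc d) ∸ suc (tri d + y)) (suc d) d ≡ d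
  lem d y y<d = trans (cong (λ z → ifz z (suc d) d) (m>n⇒m∸n≡1+ d y y<d)) refl
   where
   m>n⇒m∸n≡1+ : ∀ d y → y < d → tri (suc d) ∸ suc (tri d + y) ≡ suc (pred (d ∸ y))
   m>n⇒m∸n≡1+ d y y<d = trans (cong (_∸ (tri d + y)) (+-comm d (tri d)))
    (trans ([m+n]∸[m+o]≡n∸o (tri d) d y) (sym (suc-pred (d ∸ y) {{>-nonZero (m<n⇒0<n∸m y<d)}})))

 π₂-pair : ∀ x y → π₂ (pair x y) ≡ y
 π₂-pair x y rewrite pair-tri x y | diag-tri (x + y) y (m≤n+m y x) = m+n∸m≡n (tri (x + y)) y

 π₁-pair : ∀ x y → π₁ (pair x y) ≡ x
 π₁-pair x y rewrite π₂-pair x y | pair-tri x y | diag-tri (x + y) y (m≤n+m y x) = m+n∸n≡m x y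

 unpair : ∀ n → ∃[ d ] ∃[ y ] y ≤ d × n ≡ tri d + y
 unpair zero = 0 , 0 , z≤n , refl
 unpair (suc n) with unpair n
 ... | d , y , y≤d , e with m≤n⇒m<n∨m≡n y≤d
 ... | inj₁ y<d = d , suc y , y<d , trans (cong suc e) (sym (+-suc (tri d) y))
 ... | inj₂ refl = suc d , 0 , z≤n , trans (cong suc (trans e (+-comm (tri d) d))) (sym (+-identityʳ _))

 pair-π : ∀ n → pair (π₁ n) (π₂ n) ≡ n
 pair-π n with unpair n
 ... | d , y , y≤d , refl rewrite diag-tri d y y≤d | m+n∸m≡n (tri d) y =
  trans (pair-tri (d ∸ y) y) (cong (λ z → tri z + y) (m∸n+n≡m y≤d))

 pair-≥ʳ : ∀ x y → y ≤ pair x y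
 pair-≥ʳ x y = subst (y ≤_) (sym (pair-tri x y)) (m≤n+m y _)

 n≤tri : ∀ n → n ≤ tri n
 n≤tri zero = z≤n
 n≤tri (suc n) = s≤s (m≤m+n n _)

 pair-≥ˡ : ∀ x y → x ≤ pair x y
 pair-≥ˡ x y = subst (x ≤_) (sym (pair-tri x y)) (≤-trans (m≤m+n x y) (≤-trans (n≤tri (x + y)) (m≤m+n _ y)))

 pair-inj : ∀ {x y x′ y′} → pair x y ≡ pair x′ y′ → x ≡ x′ × y ≡ y′
 pair-inj {x} {y} {x′} {y′} e =
  trans (sym (π₁-pair x y)) (trans (cong π₁ e) (π₁-pair x′ y′)) ,
  trans (sym (π₂-pair x y)) (trans (cong π₂ e) (π₂-pair x′ y′))

 module _ {X : Orc} where

  v-tri : V1 X tri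
  v-tri = mk1 (v-cast (λ { (n ∷ []) → lem n }) (v-rec v-zero (c1 v-suc (c2 v-add v0 v1))))
   where
   lem : ∀ n → nrec 0 (λ i a → suc (i + a)) n ≡ tri n
   lem zero = refl
   lem (suc n) = cong (λ z → suc (n + z)) (lem n)

  v-diag : V1 X diag
  v-diag = mk1 (v-cast (λ { (n ∷ []) → lem n })
   (v-rec v-zero (c3 v-ifz (c2 v-sub (c1 v-tri (c1 v-suc v1)) (c1 v-suc v0)) (c1 v-suc v1) v1)))
   where
   lem : ∀ n → nrec 0 (λ i a → ifz (tri (suc a) ∸ suc i) (suc a) a) n ≡ diag n
   lem zero = refl
   lem (suc n) = cong (λ z → ifz (tri (suc z) ∸ suc n) (suc z) z) (lem n)

  v-pair : V2 X pair
  v-pair = mk2 (v-cast (λ { (x ∷ y ∷ []) → sym (pair-tri x y) }) (c2 v-add (c1 v-tri (c2 v-add v0 v1)) v1))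

  v-π₂ : V1 X π₂
  v-π₂ = mk1 (c2 v-sub v0 (c1 v-tri (c1 v-diag v0)))

  v-π₁ : V1 X π₁
  v-π₁ = mk1 (c2 v-sub (c1 v-diag v0) (c1 v-π₂ v0))

  v-query : V1 X (λ n → bit (X n))
  v-query = mk1 (mkV query λ { (n ∷ []) → go n (X n) refl })
   where
   go : ∀ n b → X n ≡ b → ⌞ X ⌟ ⊢ query ⟨ n ∷ [] ⟩⇓ bit b
   go n true  e = yes⇓ e
   go n false e = no⇓ λ e′ → false≢true (trans (sym e) e′)

-- Computable functions and decidable predicates on typed data

module TypedPrograms where
 open ListLemmas
 open Programs
 open import Data.Vec.Base using ([]; _∷_; head)

 infixr 7 _⊗_
 data Ty : Set where
  nat : Ty
  _⊗_ : Ty → Ty → Ty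
  list : Ty → Ty

 El : Ty → Set
 El nat = ℕ
 El (s ⊗ t) = El s × El t
 El (list t) = List (El t)

 -- Every code is a bijection with ℕ.
 enc : ∀ t → El t → ℕ
 encs : ∀ t → List (El t) → ℕ
 enc nat      n = n
 enc (s ⊗ t)  (a , b) = pair (enc s a) (enc t b)
 enc (list t) as = encs t as
 encs t [] = 0
 encs t (a ∷ as) = suc (pair (enc t a) (encs t as))

 dec : ∀ t → ℕ → El t
 -- The first number is fuel; starting from `n` itself is enough because `π₂ n ≤ n`.
 decs : ∀ t → ℕ → ℕ → List (El t)
 dec nat      n = n
 dec (s ⊗ t)  n = dec s (π₁ n) , dec t (π₂ n)
 dec (list t) n = decs t n n
 decs t zero    n = []
 decs t (suc f) zero = []
 decs t (suc f) (suc n) = dec t (π₁ n) ∷ decs t f (π₂ n)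

 π₂≤ : ∀ n → π₂ n ≤ n
 π₂≤ n = m∸n≤m n (tri (diag n))

 enc-dec : ∀ t n → enc t (dec t n) ≡ n
 encs-decs : ∀ t f n → n ≤ f → encs t (decs t f n) ≡ n
 enc-dec nat      n = refl
 enc-dec (s ⊗ t)  n = trans (cong₂ pair (enc-dec s (π₁ n)) (enc-dec t (π₂ n))) (pair-π n)
 enc-dec (list t) n = encs-decs t n n ≤-refl
 encs-decs t zero    zero    _ = refl
 encs-decs t (suc f) zero    _ = refl
 encs-decs t (suc f) (suc n) (s≤s n≤f) = cong suc
  (trans (cong₂ pair (enc-dec t (π₁ n)) (encs-decs t f (π₂ n) (≤-trans (π₂≤ n) n≤f))) (pair-π n))

 enc-inj : ∀ t {a b} → enc t a ≡ enc t b → a ≡ b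
 encs-inj : ∀ t {a b} → encs t a ≡ encs t b → a ≡ b
 enc-inj nat      e = e
 enc-inj (s ⊗ t)  e = let p , q = pair-inj e in cong₂ _,_ (enc-inj s p) (enc-inj t q)
 enc-inj (list t) e = encs-inj t e
 encs-inj t {[]}     {[]}     e = refl
 encs-inj t {a ∷ as} {b ∷ bs} e = let p , q = pair-inj (suc-injective e) in cong₂ _∷_ (enc-inj t p) (encs-inj t q)

 dec-enc : ∀ t a → dec t (enc t a) ≡ a
 dec-enc t a = enc-inj t (enc-dec t (enc t a))

 length≤encs : ∀ t as → length as ≤ encs t as
 length≤encs t [] = z≤n
 length≤encs t (a ∷ as) = s≤s (≤-trans (length≤encs t as) (pair-≥ʳ (enc t a) (encs t as)))

 -- Lets the strings of the statement be treated as typed data.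
 encode≡encs : ∀ l → encode l ≡ encs nat l
 encode≡encs [] = refl
 encode≡encs (x ∷ l) = cong (λ z → suc (pair x z)) (encode≡encs l)

 record Cmp (X : Orc) (s t : Ty) (f : El s → El t) : Set where
  constructor cmp
  field
   code : ℕ → ℕ
   computes : V1 X code
   track : ∀ a → code (enc s a) ≡ enc t (f a)

 below : ℕ → List ℕ
 below = nrec [] _∷_

 ∈-below⁺ : ∀ {i n} → i < n → i ∈ below n
 ∈-below⁺ {i} {suc n} (s≤s i≤n) with m≤n⇒m<n∨m≡n i≤n
 ... | inj₁ i<n = there (∈-below⁺ i<n)
 ... | inj₂ refl = here refl

 ∈-below⁻ : ∀ {i n} → i ∈ below n → i < n
 ∈-below⁻ {n = suc n} (here refl) = ≤-refl
 ∈-below⁻ {n = suc n} (there i∈) = m<n⇒m<1+n (∈-below⁻ i∈)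

 ifzT : ∀ {A : Set} → ℕ → A → A → A
 ifzT zero    a b = a
 ifzT (suc _) a b = b

 listCase : ∀ {A B : Set} → B → (A → List A → B) → List A → B
 listCase n c [] = n
 listCase n c (x ∷ xs) = c x xs

 module _ {X : Orc} where

  private
   un : ∀ {f} → V1 X f → V X 1 (λ xs → f (head xs))
   un = V1.v

  c-cast : ∀ {s t f g} → (∀ a → f a ≡ g a) → Cmp X s t f → Cmp X s t g
  c-cast h (cmp c v r) = cmp c v λ a → trans (r a) (cong (enc _) (h a))

  idC : ∀ {s} → Cmp X s s (λ a → a)
  idC = cmp (λ n → n) (mk1 v0) λ a → refl

  infixr 9 _∘C_
  _∘C_ : ∀ {r s t g f} → Cmp X s t g → Cmp X r s f → Cmp X r t (λ a → g (f a))
  cmp c v e ∘C cmp c′ v′ e′ = cmp (λ n → c (c′ n)) (mk1 (c1 v (un v′)))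
   λ a → trans (cong c (e′ a)) (e _)

  pairC : ∀ {r s t f g} → Cmp X r s f → Cmp X r t g → Cmp X r (s ⊗ t) (λ a → f a , g a)
  pairC (cmp c v e) (cmp c′ v′ e′) = cmp (λ n → pair (c n) (c′ n)) (mk1 (c2 v-pair (un v) (un v′)))
   λ a → cong₂ pair (e a) (e′ a)

  fstC : ∀ {r s t f} → Cmp X r (s ⊗ t) f → Cmp X r s (λ a → fst (f a))
  fstC {f = f} (cmp c v e) = cmp (λ n → π₁ (c n)) (mk1 (c1 v-π₁ (un v)))
   λ a → trans (cong π₁ (e a)) (π₁-pair (enc _ (fst (f a))) (enc _ (snd (f a))))

  sndC : ∀ {r s t f} → Cmp X r (s ⊗ t) f → Cmp X r t (λ a → snd (f a))
  sndC {f = f} (cmp c v e) = cmp (λ n → π₂ (c n)) (mk1 (c1 v-π₂ (un v)))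
   λ a → trans (cong π₂ (e a)) (π₂-pair (enc _ (fst (f a))) (enc _ (snd (f a))))

  constC : ∀ {r} t (b : El t) → Cmp X r t (λ _ → b)
  constC t b = cmp (λ _ → enc t b) (mk1 (v-const _)) λ _ → refl

  opC₁ : ∀ {r g f} → V1 X g → Cmp X r nat f → Cmp X r nat (λ a → g (f a))
  opC₁ {g = g} v (cmp c v′ e) = cmp (λ n → g (c n)) (mk1 (c1 v (un v′))) λ a → cong g (e a)

  opC₂ : ∀ {r g f h} → V2 X g → Cmp X r nat f → Cmp X r nat h → Cmp X r nat (λ a → g (f a) (h a))
  opC₂ {g = g} v (cmp c v′ e) (cmp c′ v″ e′) =
   cmp (λ n → g (c n) (c′ n)) (mk1 (c2 v (un v′) (un v″))) λ a → cong₂ g (e a) (e′ a)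

  sucC : ∀ {r f} → Cmp X r nat f → Cmp X r nat (λ a → suc (f a))
  sucC = opC₁ v-suc

  addC : ∀ {r f g} → Cmp X r nat f → Cmp X r nat g → Cmp X r nat (λ a → f a + g a)
  addC = opC₂ v-add

  subC : ∀ {r f g} → Cmp X r nat f → Cmp X r nat g → Cmp X r nat (λ a → f a ∸ g a)
  subC = opC₂ v-sub

  ifzC : ∀ {r t c f g} → Cmp X r nat c → Cmp X r t f → Cmp X r t g → Cmp X r t (λ a → ifzT (c a) (f a) (g a))
  ifzC {t = t} {c} {f} {g} (cmp c₁ v₁ e₁) (cmp c₂ v₂ e₂) (cmp c₃ v₃ e₃) =
   cmp (λ n → ifz (c₁ n) (c₂ n) (c₃ n)) (mk1 (c3 v-ifz (un v₁) (un v₂) (un v₃))) λ a →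
    trans (cong₂ (λ x y → ifz x y (c₃ _)) (e₁ a) (e₂ a))
     (trans (cong (ifz (c a) (enc t (f a))) (e₃ a)) (lem (c a)))
   where
   lem : ∀ n {x y} → ifz n (enc t x) (enc t y) ≡ enc t (ifzT n x y)
   lem zero = refl
   lem (suc n) = refl

  nrecC : ∀ {r t z s n} → Cmp X r t z → Cmp X (r ⊗ nat ⊗ t) t s → Cmp X r nat n →
   Cmp X r t (λ a → nrec (z a) (λ i y → s (a , i , y)) (n a))
  nrecC {r} {t} {z} {s} {n} (cmp c₁ v₁ e₁) (cmp c₂ v₂ e₂) (cmp c₃ v₃ e₃) =
   cmp (λ m → nrec (c₁ m) (λ i y → c₂ (pair m (pair i y))) (c₃ m))
    (mk1 (v-comp (v-rec (c1 v₁ v0) (c1 v₂ (c2 v-pair v2 (c2 v-pair v0 v1)))) (un v₃ ∷ᵥ v0 ∷ᵥ vs-nil)))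
    λ a → trans (cong (nrec _ _) (e₃ a)) (lem a (n a))
   where
   lem : ∀ a m → nrec (c₁ (enc r a)) (λ i y → c₂ (pair (enc r a) (pair i y))) m ≡
    enc t (nrec (z a) (λ i y → s (a , i , y)) m)
   lem a zero = e₁ a
   lem a (suc m) = trans (cong (λ y → c₂ (pair (enc r a) (pair m y))) (lem a m)) (e₂ _)

  nilC : ∀ {r t} → Cmp X r (list t) (λ _ → [])
  nilC {t = t} = constC (list t) []

  consC : ∀ {r t f g} → Cmp X r t f → Cmp X r (list t) g → Cmp X r (list t) (λ a → f a ∷ g a)
  consC (cmp c v e) (cmp c′ v′ e′) = cmp (λ n → suc (pair (c n) (c′ n)))
   (mk1 (c1 v-suc (c2 v-pair (un v) (un v′)))) λ a → cong suc (cong₂ pair (e a) (e′ a))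

  caseC : ∀ {r t u n c l} → Cmp X r u n → Cmp X (r ⊗ t ⊗ list t) u c → Cmp X r (list t) l →
   Cmp X r u (λ a → listCase (n a) (λ x xs → c (a , x , xs)) (l a))
  caseC {r} {t} {u} {n} {c} {l} (cmp c₁ v₁ e₁) (cmp c₂ v₂ e₂) (cmp c₃ v₃ e₃) =
   cmp (λ m → ifz (c₃ m) (c₁ m) (c₂ (pair m (pred (c₃ m)))))
    (mk1 (c3 v-ifz (un v₃) (un v₁) (c1 v₂ (c2 v-pair v0 (c1 v-pred (un v₃))))))
    λ a → trans (cong (λ y → ifz y (c₁ (enc r a)) (c₂ (pair (enc r a) (pred y)))) (e₃ a)) (lem a (l a))
   where
   lem : ∀ a l → ifz (encs t l) (c₁ (enc r a)) (c₂ (pair (enc r a) (pred (encs t l)))) ≡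
    enc u (listCase (n a) (λ x xs → c (a , x , xs)) l)
   lem a [] = e₁ a
   lem a (x ∷ xs) = e₂ _

  -- The code of a list is at least its length, so it can serve as the number of rounds of a
  -- primitive recursion; once the list is exhausted the remaining rounds change nothing.
  foldlC : ∀ {r t u z s l} → Cmp X r u z → Cmp X (r ⊗ u ⊗ t) u s → Cmp X r (list t) l →
   Cmp X r u (λ a → foldl (λ y x → s (a , y , x)) (z a) (l a))
  foldlC {r} {t} {u} {z} {s} {l} cz cs cl@(cmp c v e) =
   c-cast (λ a → cong fst (iterate a (encs t (l a)) (z a) (l a) (length≤encs t (l a))))
    (fstC {s = u} {list t} (nrecC (pairC cz cl)
     (caseC {n = λ p → snd (snd p)}
      {c = λ q → s (fst (fst q) , fst (snd (snd (fst q))) , fst (snd q)) , snd (snd q)}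
      (sndC (sndC idC))
      (pairC (cs ∘C pairC (fstC (fstC idC)) (pairC (fstC (sndC (sndC (fstC idC)))) (fstC (sndC idC))))
       (sndC (sndC idC)))
      (sndC (sndC (sndC idC))))
     (cmp {t = nat} {f = λ a → encs t (l a)} c v e)))
   where
   iter : ∀ a → ℕ → El u × List (El t) → El u × List (El t)
   iter a k p = nrec p (λ i p → listCase p (λ x xs → s (a , fst p , x) , xs) (snd p)) k
   shift : ∀ a k p → iter a (suc k) p ≡ iter a k (iter a 1 p)
   shift a zero    p = refl
   shift a (suc k) p = cong (λ p → listCase p (λ x xs → s (a , fst p , x) , xs) (snd p)) (shift a k p)
   iterate : ∀ a k y l → length l ≤ k → iter a k (y , l) ≡ (foldl (λ y x → s (a , y , x)) y l , [])
   iterate a zero    y []       _ = refl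
   iterate a (suc k) y []       _ = trans (shift a k (y , [])) (iterate a k y [] z≤n)
   iterate a (suc k) y (x ∷ l) (s≤s h) = trans (shift a k (y , x ∷ l)) (iterate a k _ l h)

  reverseC : ∀ {r t l} → Cmp X r (list t) l → Cmp X r (list t) (λ a → reverse (l a))
  reverseC cl = foldlC nilC (consC (sndC (sndC idC)) (fstC (sndC idC))) cl

  foldrC : ∀ {r t u z s l} → Cmp X r u z → Cmp X (r ⊗ t ⊗ u) u s → Cmp X r (list t) l →
   Cmp X r u (λ a → foldr (λ x y → s (a , x , y)) (z a) (l a))
  foldrC {z = z} {s} {l} cz cs cl = c-cast (λ a → reverse-foldl (λ y x → s (a , x , y)) (z a) (l a))
   (foldlC {s = λ q → s (fst q , snd (snd q) , fst (snd q))} cz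
    (cs ∘C pairC (fstC idC) (pairC (sndC (sndC idC)) (fstC (sndC idC)))) (reverseC cl))

  appendC : ∀ {r t f g} → Cmp X r (list t) f → Cmp X r (list t) g → Cmp X r (list t) (λ a → f a ++ g a)
  appendC {f = f} {g} cf cg = c-cast (λ a → lem (f a) (g a))
   (foldrC cg (consC (fstC (sndC idC)) (sndC (sndC idC))) cf)
   where
   lem : ∀ {A : Set} (xs ys : List A) → foldr _∷_ ys xs ≡ xs ++ ys
   lem []       ys = refl
   lem (x ∷ xs) ys = cong (x ∷_) (lem xs ys)

  mapC : ∀ {r s t f l} → Cmp X (r ⊗ s) t f → Cmp X r (list s) l →
   Cmp X r (list t) (λ a → map (λ x → f (a , x)) (l a))
  mapC {f = f} {l} cf cl = c-cast (λ a → lem a (l a))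
   (foldrC nilC (consC (cf ∘C pairC (fstC idC) (fstC (sndC idC))) (sndC (sndC idC))) cl)
   where
   lem : ∀ a l → foldr (λ x y → f (a , x) ∷ y) [] l ≡ map (λ x → f (a , x)) l
   lem a [] = refl
   lem a (x ∷ l) = cong (f (a , x) ∷_) (lem a l)

  concatC : ∀ {r t l} → Cmp X r (list (list t)) l → Cmp X r (list t) (λ a → concat (l a))
  concatC {l = l} cl = c-cast (λ a → lem (l a))
   (foldrC nilC (appendC (fstC (sndC idC)) (sndC (sndC idC))) cl)
   where
   lem : ∀ {A : Set} (l : List (List A)) → foldr _++_ [] l ≡ concat l
   lem l = refl

  concatMapC : ∀ {r s t f l} → Cmp X (r ⊗ s) (list t) f → Cmp X r (list s) l →
   Cmp X r (list t) (λ a → concatMap (λ x → f (a , x)) (l a))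
  concatMapC cf cl = concatC (mapC cf cl)

  belowC : ∀ {r n} → Cmp X r nat n → Cmp X r (list nat) (λ a → below (n a))
  belowC cn = nrecC nilC (consC (fstC (sndC idC)) (sndC (sndC idC))) cn

  prodC : ∀ {r t l} → Cmp X r (list (list t)) l → Cmp X r (list (list t)) (λ a → prod (l a))
  prodC {r} {t} {l} cl = c-cast (λ a → lem (l a))
   (foldrC (constC (list (list t)) ([] ∷ []))
    (concatMapC {s = t} {f = λ q → map (snd q ∷_) (snd (snd (fst q)))} {l = λ q → fst (snd q)}
     (mapC (consC (sndC (fstC idC)) (sndC idC)) (sndC (sndC (fstC idC))))
     (fstC (sndC idC)))
    cl)
   where
   lem : ∀ l → foldr (λ xs y → concatMap (λ x → map (x ∷_) y) xs) ([] ∷ []) l ≡ prod l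
   lem [] = refl
   lem (x ∷ l) = cong (λ y → concatMap (λ z → map (z ∷_) y) x) (lem l)

 record Deci (X : Orc) (s : Ty) (P : El s → Set) : Set where
  constructor deci
  field
   χ : El s → ℕ
   compute : Cmp X s nat χ
   reflect : ∀ a → (χ a ≡ 1 × P a) ⊎ (χ a ≡ 0 × ¬ P a)

 module _ {X : Orc} where

  decide : ∀ {s P} → Deci X s P → ∀ a → Dec (P a)
  decide (deci _ _ r) a with r a
  ... | inj₁ (_ , p) = yes p
  ... | inj₂ (_ , p) = no p

  d-iff : ∀ {s P Q} → (∀ a → (P a → Q a) × (Q a → P a)) → Deci X s P → Deci X s Q
  d-iff {s} {P} {Q} h (deci χ c r) = deci χ c λ a → go a (r a)
   where
   go : ∀ a → (χ a ≡ 1 × P a) ⊎ (χ a ≡ 0 × ¬ P a) → (χ a ≡ 1 × Q a) ⊎ (χ a ≡ 0 × ¬ Q a)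
   go a (inj₁ (e , p)) = inj₁ (e , fst (h a) p)
   go a (inj₂ (e , p)) = inj₂ (e , λ q → p (snd (h a) q))

  d-sub : ∀ {r s P f} → Deci X s P → Cmp X r s f → Deci X r (λ a → P (f a))
  d-sub (deci χ c r) cf = deci _ (c ∘C cf) λ a → r _

  d-not : ∀ {s P} → Deci X s P → Deci X s (λ a → ¬ P a)
  d-not {s} {P} (deci χ c r) = deci (λ a → 1 ∸ χ a) (subC (constC nat 1) c) λ a → go a (r a)
   where
   go : ∀ a → (χ a ≡ 1 × P a) ⊎ (χ a ≡ 0 × ¬ P a) → (1 ∸ χ a ≡ 1 × ¬ P a) ⊎ (1 ∸ χ a ≡ 0 × ¬ ¬ P a)
   go a (inj₁ (e , p)) = inj₂ (cong (1 ∸_) e , λ q → q p)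
   go a (inj₂ (e , p)) = inj₁ (cong (1 ∸_) e , p)

  d-and : ∀ {s P Q} → Deci X s P → Deci X s Q → Deci X s (λ a → P a × Q a)
  d-and {s} {P} {Q} (deci χ c r) (deci χ′ c′ r′) =
   deci (λ a → ifzT (χ a) 0 (χ′ a)) (ifzC c (constC nat 0) c′) λ a → go a (r a) (r′ a)
   where
   go : ∀ a → (χ a ≡ 1 × P a) ⊎ (χ a ≡ 0 × ¬ P a) → (χ′ a ≡ 1 × Q a) ⊎ (χ′ a ≡ 0 × ¬ Q a) →
    (ifzT (χ a) 0 (χ′ a) ≡ 1 × P a × Q a) ⊎ (ifzT (χ a) 0 (χ′ a) ≡ 0 × ¬ (P a × Q a))
   go a (inj₂ (e , p)) _ = inj₂ (cong (λ z → ifzT z 0 (χ′ a)) e , p ∘ fst)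
   go a (inj₁ (e , p)) (inj₁ (e′ , q)) = inj₁ (trans (cong (λ z → ifzT z 0 (χ′ a)) e) e′ , p , q)
   go a (inj₁ (e , p)) (inj₂ (e′ , q)) = inj₂ (trans (cong (λ z → ifzT z 0 (χ′ a)) e) e′ , q ∘ snd)

  d-imp : ∀ {s P Q} → Deci X s P → Deci X s Q → Deci X s (λ a → P a → Q a)
  d-imp dP dQ = d-iff (λ a → (λ h p → dne (decide dQ a) λ q → h (p , q)) , λ h (p , q) → q (h p))
   (d-not (d-and dP (d-not dQ)))
   where
   dne : ∀ {Q : Set} → Dec Q → ¬ ¬ Q → Q
   dne (yes q) h = q
   dne (no ¬q) h = ⊥-elim (h ¬q)

  d-or : ∀ {s P Q} → Deci X s P → Deci X s Q → Deci X s (λ a → P a ⊎ Q a)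
  d-or dP dQ = d-iff (λ a → (λ h → go (decide dP a) h) , λ { (inj₁ p) ¬p → ⊥-elim (¬p p) ; (inj₂ q) _ → q })
   (d-imp (d-not dP) dQ)
   where
   go : ∀ {P Q : Set} → Dec P → (¬ P → Q) → P ⊎ Q
   go (yes p) h = inj₁ p
   go (no ¬p) h = inj₂ (h ¬p)

  d-all : ∀ {s t Q l} → Deci X (s ⊗ t) Q → Cmp X s (list t) l → Deci X s (λ a → ∀ {y} → y ∈ l a → Q (a , y))
  d-all {s} {t} {Q} {l} (deci χ c r) cl =
   deci (λ a → foldr (λ x y → ifzT (χ (a , x)) 0 y) 1 (l a))
    (foldrC (constC nat 1) (ifzC (c ∘C pairC (fstC idC) (fstC (sndC idC))) (constC nat 0) (sndC (sndC idC))) cl)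
    λ a → go a (l a)
   where
   go : ∀ a l → (foldr (λ x y → ifzT (χ (a , x)) 0 y) 1 l ≡ 1 × (∀ {y} → y ∈ l → Q (a , y))) ⊎
    (foldr (λ x y → ifzT (χ (a , x)) 0 y) 1 l ≡ 0 × ¬ (∀ {y} → y ∈ l → Q (a , y)))
   go a [] = inj₁ (refl , λ ())
   go a (x ∷ l) with r (a , x)
   ... | inj₂ (e , ¬q) rewrite e = inj₂ (refl , λ h → ¬q (h (here refl)))
   ... | inj₁ (e , q) rewrite e with go a l
   ...   | inj₁ (e′ , h) = inj₁ (e′ , λ { (here refl) → q ; (there y∈) → h y∈ })
   ...   | inj₂ (e′ , h) = inj₂ (e′ , λ h′ → h λ y∈ → h′ (there y∈))

  d-any : ∀ {s t Q l} → Deci X (s ⊗ t) Q → Cmp X s (list t) l → Deci X s (λ a → ∃[ y ] y ∈ l a × Q (a , y))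
  d-any {Q = Q} {l} dQ cl =
   d-iff (λ a → (λ h → find a (l a) h) , λ { (y , y∈ , q) h → h y∈ q }) (d-not (d-all (d-not dQ) cl))
   where
   find : ∀ a l → ¬ (∀ {y} → y ∈ l → ¬ Q (a , y)) → ∃[ y ] y ∈ l × Q (a , y)
   find a []      h = ⊥-elim (h λ ())
   find a (x ∷ l) h with decide dQ (a , x)
   ... | yes q = x , here refl , q
   ... | no ¬q = let y , y∈ , q = find a l (λ h′ → h λ { (here refl) → ¬q ; (there y∈) → h′ y∈ }) in y , there y∈ , q

  d-≤ : ∀ {s f g} → Cmp X s nat f → Cmp X s nat g → Deci X s (λ a → f a ≤ g a)
  d-≤ {s} {f} {g} cf cg = deci (λ a → 1 ∸ (f a ∸ g a)) (subC (constC nat 1) (subC cf cg)) λ a → go (f a) (g a)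
   where
   go : ∀ m n → (1 ∸ (m ∸ n) ≡ 1 × m ≤ n) ⊎ (1 ∸ (m ∸ n) ≡ 0 × ¬ m ≤ n)
   go zero    n = inj₁ (cong (1 ∸_) (0∸n≡0 n) , z≤n)
   go (suc m) zero = inj₂ (0∸n≡0 m , λ ())
   go (suc m) (suc n) with go m n
   ... | inj₁ (e , p) = inj₁ (e , s≤s p)
   ... | inj₂ (e , p) = inj₂ (e , λ { (s≤s q) → p q })

  d-≡ : ∀ {s} t {f g} → Cmp X s t f → Cmp X s t g → Deci X s (λ a → f a ≡ g a)
  d-≡ t {f} {g} (cmp c v e) (cmp c′ v′ e′) =
   d-iff (λ a → (λ (p , q) → enc-inj t (≤-antisym p q)) , λ { p → ≤-reflexive (cong (enc t) p) , ≤-reflexive (cong (enc t) (sym p)) })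
    (d-and (d-≤ cf cg) (d-≤ cg cf))
   where
   cf = cmp {t = nat} {f = λ a → enc t (f a)} c v e
   cg = cmp {t = nat} {f = λ a → enc t (g a)} c′ v′ e′

  d-∈ : ∀ {s} t {f l} → Cmp X s t f → Cmp X s (list t) l → Deci X s (λ a → f a ∈ l a)
  d-∈ t {f} cf cl = d-iff (λ a → (λ { (y , y∈ , refl) → y∈ }) , λ y∈ → _ , y∈ , refl)
   (d-any {Q = λ p → f (fst p) ≡ snd p} (d-≡ t (cf ∘C fstC idC) (sndC idC)) cl)

  d-∃< : ∀ {s Q n} → Deci X (s ⊗ nat) Q → Cmp X s nat n → Deci X s (λ a → ∃[ m ] m < n a × Q (a , m))
  d-∃< dQ cn = d-iff (λ a → (λ (m , m∈ , q) → m , ∈-below⁻ m∈ , q) , λ (m , m< , q) → m , ∈-below⁺ m< , q)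
   (d-any dQ (belowC cn))

  d-oracle : Deci X nat (λ n → X n ≡ true)
  d-oracle = deci (λ n → bit (X n)) (cmp _ v-query λ _ → refl) λ n → go (X n)
   where

   go : ∀ b → (bit b ≡ 1 × b ≡ true) ⊎ (bit b ≡ 0 × ¬ b ≡ true)
   go true = inj₁ (refl , refl)
   go false = inj₂ (refl , λ ())

  ite : ∀ {s P} → Deci X s P → ∀ {A : Set} → A → A → El s → A
  ite (deci χ _ _) f g a = ifzT (χ a) g f

  iteC : ∀ {s t P f g} (d : Deci X s P) → Cmp X s t f → Cmp X s t g → Cmp X s t (λ a → ite d (f a) (g a) a)
  iteC (deci χ c _) cf cg = ifzC c cg cf

  ite-yes : ∀ {s P} (d : Deci X s P) {A : Set} {f g : A} {a} → P a → ite d f g a ≡ f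
  ite-yes (deci χ _ r) {a = a} p with r a
  ... | inj₁ (e , _) rewrite e = refl
  ... | inj₂ (_ , ¬p) = ⊥-elim (¬p p)

  ite-no : ∀ {s P} (d : Deci X s P) {A : Set} {f g : A} {a} → ¬ P a → ite d f g a ≡ g
  ite-no (deci χ _ r) {a = a} ¬p with r a
  ... | inj₁ (_ , p) = ⊥-elim (¬p p)
  ... | inj₂ (e , _) rewrite e = refl

module Classical (em : ExcludedMiddle 0ℓ) where

 -- The Halpern-Läuchli theorem for level-uniform sections: its forms and homogenization

 module HalpernLauchli where
  open ListLemmas
  open import Data.List.Relation.Binary.Pointwise.Base using (Pointwise; []; _∷_)
  open import Data.List.Relation.Unary.All using (All; []; _∷_)
  open import Data.List.Relation.Unary.AllPairs using ([]; _∷_)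
  open import Data.Nat.Tactic.RingSolver using (solve-∀)

  -- Only unique parents and the absence of leaves are required; loops may occur and no root is
  -- chosen. A tuple of trees is a list of distinct nodes of one `Tree`, and one section acts on all
  -- coordinates.
  record Tree : Set₁ where
   field
    X : Set
    kids : X → List X
    ne : ∀ x → ∃[ y ] y ∈ kids x
    uniq : ∀ {x y z} → z ∈ kids x → z ∈ kids y → x ≡ y
  open Tree

  data Desc (T : Tree) : ℕ → X T → X T → Set where
   stop : ∀ {x} → Desc T 0 x x
   step : ∀ {n x y z} → y ∈ kids T x → Desc T n y z → Desc T (suc n) x z

  module _ {T : Tree} where

   desc-trans : ∀ {n m x y z} → Desc T n x y → Desc T m y z → Desc T (n + m) x z
   desc-trans stop       e = e
   desc-trans (step k d) e = step k (desc-trans d e)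

   desc-split : ∀ n {m x z} → Desc T (n + m) x z → ∃[ y ] Desc T n x y × Desc T m y z
   desc-split zero    d = _ , stop , d
   desc-split (suc n) (step k d) = let y , e , f = desc-split n d in y , step k e , f

   desc-unique : ∀ {n x y z} → Desc T n x z → Desc T n y z → x ≡ y
   desc-unique stop       stop = refl
   desc-unique (step k d) (step l e) with desc-unique d e
   ... | refl = uniq T k l

   desc-cast : ∀ {n m x y} → n ≡ m → Desc T n x y → Desc T m x y
   desc-cast refl d = d

   kid : ∀ {x y} → y ∈ kids T x → Desc T 1 x y
   kid k = step k stop

   unkid : ∀ {x y} → Desc T 1 x y → y ∈ kids T x
   unkid (step k stop) = k

  descs : (T : Tree) → ℕ → X T → List (X T)
  descs T zero    x = x ∷ []
  descs T (suc n) x = concatMap (descs T n) (kids T x)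

  ∈-descs⁺ : ∀ {T n x y} → Desc T n x y → y ∈ descs T n x
  ∈-descs⁺ stop = here refl
  ∈-descs⁺ {T} {suc n} (step {y = y} k d) = ∈-concatMap {f = descs T n} k (∈-descs⁺ {T} {n} {y} d)

  ∈-descs⁻ : ∀ {T} n {x y} → y ∈ descs T n x → Desc T n x y
  ∈-descs⁻     zero    (here refl) = stop
  ∈-descs⁻ {T} (suc n) y∈ with ∈-concatMap′ {f = descs T n} (kids T _) y∈
  ... | _ , k , d = step k (∈-descs⁻ n d)

  lm : (T : Tree) → ℕ → X T → X T
  lm T zero    x = x
  lm T (suc n) x = lm T n (fst (ne T x))

  lm-desc : ∀ T n x → Desc T n x (lm T n x)
  lm-desc T zero    x = stop
  lm-desc T (suc n) x = step (snd (ne T x)) (lm-desc T n _)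

  tuples : (T : Tree) → ℕ → List (X T) → List (List (X T))
  tuples T n xs = prod (map (descs T n) xs)

  ∈-tuples⁺ : ∀ {T n xs ys} → Pointwise (Desc T n) xs ys → ys ∈ tuples T n xs
  ∈-tuples⁺ {T} {n} ds = ∈-prod⁺ (go ds)
   where
   go : ∀ {xs ys} → Pointwise (Desc T n) xs ys → Pointwise (λ zs y → y ∈ zs) (map (descs T n) xs) ys
   go [] = []
   go (d ∷ ds) = ∈-descs⁺ d ∷ go ds

  ∈-tuples⁻ : ∀ {T} n {xs ys} → ys ∈ tuples T n xs → Pointwise (Desc T n) xs ys
  ∈-tuples⁻ {T} n {xs} ys∈ = go xs (∈-prod⁻ (map (descs T n) xs) ys∈)
   where
   go : ∀ xs {ys} → Pointwise (λ zs y → y ∈ zs) (map (descs T n) xs) ys → Pointwise (Desc T n) xs ys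
   go []       [] = []
   go (x ∷ xs) (d ∷ ds) = ∈-descs⁻ n d ∷ go xs ds

  descs-distinct : ∀ {T n x y xs ys} → Desc T n x y → Pointwise (Desc T n) xs ys →
   All (λ z → ¬ x ≡ z) xs → All (λ z → ¬ y ≡ z) ys
  descs-distinct d []       [] = []
  descs-distinct d (e ∷ ds) (p ∷ ps) = (λ { refl → p (desc-unique d e) }) ∷ descs-distinct d ds ps

  descs-unique : ∀ {T n xs ys} → Pointwise (Desc T n) xs ys → Unique xs → Unique ys
  descs-unique []       [] = []
  descs-unique (d ∷ ds) (p ∷ ps) = descs-distinct d ds p ∷ descs-unique ds ps

  Sec : (T : Tree) → ℕ → (X T → X T) → Set
  Sec T m s = ∀ x → Desc T m x (s x)

  -- The images under `s` of level `n` above `bs` form what is usually called an n-dense set: they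
  -- dominate that level. As `s` has the uniform height `m`, they also lie on one level, which
  -- strong subtrees require.
  record Hom (T : Tree) (c : List (X T) → ℕ) (bs : List (X T)) (n m : ℕ) (s : X T → X T) (i : ℕ) : Set where
   constructor hom
   field
    sec : Sec T m s
    col : ∀ {ts} → Pointwise (Desc T n) bs ts → c (map s ts) ≡ i

  -- The one-step and the dense-set forms of the Halpern–Läuchli theorem for d trees.
  OneStepHL DenseHL LevelHL : ℕ → Set₁
  OneStepHL d = ∀ T (rs : List (X T)) → Unique rs → length rs ≡ d →
   ∀ k c → (∀ ts → c ts < k) →
   ∃[ l ] ∃[ σs ] ∃[ i ] i < k × Pointwise (Desc T l) rs σs × ∃[ m ] ∃[ s ] Hom T c σs 1 m s i
  DenseHL d = ∀ T (rs : List (X T)) → Unique rs → length rs ≡ d →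
   ∀ k c → (∀ ts → c ts < k) →
   ∃[ l ] ∃[ σs ] ∃[ i ] i < k × Pointwise (Desc T l) rs σs × (∀ n → ∃[ m ] ∃[ s ] Hom T c σs n m s i)
  LevelHL d = ∀ T (rs : List (X T)) → Unique rs → length rs ≡ d →
   ∀ k (c : ℕ → List (X T) → ℕ) → (∀ n ts → c n ts < k) →
   ∃[ l ] ∃[ σs ] ∃[ i ] i < k × Pointwise (Desc T l) rs σs ×
    (∀ n → ∃[ m ] ∃[ s ] Hom T (c (l + (n + m))) σs n m s i)

  hom-down : ∀ {T c bs n n′ i} → n ≤ n′ → ∀ {m s} → Hom T c bs n′ m s i → ∃[ m′ ] ∃[ s′ ] Hom T c bs n m′ s′ i
  hom-down {T} {c} {bs} {n} {n′} n≤ {m} {s} (hom sec col) =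
   e + m , s ∘ lm T e , hom (λ x → desc-trans (lm-desc T e x) (sec _)) λ {ts} ds →
    trans (cong c (map-∘ ts))
     (col (subst (λ q → Pointwise (Desc T q) bs (map (lm T e) ts)) (m+[n∸m]≡n n≤)
      (pw-trans desc-trans ds (pw-graph (lm-desc T e) ts))))
   where e = n′ ∸ n

  -- Trees whose nodes carry their level, a step of which is an accelerated step of T.
  module Tagged (T : Tree) (p : ℕ → ℕ) (ext : ℕ → X T → List (X T))
   (ext-ne : ∀ l x → ∃[ y ] y ∈ ext l x)
   (ext-desc : ∀ {l x y} → y ∈ ext l x → Desc T (p l) x y) where

   tag : Tree
   tag = record
    { X = ℕ × X T
    ; kids = λ { (l , x) → map (suc l ,_) (ext l x) }
    ; ne = λ { (l , x) → (suc l , fst (ext-ne l x)) , ∈-map⁺ (suc l ,_) (snd (ext-ne l x)) }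
    ; uniq = u
    }
    where
    u : ∀ {x y z : ℕ × X T} → z ∈ map (suc (fst x) ,_) (ext (fst x) (snd x)) →
     z ∈ map (suc (fst y) ,_) (ext (fst y) (snd y)) → x ≡ y
    u {l , x} {l′ , y} z∈ z∈′ with ∈-map⁻ (suc l ,_) z∈ | ∈-map⁻ (suc l′ ,_) z∈′
    ... | _ , a , refl | _ , b , refl = cong (l ,_) (desc-unique (ext-desc a) (ext-desc b))

   gap : ℕ → ℕ → ℕ
   gap l zero = 0
   gap l (suc n) = p l + gap (suc l) n

   untag : ∀ {n l x l′ y} → Desc tag n (l , x) (l′ , y) → l′ ≡ l + n × Desc T (gap l n) x y
   untag {l = l} stop = sym (+-identityʳ l) , stop
   untag {suc n} {l} (step k d) with ∈-map⁻ (suc l ,_) k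
   ... | _ , a , refl = let e , d′ = untag d in
    trans e (sym (+-suc l n)) , desc-trans (ext-desc a) d′

   tag-kid : ∀ {l x y} → y ∈ ext l x → Desc tag 1 (l , x) (suc l , y)
   tag-kid k = step (∈-map⁺ (suc _ ,_) k) stop

   untags : ∀ {n l xs ys} → Pointwise (Desc tag n) (map (l ,_) xs) ys →
    ys ≡ map (l + n ,_) (map snd ys) × Pointwise (Desc T (gap l n)) xs (map snd ys)
   untags {xs = []}     [] = refl , []
   untags {xs = x ∷ xs} (d ∷ ds) =
    let e , f = untag d ; e′ , fs = untags ds in cong₂ _∷_ (cong (_, _) e) e′ , f ∷ fs

   untags-any : ∀ {n l xs ys} → Pointwise (Desc tag n) (map (l ,_) xs) ys →
    Pointwise (Desc T (gap l n)) xs (map snd ys)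
   untags-any ds = snd (untags ds)

   roots-unique : ∀ {l : ℕ} {rs : List (X T)} → Unique rs → Unique (map (l ,_) rs)
   roots-unique [] = []
   roots-unique (p ∷ ps) = go p ∷ roots-unique ps
    where
    go : ∀ {l : ℕ} {x} {xs : List (X T)} → All (λ z → ¬ x ≡ z) xs → All (λ z → ¬ (l , x) ≡ z) (map (l ,_) xs)
    go [] = []
    go (q ∷ qs) = (λ { refl → q refl }) ∷ go qs

  -- N l bounds, over all tuples of level l and all colours, the heights at which density fails.
  module Collapse {d : ℕ} (one : OneStepHL d) (T : Tree) (rs : List (X T)) (u : Unique rs) (len : length rs ≡ d)
   (k : ℕ) (c : List (X T) → ℕ) (c< : ∀ ts → c ts < k) (N : ℕ → ℕ)
   (fail : ∀ l {σs i} → i < k → Pointwise (Desc T l) rs σs → ∀ m s → ¬ Hom T c σs (N l) m s i) where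

   lam p : ℕ → ℕ
   lam zero = 0
   lam (suc l) = lam l + suc (N (lam l))
   p l = suc (N (lam l))

   open Tagged T p (λ l → descs T (p l)) (λ l x → lm T (p l) x , ∈-descs⁺ (lm-desc T (p l) x))
    (λ {l} → ∈-descs⁻ (p l))

   lam-gap : ∀ l n → lam l + gap l n ≡ lam (l + n)
   lam-gap l zero = trans (+-identityʳ _) (cong lam (sym (+-identityʳ l)))
   lam-gap l (suc n) = trans (sym (+-assoc (lam l) (p l) _))
    (trans (lam-gap (suc l) n) (cong lam (sym (+-suc l n))))

   -- A one-step answer for the collapsed tree at level `l` unravels to homogeneity at height `p l`
   -- above level `lam l` of `T`, which exceeds the height `N (lam l)` at which density was assumed
   -- to fail.
   contra : ⊥
   contra =
    let l , σ̂s , i , i< , ds , m , ŝ , hom sec col =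
         one tag (map (0 ,_) rs) (roots-unique u) (trans (length-map _ rs) len) k (c ∘ map snd) (λ ts → c< _)
        σs = map snd σ̂s
        H : Hom T c σs (p l) (gap (suc l) m) (λ t → snd (ŝ (suc l , t))) i
        H = hom (λ x → snd (untag (sec (suc l , x)))) λ {ts} es →
         trans (cong c (trans (map-∘ ts) (cong (map snd) (map-∘ ts))))
          (col (subst (λ q → Pointwise (Desc tag 1) q (map (suc l ,_) ts)) (sym (fst (untags ds)))
           (pw-map (λ e → tag-kid (∈-descs⁺ e)) es)))
        m′ , s′ , H′ = hom-down (n≤1+n (N (lam l))) H
    in fail (lam l) i< (subst (λ q → Pointwise (Desc T q) rs σs) (lam-gap 0 l) (untags-any ds)) m′ s′ H′

  -- Compactness: suppose every tuple and colour fail at some height. Each level has finitely many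
  -- tuples, so the heights are bounded level by level, and the tree collapsed along these bounds
  -- contradicts the one-step form.
  dense : ∀ {d} → OneStepHL d → DenseHL d
  dense one T rs u len k c c< = by-contra em λ no-dense →
   let fail : ∀ l {σs i} → i < k → Pointwise (Desc T l) rs σs → ∃[ n ] (∀ m s → ¬ Hom T c σs n m s i)
       fail l {σs} {i} i< ds = by-contra em λ none → no-dense (l , σs , i , i< , ds , λ n →
        by-contra em λ no-hom → none (n , λ m s H → no-hom (m , s , H)))
       bound : ∀ l → ∃[ n ] ∀ {a} → a ∈ cartesianProduct (tuples T l rs) (upTo k) →
        ∀ m s → ¬ Hom T c (fst a) n m s (snd a)
       bound l = bounded-∀ (λ n≤ h m s H → let m′ , s′ , H′ = hom-down n≤ H in h m′ s′ H′) _
        λ a∈ → let b∈ , i∈ = ∈-cartesianProduct⁻ (tuples T l rs) (upTo k) a∈ in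
         fail l (∈-upTo⁻ i∈) (∈-tuples⁻ l b∈)
   in Collapse.contra one T rs u len k c c< (λ l → fst (bound l)) λ l i< ds →
    snd (bound l) (∈-cartesianProduct⁺ (∈-tuples⁺ ds) (∈-upTo⁺ i<))

  pigeonhole : ∀ k (c : ℕ → ℕ) → (∀ n → c n < k) → ∃[ i ] i < k × (∀ n → ∃[ m ] c (n + m) ≡ i)
  pigeonhole k c c< = by-contra em λ none →
   let N , h = bounded-∀ {P = λ i n → ∀ m → ¬ c (n + m) ≡ i}
        (λ {i} {m} {n} m≤n h q e → h (n ∸ m + q)
         (trans (cong c (trans (sym (+-assoc m (n ∸ m) q)) (cong (_+ q) (m+[n∸m]≡n m≤n)))) e))
        (upTo k)
        λ {i} i∈ → by-contra em λ none′ → none (i , ∈-upTo⁻ i∈ , λ n →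
         by-contra em λ none″ → none′ (n , λ m e → none″ (m , e)))
   in h (∈-upTo⁺ (c< (N + 0))) 0 refl

  module Levels (T : Tree) (c : ℕ → List (X T) → ℕ) where
   open Tagged T (λ _ → 1) (λ _ → kids T) (λ _ → ne T) kid public renaming (tag to lev)

   -- The level is read off the first node, which requires at least one tree.
   ĉ : List (ℕ × X T) → ℕ
   ĉ [] = c 0 []
   ĉ ((l , x) ∷ ts) = c l (x ∷ map snd ts)

   ĉ< : ∀ {k} → (∀ n ts → c n ts < k) → ∀ ts → ĉ ts < k
   ĉ< c< [] = c< _ _
   ĉ< c< ((l , x) ∷ ts) = c< _ _

   gap≡ : ∀ l n → gap l n ≡ n
   gap≡ l zero = refl
   gap≡ l (suc n) = cong suc (gap≡ (suc l) n)

   lev-desc : ∀ {n l x z} → Desc T n x z → Desc lev n (l , x) (l + n , z)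
   lev-desc {l = l} {x} stop = subst (λ q → Desc lev 0 (l , x) (q , x)) (sym (+-identityʳ l)) stop
   lev-desc {suc n} {l} {z = z} (step {y = y} k d) = step (∈-map⁺ (suc l ,_) k)
    (subst (λ q → Desc lev n (suc l , y) (q , z)) (sym (+-suc l n)) (lev-desc d))

   head-level : ∀ {d} l n m ŝ → Sec lev m ŝ → ∀ ts → length ts ≡ suc d →
    c (l + (n + m)) (map (λ t → snd (ŝ (l + n , t))) ts) ≡ ĉ (map ŝ (map (l + n ,_) ts))
   head-level l n m ŝ sec (t ∷ ts) _ = cong₂ c
    (trans (sym (+-assoc l n m)) (sym (fst (untag (sec (l + n , t))))))
    (cong (_ ∷_) (trans (map-∘ ts) (map-∘ (map (l + n ,_) ts))))

  levelled : ∀ {d} → DenseHL d → LevelHL d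
  -- Without trees the colour depends on the level alone, and a colour recurring beyond every level
  -- is taken.
  levelled {zero} D T [] u len k c c< =
   let i , i< , h = pigeonhole k (λ n → c n []) (λ n → c< n [])
   in 0 , [] , i , i< , [] , λ n → let m , e = h n in m , lm T m , hom (lm-desc T m) λ { [] → e }
  levelled {suc d} D T rs u len k c c< =
   let l , σ̂s , i , i< , ds , h =
        D lev (map (0 ,_) rs) (roots-unique u) (trans (length-map _ rs) len) k ĉ (ĉ< c<)
       len′ = trans (length-map snd σ̂s) (trans (sym (pw-length ds)) (trans (length-map _ rs) len))
   in l , map snd σ̂s , i , i< ,
    subst (λ q → Pointwise (Desc T q) rs (map snd σ̂s)) (gap≡ 0 l) (untags-any ds) , λ n →
     let m , ŝ , hom sec col = h n in
     m , (λ t → snd (ŝ (l + n , t))) ,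
     hom (λ x → desc-cast (gap≡ (l + n) m) (snd (untag (sec (l + n , x)))))
      λ {ts} es → trans (head-level l n m ŝ sec ts (trans (sym (pw-length es)) len′))
       (col (subst (λ q → Pointwise (Desc lev n) q (map (l + n ,_) ts)) (sym (fst (untags ds)))
        (pw-map (λ e → lev-desc e) es)))
   where open Levels T c

  record Task (T : Tree) : Set where
   constructor task
   field
    cones : List (X T)
    colours : ℕ
    colour : ℕ → List (X T) → ℕ
  open Task

  Ready : ∀ {T} → Task T → Set₁
  Ready t = Unique (cones t) × (∀ n ts → colour t n ts < colours t) × LevelHL (length (cones t))

  -- The sections for different `n` are unrelated, so this is a supply of extensions and not yet a
  -- subtree. Levels are counted from the cones: `p + (n + m n)` is the level of the values of `s n`
  -- above the new positions.
  record Homogenized (T : Tree) (tasks : List (Task T)) : Set where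
   field
    p : ℕ
    pos : X T → X T
    pos↓ : Sec T p pos
    m : ℕ → ℕ
    s : ℕ → X T → X T
    sec : ∀ n → Sec T (m n) (s n)
    same : ∀ {t} → t ∈ tasks → ∀ n {us} → Pointwise (Desc T n) (map pos (cones t)) us →
     colour t (p + (n + m n)) (map (s n) us) ≡ colour t (p + (0 + m 0)) (map (s 0) (map pos (cones t)))

  pw-mapˡ⁻ : ∀ {A A′ B : Set} {R : A′ → B → Set} {f : A → A′} {xs ys} →
   Pointwise R (map f xs) ys → Pointwise (λ x → R (f x)) xs ys
  pw-mapˡ⁻ {xs = []}     [] = []
  pw-mapˡ⁻ {xs = x ∷ xs} (r ∷ rs) = r ∷ pw-mapˡ⁻ rs

  pw-refl : ∀ {A : Set} {R : A → A → Set} → (∀ {x} → R x x) → ∀ {xs} → Pointwise R xs xs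
  pw-refl r {[]} = []
  pw-refl r {x ∷ xs} = r ∷ pw-refl r

  private
   height-assoc : ∀ p l n a b → (p + l) + (n + (a + b)) ≡ p + ((l + (n + a)) + b)
   height-assoc = solve-∀

  module HomogenizeStep {T : Tree} {tasks : List (Task T)} (t : Task T) (H : Homogenized T tasks)
   (u : Unique (cones t)) (l : ℕ) (σs : List (X T)) (i : ℕ)
   (σs↓ : Pointwise (Desc T l) (map (Homogenized.pos H) (cones t)) σs)
   (m′ : ℕ → ℕ) (s′ : ℕ → X T → X T)
   (H′ : ∀ n → Hom T (λ us → colour t (Homogenized.p H + ((l + (n + m′ n)) + Homogenized.m H (l + (n + m′ n)))) (map (Homogenized.s H (l + (n + m′ n))) us))
    σs n (m′ n) (s′ n) i) where
   open Homogenized H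

   sec′ : ∀ n → Sec T (m′ n) (s′ n)
   sec′ n = Hom.sec (H′ n)

   q m″ : ℕ → ℕ
   q n = l + (n + m′ n)
   m″ n = m′ n + m (q n)

   s″ : ℕ → X T → X T
   s″ n x = s (q n) (s′ n x)

   unfold : ∀ (t : Task T) n us → colour t ((p + l) + (n + m″ n)) (map (s″ n) us) ≡
    colour t (p + (q n + m (q n))) (map (s (q n)) (map (s′ n) us))
   unfold t n us = cong₂ (colour t) (height-assoc p l n (m′ n) (m (q n))) (map-∘ us)

   -- Earlier tasks survive because `s″ n` factors through `s (q n)`, at a level where they are
   -- already homogeneous; the new task is settled by `H′`.
   result : Homogenized T (t ∷ tasks)
   result =
    let pos′ , pos′↓ , e = realize em {R = λ x y → Desc T l (pos x) y} u (pw-mapˡ⁻ σs↓) (λ x → lm T l (pos x))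
         (λ x → lm-desc T l (pos x))
        new : ∀ n {us} → Pointwise (Desc T n) (map pos′ (cones t)) us →
         colour t ((p + l) + (n + m″ n)) (map (s″ n) us) ≡ i
        new n {us} ds = trans (unfold t n us)
         (Hom.col (H′ n) (subst (λ z → Pointwise (Desc T n) z us) e ds))
        old : ∀ {t} → t ∈ tasks → ∀ n {us} → Pointwise (Desc T n) (map pos′ (cones t)) us →
         colour t ((p + l) + (n + m″ n)) (map (s″ n) us) ≡
         colour t (p + (0 + m 0)) (map (s 0) (map pos (cones t)))
        old {t} t∈ n {us} ds = trans (unfold t n us) (same t∈ (q n)
         (pw-map (λ {x} {y} d → desc-trans (pos′↓ x) (desc-trans d (sec′ n y))) (pw-mapˡ⁻ ds)))
    in record
    { p = p + l ; pos = pos′ ; pos↓ = λ x → desc-trans (pos↓ x) (pos′↓ x)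
    ; m = m″ ; s = s″ ; sec = λ n x → desc-trans (sec′ n x) (sec (q n) _)
    ; same = λ { (here refl) n ds → trans (new n ds) (sym (new 0 (pw-refl stop)))
     ; (there t∈) n ds → trans (old t∈ n ds) (sym (old t∈ 0 (pw-refl stop))) }
    }

  abstract
   homogenize : ∀ T (tasks : List (Task T)) → (∀ {t} → t ∈ tasks → Ready t) → Homogenized T tasks
   homogenize T [] ready = record
    { p = 0 ; pos = id ; pos↓ = λ x → stop ; m = λ _ → 0 ; s = λ _ → id ; sec = λ _ _ → stop ; same = λ () }
   homogenize T (t ∷ tasks) ready =
    let H = homogenize T tasks (ready ∘ there)
        open Homogenized H
        u , c< , D = ready (here refl)
        l , σs , i , _ , σs↓ , D′ = D T (map pos (cones t))
         (descs-unique (pw-graph pos↓ (cones t)) u) (length-map pos (cones t))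
         (colours t) (λ n us → colour t (p + (n + m n)) (map (s n) us)) (λ n us → c< _ _)
    in HomogenizeStep.result t H u l σs i σs↓ (λ n → fst (D′ n)) (λ n → fst (snd (D′ n)))
     (λ n → snd (snd (D′ n)))

 -- Proof of the Halpern-Läuchli theorem by induction on the number of trees

 module HalpernLauchliProof where
  open ListLemmas
  open HalpernLauchli
  open import Data.List.Relation.Binary.Pointwise.Base using (Pointwise; []; _∷_)
  open import Data.List.Relation.Unary.All using (All; []; _∷_)
  open import Data.List.Relation.Unary.AllPairs as AllPairs using ([]; _∷_)
  open import Data.Nat.Tactic.RingSolver using (solve-∀)

  open Tree
  open Task

  private
   ar1 : ∀ g p n a → (suc g + p + n) + a ≡ suc g + (p + (n + a))
   ar1 = solve-∀
   ar3 : ∀ q n m m₂ → q + (n + (m + m₂)) ≡ q + ((n + m) + m₂)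
   ar3 = solve-∀
   ar4 : ∀ m′ m₂ q n m → (m₂ + m′) + (q + (n + m)) ≡ m′ + (q + (n + (m + m₂)))
   ar4 = solve-∀
   ar5 : ∀ q v m → suc (q + v) + m ≡ q + (suc v + m)
   ar5 = solve-∀
   ar6 : ∀ g p a b → (p + a) + b + suc g ≡ (suc g + p + a) + b
   ar6 = solve-∀
   ar7 : ∀ q n e m → q + (n + (e + m)) ≡ q + ((n + e) + m)
   ar7 = solve-∀
   ar8 : ∀ q n v m → q + ((n + suc (suc q + v)) + m) ≡ suc (suc q + v + (q + n + m))
   ar8 = solve-∀

  -- The fusion argument. In d of the d + 1 trees, with roots rs, a fused subtree is built along
  -- which the colour of a tuple together with the leftmost branch through a node w of the
  -- remaining tree no longer changes once the level of w has been passed.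
  module Fusion (T : Tree) (w₀ : X T) (rs : List (X T)) (u : Unique (w₀ ∷ rs)) {d : ℕ} (len : length rs ≡ d)
   (D : LevelHL d) (k : ℕ) (c : List (X T) → ℕ) (c< : ∀ ts → c ts < k) where

   urs : Unique rs
   urs = AllPairs.tail u

   -- Levels are those of `T`: the fused tree is fixed up to level `g`, and `s n` is meant for the
   -- nodes on the levels `n` from `g` on.
   record Stage : Set where
    field
     g : ℕ
     m : ℕ → ℕ
     s : ℕ → X T → X T
     sec : ∀ n → Sec T (m n) (s n)
   open Stage

   -- The leftmost branch through `w` stands in for the last tree. This leaves finitely many level
   -- colourings of d-tuples, one for each `κs` and `w`, which the induction hypothesis homogenizes
   -- together.
   tasksOf : Stage → List (Task T)
   tasksOf st = map
    (λ { (κs , w) → task κs k λ q ts → c (lm T (q + m st (suc (g st) + q)) w ∷ map (s st (suc (g st) + q)) ts) })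
    (cartesianProduct (tuples T (suc (g st)) rs) (descs T (suc (g st)) w₀))

   ready : ∀ st {t} → t ∈ tasksOf st → Ready t
   ready st t∈ with ∈-map⁻ _ t∈
   ... | (κs , w) , a∈ , refl =
    let κs∈ , _ = ∈-cartesianProduct⁻ (tuples T (suc (g st)) rs) _ a∈
        ds = ∈-tuples⁻ {T} (suc (g st)) {rs} {κs} κs∈
    in descs-unique ds urs , (λ n ts → c< _) , subst LevelHL (trans (sym len) (pw-length ds)) D

   next : (st : Stage) → Homogenized T (tasksOf st) → Stage
   next st h = record
    { g = suc (g st) + H.p
    ; m = λ q → H.m (q ∸ (suc (g st) + H.p)) + m st (q + H.m (q ∸ (suc (g st) + H.p)))
    ; s = λ q x → s st (q + H.m (q ∸ (suc (g st) + H.p))) (H.s (q ∸ (suc (g st) + H.p)) x)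
    ; sec = λ q x → desc-trans (H.sec _ x) (sec st _ _)
    }
    where module H = Homogenized h

   st : ℕ → Stage
   hm : ∀ l → Homogenized T (tasksOf (st l))
   st zero = record { g = 0 ; m = λ _ → 0 ; s = λ _ → id ; sec = λ _ _ → stop }
   st (suc l) = next (st l) (hm l)
   hm l = homogenize T (tasksOf (st l)) (ready (st l))

   module H l = Homogenized (hm l)

   gl : ℕ → ℕ
   gl l = g (st l)

   abstract
    -- `v` is the level of `w`, so the difference brings the leftmost extension of `w` to the level
    -- that the section reaches.
    Col : ℕ → ℕ → List (X T) → ℕ → X T → ℕ
    Col l q ts v w = c (lm T ((q + m (st l) q) ∸ v) w ∷ map (s (st l) q) ts)

    Col-def : ∀ l q ts v w → Col l q ts v w ≡ c (lm T ((q + m (st l) q) ∸ v) w ∷ map (s (st l) q) ts)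
    Col-def l q ts v w = refl

    Col< : ∀ l q ts v w → Col l q ts v w < k
    Col< l q ts v w = c< _

    down : ∀ l q ts v w → let n = q ∸ gl (suc l) in
     Col (suc l) q ts v w ≡ Col l (q + H.m l n) (map (H.s l n) ts) v w
    down l q ts v w = cong₂ (λ a b → c (lm T (a ∸ v) w ∷ b)) (sym (+-assoc q _ _)) (map-∘ ts)

   colour-at : ∀ l → List (X T) → X T → ℕ → ℕ
   colour-at l ts w q = c (lm T (q + m (st l) (suc (gl l) + q)) w ∷ map (s (st l) (suc (gl l) + q)) ts)

   base-form : ∀ l n ts w → Col (suc l) (gl (suc l) + n) ts (suc (gl l)) w ≡
    colour-at l (map (H.s l n) ts) w (H.p l + (n + H.m l n))
   base-form l n ts w = trans (down l (gl (suc l) + n) ts (suc G) w)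
    (trans (Col-def l _ _ (suc G) w)
     (trans (cong (λ e → c (lm T (((gl (suc l) + n + H.m l e) + m (st l) (gl (suc l) + n + H.m l e)) ∸ suc G) w ∷
      map (s (st l) (gl (suc l) + n + H.m l e)) (map (H.s l e) ts)))
      (m+n∸m≡n (gl (suc l)) n))
      (trans (cong (λ r → c (lm T ((r + m (st l) r) ∸ suc G) w ∷ map (s (st l) r) (map (H.s l n) ts)))
       (ar1 G (H.p l) n (H.m l n)))
       (cong (λ a → c (lm T a w ∷ map (s (st l) (suc G + r)) (map (H.s l n) ts)))
        (trans (cong (_∸ suc G) (+-assoc (suc G) r _)) (m+n∸m≡n (suc G) _))))))
    where
    G = gl l
    r = H.p l + (n + H.m l n)

   base : ∀ l {κs w} → Pointwise (Desc T (suc (gl l))) rs κs → Desc T (suc (gl l)) w₀ w →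
    ∀ n {ts} → Pointwise (Desc T n) (map (H.pos l) κs) ts →
    Col (suc l) (gl (suc l) + n) ts (suc (gl l)) w ≡
    Col (suc l) (gl (suc l) + 0) (map (H.pos l) κs) (suc (gl l)) w
   base l {κs} {w} ds dw n {ts} ts↓ =
    trans (base-form l n ts w) (trans (H.same l t∈ n ts↓) (sym (base-form l 0 (map (H.pos l) κs) w)))
    where
    t∈ : task κs k (λ q ts → colour-at l ts w q) ∈ tasksOf (st l)
    t∈ = ∈-map⁺ (λ { (κs , w) → task κs k λ q ts → c (lm T (q + m (st l) (suc (gl l) + q)) w ∷ map (s (st l) (suc (gl l) + q)) ts) })
     (∈-cartesianProduct⁺ (∈-tuples⁺ ds) (∈-descs⁺ dw))

   -- Each later stage picks its nodes through the sections of the stage before, hence among nodes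
   -- whose colour is already settled.
   stable : ∀ l {κs w} → Pointwise (Desc T (suc (gl l))) rs κs → Desc T (suc (gl l)) w₀ w →
    ∀ j n {ts} → Pointwise (Desc T n) (map (H.pos l) κs) ts →
    Col (j + suc l) (gl (suc l) + n) ts (suc (gl l)) w ≡
    Col (suc l) (gl (suc l) + 0) (map (H.pos l) κs) (suc (gl l)) w
   stable l ds dw zero    n ts↓ = base l ds dw n ts↓
   stable l {κs} {w} ds dw (suc j) n {ts} ts↓ =
    trans (down (j + suc l) (gl (suc l) + n) ts (suc (gl l)) w)
     (trans (cong (λ q → Col (j + suc l) q (map (H.s (j + suc l) e) ts) (suc (gl l)) w) (+-assoc (gl (suc l)) n _))
      (stable l ds dw j (n + H.m (j + suc l) e)
       (pw-trans desc-trans ts↓ (pw-graph (H.sec (j + suc l) e) ts))))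
    where e = (gl (suc l) + n) ∸ gl (suc (j + suc l))

   ext-desc : ∀ {l x y} → y ∈ map (H.pos l) (kids T x) → Desc T (suc (H.p l)) x y
   ext-desc {l} y∈ with ∈-map⁻ (H.pos l) y∈
   ... | _ , κ∈ , refl = step κ∈ (H.pos↓ l _)

   open Tagged T (λ l → suc (H.p l)) (λ l b → map (H.pos l) (kids T b))
    (λ l b → H.pos l (fst (ne T b)) , ∈-map⁺ (H.pos l) (snd (ne T b))) (λ {l} → ext-desc {l})

   g-gap : ∀ l n → gl l + gap l n ≡ gl (l + n)
   g-gap l zero = trans (+-identityʳ _) (cong gl (sym (+-identityʳ l)))
   g-gap l (suc n) = trans (trans (+-suc (gl l) _) (cong suc (sym (+-assoc (gl l) (H.p l) _))))
    (trans (g-gap (suc l) n) (cong gl (sym (+-suc l n))))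

   g-mono : ∀ {a b} → a ≤ b → gl a ≤ gl b
   g-mono {a} {b} a≤b = subst (gl a ≤_) (trans (g-gap a (b ∸ a)) (cong gl (m+[n∸m]≡n a≤b))) (m≤m+n _ _)

   l≤g : ∀ l → l ≤ gl l
   l≤g zero = z≤n
   l≤g (suc l) = s≤s (≤-trans (l≤g l) (m≤m+n _ _))

   E : ℕ → List (X T) → ℕ → X T → ℕ
   E l ts v w = Col l (gl l) ts v w

   roots : List (ℕ × X T)
   roots = map (0 ,_) rs

   root-desc : ∀ {n r y} → Desc tag n (0 , r) y → fst y ≡ n × Desc T (gl n) r (snd y)
   root-desc {n} d = let e , f = untag d in e , desc-cast (g-gap 0 n) f

   roots-desc : ∀ n {σs} → Pointwise (Desc tag n) roots σs →
    σs ≡ map (n ,_) (map snd σs) × Pointwise (Desc T (gl n)) rs (map snd σs)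
   roots-desc n {σs} ds = fst (untags ds) ,
    subst (λ q → Pointwise (Desc T q) rs (map snd σs)) (g-gap 0 n) (untags-any ds)

   ext-kid : ∀ {l x y} → Desc tag 1 (l , x) y → ∃[ κ ] κ ∈ kids T x × snd y ≡ H.pos l κ
   ext-kid {l} {x} d =
    let b , b∈ , e = ∈-map⁻ (suc l ,_) {xs = map (H.pos l) (kids T x)} (unkid d)
        κ , κ∈ , e′ = ∈-map⁻ (H.pos l) {xs = kids T x} b∈
    in κ , κ∈ , trans (cong snd e) e′

   last-kid : ∀ l {r y} → Desc tag (suc l) (0 , r) y → ∃[ κ ] Desc T (suc (gl l)) r κ × snd y ≡ H.pos l κ
   last-kid l {r} {y} d =
    let (l′ , b) , d₁ , d₂ = desc-split {tag} l {1} {0 , r} {y} (desc-cast (+-comm 1 l) d)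
        e , f = root-desc {l} {r} {l′ , b} d₁
        κ , κ∈ , h = ext-kid {l} {b} {y} (subst (λ z → Desc tag 1 (z , b) y) e d₂)
    in κ , desc-cast (+-comm (gl l) 1) (desc-trans f (kid κ∈)) , h

   last-step : ∀ l rs {σs} → Pointwise (Desc tag (suc l)) (map (0 ,_) rs) σs →
    ∃[ κs ] Pointwise (Desc T (suc (gl l))) rs κs × map snd σs ≡ map (H.pos l) κs
   last-step l []       [] = [] , [] , refl
   last-step l (r ∷ rs) (d ∷ ds) =
    let κ , e , h = last-kid l d
        κs , es , hs = last-step l rs ds
    in κ ∷ κs , e ∷ es , cong₂ _∷_ h hs

   -- This is `stable` read in the fused tree: the last step into level `suc l` ends in `H.pos l` of
   -- a direct extension, and above such nodes stage `l` homogenized.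
   fused : ∀ l {σs w} → Pointwise (Desc tag (suc l)) roots σs → Desc T (suc (gl l)) w₀ w →
    ∀ j {σs′} → Pointwise (Desc tag j) σs σs′ →
    E (j + suc l) (map snd σs′) (suc (gl l)) w ≡ E (suc l) (map snd σs) (suc (gl l)) w
   fused l {σs} {w} ds dw j {σs′} es with last-step l rs ds
   ... | κs , fs , eq = trans
    (trans (cong (λ q → Col (j + suc l) q (map snd σs′) (suc (gl l)) w)
     (sym (trans (g-gap (suc l) j) (cong gl (+-comm (suc l) j)))))
     (stable l fs dw j (gap (suc l) j)
      (subst (λ z → Pointwise (Desc T (gap (suc l) j)) z (map snd σs′)) eq
       (untags-any (subst (λ z → Pointwise (Desc tag j) z σs′) (fst (roots-desc (suc l) ds)) es)))))
    (cong₂ (λ q z → Col (suc l) q z (suc (gl l)) w) (+-identityʳ _) (sym eq))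

   -- Colour i is dense above σs (of fused level q) with respect to branches above x (of level v).
   Den : ℕ → List (ℕ × X T) → ℕ → ℕ → X T → Set
   Den q σs i v x = ∀ n → ∃[ m ] ∃[ s ] ∃[ l ] ∃[ w ] q + (n + m) ≡ suc l × Sec tag m s ×
    Desc T (suc (gl l)) w₀ w × (∃[ y ] v + y ≡ suc (gl l) × Desc T y x w) ×
    (∀ {ts} → Pointwise (Desc tag n) σs ts → E (suc l) (map snd (map s ts)) (suc (gl l)) w ≡ i)

   -- Used contrapositively: a failure of density at a node persists at all its extensions, so
   -- failures can be accumulated along a branch.
   den-up : ∀ q σs i {v x y x′} → Desc T y x x′ → Den q σs i (v + y) x′ → Den q σs i v x
   den-up q σs i {v} {y = y} d D n =
    let m , s , l , w , e , sec , dw , (z , e′ , d′) , col = D n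
    in m , s , l , w , e , sec , dw , (y + z , trans (sym (+-assoc v y z)) e′ , desc-trans d d′) , col

   Goal : Set
   Goal = ∃[ l ] ∃[ σs ] ∃[ i ] i < k × Pointwise (Desc T l) (w₀ ∷ rs) σs × ∃[ m ] ∃[ s ] Hom T c σs 1 m s i

   module Win (q : ℕ) (σs : List (ℕ × X T)) (i : ℕ) (i< : i < k) (v₀ : ℕ) (x₀ : X T)
    (σs↓ : Pointwise (Desc tag q) roots σs) (x₀↓ : Desc T v₀ w₀ x₀)
    (den : ∀ y {x} → Desc T y x₀ x → Den q σs i (v₀ + y) x) where

    Claim : ℕ → List (X T) → ℕ → ℕ → (ℕ × X T → ℕ × X T) → Set
    Claim V ws n m s = ∀ {w} → w ∈ ws → ∃[ y ] ∃[ w′ ] Desc T y w w′ × V + y ≤ gl (q + (n + m)) ×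
     (∀ {ts} → Pointwise (Desc tag n) σs ts → ∀ m′ {ts′} → Pointwise (Desc tag m′) (map s ts) ts′ →
      E (m′ + (q + (n + m))) (map snd ts′) (V + y) w′ ≡ i)

    module Claim∷ (V : ℕ) (w : X T) (ws : List (X T)) (n m : ℕ) (s : ℕ × X T → ℕ × X T) (sec : Sec tag m s)
     (old : Claim V ws n m s) (m₂ : ℕ) (s₂ : ℕ × X T → ℕ × X T) (sec₂ : Sec tag m₂ s₂) (l : ℕ) (w′ : X T)
     (e : q + ((n + m) + m₂) ≡ suc l) (dw : Desc T (suc (gl l)) w₀ w′) (z : ℕ) (ez : V + z ≡ suc (gl l))
     (dz : Desc T z w w′)
     (col : ∀ {ts} → Pointwise (Desc tag (n + m)) σs ts → E (suc l) (map snd (map s₂ ts)) (suc (gl l)) w′ ≡ i)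
     where

     e′ : q + (n + (m + m₂)) ≡ suc l
     e′ = trans (ar3 q n m m₂) e

     first : ∀ {ts} → Pointwise (Desc tag n) σs ts → ∀ m′ {ts′} → Pointwise (Desc tag m′) (map (s₂ ∘ s) ts) ts′ →
      E (m′ + (q + (n + (m + m₂)))) (map snd ts′) (V + z) w′ ≡ i
     first {ts} ds m′ {ts′} fs =
      let gs = pw-trans desc-trans ds (pw-graph sec ts) in
      trans (cong₂ (λ a b → E (m′ + a) (map snd ts′) b w′) e′ ez)
       (trans (fused l {map s₂ (map s ts)} {w′}
        (subst (λ a → Pointwise (Desc tag a) roots (map s₂ (map s ts))) e
         (pw-trans desc-trans σs↓ (pw-trans desc-trans gs (pw-graph sec₂ (map s ts)))))
        dw m′ {ts′} (subst (λ a → Pointwise (Desc tag m′) a ts′) (map-∘ ts) fs))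
        (col gs))

     both : Claim V (w ∷ ws) n (m + m₂) (s₂ ∘ s)
     both (here refl) = z , w′ , dz , subst₂ _≤_ (sym ez) (cong gl (sym e′)) (s≤s (m≤m+n (gl l) (H.p l))) ,
      λ {ts} ds m′ {ts′} fs → first ds m′ fs
     both (there w∈) =
      let y , w″ , dy , V≤ , col′ = old w∈ in
      y , w″ , dy , ≤-trans V≤ (g-mono (+-monoʳ-≤ q (+-monoʳ-≤ n (m≤m+n m m₂)))) ,
      λ {ts} ds m′ {ts′} fs →
       trans (cong (λ a → E a (map snd ts′) (V + y) w″) (sym (ar4 m′ m₂ q n m)))
        (col′ ds (m₂ + m′) (pw-trans desc-trans (pw-graph sec₂ (map s ts))
         (subst (λ a → Pointwise (Desc tag m′) a ts′) (map-∘ ts) fs)))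

    -- The nodes `ws` are served one at a time. Density is applied at height `n + m`, above the
    -- section already built, and `fused` keeps the colours secured before.
    claim : ∀ V ws → (∀ {w} → w ∈ ws → ∃[ y ] v₀ + y ≡ V × Desc T y x₀ w) → ∀ n →
     ∃[ m ] ∃[ s ] Sec tag m s × Claim V ws n m s
    claim V []       h n = 0 , id , (λ _ → stop) , λ ()
    claim V (w ∷ ws) h n =
     let m , s , sec , old = claim V ws (h ∘ there) n
         y , eV , dy = h (here refl)
         m₂ , s₂ , l , w′ , e , sec₂ , dw , (z , ez , dz) , col = den y dy (n + m)
     in m + m₂ , s₂ ∘ s , (λ x → desc-trans (sec x) (sec₂ _)) ,
      Claim∷.both V w ws n m s sec old m₂ s₂ sec₂ l w′ e dw z (trans (cong (_+ z) (sym eV)) ez) dz col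

    l₀ V : ℕ
    -- At least `q`, so that `τs` fits above `σs`, and with `gl l₀` at least `v₀`, so that `w*` fits
    -- above `x₀`.
    l₀ = q + v₀
    V = suc (gl l₀)

    τs : List (ℕ × X T)
    τs = map (lm tag v₀) σs

    τs↓ : Pointwise (Desc tag l₀) roots τs
    τs↓ = pw-trans desc-trans σs↓ (pw-graph (lm-desc tag v₀) σs)

    v₀≤ : v₀ ≤ gl l₀
    v₀≤ = ≤-trans (m≤n+m v₀ q) (l≤g l₀)

    w* : X T
    w* = lm T (gl l₀ ∸ v₀) x₀

    w*↓ : Desc T (gl l₀) w₀ w*
    w*↓ = desc-cast (m+[n∸m]≡n v₀≤) (desc-trans x₀↓ (lm-desc T _ x₀))

    kids↓ : ∀ {w} → w ∈ kids T w* → ∃[ y ] v₀ + y ≡ V × Desc T y x₀ w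
    kids↓ w∈ = gl l₀ ∸ v₀ + 1 ,
     trans (sym (+-assoc v₀ _ 1)) (trans (cong (_+ 1) (m+[n∸m]≡n v₀≤)) (+-comm (gl l₀) 1)) ,
     desc-trans (lm-desc T _ x₀) (kid w∈)

    module Finish (m : ℕ) (sc : ℕ × X T → ℕ × X T) (sec′ : Sec tag m sc) (cl : Claim V (kids T w*) (suc v₀) m sc) where
     Λ G M : ℕ
     Λ = q + (suc v₀ + m)
     G = gl Λ + Stage.m (st Λ) (gl Λ)
     M = G ∸ V

     onward : X T → X T
     onward x = s (st Λ) (gl Λ) (snd (sc (suc l₀ , H.pos l₀ x)))

     -- Direct extensions of `w*` follow the branch chosen for them up to the common level `G`; all
     -- other nodes follow the fused sections to that level.
     fin′ : ∀ x → Dec (x ∈ kids T w*) → X T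
     fin′ x (yes x∈) = let y , w′ , _ = cl x∈ in lm T (G ∸ (V + y)) w′
     fin′ x (no _) = onward x

     fin : X T → X T
     fin x = fin′ x em

     V+M : suc l₀ + m ≡ Λ
     V+M = ar5 q v₀ m

     into : ∀ {y} → V + y ≤ gl Λ → y + (G ∸ (V + y)) ≡ M
     into {y} V≤ = +-cancelˡ-≡ V _ _ (trans (sym (+-assoc V y _))
      (trans (m+[n∸m]≡n (≤-trans V≤ (m≤m+n _ _)))
       (sym (m+[n∸m]≡n (≤-trans (≤-trans (m≤m+n V y) V≤) (m≤m+n _ _))))))

     V≤Λ : V ≤ gl Λ
     V≤Λ = ≤-trans (m≤m+n V (H.p l₀)) (g-mono (subst (suc l₀ ≤_) V+M (m≤m+n _ m)))

     onto : (H.p l₀ + gap (suc l₀) m) + Stage.m (st Λ) (gl Λ) ≡ M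
     onto = +-cancelʳ-≡ V _ _ (trans (ar6 (gl l₀) (H.p l₀) (gap (suc l₀) m) _)
      (trans (cong (_+ Stage.m (st Λ) (gl Λ)) (trans (g-gap (suc l₀) m) (cong gl V+M)))
       (sym (m∸n+n≡m (≤-trans V≤Λ (m≤m+n _ _))))))

     fin-sec′ : ∀ x (x∈? : Dec (x ∈ kids T w*)) → Desc T M x (fin′ x x∈?)
     fin-sec′ x (yes x∈) = let y , w′ , dy , V≤ , _ = cl x∈ in
      desc-cast (into V≤) (desc-trans dy (lm-desc T _ w′))
     fin-sec′ x (no _) = desc-cast onto
      (desc-trans (desc-trans (H.pos↓ l₀ x) (snd (untag (sec′ (suc l₀ , H.pos l₀ x))))) (sec (st Λ) (gl Λ) _))

     fin-off : ∀ {x} → ¬ x ∈ kids T w* → fin x ≡ onward x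
     fin-off {x} x∉ = go em
      where
      go : ∀ x∈? → fin′ x x∈? ≡ onward x
      go (yes x∈) = ⊥-elim (x∉ x∈)
      go (no _) = refl

     -- Nodes above different roots have different direct extensions, which lets `fin` single out
     -- the first tree.
     disjoint : ∀ {r b κ} → ¬ w₀ ≡ r → Desc T (gl l₀) r b → κ ∈ kids T b → ¬ κ ∈ kids T w*
     disjoint {r} r≢ db κ∈ κ∈′ =
      r≢ (desc-unique w*↓ (subst (Desc T (gl l₀) r) (uniq T κ∈ κ∈′) db))

     off : ∀ {rs bs κs} → All (λ r → ¬ w₀ ≡ r) rs → Pointwise (Desc T (gl l₀)) rs bs → Pointwise (Desc T 1) bs κs →
      map fin κs ≡ map onward κs
     off []       []       [] = refl
     off (a ∷ as) (b ∷ bs) (e ∷ es) = cong₂ _∷_ (fin-off (disjoint a b (unkid e))) (off as bs es)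

     bs : List (X T)
     bs = map snd τs

     bs↓ : Pointwise (Desc T (gl l₀)) rs bs
     bs↓ = snd (roots-desc l₀ τs↓)

     first-kid : ∀ {w κs} → w ∈ kids T w* → Pointwise (Desc T 1) bs κs → (w∈? : Dec (w ∈ kids T w*)) →
      c (fin′ w w∈? ∷ map onward κs) ≡ i
     first-kid w∈ es (no w∉) = ⊥-elim (w∉ w∈)
     first-kid {w} {κs} _ es (yes w∈) =
      let y , w′ , dy , V≤ , col = cl w∈
          ts = map (λ κ → suc l₀ , H.pos l₀ κ) κs
          ts↓ : Pointwise (Desc tag 1) τs ts
          ts↓ = subst (λ z → Pointwise (Desc tag 1) z ts) (sym (fst (roots-desc l₀ τs↓)))
           (pw-map (λ e → tag-kid (∈-map⁺ (H.pos l₀) (unkid e))) es)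
      in trans (cong (λ z → c (lm T (G ∸ (V + y)) w′ ∷ z))
       (trans (map-∘ κs) (cong (map (s (st Λ) (gl Λ))) (trans (map-∘ κs) (cong (map snd) (map-∘ κs))))))
       (trans (sym (Col-def Λ (gl Λ) (map snd (map sc ts)) (V + y) w′))
        (col (subst (λ z → Pointwise (Desc tag z) σs ts) (+-comm v₀ 1)
         (pw-trans desc-trans (pw-graph (lm-desc tag v₀) σs) ts↓)) 0 (pw-refl stop)))

     goal : Goal
     goal = gl l₀ , w* ∷ bs , i , i< , w*↓ ∷ bs↓ , M , fin ,
      hom (λ x → fin-sec′ x em) λ { (e ∷ es) →
       trans (cong (λ z → c (_ ∷ z)) (off (AllPairs.head u) bs↓ es)) (first-kid (unkid e) es em) }

    win : Goal
    win = let m , sc , sec′ , cl = claim V (kids T w*) kids↓ (suc v₀) in Finish.goal m sc sec′ cl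

   Pt : Set
   Pt = Σ ℕ λ v → Σ (X T) λ x → Desc T v w₀ x

   _⊒_ : Pt → Pt → Set
   (v′ , x′ , _) ⊒ (v , x , _) = ∃[ y ] v + y ≡ v′ × Desc T y x x′

   ⊒-trans : ∀ {a b c} → a ⊒ b → b ⊒ c → a ⊒ c
   ⊒-trans {c = v , _} (y , refl , d) (z , refl , e) = z + y , sym (+-assoc v z y) , desc-trans e d

   ⊒-refl : ∀ {a} → a ⊒ a
   ⊒-refl {v , _} = 0 , +-identityʳ v , stop

   module NoWin (no-win : ¬ Goal) where

    -- If no extension of `a` escaped, colour `i` would be dense above `σs` with respect to every
    -- extension of `a`, which is what `Win` starts from.
    escape : ∀ q {σs i} → i < k → Pointwise (Desc tag q) roots σs → ∀ (a : Pt) →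
     ∃[ b ] b ⊒ a × ¬ Den q σs i (fst b) (fst (snd b))
    escape q {σs} {i} i< ds (v , x , dx) = by-contra em λ none →
     no-win (Win.win q σs i i< v x ds dx λ y {x′} d → by-contra em λ ¬den →
      none ((v + y , x′ , desc-trans dx d) , (y , refl , d) , ¬den))

    Avoids : ℕ → Pt → Set
    Avoids q (v , x , _) = ∀ {σs i} → Pointwise (Desc tag q) roots σs → i < k → ¬ Den q σs i v x

    abstract
     avoid : ∀ q (a : Pt) → ∃[ b ] b ⊒ a × Avoids q b
     avoid q a =
      let b , b⊒a , h = meet-all {_≤′_ = _⊒_} {P = λ { (σs , i) (v , x , _) → ¬ Den q σs i v x }}
           (λ {s} → ⊒-refl {s}) (λ {s} {t} {u} → ⊒-trans {s} {t} {u})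
           (λ { {a = σs , i} {t = v , x , _} (y , refl , d) ¬den den → ¬den (den-up q σs i d den) })
           (cartesianProduct (tuples tag q roots) (upTo k)) a
           (λ a∈ s _ → let b∈ , i∈ = ∈-cartesianProduct⁻ (tuples tag q roots) (upTo k) a∈ in
            escape q (∈-upTo⁻ i∈) (∈-tuples⁻ q b∈) s)
      in b , b⊒a , λ ds i< → h (∈-cartesianProduct⁺ (∈-tuples⁺ ds) (∈-upTo⁺ i<))

    chain : ℕ → Pt
    chain zero = 0 , w₀ , stop
    chain (suc q) = fst (avoid q (chain q))

    chain-⊒ : ∀ e j → chain (j + e) ⊒ chain e
    chain-⊒ e zero = ⊒-refl {chain e}
    chain-⊒ e (suc j) = ⊒-trans {chain (suc (j + e))} {chain (j + e)} {chain e}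
     (fst (snd (avoid (j + e) (chain (j + e))))) (chain-⊒ e j)

    Above : ℕ → X T → ℕ → Set
    Above L w e = fst (chain e) ≤ L → ∃[ y ] fst (chain e) + y ≡ L × Desc T y (fst (snd (chain e))) w

    -- The chain is increasing, so a node above its highest member that fits below level `L` lies
    -- above all earlier members as well.
    node : ∀ L e → ∃[ w ] Desc T L w₀ w × (∀ {e′} → e′ ≤ e → Above L w e′)
    node L zero = lm T L w₀ , lm-desc T L w₀ , λ { z≤n _ → L , refl , lm-desc T L w₀ }
    node L (suc e) with em {fst (chain (suc e)) ≤ L}
    ... | no ≰ = let w , dw , h = node L e in w , dw , λ {e′} e′≤ ≤L → lower w h e′≤ ≤L
     where
     lower : ∀ w → (∀ {e′} → e′ ≤ e → Above L w e′) → ∀ {e′} → e′ ≤ suc e → Above L w e′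
     lower w h {e′} e′≤ ≤L with e′ ≟ suc e
     ... | yes refl = ⊥-elim (≰ ≤L)
     ... | no ≢ = h (≤-pred (≤∧≢⇒< e′≤ ≢)) ≤L
    ... | yes v≤ = lm T y x , desc-cast (m+[n∸m]≡n v≤) (desc-trans dx (lm-desc T y x)) , λ {e′} e′≤ _ →
     let z , ez , dz = subst (λ a → chain a ⊒ chain e′) (m∸n+n≡m e′≤) (chain-⊒ e′ (suc e ∸ e′)) in
     z + y , trans (sym (+-assoc _ z y)) (trans (cong (_+ y) ez) (m+[n∸m]≡n v≤)) , desc-trans dz (lm-desc T y x)
     where
     v = fst (chain (suc e))
     x = fst (snd (chain (suc e)))
     dx = snd (snd (chain (suc e)))
     y = L ∸ v

    w : ℕ → X T
    w l = fst (node (suc (gl l)) l)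

    -- Completing each tuple by the leftmost branch through `w` turns `E` into a level colouring in
    -- `d` trees. The induction hypothesis makes some colour dense above some `σs` on fused level
    -- `q`, with respect to branches above `chain (suc q)`, and that node was chosen to exclude
    -- this.
    contra : ⊥
    contra =
     let q , σs , i , i< , ds , h = D tag roots (roots-unique urs) (trans (length-map _ rs) len) k
          (λ n ts → E n (map snd ts) (suc (gl (pred n))) (w (pred n))) (λ n ts → Col< n _ _ _ _)
         v , x , _ = chain (suc q)
     in snd (snd (avoid q (chain q))) ds i< λ n →
      -- Raises the level far enough for `w l` to extend `chain (suc q)`: `l` has to be at least
      -- `suc q`, and the level of `w l` at least `v`.
      let e = suc (suc q + v)
          m , s , hom sec col = h (n + e)
          l = suc q + v + (q + n + m)
          eq : q + ((n + e) + m) ≡ suc l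
          eq = ar8 q n v m
          _ , dw , above = node (suc (gl l)) l
      in e + m , s ∘ lm tag e , l , w l , trans (ar7 q n e m) eq ,
       (λ x → desc-trans (lm-desc tag e x) (sec _)) , dw ,
       above (≤-trans (m≤m+n (suc q) v) (m≤m+n _ _))
        (≤-trans (≤-trans (m≤n+m v (suc q)) (m≤m+n _ _)) (≤-trans (l≤g l) (n≤1+n _))) ,
       λ {ts} es → trans
        (cong₂ (λ a z → E a (map snd z) (suc (gl (pred a))) (w (pred a))) (sym eq) (map-∘ ts))
        (col (pw-trans desc-trans es (pw-graph (lm-desc tag e) ts)))

   goal : Goal
   goal = by-contra em λ no-win → NoWin.contra no-win

  one-step : ∀ d → OneStepHL d
  one-step zero T [] u len k c c< = 0 , [] , c [] , c< [] , [] , 0 , id , hom (λ _ → stop) λ { [] → refl }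
  one-step (suc d) T (w₀ ∷ rs) u len k c c< =
   Fusion.goal T w₀ rs u (suc-injective len) (levelled (dense (one-step d))) k c c<

  levelHL : ∀ d → LevelHL d
  levelHL d = levelled (dense (one-step d))

 -- Search, enumerability and Turing reducibility

 module Computability where
  open ListLemmas
  open Programs
  open TypedPrograms
  open import Data.Fin.Base using (zero; suc)
  open import Data.List.Relation.Unary.All using ([]; _∷_)
  open import Data.Vec.Base using (Vec; []; _∷_; head; tail)
  open import Data.Vec.Relation.Binary.Pointwise.Inductive using (Pointwise; []; _∷_)

  least : {P : ℕ → Set} → ∃ P → ∃[ n ] P n × (∀ {m} → m < n → ¬ P m)
  least {P} (n , p) with go (suc n)
   where
   go : ∀ k → (∃[ n ] P n × (∀ {m} → m < n → ¬ P m)) ⊎ (∀ {m} → m < k → ¬ P m)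
   go zero = inj₂ λ ()
   go (suc k) with go k
   ... | inj₁ h = inj₁ h
   ... | inj₂ h with em {P k}
   ...   | yes p = inj₁ (k , p , h)
   ...   | no ¬p = inj₂ λ {m} m<sk q → ¬p (subst P (≤-antisym (≤-pred m<sk) (≮⇒≥ λ m<k → h m<k q)) q)
  ... | inj₁ h = h
  ... | inj₂ h = ⊥-elim (h ≤-refl p)

  module _ {X : Orc} where

   -- Minimization turns a classical existence proof for a decidable relation into a computable
   -- choice function. This is how objects obtained by noneffective arguments are made computable.
   search : ∀ {s t R} → Deci X (s ⊗ t) R → (∀ a → ∃[ y ] R (a , y)) →
    Σ (El s → El t) λ F → Cmp X s t F × (∀ a → R (a , F a))
   search {s} {t} {R} (deci χ (cmp c v e) r) ex =
    (λ a → dec t (g (enc s a))) , cmp g (mk1 (mkV (mu (V.prog test)) run)) (λ a → sym (enc-dec t _)) , λ a →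
     subst (λ b → R (b , dec t (g (enc s a)))) (dec-enc s a) (fst (snd (L (enc s a))))
    where
    P : ℕ → ℕ → Set
    P m n = R (dec s m , dec t n)
    L : ∀ m → ∃[ n ] P m n × (∀ {k} → k < n → ¬ P m k)
    L m = least (let y , p = ex (dec s m) in enc t y , subst (λ z → R (dec s m , z)) (sym (dec-enc t y)) p)
    g : ℕ → ℕ
    g m = fst (L m)
    test : V X 2 (λ xs → 1 ∸ c (pair (head (tail xs)) (head xs)))
    test = c2 v-sub (v-const 1) (c1 v (c2 v-pair v1 v0))
    value : ∀ m n → c (pair m n) ≡ χ (dec s m , dec t n)
    value m n = trans (cong c (cong₂ pair (sym (enc-dec s m)) (sym (enc-dec t n)))) (e _)
    runs : ∀ m n {z} → 1 ∸ c (pair m n) ≡ z → ⌞ X ⌟ ⊢ V.prog test ⟨ n ∷ m ∷ [] ⟩⇓ z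
    runs m n refl = V.runs test (n ∷ m ∷ [])
    isone : ∀ m n → P m n → 1 ∸ c (pair m n) ≡ 0
    isone m n p with r (dec s m , dec t n)
    ... | inj₁ (q , _) = cong (1 ∸_) (trans (value m n) q)
    ... | inj₂ (_ , ¬p) = ⊥-elim (¬p p)
    iszero : ∀ m n → ¬ P m n → 1 ∸ c (pair m n) ≡ 1
    iszero m n ¬p with r (dec s m , dec t n)
    ... | inj₁ (_ , p) = ⊥-elim (¬p p)
    ... | inj₂ (q , _) = cong (1 ∸_) (trans (value m n) q)
    run : ∀ xs → ⌞ X ⌟ ⊢ mu (V.prog test) ⟨ xs ⟩⇓ g (head xs)
    run (m ∷ []) = mu⇓ (runs m (g m) (isone m _ (fst (snd (L m)))))
     λ {k} k< → 0 , runs m k (iszero m k (snd (snd (L m)) k<))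

  -- The stages need not be increasing in the second argument; `re-all` therefore searches below a
  -- common bound.
  record RE (X : Orc) (s : Ty) (P : El s → Set) : Set₁ where
   constructor re
   field
    {R} : El (s ⊗ nat) → Set
    stage : Deci X (s ⊗ nat) R
    sound : ∀ {a n} → R (a , n) → P a
    complete : ∀ {a} → P a → ∃[ n ] R (a , n)

  module _ {X : Orc} where

   re-dec : ∀ {s P} → Deci X s P → RE X s P
   re-dec d = re (d-sub d (fstC idC)) id (λ p → 0 , p)

   re-iff : ∀ {s P Q} → (∀ a → (P a → Q a) × (Q a → P a)) → RE X s P → RE X s Q
   re-iff h (re d f g) = re d (λ {a} r → fst (h a) (f r)) (λ {a} q → g (snd (h a) q))

   re-sub : ∀ {r s P f} → RE X s P → Cmp X r s f → RE X r (λ a → P (f a))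
   re-sub {f = f} (re {R} d g h) cf = re {R = λ p → R (f (fst p) , snd p)}
    (d-sub d (pairC (cf ∘C fstC idC) (sndC idC))) g h

   re-∃ : ∀ {s} t {P} → RE X (s ⊗ t) P → RE X s (λ a → ∃[ y ] P (a , y))
   re-∃ {s} t {P} (re {R} d f g) =
    re {R = λ p → R ((fst p , dec t (π₁ (snd p))) , π₂ (snd p))}
     (d-sub d (pairC (pairC (fstC idC) (decC ∘C opC₁ v-π₁ (sndC idC))) (opC₁ v-π₂ (sndC idC))))
     (λ r → _ , f r)
     λ {a} (y , p) → let n , r = g p in pair (enc t y) n ,
      subst₂ (λ u v → R ((a , u) , v)) (sym (trans (cong (dec t) (π₁-pair (enc t y) n)) (dec-enc t y)))
       (sym (π₂-pair (enc t y) n)) r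
    where
    decC : Cmp X nat t (dec t)
    decC = cmp (λ n → n) (mk1 v0) λ n → sym (enc-dec t n)

   re-and : ∀ {s P Q} → RE X s P → RE X s Q → RE X s (λ a → P a × Q a)
   re-and {s} {P} {Q} (re {R} d f g) (re {R′} d′ f′ g′) = re-iff
    (λ a → (λ { ((n , m) , r , r′) → f r , f′ r′ }) ,
     (λ (p , q) → let n , r = g p ; m , r′ = g′ q in (n , m) , r , r′))
    (re-∃ (nat ⊗ nat) {P = λ p → R (fst p , fst (snd p)) × R′ (fst p , snd (snd p))}
     (re-dec (d-and (d-sub d (pairC (fstC idC) (fstC (sndC idC)))) (d-sub d′ (pairC (fstC idC) (sndC (sndC idC)))))))

   re-or : ∀ {s P Q} → RE X s P → RE X s Q → RE X s (λ a → P a ⊎ Q a)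
   re-or {s} {P} {Q} (re {R} d f g) (re {R′} d′ f′ g′) = re {R = λ p → R p ⊎ R′ p} (d-or d d′)
    (λ { (inj₁ r) → inj₁ (f r) ; (inj₂ r) → inj₂ (f′ r) })
    (λ { (inj₁ p) → let n , r = g p in n , inj₁ r ; (inj₂ p) → let n , r = g′ p in n , inj₂ r })

   re-none : ∀ {s} → RE X s (λ _ → ⊥)
   re-none = re-dec (deci (λ _ → 0) (constC nat 0) λ _ → inj₂ (refl , id))

   re-union : ∀ {A : Set} {s} (ts : List A) {P : A → El s → Set} → (∀ {t} → t ∈ ts → RE X s (P t)) →
    RE X s (λ a → ∃[ t ] t ∈ ts × P t a)
   re-union []       h = re-iff (λ a → (λ ()) , λ ()) re-none
   re-union (t ∷ ts) h = re-iff
    (λ a → (λ { (inj₁ p) → _ , here refl , p ; (inj₂ (t , t∈ , p)) → t , there t∈ , p }) ,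
     (λ { (_ , here refl , p) → inj₁ p ; (t , there t∈ , p) → inj₂ (t , t∈ , p) }))
    (re-or (h (here refl)) (re-union ts (h ∘ there)))

   re-all : ∀ {s} t {Q l} → RE X (s ⊗ t) Q → Cmp X s (list t) l → RE X s (λ a → ∀ {y} → y ∈ l a → Q (a , y))
   re-all {s} t {Q} {l} (re {R} d f g) cl =
    re {R = λ p → ∀ {y} → y ∈ l (fst p) → ∃[ m ] m < snd p × R ((fst p , y) , m)}
     (d-all {Q = λ q → ∃[ m ] m < snd (fst q) × R ((fst (fst q) , snd q) , m)}
      (d-∃< {Q = λ q → R ((fst (fst (fst q)) , snd (fst q)) , snd q)}
       (d-sub d (pairC (pairC (fstC (fstC (fstC idC))) (sndC (fstC idC))) (sndC idC)))
       (sndC (fstC idC)))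
      (cl ∘C fstC idC))
     (λ h y∈ → let m , _ , r = h y∈ in f r)
     λ {a} h → bounded-∀ {P = λ y n → ∃[ m ] m < n × R ((a , y) , m)}
      (λ m≤n (k , k< , r) → k , ≤-trans k< m≤n , r) (l a)
      λ y∈ → let n , r = g (h y∈) in suc n , n , ≤-refl , r

  χ : Pred ℕ 0ℓ → ℕ → ℕ
  χ C n with em {C n}
  ... | yes _ = 1
  ... | no _ = 0

  χ-cases : ∀ C n → (χ C n ≡ 1 × C n) ⊎ (χ C n ≡ 0 × ¬ C n)
  χ-cases C n with em {C n}
  ... | yes c = inj₁ (refl , c)
  ... | no ¬c = inj₂ (refl , ¬c)

  ≤T⇒runs : ∀ {C P : Pred ℕ 0ℓ} ((e , _) : C ≤T P) → ∀ x → P ⊢ e ⟨ x ∷ [] ⟩⇓ χ C x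
  ≤T⇒runs {C} (e , h) x with em {C x}
  ... | yes c = fst (h x) c
  ... | no ¬c = snd (h x) ¬c

  ≤T⇒deci : ∀ {C X} → C ≤T ⌞ X ⌟ → Deci X nat C
  ≤T⇒deci {C} r = deci (χ C) (cmp (χ C) (mk1 (mkV (fst r) λ { (x ∷ []) → ≤T⇒runs r x })) λ _ → refl) (χ-cases C)

  deci⇒≤T : ∀ {C X} → Deci X nat C → C ≤T ⌞ X ⌟
  deci⇒≤T {C} {X} (deci χ (cmp c (mk1 (mkV p r)) e) ref) = p , λ x →
   (λ cx → subst (λ y → ⌞ X ⌟ ⊢ p ⟨ x ∷ [] ⟩⇓ y) (trans (e x) (yes-case x (ref x) cx)) (r (x ∷ []))) ,
   (λ cx → subst (λ y → ⌞ X ⌟ ⊢ p ⟨ x ∷ [] ⟩⇓ y) (trans (e x) (no-case x (ref x) cx)) (r (x ∷ [])))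
   where
   yes-case : ∀ x → (χ x ≡ 1 × C x) ⊎ (χ x ≡ 0 × ¬ C x) → C x → χ x ≡ 1
   yes-case x (inj₁ (e , _))  _ = e
   yes-case x (inj₂ (_ , ¬c)) c = ⊥-elim (¬c c)
   no-case : ∀ x → (χ x ≡ 1 × C x) ⊎ (χ x ≡ 0 × ¬ C x) → ¬ C x → χ x ≡ 0
   no-case x (inj₂ (e , _)) _ = e
   no-case x (inj₁ (_ , c)) ¬c = ⊥-elim (¬c c)

  -- Each query to `P` is replaced by the program `q`, which answers it from `Q`. Transitivity of
  -- reducibility and the passage to stronger oracles both rest on this.
  module Subst (P Q : Pred ℕ 0ℓ) (q : Rec 1) (q-yes : ∀ {x} → P x → Q ⊢ q ⟨ x ∷ [] ⟩⇓ 1)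
   (q-no : ∀ {x} → ¬ P x → Q ⊢ q ⟨ x ∷ [] ⟩⇓ 0) where
   tr : ∀ {n} → Rec n → Rec n
   trs : ∀ {n m} → Vec (Rec n) m → Vec (Rec n) m
   tr zer = zer
   tr succ = succ
   tr (proj i) = proj i
   tr query = q
   tr (comp e es) = comp (tr e) (trs es)
   tr (prec e e′) = prec (tr e) (tr e′)
   tr (mu e) = mu (tr e)
   trs [] = []
   trs (e ∷ es) = tr e ∷ trs es

   run : ∀ {n} {e : Rec n} {xs y} → P ⊢ e ⟨ xs ⟩⇓ y → Q ⊢ tr e ⟨ xs ⟩⇓ y
   runs : ∀ {n m} {es : Vec (Rec n) m} {xs ys} → Pointwise (λ e y → P ⊢ e ⟨ xs ⟩⇓ y) es ys →
    Pointwise (λ e y → Q ⊢ e ⟨ xs ⟩⇓ y) (trs es) ys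
   run zer⇓ = zer⇓
   run succ⇓ = succ⇓
   run proj⇓ = proj⇓
   run (yes⇓ p) = q-yes p
   run (no⇓ p) = q-no p
   run (comp⇓ ds d) = comp⇓ (runs ds) (run d)
   run (prec0⇓ d) = prec0⇓ (run d)
   run (prec+⇓ d e) = prec+⇓ (run d) (run e)
   run {e = mu e₀} {xs} (mu⇓ {y = y} d h) = mu⇓ (run d) h′
    where
    h′ : ∀ {z} → z < y → ∃[ w ] Q ⊢ tr e₀ ⟨ z ∷ xs ⟩⇓ suc w
    h′ z< with h z<
    ... | w , e = w , run e
   runs [] = []
   runs (d ∷ ds) = run d ∷ runs ds

  ≤T-trans : ∀ {C P Q : Pred ℕ 0ℓ} → C ≤T P → P ≤T Q → C ≤T Q
  ≤T-trans {C} {P} {Q} (e , h) (q , k) = S.tr e , λ x → (λ c → S.run (fst (h x) c)) , (λ c → S.run (snd (h x) c))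
   where module S = Subst P Q q (λ {x} → fst (k x)) (λ {x} → snd (k x))

  ≤T-iff : ∀ {P Q : Pred ℕ 0ℓ} → (∀ x → (P x → Q x) × (Q x → P x)) → P ≤T Q
  ≤T-iff h = query , λ x → (λ p → yes⇓ (fst (h x) p)) , (λ ¬p → no⇓ λ q → ¬p (snd (h x) q))

  infix 4 _⊑_
  _⊑_ : Orc → Orc → Set
  X ⊑ Y = ⌞ X ⌟ ≤T ⌞ Y ⌟

  ⊑-refl : ∀ {X} → X ⊑ X
  ⊑-refl = ≤T-iff λ x → id , id

  ⊑-trans : ∀ {X Y Z} → X ⊑ Y → Y ⊑ Z → X ⊑ Z
  ⊑-trans = ≤T-trans

  v-up : ∀ {X Y n f} → X ⊑ Y → V X n f → V Y n f
  v-up {X} {Y} (q , k) (mkV p r) = mkV (S.tr p) λ xs → S.run (r xs)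
   where module S = Subst ⌞ X ⌟ ⌞ Y ⌟ q (λ {x} → fst (k x)) (λ {x} → snd (k x))

  c-up : ∀ {X Y s t f} → X ⊑ Y → Cmp X s t f → Cmp Y s t f
  c-up h (cmp c (mk1 v) e) = cmp c (mk1 (v-up h v)) e

  d-up : ∀ {X Y s P} → X ⊑ Y → Deci X s P → Deci Y s P
  d-up h (deci χ c r) = deci χ (c-up h c) r

  oracle : Pred ℕ 0ℓ → Orc
  oracle P n with em {P n}
  ... | yes _ = true
  ... | no _ = false

  oracle-iff : ∀ P n → (P n → ⌞ oracle P ⌟ n) × (⌞ oracle P ⌟ n → P n)
  oracle-iff P n with em {P n}
  ... | yes p = (λ _ → refl) , (λ _ → p)
  ... | no ¬p = (λ p → ⊥-elim (¬p p)) , (λ ())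

  ≤T-oracle : ∀ {P} → P ≤T ⌞ oracle P ⌟
  ≤T-oracle {P} = ≤T-iff (oracle-iff P)

  oracle-≤T : ∀ {P} → ⌞ oracle P ⌟ ≤T P
  oracle-≤T {P} = ≤T-iff λ n → snd (oracle-iff P n) , fst (oracle-iff P n)

  par half : ℕ → ℕ
  par zero = 0
  par (suc n) = 1 ∸ par n
  half zero = 0
  half (suc n) = half n + par n

  par-half-even : ∀ y → par (2 * y) ≡ 0 × half (2 * y) ≡ y
  par-half-even zero = refl , refl
  par-half-even (suc y) rewrite +-suc y (y + 0) with par-half-even y
  ... | p , h rewrite p | h = refl , trans (cong (_+ 1) (+-identityʳ y)) (+-comm y 1)

  par-half-odd : ∀ y → par (suc (2 * y)) ≡ 1 × half (suc (2 * y)) ≡ y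
  par-half-odd y with par-half-even y
  ... | p , h rewrite p | h = refl , +-identityʳ y

  parity : ∀ n → (par n ≡ 0 × n ≡ 2 * half n) ⊎ (par n ≡ 1 × n ≡ suc (2 * half n))
  parity zero = inj₁ (refl , refl)
  parity (suc n) with parity n
  ... | inj₁ (p , e) rewrite p = inj₂ (refl , cong suc (trans e (cong (2 *_) (sym (+-identityʳ (half n))))))
  ... | inj₂ (p , e) rewrite p = inj₁ (refl , trans (cong suc e) (sym (trans (cong (2 *_) (+-comm (half n) 1)) (cong suc (+-suc _ _)))))

  join : Orc → Orc → Orc
  join X Z n = ifzT (par n) (X (half n)) (Z (half n))

  join-even : ∀ X Z y → join X Z (2 * y) ≡ X y
  join-even X Z y with par-half-even y
  ... | p , h rewrite p | h = refl

  join-odd : ∀ X Z y → join X Z (suc (2 * y)) ≡ Z y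
  join-odd X Z y with par-half-odd y
  ... | p , h rewrite p | h = refl

  join-iff : ∀ X Z n → (⌞ join X Z ⌟ n → (⌞ X ⌟ ⊕ ⌞ Z ⌟) n) × ((⌞ X ⌟ ⊕ ⌞ Z ⌟) n → ⌞ join X Z ⌟ n)
  join-iff X Z n = (λ h → go h (parity n)) ,
   λ { (inj₁ (y , refl , p)) → trans (join-even X Z y) p ; (inj₂ (y , refl , p)) → trans (join-odd X Z y) p }
   where
   go : join X Z n ≡ true → (par n ≡ 0 × n ≡ 2 * half n) ⊎ (par n ≡ 1 × n ≡ suc (2 * half n)) → (⌞ X ⌟ ⊕ ⌞ Z ⌟) n
   go h (inj₁ (p , e)) = inj₁ (half n , e , trans (cong (λ z → ifzT z (X (half n)) (Z (half n))) (sym p)) h)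
   go h (inj₂ (p , e)) = inj₂ (half n , e , trans (cong (λ z → ifzT z (X (half n)) (Z (half n))) (sym p)) h)

  doubleC : ∀ {X s f} → Cmp X s nat f → Cmp X s nat (λ a → 2 * f a)
  doubleC {f = f} c = c-cast (λ a → cong (f a +_) (sym (+-identityʳ (f a)))) (addC c c)

  ⊑-joinˡ : ∀ X Z → X ⊑ join X Z
  ⊑-joinˡ X Z = deci⇒≤T (d-iff (λ y → (λ p → trans (sym (join-even X Z y)) p) , (λ p → trans (join-even X Z y) p))
   (d-sub d-oracle (doubleC idC)))

  ⊑-joinʳ : ∀ X Z → Z ⊑ join X Z
  ⊑-joinʳ X Z = deci⇒≤T (d-iff (λ y → (λ p → trans (sym (join-odd X Z y)) p) , (λ p → trans (join-odd X Z y) p))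
   (d-sub d-oracle (sucC (doubleC idC))))

  module _ {X : Orc} where

   parC : ∀ {s f} → Cmp X s nat f → Cmp X s nat (λ a → par (f a))
   parC {f = f} cf = c-cast (λ a → lem (f a)) (nrecC (constC nat 0) (subC (constC nat 1) (sndC (sndC idC))) cf)
    where
    lem : ∀ n → nrec 0 (λ _ y → 1 ∸ y) n ≡ par n
    lem zero = refl
    lem (suc n) = cong (1 ∸_) (lem n)

   halfC : ∀ {s f} → Cmp X s nat f → Cmp X s nat (λ a → half (f a))
   halfC {f = f} cf = c-cast (λ a → lem (f a))
    (nrecC (constC nat 0) (addC (sndC (sndC idC)) (parC (fstC (sndC idC)))) cf)
    where
    lem : ∀ n → nrec 0 (λ i y → y + par i) n ≡ half n
    lem zero = refl
    lem (suc n) = cong (_+ par n) (lem n)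

  ⊑-join : ∀ {X Z Y} → X ⊑ Y → Z ⊑ Y → join X Z ⊑ Y
  ⊑-join {X} {Z} h k = deci⇒≤T (d-iff
   (λ n → (λ { (f , g) → go n (par n) refl f g }) , λ e → back n (par n) refl e)
   (d-and (d-imp (d-≡ nat (parC idC) (constC nat 0)) (d-sub (≤T⇒deci h) (halfC idC)))
    (d-imp (d-not (d-≡ nat (parC idC) (constC nat 0))) (d-sub (≤T⇒deci k) (halfC idC)))))
   where
   go : ∀ n p → par n ≡ p → (par n ≡ 0 → X (half n) ≡ true) → (¬ par n ≡ 0 → Z (half n) ≡ true) → join X Z n ≡ true
   go n zero    e f g rewrite e = f refl
   go n (suc p) e f g rewrite e = g λ ()
   back : ∀ n p → par n ≡ p → join X Z n ≡ true → (par n ≡ 0 → X (half n) ≡ true) × (¬ par n ≡ 0 → Z (half n) ≡ true)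
   back n zero    e t rewrite e = (λ _ → t) , λ q → ⊥-elim (q refl)
   back n (suc p) e t rewrite e = (λ ()) , λ _ → t

 -- Bounded simulation of oracle computations and the use principle

 module Simulation where
  open ListLemmas
  open Programs
  open TypedPrograms
  open Computability
  open import Data.Fin.Base using (zero; suc)
  open import Data.Vec.Base using (Vec; []; _∷_; head; tail; lookup)
  open import Data.Vec.Relation.Binary.Pointwise.Inductive using (Pointwise; []; _∷_)

  -- A string lists the first values of a set in reverse order; at ρ z is 0 where the string is
  -- undefined and the successor of the value elsewhere.
  dist : ℕ → ℕ → ℕ
  dist m n = (m ∸ n) + (n ∸ m)

  dist≡0 : ∀ m n → dist m n ≡ 0 → m ≡ n
  dist≡0 m n e = ≤-antisym (m∸n≡0⇒m≤n (m+n≡0⇒m≡0 _ e)) (m∸n≡0⇒m≤n (m+n≡0⇒n≡0 (m ∸ n) e))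

  dist-self : ∀ m → dist m m ≡ 0
  dist-self m = cong₂ _+_ (n∸n≡0 m) (n∸n≡0 m)

  at : List ℕ → ℕ → ℕ
  at []      z = 0
  at (b ∷ ρ) z = ifzT (dist (length ρ) z) (ifzT b 1 2) (at ρ z)

  pre : Orc → ℕ → List ℕ
  pre Z zero = []
  pre Z (suc m) = bit (Z m) ∷ pre Z m

  length-pre : ∀ Z m → length (pre Z m) ≡ m
  length-pre Z zero = refl
  length-pre Z (suc m) = cong suc (length-pre Z m)

  Agree : List ℕ → Orc → Set
  Agree ρ Z = ∀ z v → at ρ z ≡ suc v → v ≡ bit (Z z)

  ifzT-suc : ∀ {A : Set} n {a b : A} → ¬ n ≡ 0 → ifzT n a b ≡ b
  ifzT-suc zero    h = ⊥-elim (h refl)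
  ifzT-suc (suc n) h = refl

  at< : ∀ ρ z {v} → at ρ z ≡ suc v → z < length ρ
  at< (b ∷ ρ) z e with dist (length ρ) z in eq
  ... | zero = subst (_< suc (length ρ)) (dist≡0 (length ρ) z eq) ≤-refl
  ... | suc _ = m<n⇒m<1+n (at< ρ z e)

  at-cons : ∀ b ρ z {v} → at ρ z ≡ suc v → at (b ∷ ρ) z ≡ suc v
  at-cons b ρ z e = trans (ifzT-suc _ λ d → <-irrefl (sym (dist≡0 (length ρ) z d)) (at< ρ z e)) e

  at-pre : ∀ Z m {z} → z < m → at (pre Z m) z ≡ suc (bit (Z z))
  at-pre Z (suc m) {z} (s≤s z≤m) with m≤n⇒m<n∨m≡n z≤m
  ... | inj₁ z<m = at-cons (bit (Z m)) (pre Z m) z (at-pre Z m z<m)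
  ... | inj₂ refl rewrite length-pre Z z | dist-self z with Z z
  ...   | true = refl
  ...   | false = refl

  agree-pre : ∀ Z m → Agree (pre Z m) Z
  agree-pre Z m z v e = suc-injective (trans (sym e)
   (at-pre Z m (subst (z <_) (length-pre Z m) (at< (pre Z m) z e))))

  agree-tail : ∀ b ρ Z → Agree (b ∷ ρ) Z → Agree ρ Z
  agree-tail b ρ Z h z v e = h z v (at-cons b ρ z e)

  -- As strings are reversed, this forgets the latest `n` values and so runs through the initial
  -- segments.
  dropN : ℕ → List ℕ → List ℕ
  dropN n ρ = nrec ρ (λ _ → listCase [] (λ _ ρ → ρ)) n

  dropN-nil : ∀ n → dropN n [] ≡ []
  dropN-nil zero = refl
  dropN-nil (suc n) = cong (listCase [] (λ _ ρ → ρ)) (dropN-nil n)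

  dropN-cons : ∀ n b ρ → dropN (suc n) (b ∷ ρ) ≡ dropN n ρ
  dropN-cons zero    b ρ = refl
  dropN-cons (suc n) b ρ = cong (listCase [] (λ _ ρ → ρ)) (dropN-cons n b ρ)

  agree-drop : ∀ n ρ Z → Agree ρ Z → Agree (dropN n ρ) Z
  agree-drop zero    ρ       Z h = h
  agree-drop (suc n) []      Z h = subst (λ ρ → Agree ρ Z) (sym (dropN-nil (suc n))) h
  agree-drop (suc n) (b ∷ ρ) Z h = subst (λ ρ → Agree ρ Z) (sym (dropN-cons n b ρ))
   (agree-drop n ρ Z (agree-tail b ρ Z h))

  string : List ℕ → Orc
  string σ z with at σ z
  ... | suc (suc _) = true
  ... | _ = false

  at≤2 : ∀ ρ z → at ρ z ≤ 2
  at≤2 []      z = z≤n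
  at≤2 (b ∷ ρ) z with dist (length ρ) z
  ... | suc _ = at≤2 ρ z
  ... | zero with b
  ...   | zero = s≤s z≤n
  ...   | suc _ = ≤-refl

  agree-string : ∀ σ → Agree σ (string σ)
  agree-string σ z v e with at σ z | at≤2 σ z
  agree-string σ z v refl | suc (suc .0) | s≤s (s≤s z≤n) = refl
  agree-string σ z v refl | suc zero     | _ = refl

  module _ {X : Orc} where

   lengthC : ∀ {s t l} → Cmp X s (list t) l → Cmp X s nat (λ a → length (l a))
   lengthC {l = l} cl = c-cast (λ a → lem (l a)) (foldrC (constC nat 0) (sucC (sndC (sndC idC))) cl)
    where
    lem : ∀ {A : Set} (l : List A) → foldr (λ _ n → suc n) 0 l ≡ length l
    lem [] = refl
    lem (x ∷ l) = cong suc (lem l)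

   distC : ∀ {s f g} → Cmp X s nat f → Cmp X s nat g → Cmp X s nat (λ a → dist (f a) (g a))
   distC f g = addC (subC f g) (subC g f)

   atC : ∀ {s l f} → Cmp X s (list nat) l → Cmp X s nat f → Cmp X s nat (λ a → at (l a) (f a))
   atC {s} {l} {f} cl cf = c-cast (λ a → cong snd (lem (f a) (l a)))
    (sndC {s = nat} (foldrC {t = nat} {u = nat ⊗ nat}
     (pairC (constC nat 0) (constC nat 0))
     (pairC (sucC (fstC (sndC (sndC idC))))
      (ifzC (distC (fstC (sndC (sndC idC))) (cf ∘C fstC idC))
       (ifzC (fstC (sndC idC)) (constC nat 1) (constC nat 2)) (sndC (sndC (sndC idC)))))
     cl))
    where
    lem : ∀ z l → foldr (λ b p → suc (fst p) , ifzT (dist (fst p) z) (ifzT b 1 2) (snd p)) (0 , 0) l ≡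
     (length l , at l z)
    lem z [] = refl
    lem z (b ∷ l) rewrite lem z l = refl

   dropC : ∀ {s f l} → Cmp X s nat f → Cmp X s (list nat) l → Cmp X s (list nat) (λ a → dropN (f a) (l a))
   dropC cf cl = nrecC cl (caseC nilC (sndC (sndC idC)) (sndC (sndC idC))) cf

  -- The state of a bounded minimization: 0 while searching, 1 after an undefined value, and `k + 2`
  -- once the value 0 has been found at `k`. The values `v k` are shifted by one, 0 meaning
  -- undefined.
  scan : (ℕ → ℕ) → ℕ → ℕ
  scan v s = nrec 0 (λ k a → ifz a (ifz (v k) 1 (ifz (pred (v k)) (suc (suc k)) 0)) a) s

  scan-none : ∀ v y → (∀ {z} → z < y → ∃[ w ] v z ≡ suc (suc w)) → scan v y ≡ 0
  scan-none v zero    h = refl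
  scan-none v (suc y) h rewrite scan-none v y (λ z< → h (m<n⇒m<1+n z<)) | snd (h {y} ≤-refl) = refl

  scan-found : ∀ v y s → y < s → v y ≡ 1 → (∀ {z} → z < y → ∃[ w ] v z ≡ suc (suc w)) → scan v s ≡ suc (suc y)
  scan-found v y (suc s) (s≤s y≤s) e h with m≤n⇒m<n∨m≡n y≤s
  ... | inj₁ y<s  rewrite scan-found v y s y<s e h = refl
  ... | inj₂ refl rewrite scan-none v y h | e = refl

  scan-0 : ∀ v s → scan v s ≡ 0 → ∀ {z} → z < s → ∃[ w ] v z ≡ suc (suc w)
  scan-0 v (suc s) e {z} (s≤s z≤s) with scan v s in eq | v s in eqv
  scan-0 v (suc s) () z≤s | suc _ | _
  scan-0 v (suc s) () z≤s | zero | zero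
  scan-0 v (suc s) () z≤s | zero | suc zero
  scan-0 v (suc s) e {z} (s≤s z≤s) | zero | suc (suc w) with m≤n⇒m<n∨m≡n z≤s
  ... | inj₁ z<s = scan-0 v s eq z<s
  ... | inj₂ refl = w , eqv

  scan-sound : ∀ v s y → scan v s ≡ suc (suc y) → v y ≡ 1 × (∀ {z} → z < y → ∃[ w ] v z ≡ suc (suc w))
  scan-sound v zero    y ()
  scan-sound v (suc s) y e with scan v s in eq | v s in eqv
  scan-sound v (suc s) y e    | suc _ | _ = scan-sound v s y (trans eq e)
  scan-sound v (suc s) y ()   | zero  | zero
  scan-sound v (suc s) y refl | zero  | suc zero = eqv , scan-0 v s eq
  scan-sound v (suc s) y ()   | zero  | suc (suc _)

  -- ev e r s xs is 0, or the successor of the value that e takes on xs when its oracle is X ⊕ ρ,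
  -- where r is the code of the string ρ and s bounds all unbounded searches.
  module Sim (X : Orc) where

   answer : List ℕ × ℕ → ℕ
   answer (ρ , q) = ifzT (par q) (suc (bit (X (half q)))) (at ρ (half q))

   abstract
    answerC : Cmp X (list nat ⊗ nat) nat answer
    answerC = ifzC (parC (sndC idC)) (sucC (opC₁ v-query (halfC (sndC idC)))) (atC (fstC idC) (halfC (sndC idC)))

   og : ℕ → ℕ → ℕ
   og r q = Cmp.code answerC (pair r q)

   og-answer : ∀ ρ q → og (enc (list nat) ρ) q ≡ answer (ρ , q)
   og-answer ρ q = Cmp.track answerC (ρ , q)

   ev : ∀ {n} → Rec n → ℕ → ℕ → Vec ℕ n → ℕ
   defs : ∀ {n m} → Vec (Rec n) m → ℕ → ℕ → Vec ℕ n → ℕ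
   vals : ∀ {n m} → Vec (Rec n) m → ℕ → ℕ → Vec ℕ n → Vec ℕ m
   ev zer         r s xs = 1
   ev succ        r s xs = suc (suc (head xs))
   ev (proj i)    r s xs = suc (lookup xs i)
   ev query       r s xs = og r (head xs)
   ev (comp e es) r s xs = ifz (defs es r s xs) 0 (ev e r s (vals es r s xs))
   ev (prec e e′) r s xs = nrec (ev e r s (tail xs)) (λ k a → ifz a 0 (ev e′ r s (k ∷ pred a ∷ tail xs))) (head xs)
   ev (mu e)      r s xs = pred (scan (λ k → ev e r s (k ∷ xs)) s)
   defs []       r s xs = 1
   defs (e ∷ es) r s xs = ifz (ev e r s xs) 0 (defs es r s xs)
   vals []       r s xs = []
   vals (e ∷ es) r s xs = pred (ev e r s xs) ∷ vals es r s xs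

   evV : ∀ {n} (e : Rec n) → V X (suc (suc n)) (λ v → ev e (head v) (head (tail v)) (tail (tail v)))
   defsV : ∀ {n m} (es : Vec (Rec n) m) → V X (suc (suc n)) (λ v → defs es (head v) (head (tail v)) (tail (tail v)))
   valsV : ∀ {n m} (es : Vec (Rec n) m) → Vs X (suc (suc n)) m (λ v → vals es (head v) (head (tail v)) (tail (tail v)))
   evV zer = v-const 1
   evV succ = c1 v-suc (c1 v-suc v2)
   evV (proj i) = v-cast (λ { (x ∷ y ∷ xs) → refl }) (c1 v-suc (v-proj (suc (suc i))))
   evV query = c1 (Cmp.computes answerC) (c2 v-pair v0 v2)
   evV (comp e es) = c3 v-ifz (defsV es) (v-const 0) (v-comp (evV e) (v0 ∷ᵥ v1 ∷ᵥ valsV es))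
   evV {suc n} (prec e e′) = v-comp
    (v-rec {f = λ v → ev e (head v) (head (tail v)) (tail (tail v))}
     {h = λ v → ifz (head (tail v)) 0 (ev e′ (head (tail (tail v))) (head (tail (tail (tail v))))
      (head v ∷ pred (head (tail v)) ∷ tail (tail (tail (tail v)))))}
     (evV e) (c3 v-ifz v1 (v-const 0) (v-comp (evV e′) (v2 ∷ᵥ v3 ∷ᵥ v0 ∷ᵥ c1 v-pred v1 ∷ᵥ vs-tail4))))
    (v2 ∷ᵥ v0 ∷ᵥ v1 ∷ᵥ vs-tail3)
   evV (mu e) = c1 v-pred (v-comp
    (v-rec {f = λ _ → 0}
     {h = λ v → ifz (head (tail v)) (ifz (val v) 1 (ifz (pred (val v)) (suc (suc (head v))) 0)) (head (tail v))}
     (v-const 0) (c3 v-ifz v1 (c3 v-ifz valV (v-const 1) (c3 v-ifz (c1 v-pred valV) (c1 v-suc (c1 v-suc v0)) (v-const 0))) v1))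
    (v1 ∷ᵥ v0 ∷ᵥ v1 ∷ᵥ vs-tail2))
    where
    val : Vec ℕ _ → ℕ
    val v = ev e (head (tail (tail v))) (head (tail (tail (tail v)))) (head v ∷ tail (tail (tail (tail v))))
    valV : V X _ val
    valV = v-comp (evV e) (v2 ∷ᵥ v3 ∷ᵥ v0 ∷ᵥ vs-tail4)
   defsV [] = v-const 1
   defsV (e ∷ es) = c3 v-ifz (evV e) (v-const 0) (defsV es)
   valsV [] = vs-nil
   valsV (e ∷ es) = c1 v-pred (evV e) ∷ᵥ valsV es

   module _ (J : Orc) (r s : ℕ) (O : ∀ q v → og r q ≡ suc v → v ≡ bit (J q)) where

    sound : ∀ {n} (e : Rec n) xs y → ev e r s xs ≡ suc y → ⌞ J ⌟ ⊢ e ⟨ xs ⟩⇓ y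
    sounds : ∀ {n m} (es : Vec (Rec n) m) xs {c} → defs es r s xs ≡ suc c →
     Pointwise (λ e y → ⌞ J ⌟ ⊢ e ⟨ xs ⟩⇓ y) es (vals es r s xs)
    sound-prec : ∀ {n} (e : Rec n) e′ k xs y → ev (prec e e′) r s (k ∷ xs) ≡ suc y → ⌞ J ⌟ ⊢ prec e e′ ⟨ k ∷ xs ⟩⇓ y
    sound zer         xs       y refl = zer⇓
    sound succ        (x ∷ []) y refl = succ⇓
    sound (proj i)    xs       y refl = proj⇓
    sound query       (q ∷ []) y eq = go (J q) refl (O q y eq)
     where
     go : ∀ b → J q ≡ b → y ≡ bit (J q) → ⌞ J ⌟ ⊢ query ⟨ q ∷ [] ⟩⇓ y
     go true  e h = subst (λ y → ⌞ J ⌟ ⊢ query ⟨ q ∷ [] ⟩⇓ y) (sym (trans h (cong bit e))) (yes⇓ e)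
     go false e h = subst (λ y → ⌞ J ⌟ ⊢ query ⟨ q ∷ [] ⟩⇓ y) (sym (trans h (cong bit e)))
      (no⇓ λ e′ → false≢true (trans (sym e) e′))
    sound (comp e es) xs       y eq   with defs es r s xs in d
    ... | suc _ = comp⇓ (sounds es xs d) (sound e _ y eq)
    sound (prec e e′) (k ∷ xs) y eq = sound-prec e e′ k xs y eq
    sound (mu e)      xs       y eq   with scan (λ k → ev e r s (k ∷ xs)) s in sc
    sound (mu e)      xs       y refl | suc .(suc y) =
     let h , k = scan-sound (λ k → ev e r s (k ∷ xs)) s y sc
     in mu⇓ (sound e (y ∷ xs) 0 h) λ {z} z< → let w , eq = k z< in w , sound e (z ∷ xs) (suc w) eq
    sounds []       xs d = []
    sounds (e ∷ es) xs d with ev e r s xs in eq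
    ... | suc y = sound e xs y eq ∷ sounds es xs d
    sound-prec e e′ zero    xs y eq = prec0⇓ (sound e xs y eq)
    sound-prec e e′ (suc k) xs y eq with ev (prec e e′) r s (k ∷ xs) in eq′
    ... | suc a = prec+⇓ (sound-prec e e′ k xs a eq′) (sound e′ (k ∷ a ∷ xs) y eq)

   module _ (J : Orc) where

    Knows : ℕ → ℕ → Set
    Knows r m = ∀ {q} → q < m → og r q ≡ suc (bit (J q))

    knows-≤ : ∀ r {m n} → m ≤ n → Knows r n → Knows r m
    knows-≤ r m≤n k q< = k (≤-trans q< m≤n)

    -- One number `m` bounds the queries and the searches at once, and all larger bounds give the
    -- same value.
    Converges : ∀ {n} → Rec n → Vec ℕ n → ℕ → ℕ → Set
    Converges e xs y m = ∀ r s → m ≤ s → Knows r m → ev e r s xs ≡ suc y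

    complete : ∀ {n} {e : Rec n} {xs y} → ⌞ J ⌟ ⊢ e ⟨ xs ⟩⇓ y → ∃[ m ] Converges e xs y m
    completes : ∀ {n k} {es : Vec (Rec n) k} {xs ys} → Pointwise (λ e y → ⌞ J ⌟ ⊢ e ⟨ xs ⟩⇓ y) es ys →
     ∃[ m ] ∀ r s → m ≤ s → Knows r m → (∃[ c ] defs es r s xs ≡ suc c) × vals es r s xs ≡ ys
    complete zer⇓ = 0 , λ _ _ _ _ → refl
    complete succ⇓ = 0 , λ _ _ _ _ → refl
    complete proj⇓ = 0 , λ _ _ _ _ → refl
    complete (yes⇓ {x} p) = suc x , λ r s _ k → trans (k ≤-refl) (cong (suc ∘ bit) p)
    complete (no⇓ {x} ¬p) = suc x , λ r s _ k → trans (k ≤-refl) (cong (suc ∘ bit) (lem (J x) ¬p))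
     where
     lem : ∀ b → ¬ b ≡ true → b ≡ false
     lem true  h = ⊥-elim (h refl)
     lem false h = refl
    complete (comp⇓ {e = e} {es} {xs} {ys} {y} ds d) =
     let m , f = completes ds ; k , g = complete d
     in m ⊔ k , λ r s h kn →
      let (c , eqd) , eqv = f r s (≤-trans (m≤m⊔n m k) h) (knows-≤ r (m≤m⊔n m k) kn)
      in trans (cong₂ (λ a b → ifz a 0 (ev e r s b)) eqd eqv)
       (g r s (≤-trans (m≤n⊔m m k) h) (knows-≤ r (m≤n⊔m m k) kn))
    complete (prec0⇓ d) = complete d
    complete (prec+⇓ {e′ = e′} {xs} {x} {y} {z} d d′) =
     let m , f = complete d ; k , g = complete d′
     in m ⊔ k , λ r s h kn →
      trans (cong (λ a → ifz a 0 (ev e′ r s (x ∷ pred a ∷ xs)))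
       (f r s (≤-trans (m≤m⊔n m k) h) (knows-≤ r (m≤m⊔n m k) kn)))
       (g r s (≤-trans (m≤n⊔m m k) h) (knows-≤ r (m≤n⊔m m k) kn))
    complete {e = mu e₀} {xs} (mu⇓ {y = y} d h) =
     let m , f = complete d
         k , g = bounded-∀ {P = λ z m → ∃[ w ] Converges e₀ (z ∷ xs) (suc w) m}
          (λ { m≤n (w , c) → w , λ r s n≤s kn → c r s (≤-trans m≤n n≤s) (knows-≤ r m≤n kn) })
          (below y) (λ z∈ → all (∈-below⁻ z∈))
     in (m ⊔ k) ⊔ suc y , λ r s l kn →
      let m≤ = ≤-trans (m≤m⊔n m k) (m≤m⊔n (m ⊔ k) (suc y))
          k≤ = ≤-trans (m≤n⊔m m k) (m≤m⊔n (m ⊔ k) (suc y))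
      in cong pred (scan-found (λ z → ev e₀ r s (z ∷ xs)) y s (≤-trans (m≤n⊔m (m ⊔ k) (suc y)) l)
       (f r s (≤-trans m≤ l) (knows-≤ r m≤ kn))
       λ z< → let w , c = g (∈-below⁺ z<) in w , c r s (≤-trans k≤ l) (knows-≤ r k≤ kn))
     where
     all : ∀ {z} → z < y → ∃[ m ] ∃[ w ] Converges e₀ (z ∷ xs) (suc w) m
     all z< with h z<
     ... | w , d′ with complete d′
     ...   | m , c = m , w , c
    completes [] = 0 , λ r s _ _ → (0 , refl) , refl
    completes {es = e ∷ es} {xs} (ds-d ∷ ds) =
     let m , f = complete ds-d ; k , g = completes ds
     in m ⊔ k , λ r s h kn →
      let eq = f r s (≤-trans (m≤m⊔n m k) h) (knows-≤ r (m≤m⊔n m k) kn)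
          (c , eqd) , eqv = g r s (≤-trans (m≤n⊔m m k) h) (knows-≤ r (m≤n⊔m m k) kn)
      in (c , trans (cong (λ a → ifz a 0 (defs es r s xs)) eq) eqd) , cong₂ _∷_ (cong pred eq) eqv

   module _ (Z : Orc) where

    J : Orc
    J = join X Z

    oracle-sound : ∀ ρ → Agree ρ Z → ∀ q v → og (enc (list nat) ρ) q ≡ suc v → v ≡ bit (J q)
    oracle-sound ρ ag q v e with trans (sym (og-answer ρ q)) e
    ... | e′ with par q
    ...   | zero = sym (suc-injective e′)
    ...   | suc _ = ag (half q) v e′

    half≤ : ∀ q → half q ≤ q
    half≤ q with parity q
    ... | inj₁ (_ , e) = subst (half q ≤_) (sym e) (m≤m+n (half q) _)
    ... | inj₂ (_ , e) = subst (half q ≤_) (sym e) (m≤n⇒m≤1+n (m≤m+n (half q) _))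

    oracle-knows : ∀ m M → m ≤ M → Knows J (enc (list nat) (pre Z M)) m
    oracle-knows m M m≤M {q} q<m with og-answer (pre Z M) q
    ... | e with par q
    ...   | zero = e
    ...   | suc _ = trans e (at-pre Z M (≤-trans (s≤s (half≤ q)) (≤-trans q<m m≤M)))

    -- The use principle; the length `M` of the initial segment doubles as the bound on searches.
    use : ∀ {e : Rec 1} {x y} → ⌞ J ⌟ ⊢ e ⟨ x ∷ [] ⟩⇓ y →
     ∃[ m ] ∀ M → m ≤ M → ev e (enc (list nat) (pre Z M)) M (x ∷ []) ≡ suc y
    use d = let m , h = complete J d in m , λ M m≤M → h _ M m≤M (λ q< → oracle-knows m M m≤M q<)

    -- Both computations are reproduced by `ev` on one long initial segment, and `ev` is a function.
    deterministic : ∀ {e : Rec 1} {x y y′} → ⌞ J ⌟ ⊢ e ⟨ x ∷ [] ⟩⇓ y → ⌞ J ⌟ ⊢ e ⟨ x ∷ [] ⟩⇓ y′ → y ≡ y′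
    deterministic d d′ =
     let m , h = use d ; k , g = use d′
     in suc-injective (trans (sym (h (m ⊔ k) (m≤m⊔n m k))) (g (m ⊔ k) (m≤n⊔m m k)))

    ev-sound : ∀ {e : Rec 1} {ρ s x y} → Agree ρ Z → ev e (enc (list nat) ρ) s (x ∷ []) ≡ suc y →
     ⌞ J ⌟ ⊢ e ⟨ x ∷ [] ⟩⇓ y
    ev-sound {e} {ρ} {s} {x} {y} ag = sound J _ s (oracle-sound ρ ag) e (x ∷ []) y

   evC : ∀ {r} (e : Rec 1) {l f g} → Cmp X r (list nat) l → Cmp X r nat f → Cmp X r nat g →
    Cmp X r nat (λ a → ev e (enc (list nat) (l a)) (f a) (g a ∷ []))
   evC {r} e {l} {f} {g} (cmp c₁ v₁ e₁) (cmp c₂ v₂ e₂) (cmp c₃ v₃ e₃) = cmp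
    (λ n → ev e (c₁ n) (c₂ n) (c₃ n ∷ []))
    (mk1 (v-comp (evV e) (V1.v v₁ ∷ᵥ V1.v v₂ ∷ᵥ V1.v v₃ ∷ᵥ vs-nil)))
    λ a → trans (cong (λ x → ev e x (c₂ (enc r a)) (c₃ (enc r a) ∷ [])) (e₁ a))
     (trans (cong (λ y → ev e (enc (list nat) (l a)) y (c₃ (enc r a) ∷ [])) (e₂ a))
      (cong (λ z → ev e (enc (list nat) (l a)) (f a) (z ∷ [])) (e₃ a)))

 -- The cone avoidance basis theorem

 module BasisTheorem where
  open ListLemmas
  open Programs
  open TypedPrograms
  open Computability
  open Simulation
  open import Data.Fin.Base using (Fin; zero; suc; toℕ)
  open import Data.List.Relation.Unary.All using (All; []; _∷_)
  open import Data.Vec.Base using (Vec; []; _∷_)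

  finOf : ∀ n → ℕ → Rec n
  finOf zero          i = zer
  finOf (suc n)       zero = proj zero
  finOf (suc zero)    (suc i) = zer
  finOf (suc (suc n)) (suc i) = shift (finOf (suc n) i)
   where
   shift : ∀ {n} → Rec n → Rec (suc n)
   shift (proj i) = proj (suc i)
   shift _ = zer

  finOf-toℕ : ∀ {n} (i : Fin n) → finOf n (toℕ i) ≡ proj i
  finOf-toℕ {suc n}       zero = refl
  finOf-toℕ {suc (suc n)} (suc i) rewrite finOf-toℕ i = refl

  -- The first number bounds the depth of the term. Only surjectivity of the enumeration matters, so
  -- malformed codes are read as `zer`.
  program : ℕ → ∀ n → ℕ → Rec n
  programs : ℕ → ∀ n m → ℕ → Vec (Rec n) m
  node : ℕ → ℕ → ∀ n → ℕ → Rec n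
  program zero    n c = zer
  program (suc f) n c = node f (π₁ c) n (π₂ c)
  programs f n zero    c = []
  programs f n (suc m) c = program f n (π₁ c) ∷ programs f n m (π₂ c)
  node f 1 1       p = succ
  node f 2 n       p = finOf n p
  node f 3 1       p = query
  node f 4 n       p = comp (program f (π₁ p) (π₁ (π₂ p))) (programs f n (π₁ p) (π₂ (π₂ p)))
  node f 5 (suc n) p = prec (program f n (π₁ p)) (program f (suc (suc n)) (π₂ p))
  node f 6 n       p = mu (program f (suc n) p)
  node f _ n       p = zer

  program-pair : ∀ f n t p → program (suc f) n (pair t p) ≡ node f t n p
  program-pair f n t p rewrite π₁-pair t p | π₂-pair t p = refl

  Listed : ∀ {n} → Rec n → Set
  Listed {n} e = ∃[ c ] ∃[ f₀ ] ∀ f → f₀ ≤ f → program f n c ≡ e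

  private
   up : ∀ {n t p f₀} {e : Rec n} → (∀ f → f₀ ≤ f → node f t n p ≡ e) → Listed e
   up {n} {t} {p} {f₀} h = pair t p , suc f₀ , λ { (suc f) (s≤s f₀≤) → trans (program-pair f n t p) (h f f₀≤) }

  listed : ∀ {n} (e : Rec n) → Listed e
  listeds : ∀ {n m} (es : Vec (Rec n) m) → ∃[ c ] ∃[ f₀ ] ∀ f → f₀ ≤ f → programs f n m c ≡ es
  listed zer = up {t = 0} {0} {0} λ f _ → refl
  listed {n} succ = up {t = 1} {0} {0} λ f _ → refl
  listed (proj i) = up {t = 2} {toℕ i} {0} λ f _ → finOf-toℕ i
  listed query = up {t = 3} {0} {0} λ f _ → refl
  listed {n} (comp {m} e es) =
   let c , f₀ , h = listed e ; d , f₁ , k = listeds es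
   in up {t = 4} {pair m (pair c d)} {f₀ ⊔ f₁} λ f l → go c d f (h f (≤-trans (m≤m⊔n f₀ f₁) l)) (k f (≤-trans (m≤n⊔m f₀ f₁) l))
   where
   go : ∀ c d f → program f m c ≡ e → programs f n m d ≡ es → node f 4 n (pair m (pair c d)) ≡ comp e es
   go c d f h k rewrite π₁-pair m (pair c d) | π₂-pair m (pair c d) | π₁-pair c d | π₂-pair c d | h | k = refl
  listed {suc n} (prec e e′) =
   let c , f₀ , h = listed e ; d , f₁ , k = listed e′
   in up {t = 5} {pair c d} {f₀ ⊔ f₁} λ f l → go c d f (h f (≤-trans (m≤m⊔n f₀ f₁) l)) (k f (≤-trans (m≤n⊔m f₀ f₁) l))
   where
   go : ∀ c d f → program f n c ≡ e → program f (suc (suc n)) d ≡ e′ → node f 5 (suc n) (pair c d) ≡ prec e e′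
   go c d f h k rewrite π₁-pair c d | π₂-pair c d | h | k = refl
  listed {n} (mu e) = let c , f₀ , h = listed e in up {t = 6} {c} {f₀} λ f l → cong mu (h f l)
  listeds [] = 0 , 0 , λ _ _ → refl
  listeds {n} {suc m} (e ∷ es) =
   let c , f₀ , h = listed e ; d , f₁ , k = listeds es
   in pair c d , f₀ ⊔ f₁ , λ f l → go c d f (h f (≤-trans (m≤m⊔n f₀ f₁) l)) (k f (≤-trans (m≤n⊔m f₀ f₁) l))
   where
   go : ∀ c d f → program f n c ≡ e → programs f n m d ≡ es → programs f n (suc m) (pair c d) ≡ e ∷ es
   go c d f h k rewrite π₁-pair c d | π₂-pair c d | h | k = refl

  index : ℕ → Rec 1
  index n = program (π₁ n) 1 (π₂ n)

  index-onto : ∀ e → ∃[ n ] index n ≡ e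
  index-onto e = let c , f , h = listed e in
   pair f c , trans (cong₂ (λ a b → program a 1 b) (π₁-pair f c) (π₂-pair f c)) (h f ≤-refl)

  Bits : List ℕ → Set
  Bits = All (_≤ 1)

  strs : ℕ → List (List ℕ)
  strs = nrec ([] ∷ []) (λ _ l → map (0 ∷_) l ++ map (1 ∷_) l)

  ∈-strs⁺ : ∀ {τ} → Bits τ → τ ∈ strs (length τ)
  ∈-strs⁺ [] = here refl
  ∈-strs⁺ (z≤n ∷ bs) = ∈-++⁺ˡ (∈-map⁺ (0 ∷_) (∈-strs⁺ bs))
  ∈-strs⁺ {_ ∷ τ} (s≤s z≤n ∷ bs) = ∈-++⁺ʳ (map (0 ∷_) (strs (length τ))) (∈-map⁺ (1 ∷_) (∈-strs⁺ bs))

  strs-bits : ∀ M {τ} → τ ∈ strs M → Bits τ × length τ ≡ M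
  strs-bits zero (here refl) = [] , refl
  strs-bits (suc M) τ∈ with ∈-++⁻ (map (0 ∷_) (strs M)) τ∈
  ... | inj₁ p with ∈-map⁻ (0 ∷_) p
  ...   | _ , q , refl = let b , l = strs-bits M q in z≤n ∷ b , cong suc l
  strs-bits (suc M) τ∈ | inj₂ p with ∈-map⁻ (1 ∷_) p
  ...   | _ , q , refl = let b , l = strs-bits M q in ≤-refl ∷ b , cong suc l

  bits-++ : ∀ τ {ρ} → Bits (τ ++ ρ) → Bits ρ
  bits-++ []      bs = bs
  bits-++ (b ∷ τ) (_ ∷ bs) = bits-++ τ bs

  splitL : ∀ m {n} (τ : List ℕ) → length τ ≡ m + n → ∃[ τ₁ ] ∃[ τ₂ ] τ ≡ τ₁ ++ τ₂ × length τ₂ ≡ n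
  splitL zero    τ       e = [] , τ , refl , e
  splitL (suc m) (b ∷ τ) e = let τ₁ , τ₂ , eq , l = splitL m τ (suc-injective e) in b ∷ τ₁ , τ₂ , cong (b ∷_) eq , l

  bit-≤ : ∀ b → bit b ≤ 1
  bit-≤ true = ≤-refl
  bit-≤ false = z≤n

  module Basis (X : Orc) (C : Pred ℕ 0ℓ) (C≰X : ¬ C ≤T ⌞ X ⌟) where

   open Sim X

   abstract
    strsC : ∀ {s f} → Cmp X s nat f → Cmp X s (list (list nat)) (λ a → strs (f a))
    strsC cf = nrecC (constC (list (list nat)) ([] ∷ []))
     (appendC (mapC (consC (constC nat 0) (sndC idC)) (sndC (sndC idC)))
      (mapC (consC (constC nat 1) (sndC idC)) (sndC (sndC idC)))) cf

   -- Quantifying over all initial segments of `σ` and all search bounds makes this monotone in `σ`.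
   Hit : Rec 1 → List ℕ → ℕ → ℕ → Set
   Hit e σ x v = ∃[ p ] ev e (enc (list nat) (dropN (fst p) σ)) (snd p) (x ∷ []) ≡ suc v

   hit-cons : ∀ {e b σ x v} → Hit e σ x v → Hit e (b ∷ σ) x v
   hit-cons {e} {b} {σ} {x} {v} ((n , s) , h) = (suc n , s) ,
    subst (λ ρ → ev e (enc (list nat) ρ) s (x ∷ []) ≡ suc v) (sym (dropN-cons n b σ)) h

   abstract
    hitRE : ∀ {r} e {l f g} → Cmp X r (list nat) l → Cmp X r nat f → Cmp X r nat g →
     RE X r (λ a → Hit e (l a) (f a) (g a))
    hitRE e cl cf cg = re-∃ (nat ⊗ nat) (re-dec (d-≡ nat
     (evC e (dropC (fstC (sndC idC)) (cl ∘C fstC idC)) (sndC (sndC idC)) (cf ∘C fstC idC))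
     (sucC (cg ∘C fstC idC))))

    -- C is computable if its graph is the only part of an r.e. relation.
    graph : (Q : ℕ × ℕ → Set) → RE X (nat ⊗ nat) Q → (∀ x → Q (x , χ C x)) → (∀ {x v} → Q (x , v) → v ≡ χ C x) → ⊥
    graph Q (re {R} d f g) tot uni =
     let F , cF , hF = search {X} {nat} {nat ⊗ nat} {λ p → R ((fst p , fst (snd p)) , snd (snd p))}
          (d-sub d (pairC (pairC (fstC idC) (fstC (sndC idC))) (sndC (sndC idC))))
          (λ x → let n , r = g (tot x) in (χ C x , n) , r)
     in C≰X (deci⇒≤T (deci (λ x → fst (F x)) (fstC cF) λ x →
      subst (λ v → (v ≡ 1 × C x) ⊎ (v ≡ 0 × ¬ C x)) (sym (uni (f (hF x)))) (χ-cases C x)))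

   -- Both computations use initial segments of `σ`, hence are computations from the one set
   -- `string σ`.
   unique-hit : ∀ {e σ n n′ x v v′} → Hit e (dropN n σ) x v → Hit e (dropN n′ σ) x v′ → v ≡ v′
   unique-hit {e} {σ} {n} {n′} {x} {v} {v′} ((k , s) , h) ((k′ , s′) , h′) = deterministic Z {e} {x}
    (ev-sound Z {e} {dropN k (dropN n σ)} {s} {x} {v} (agree-drop k (dropN n σ) Z (agree-drop n σ Z (agree-string σ))) h)
    (ev-sound Z {e} {dropN k′ (dropN n′ σ)} {s′} {x} {v′} (agree-drop k′ (dropN n′ σ) Z (agree-drop n′ σ Z (agree-string σ))) h′)
    where Z = string σ

   -- For a monotone `Bad` this says, by König's lemma, that the class has a member extending `ρ`.
   -- Strings are reversed, so `τ ++ ρ` is an extension of `ρ`.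
   Alive : (List ℕ → Set) → List ℕ → Set
   Alive Bad ρ = ∀ M → ∃[ τ ] Bits τ × length τ ≡ M × ¬ Bad (τ ++ ρ)

   record Class : Set₁ where
    field
     Bad : List ℕ → Set
     enum : RE X (list nat) Bad
     mono : ∀ {b ρ} → Bad ρ → Bad (b ∷ ρ)

    mono-++ : ∀ τ {ρ} → Bad ρ → Bad (τ ++ ρ)
    mono-++ []      h = h
    mono-++ (b ∷ τ) h = mono (mono-++ τ h)

   open Class

   dropN-++ : ∀ τ ρ → dropN (length τ) (τ ++ ρ) ≡ ρ
   dropN-++ []      ρ = refl
   dropN-++ (b ∷ τ) ρ = trans (dropN-cons (length τ) b (τ ++ ρ)) (dropN-++ τ ρ)

   module Force (K : Class) (ρ : List ℕ) (alive : Alive (Bad K) ρ) (e : Rec 1) where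

    Bad′ : ℕ → List ℕ → Set
    Bad′ x σ = Bad K σ ⊎ Hit e σ x (χ C x)

    Q : ℕ × ℕ → Set
    Q (x , v) = ∃[ M ] ∀ {τ} → τ ∈ strs M → Bad K (τ ++ ρ) ⊎ Hit e (τ ++ ρ) x v

    abstract
     Q-re : RE X (nat ⊗ nat) Q
     Q-re = re-∃ nat (re-all (list nat)
      (re-or (re-sub (enum K) (appendC (sndC idC) (constC (list nat) ρ)))
       (hitRE e (appendC (sndC idC) (constC (list nat) ρ)) (fstC (fstC (fstC idC))) (sndC (fstC (fstC idC)))))
      (strsC (sndC idC)))

    hit-at : ∀ {x v M M′} → (∀ {τ} → τ ∈ strs M → Bad K (τ ++ ρ) ⊎ Hit e (τ ++ ρ) x v) →
     ∀ {τ} → Bits τ → length τ ≡ M′ + M → ¬ Bad K (τ ++ ρ) → ∃[ n ] Hit e (dropN n (τ ++ ρ)) x v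
    hit-at {x} {v} {M} {M′} h {τ} bs len ¬bad with splitL M′ τ len
    ... | τ₁ , τ₂ , refl , refl with h (∈-strs⁺ (bits-++ τ₁ bs))
    ...   | inj₁ bad = ⊥-elim (¬bad (subst (Bad K) (sym (++-assoc τ₁ τ₂ ρ)) (mono-++ K τ₁ bad)))
    ...   | inj₂ hit = length τ₁ , subst (λ σ → Hit e σ x v)
     (sym (trans (cong (dropN (length τ₁)) (++-assoc τ₁ τ₂ ρ)) (dropN-++ τ₁ (τ₂ ++ ρ)))) hit

    -- Otherwise, for every `x`, all long enough extensions of `ρ` in the class would compute
    -- `χ C x`. A search for a value on which all extensions of some length agree would then compute
    -- `C`.
    some : ∃[ x ] Alive (Bad′ x) ρ
    some = by-contra em λ none →
     let dead : ∀ x → ∃[ M ] ∀ {τ} → τ ∈ strs M → Bad′ x (τ ++ ρ)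
         dead x = by-contra em λ never → none (x , λ M → by-contra em λ none′ →
          never (M , λ {τ} τ∈ → by-contra em λ ¬bad → none′ (τ , fst (strs-bits M τ∈) , snd (strs-bits M τ∈) , ¬bad)))
     in graph Q Q-re dead λ {x} {v} (M , h) →
      let M′ , h′ = dead x
          -- Long enough to contain strings of both lengths, so that both values are computed along
          -- the one string `τ`.
          τ , bs , l , ¬bad = alive (M′ + M)
          n , hit = hit-at {x} {v} {M} {M′} h {τ} bs l ¬bad
          n′ , hit′ = hit-at {x} {χ C x} {M′} {M} h′ {τ} bs (trans l (+-comm M′ M)) ¬bad
      in unique-hit {e} {τ ++ ρ} {n} {n′} {x} {v} {χ C x} hit hit′

    x₀ : ℕ
    x₀ = fst some

    forced : Class
    forced = record
     { Bad = Bad′ x₀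
     ; enum = re-or (enum K) (hitRE e idC (constC nat x₀) (constC nat (χ C x₀)))
     ; mono = λ { (inj₁ h) → inj₁ (mono K h) ; (inj₂ h) → inj₂ (hit-cons {e} h) }
     }

   -- If both one-bit extensions died, at lengths `M₀` and `M₁`, then all extensions of `ρ` by
   -- `M₁ + M₀ + 1` bits would be bad.
   extend : (K : Class) (ρ : List ℕ) → Alive (Bad K) ρ → ∃[ b ] Alive (Bad K) (bit b ∷ ρ)
   extend K ρ alive = by-contra em λ none →
    let dead : ∀ b → ∃[ M ] ∀ {τ} → Bits τ → length τ ≡ M → Bad K (τ ++ (bit b ∷ ρ))
        dead b = by-contra em λ never → none (b , λ M → by-contra em λ none′ →
         never (M , λ {τ} bs l → by-contra em λ ¬bad → none′ (τ , bs , l , ¬bad)))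
        M₀ , h₀ = dead false ; M₁ , h₁ = dead true
        τ , bs , l , ¬bad = alive ((M₁ + M₀) + 1)
    in contra ¬bad bs l h₀ h₁
    where
    contra : ∀ {M₀ M₁ τ} → ¬ Bad K (τ ++ ρ) → Bits τ → length τ ≡ (M₁ + M₀) + 1 →
     (∀ {τ} → Bits τ → length τ ≡ M₀ → Bad K (τ ++ (0 ∷ ρ))) →
     (∀ {τ} → Bits τ → length τ ≡ M₁ → Bad K (τ ++ (1 ∷ ρ))) → ⊥
    contra {M₀} {M₁} {τ} ¬bad bs l h₀ h₁ with splitL (M₁ + M₀) {1} τ l
    ... | τ₁ , b ∷ [] , refl , refl = go b (bits-++ τ₁ bs) ¬bad₂
     where
     bs₁ : Bits τ₁
     bs₁ = bits-prefix τ₁ bs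
      where
      bits-prefix : ∀ τ {ρ} → Bits (τ ++ ρ) → Bits τ
      bits-prefix []      bs = []
      bits-prefix (b ∷ τ) (p ∷ bs) = p ∷ bits-prefix τ bs
     len₁ : length τ₁ ≡ M₁ + M₀
     len₁ = +-cancelʳ-≡ 1 _ _ (trans (sym (length-++ τ₁)) l)
     ¬bad₂ : ¬ Bad K (τ₁ ++ (b ∷ ρ))
     ¬bad₂ bad = ¬bad (subst (Bad K) (sym (++-assoc τ₁ (b ∷ []) ρ)) bad)
     late : ∀ {M M′ c} → (∀ {τ} → Bits τ → length τ ≡ M → Bad K (τ ++ (c ∷ ρ))) → length τ₁ ≡ M′ + M →
      Bad K (τ₁ ++ (c ∷ ρ))
     late {M} {M′} {c} h l with splitL M′ τ₁ l
     ... | τ₂ , τ₃ , e , l₃ = subst (λ τ → Bad K (τ ++ (c ∷ ρ))) (sym e)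
      (subst (Bad K) (sym (++-assoc τ₂ τ₃ (c ∷ ρ)))
       (mono-++ K τ₂ (h (bits-++ τ₂ (subst Bits e bs₁)) l₃)))
     go : ∀ b → Bits (b ∷ []) → ¬ Bad K (τ₁ ++ (b ∷ ρ)) → ⊥
     go zero       _              ¬b = ¬b (late h₀ len₁)
     go (suc zero) _              ¬b = ¬b (late h₁ (trans len₁ (+-comm M₁ M₀)))
     go (suc (suc _)) (s≤s () ∷ _) _

   record State : Set₁ where
    field
     cls : Class
     str : List ℕ
     alive : Alive (Bad cls) str

   open State

   module Generic (K : Class) (alive₀ : Alive (Bad K) []) where

    abstract
     -- The string built by stage `n` has length `n`, so the program treated there is `index n`; one
     -- more bit is fixed afterwards.
     pick : ∀ st → ∃[ b ] Alive (Bad (Force.forced (cls st) (str st) (alive st) (index (length (str st))))) (bit b ∷ str st)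
     pick st = extend (Force.forced (cls st) (str st) (alive st) (index (length (str st)))) (str st) (snd (Force.some (cls st) (str st) (alive st) (index (length (str st)))))

    next : State → State
    next st = record
     { cls = Force.forced (cls st) (str st) (alive st) (index (length (str st)))
     ; str = bit (fst (pick st)) ∷ str st
     ; alive = snd (pick st)
     }

    st : ℕ → State
    st zero = record { cls = K ; str = [] ; alive = alive₀ }
    st (suc n) = next (st n)

    Z : Orc
    Z n = fst (pick (st n))

    str-pre : ∀ n → str (st n) ≡ pre Z n
    str-pre zero = refl
    str-pre (suc n) = cong (bit (Z n) ∷_) (str-pre n)

    len-str : ∀ n → length (str (st n)) ≡ n
    len-str n = trans (cong length (str-pre n)) (length-pre Z n)

    keep : ∀ e j {σ} → Bad (cls (st e)) σ → Bad (cls (st (j + e))) σ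
    keep e zero    h = h
    keep e (suc j) h = inj₁ (keep e j h)

    longer : ∀ (L : Class) n j → Bad L (pre Z n) → Bad L (pre Z (j + n))
    longer L n zero    h = h
    longer L n (suc j) h = mono L (longer L n j h)

    -- A bad initial segment of `Z` would remain bad at a later stage whose string extends it, yet
    -- that string is alive.
    never : ∀ e n → ¬ Bad (cls (st e)) (pre Z n)
    never e n h =
     let τ , _ , l , ¬bad = alive (st (n + e)) 0
     in ¬bad (subst (Bad (cls (st (n + e)))) (lem τ l)
      (keep e n (subst (λ m → Bad (cls (st e)) (pre Z m)) (+-comm e n) (longer (cls (st e)) n e h))))
     where
     lem : ∀ τ → length τ ≡ 0 → pre Z (n + e) ≡ τ ++ str (st (n + e))
     lem [] _ = sym (str-pre (n + e))

    avoids : ¬ C ≤T ⌞ join X Z ⌟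
    avoids r =
     let e = fst r
         n , en = index-onto e
         x = Force.x₀ (cls (st n)) (str (st n)) (alive (st n)) (index (length (str (st n))))
         m , h = use Z (≤T⇒runs r x)
     in never (suc n) m (inj₂ ((0 , m) ,
      subst (λ i → ev i (enc (list nat) (pre Z m)) m (x ∷ []) ≡ suc (χ C x))
       (sym (trans (cong index (len-str n)) en)) (h m ≤-refl)))

   -- A Π⁰₁ question about all sets Z either has a finite positive answer at a wrong value of C
   -- or a negative one witnessed by some Z that does not help to compute C.
   dichotomy : (Bad : (ℕ × ℕ) × List ℕ → Set) → RE X ((nat ⊗ nat) ⊗ list nat) Bad →
    (∀ {xv b ρ} → Bad (xv , ρ) → Bad (xv , b ∷ ρ)) →
    (∃[ x ] ∃[ v ] ¬ v ≡ χ C x × ∃[ M ] (∀ τ → Bits τ → length τ ≡ M → Bad ((x , v) , τ))) ⊎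
    (∃[ x ] ∃[ Z ] ¬ C ≤T ⌞ join X Z ⌟ × (∀ m → ¬ Bad ((x , χ C x) , pre Z m)))
   dichotomy Bad rec mono = go em
    where
    ++-[] : ∀ (τ : List ℕ) → τ ++ [] ≡ τ
    ++-[] [] = refl
    ++-[] (b ∷ τ) = cong (b ∷_) (++-[] τ)
    K : ℕ → Class
    K x = record { Bad = λ ρ → Bad ((x , χ C x) , ρ)
     ; enum = re-sub rec (pairC (constC (nat ⊗ nat) (x , χ C x)) idC) ; mono = mono }
    Q : ℕ × ℕ → Set
    Q xv = ∃[ M ] ∀ {τ} → τ ∈ strs M → Bad (xv , τ)
    abstract
     Q-re : RE X (nat ⊗ nat) Q
     Q-re = re-∃ nat (re-all (list nat) (re-sub rec (pairC (fstC (fstC idC)) (sndC idC))) (strsC (sndC idC)))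
    Wrong : Set
    Wrong = ∃[ x ] ∃[ v ] ¬ v ≡ χ C x × Q (x , v)
    bits→ : ∀ {M} {P : List ℕ → Set} → (∀ {τ} → τ ∈ strs M → P τ) → ∀ τ → Bits τ → length τ ≡ M → P τ
    bits→ h τ bs refl = h (∈-strs⁺ bs)
    go : Dec Wrong → _
    go (yes (x , v , v≢ , M , h)) = inj₁ (x , v , v≢ , M , bits→ h)
    go (no ¬wrong) =
     -- `Q` never holds at a wrong value here. If it held at the right value for every `x`, then `C`
     -- would be computable, so for some `x` the class of sets that avoid the right value is
     -- nonempty.
     let x , nq = by-contra em {∃[ x ] ¬ Q (x , χ C x)} λ none → graph Q Q-re
          (λ x → by-contra em λ nq → none (x , nq))
          (λ {x} {v} q → by-contra em λ v≢ → ¬wrong (x , v , v≢ , q))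
         alive : Alive (Bad ∘ ((x , χ C x) ,_)) []
         alive M = by-contra em λ none → nq (M , λ {τ} τ∈ → by-contra em λ ¬bad →
          none (τ , fst (strs-bits M τ∈) , snd (strs-bits M τ∈) , λ bad → ¬bad (subst (λ σ → Bad ((x , χ C x) , σ)) (++-[] τ) bad)))
     in inj₂ (x , Generic.Z (K x) alive , Generic.avoids (K x) alive , λ m bad → Generic.never (K x) alive 0 m bad)

 -- Computable forests and chains of levels

 module Forests where
  open ListLemmas
  open HalpernLauchli
  open Programs
  open TypedPrograms
  open Computability
  open Simulation
  open BasisTheorem
  open import Data.List.Relation.Binary.Pointwise.Base using (Pointwise; []; _∷_)
  open import Data.List.Relation.Unary.All using ([]; _∷_)
  open import Data.Vec.Base using ([]; _∷_)

  -- One list of nodes for each tree, so that `prod` of a level yields the tuples with one node from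
  -- each tree.
  Lev : Set
  Lev = List (List ℕ)

  lev : Ty
  lev = list (list nat)

  -- `grow` makes codes increase along descents, so the depth of a node is at most its code; raising
  -- the level thereby controls an initial segment of the oracle. It is imposed only above the
  -- roots, since loops are allowed elsewhere.
  record Forest (X : Orc) : Set where
   field
    kd : ℕ → List ℕ
    kd-ne : ∀ x → ∃[ y ] y ∈ kd x
    kd-uniq : ∀ {x y z} → z ∈ kd x → z ∈ kd y → x ≡ y
    kd! : ∀ x → Unique (kd x)
    kdC : Cmp X nat (list nat) kd

   tree : Tree
   tree = record { X = ℕ ; kids = kd ; ne = kd-ne ; uniq = kd-uniq }

   field
    rs : List ℕ
    rs! : Unique rs
    orphan : ∀ {r x} → r ∈ rs → ¬ r ∈ kd x
    grow : ∀ {r n x y} → r ∈ rs → Desc tree n r x → y ∈ kd x → x < y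

  ∈-concat : ∀ {A : Set} {x : A} {xs} {xss : List (List A)} → x ∈ xs → xs ∈ xss → x ∈ concat xss
  ∈-concat = ∈-concat⁺′

  pw-concat : ∀ {A B : Set} {R : A → B → Set} {xss yss} → Pointwise (Pointwise R) xss yss →
   Pointwise R (concat xss) (concat yss)
  pw-concat [] = []
  pw-concat (rs ∷ rss) = go rs (pw-concat rss)
   where
   go : ∀ {A B : Set} {R : A → B → Set} {xs ys xs′ ys′} → Pointwise R xs ys → Pointwise R xs′ ys′ →
    Pointwise R (xs ++ xs′) (ys ++ ys′)
   go []       ss = ss
   go (r ∷ rs) ss = r ∷ go rs ss

  ∈-concatMapʳ : ∀ {A B : Set} (f : A → List B) (xss : List (List A)) {y} →
   y ∈ concat (map (concatMap f) xss) → ∃[ x ] x ∈ concat xss × y ∈ f x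
  ∈-concatMapʳ f xss y∈ with ∈-concat⁻′ (map (concatMap f) xss) y∈
  ... | ys , y∈ys , ys∈ with ∈-map⁻ (concatMap f) ys∈
  ... | xs , xs∈ , refl with ∈-concatMap′ {f = f} xs y∈ys
  ... | x , x∈ , y∈fx = x , ∈-concat x∈ xs∈ , y∈fx

  ∈-concatMapʳ⁺ : ∀ {A B : Set} (f : A → List B) (xss : List (List A)) {x y} → x ∈ concat xss → y ∈ f x →
   y ∈ concat (map (concatMap f) xss)
  ∈-concatMapʳ⁺ f xss x∈ y∈ with ∈-concat⁻′ xss x∈
  ... | xs , x∈xs , xs∈ = ∈-concat (∈-concatMap {f = f} x∈xs y∈) (∈-map⁺ (concatMap f) xs∈)

  ∈-prod-concat : ∀ {A : Set} {L : List (List A)} {xs} → xs ∈ prod L → ∀ {x} → x ∈ xs → x ∈ concat L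
  ∈-prod-concat {L = L} xs∈ x∈ = go (∈-prod⁻ L xs∈) x∈
   where
   go : ∀ {A : Set} {L : List (List A)} {xs} → Pointwise (λ l x → x ∈ l) L xs → ∀ {x} → x ∈ xs → x ∈ concat L
   go (r ∷ rs) (here refl) = ∈-++⁺ˡ r
   go {L = l ∷ L} (r ∷ rs) (there x∈) = ∈-++⁺ʳ l (go rs x∈)

  bit-oracle : ∀ (P : ℕ → Set) z → (P z → bit (oracle P z) ≡ 1) × (¬ P z → bit (oracle P z) ≡ 0)
  bit-oracle P z with em {P z}
  ... | yes p = (λ _ → refl) , (λ ¬p → ⊥-elim (¬p p))
  ... | no ¬p = (λ p → ⊥-elim (¬p p)) , (λ _ → refl)

  pre-cong : ∀ {Z Z′} M → (∀ {z} → z < M → Z z ≡ Z′ z) → pre Z M ≡ pre Z′ M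
  pre-cong zero    h = refl
  pre-cong (suc M) h = cong₂ _∷_ (cong bit (h ≤-refl)) (pre-cong M λ z< → h (m<n⇒m<1+n z<))

  oracle-cong : ∀ {P Q : ℕ → Set} {z} → (P z → Q z) → (Q z → P z) → oracle P z ≡ oracle Q z
  oracle-cong {P} {Q} {z} f g with em {P z} | em {Q z}
  ... | yes _ | yes _ = refl
  ... | no _  | no _ = refl
  ... | yes p | no ¬q = ⊥-elim (¬q (f p))
  ... | no ¬p | yes q = ⊥-elim (¬p (g q))

  module Basics {X₀ : Orc} (F : Forest X₀) where

   open Forest F

   T : Tree
   T = tree

   Depth : ℕ → ℕ → Set
   Depth n z = ∃[ r ] r ∈ rs × Desc T n r z

   depth-down : ∀ {n m x y} → Depth n x → Desc T m x y → Depth (n + m) y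
   depth-down (r , r∈ , d) e = r , r∈ , desc-trans d e

   depth≤ : ∀ {n z} → Depth n z → n ≤ z
   depth≤ {zero}  _ = z≤n
   depth≤ {suc n} {z} (r , r∈ , d) with desc-split n {1} (desc-cast (+-comm 1 n) d)
   ... | y , d₁ , d₂ = ≤-trans (s≤s (depth≤ (r , r∈ , d₁))) (grow r∈ d₁ (unkid d₂))

   no-parent : ∀ {r x n} → r ∈ rs → Desc T n x r → n ≡ 0
   no-parent {n = zero}  r∈ d = refl
   no-parent {n = suc n} r∈ d with desc-split n {1} (desc-cast (+-comm 1 n) d)
   ... | y , _ , d₂ = ⊥-elim (orphan r∈ (unkid d₂))

   private
    depth-≤ : ∀ {n m z} → n ≤ m → Depth n z → Depth m z → n ≡ m
    depth-≤ {n} {m} n≤m (r , r∈ , d) (r′ , r′∈ , d′) with desc-split (m ∸ n) {n} (desc-cast (sym (m∸n+n≡m n≤m)) d′)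
    ... | y , d₁ , d₂ with desc-unique d₂ d
    ... | refl = ≤-antisym n≤m (m∸n≡0⇒m≤n (no-parent r∈ d₁))

   depth-unique : ∀ {n m z} → Depth n z → Depth m z → n ≡ m
   depth-unique {n} {m} d e with ≤-total n m
   ... | inj₁ n≤m = depth-≤ n≤m d e
   ... | inj₂ m≤n = sym (depth-≤ m≤n e d)

   ancestor : ∀ {n m x y z} → Desc T (n + m) x z → Desc T m y z → Desc T n x y
   ancestor {n} d e with desc-split n d
   ... | w , d₁ , d₂ with desc-unique d₂ e
   ... | refl = d₁

   -- The nodes of `descs`, by a recursion on the number of levels that `nrecC` covers.
   dl : ℕ → ℕ → List ℕ
   dl n x = nrec (x ∷ []) (λ _ l → concatMap kd l) n

   ∈dl⁺ : ∀ {n x y} → Desc T n x y → y ∈ dl n x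
   ∈dl⁺ {zero} stop = here refl
   ∈dl⁺ {suc n} {x} d with desc-split n {1} (desc-cast (+-comm 1 n) d)
   ... | z , d₁ , d₂ = ∈-concatMap {f = kd} {xs = dl n x} (∈dl⁺ d₁) (unkid d₂)

   ∈dl⁻ : ∀ n {x y} → y ∈ dl n x → Desc T n x y
   ∈dl⁻ zero (here refl) = stop
   ∈dl⁻ (suc n) {x} y∈ with ∈-concatMap′ {f = kd} (dl n x) y∈
   ... | z , z∈ , y∈z = desc-cast (+-comm n 1) (desc-trans (∈dl⁻ n z∈) (kid y∈z))

   tup : ℕ → List ℕ → List (List ℕ)
   tup m xs = prod (map (dl m) xs)

   ∈tup⁺ : ∀ {m xs ys} → Pointwise (Desc T m) xs ys → ys ∈ tup m xs
   ∈tup⁺ {m} ds = ∈-prod⁺ (go ds)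
    where
    go : ∀ {xs ys} → Pointwise (Desc T m) xs ys → Pointwise (λ zs y → y ∈ zs) (map (dl m) xs) ys
    go [] = []
    go (d ∷ ds) = ∈dl⁺ d ∷ go ds

   ∈tup⁻ : ∀ m xs {ys} → ys ∈ tup m xs → Pointwise (Desc T m) xs ys
   ∈tup⁻ m xs ys∈ = pw-imp (∈dl⁻ m) (pw-mapˡ⁻ {R = λ zs y → y ∈ zs} (∈-prod⁻ (map (dl m) xs) ys∈))

   Above : ℕ → Lev → Lev → Set
   Above m fr L = Pointwise (Pointwise (Desc T m)) fr L

   abv : ℕ → Lev → List Lev
   abv m fr = prod (map (tup m) fr)

   ∈abv⁺ : ∀ {m fr L} → Above m fr L → L ∈ abv m fr
   ∈abv⁺ {m} ds = ∈-prod⁺ (go ds)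
    where
    go : ∀ {fr L} → Above m fr L → Pointwise (λ zs y → y ∈ zs) (map (tup m) fr) L
    go [] = []
    go (d ∷ ds) = ∈tup⁺ d ∷ go ds

   ∈abv⁻ : ∀ m fr {L} → L ∈ abv m fr → Above m fr L
   ∈abv⁻ m fr L∈ = pw-imp (λ {xs} → ∈tup⁻ m xs) (pw-mapˡ⁻ {R = λ zs y → y ∈ zs} (∈-prod⁻ (map (tup m) fr) L∈))

   kidsL : Lev → Lev
   kidsL = map (concatMap kd)

   above-trans : ∀ {m n fr L L′} → Above m fr L → Above n L L′ → Above (m + n) fr L′
   above-trans = pw-trans (pw-trans desc-trans)

   above-graph : ∀ {m} {f : ℕ → ℕ} → Sec T m f → ∀ fr → Above m fr (map (map f) fr)
   above-graph h fr = pw-graph (pw-graph h) fr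

   -- The nodes above which the next level has to be chosen: the direct extensions of the last
   -- level, or `fr` at the start.
   frontFrom : Lev → List Lev → Lev
   frontFrom fr [] = fr
   frontFrom fr (L ∷ E) = frontFrom (kidsL L) E

   frontFrom-++ : ∀ fr E E′ → frontFrom fr (E ++ E′) ≡ frontFrom (frontFrom fr E) E′
   frontFrom-++ fr []      E′ = refl
   frontFrom-++ fr (L ∷ E) E′ = frontFrom-++ (kidsL L) E E′

   -- One `n` serves the whole level, because homogeneity of a reservoir is stated level by level.
   Step : (ℕ → ℕ → Set) → Lev × Lev → Set
   Step P (fr , L) = (∃[ m ] Above m fr L) × (∃[ n ] ∀ {z} → z ∈ concat L → P n z)

   Chain : (ℕ → ℕ → Set) → Lev → List Lev → Set
   Chain P fr [] = ⊤
   Chain P fr (L ∷ E) = Step P (fr , L) × Chain P (kidsL L) E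

   chain-++ : ∀ {P} fr E E′ → Chain P fr E → Chain P (frontFrom fr E) E′ → Chain P fr (E ++ E′)
   chain-++ fr []      E′ _        c′ = c′
   chain-++ fr (L ∷ E) E′ (s , c) c′ = s , chain-++ (kidsL L) E E′ c c′

   chain-imp : ∀ {P Q : ℕ → ℕ → Set} → (∀ n → ∃[ m ] ∀ {z} → P n z → Q m z) → ∀ fr E → Chain P fr E → Chain Q fr E
   chain-imp h fr []      _ = tt
   chain-imp h fr (L ∷ E) ((a , n , p) , c) =
    let m , g = h n in (a , m , λ z∈ → g (p z∈)) , chain-imp h (kidsL L) E c

   -- Lists the steps of a chain. The recursion in `Chain` becomes a bounded quantifier over this
   -- list, to which `re-all` applies.
   stepsAcc : Lev → List (Lev × Lev) → List Lev → List (Lev × Lev)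
   stepsAcc fr acc [] = acc
   stepsAcc fr acc (L ∷ E) = stepsAcc (kidsL L) ((fr , L) ∷ acc) E

   chain⇒steps : ∀ {P} fr acc E → (∀ {p} → p ∈ acc → Step P p) → Chain P fr E →
    ∀ {p} → p ∈ stepsAcc fr acc E → Step P p
   chain⇒steps fr acc []      h _       p∈ = h p∈
   chain⇒steps fr acc (L ∷ E) h (s , c) p∈ =
    chain⇒steps (kidsL L) ((fr , L) ∷ acc) E (λ { (here refl) → s ; (there q) → h q }) c p∈

   steps⇒chain : ∀ {P} fr acc E → (∀ {p} → p ∈ stepsAcc fr acc E → Step P p) → (∀ {p} → p ∈ acc → Step P p) × Chain P fr E
   steps⇒chain fr acc []      h = h , tt
   steps⇒chain fr acc (L ∷ E) h =
    let a , c = steps⇒chain (kidsL L) ((fr , L) ∷ acc) E h in (λ q → a (there q)) , a (here refl) , c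

   nodes : List Lev → List ℕ
   nodes E = concat (concat E)

   -- An E-computation: the program converges on x with an initial segment of the finite set E as oracle.
   Good : Rec 1 → List ℕ → ℕ → ℕ → Set
   Good e E x v = ∃[ M ] Sim.ev X₀ e (enc (list nat) (pre (oracle (_∈ E)) M)) M (x ∷ []) ≡ suc v

   module _ {X : Orc} (up : X₀ ⊑ X) where

    abstract
     dlC : ∀ {s f g} → Cmp X s nat f → Cmp X s nat g → Cmp X s (list nat) (λ a → dl (f a) (g a))
     dlC cf cg = nrecC (consC cg nilC) (concatMapC (c-up up kdC ∘C sndC idC) (sndC (sndC idC))) cf

     tupC : ∀ {s f g} → Cmp X s nat f → Cmp X s (list nat) g → Cmp X s (list (list nat)) (λ a → tup (f a) (g a))
     tupC cf cg = prodC (mapC (dlC (cf ∘C fstC idC) (sndC idC)) cg)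

     abvC : ∀ {s f g} → Cmp X s nat f → Cmp X s lev g → Cmp X s (list lev) (λ a → abv (f a) (g a))
     abvC cf cg = prodC (mapC (tupC (cf ∘C fstC idC) (sndC idC)) cg)

     kidsLC : ∀ {s f} → Cmp X s lev f → Cmp X s lev (λ a → kidsL (f a))
     kidsLC cf = mapC (concatMapC (c-up up kdC ∘C sndC idC) (sndC idC)) cf

     d-desc : ∀ {s f g h} → Cmp X s nat f → Cmp X s nat g → Cmp X s nat h → Deci X s (λ a → Desc T (f a) (g a) (h a))
     d-desc {f = f} cf cg ch = d-iff (λ a → ∈dl⁻ (f a) , ∈dl⁺) (d-∈ nat ch (dlC cf cg))

     d-above : ∀ {s f g h} → Cmp X s nat f → Cmp X s lev g → Cmp X s lev h → Deci X s (λ a → Above (f a) (g a) (h a))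
     d-above {f = f} {g} cf cg ch = d-iff (λ a → ∈abv⁻ (f a) (g a) , ∈abv⁺) (d-∈ lev ch (abvC cf cg))

     stepsC : ∀ {s f g} → Cmp X s lev f → Cmp X s (list lev) g →
      Cmp X s (lev ⊗ list (lev ⊗ lev)) (λ a → frontFrom (f a) (g a) , stepsAcc (f a) [] (g a))
     stepsC {f = f} {g} cf cg = c-cast (λ a → lem (f a) [] (g a))
      (foldlC {t = lev} {u = lev ⊗ list (lev ⊗ lev)} (pairC cf nilC)
       (pairC (kidsLC (sndC (sndC idC)))
        (consC (pairC (fstC (fstC (sndC idC))) (sndC (sndC idC))) (sndC (fstC (sndC idC))))) cg)
      where
      lem : ∀ fr acc E → Data.List.Base.foldl (λ y x → kidsL x , (fst y , x) ∷ snd y) (fr , acc) E ≡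
       (frontFrom fr E , stepsAcc fr acc E)
      lem fr acc [] = refl
      lem fr acc (L ∷ E) = lem (kidsL L) ((fr , L) ∷ acc) E

     nodesC : ∀ {s f} → Cmp X s (list lev) f → Cmp X s (list nat) (λ a → nodes (f a))
     nodesC cf = concatC (concatC cf)

     preC : ∀ {s f g} → Cmp X s (list nat) f → Cmp X s nat g → Cmp X s (list nat) (λ a → pre (oracle (_∈ f a)) (g a))
     preC {s} {f} {g} cf cg = c-cast (λ a → lem a (g a))
      (nrecC nilC (consC (iteC D (constC nat 1) (constC nat 0)) (sndC (sndC idC))) cg)
      where
      D : Deci X (s ⊗ nat ⊗ list nat) (λ q → fst (snd q) ∈ f (fst q))
      D = d-∈ nat (fstC (sndC idC)) (cf ∘C fstC idC)
      lem : ∀ a M → nrec [] (λ i y → ite D 1 0 (a , i , y) ∷ y) M ≡ pre (oracle (_∈ f a)) M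
      lem a zero = refl
      lem a (suc M) = cong₂ _∷_ (go (nrec [] (λ i y → ite D 1 0 (a , i , y) ∷ y) M) em) (lem a M)
       where
       go : ∀ ρ → Dec (M ∈ f a) → ite D 1 0 (a , M , ρ) ≡ bit (oracle (_∈ f a) M)
       go ρ (yes m∈) = trans (ite-yes D {a = a , M , ρ} m∈) (sym (fst (bit-oracle (_∈ f a) M) m∈))
       go ρ (no m∉) = trans (ite-no D {a = a , M , ρ} m∉) (sym (snd (bit-oracle (_∈ f a) M) m∉))

     re-good : ∀ {s} e {f g h} → Cmp X s (list nat) f → Cmp X s nat g → Cmp X s nat h →
      RE X s (λ a → Good e (f a) (g a) (h a))
     re-good e {f} cf cg ch = re-∃ nat (re-dec (d-≡ nat
      (c-up′ (preC (cf ∘C fstC idC) (sndC idC)) (sndC idC) (cg ∘C fstC idC)) (sucC (ch ∘C fstC idC))))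
      where
      c-up′ : ∀ {s l f g} → Cmp X s (list nat) l → Cmp X s nat f → Cmp X s nat g →
       Cmp X s nat (λ a → Sim.ev X₀ e (enc (list nat) (l a)) (f a) (g a ∷ []))
      c-up′ cl cf cg = c-up up (Sim.evC X₀ e {l = λ (p : List ℕ × ℕ × ℕ) → fst p} (fstC {s = list nat} {nat ⊗ nat} idC)
       (fstC (sndC idC)) (sndC (sndC idC))) ∘C pairC cl (pairC cf cg)

     re-chain : ∀ {s P f g} → RE X (nat ⊗ nat) (λ p → P (fst p) (snd p)) → Cmp X s lev f → Cmp X s (list lev) g →
      RE X s (λ a → Chain P (f a) (g a))
     re-chain {P = P} {f} {g} rP cf cg = re-iff
      {P = λ a → ∀ {p} → p ∈ stepsAcc (f a) [] (g a) → Step P p}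
      (λ a → (λ h → snd (steps⇒chain {P} (f a) [] (g a) h)) , λ c {p} → chain⇒steps {P} (f a) [] (g a) (λ ()) c {p})
      (re-all (lev ⊗ lev) {Q = λ q → Step P (snd q)} (re-sub {P = Step P} reStep (sndC idC)) (sndC (stepsC cf cg)))
      where
      reStep : RE X (lev ⊗ lev) (Step P)
      reStep = re-and
       (re-∃ nat (re-dec (d-above (sndC idC) (fstC (fstC idC)) (sndC (fstC idC)))))
       (re-∃ nat (re-all nat (re-sub rP (pairC (sndC (fstC idC)) (sndC idC))) (concatC (sndC (fstC idC)))))

 -- Reservoirs, conditions and generic branches

 module ForcingConditions where
  open ListLemmas
  open HalpernLauchli
  open HalpernLauchliProof using (levelHL)
  open Programs
  open TypedPrograms
  open Computability
  open Simulation
  open BasisTheorem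
  open Forests
  open import Data.List.Relation.Binary.Pointwise.Base using (Pointwise; []; _∷_)
  open import Data.List.Relation.Unary.All as All using (All; []; _∷_)
  open import Data.List.Relation.Unary.AllPairs using ([]; _∷_)
  open import Data.Nat.Tactic.RingSolver using (solve-∀)
  open import Data.Vec.Base using ([]; _∷_)

  when : ∀ {P A : Set} → Dec P → A → A → A
  when (yes _) a b = a
  when (no _)  a b = b

  whenC : ∀ {X s t P f g} → Deci X s P → Cmp X s t f → Cmp X s t g → Cmp X s t (λ a → when (em {P a}) (f a) (g a))
  whenC {P = P} {f} {g} D cf cg = c-cast (λ a → go a (em {P a})) (iteC D cf cg)
   where
   go : ∀ a (p : Dec (P a)) → ite D (f a) (g a) a ≡ when p (f a) (g a)
   go a (yes p) = ite-yes D p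
   go a (no ¬p) = ite-no D ¬p

  choose : {P : ℕ → Set} {Q : ℕ → ℕ → Set} → (∀ {z} → P z → ∃[ y ] Q z y) →
   Σ (ℕ → ℕ) λ t → ∀ {z} → P z → Q z (t z)
  choose {P} {Q} h = (λ z → t z em) , λ {z} p → good z em p
   where
   t : ∀ z → Dec (P z) → ℕ
   t z (yes p) = fst (h p)
   t z (no _) = 0
   good : ∀ z (d : Dec (P z)) → P z → Q z (t z d)
   good z (yes p) _ = snd (h p)
   good z (no ¬p) p = ⊥-elim (¬p p)

  d-tasks : ∀ {X s} {A : Set} (ts : List A) {P : A → El s → Set} → (∀ t → Deci X s (P t)) →
   Deci X s (λ a → ∀ {t} → t ∈ ts → P t a)
  d-tasks []       h = deci (λ _ → 1) (constC nat 1) λ a → inj₁ (refl , λ ())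
  d-tasks {A = A} (t ∷ ts) {P} h = d-iff {P = λ a → P t a × (∀ {u} → u ∈ ts → P u a)} {Q = λ a → ∀ {u} → u ∈ (t ∷ ts) → P u a}
   (λ a → (λ p {u} u∈ → go p u∈) , (λ f → f (here refl) , λ {u} u∈ → f (there u∈)))
   (d-and (h t) (d-tasks ts {P} h))
   where
   go : ∀ {a} → P t a × (∀ {u} → u ∈ ts → P u a) → ∀ {u} → u ∈ (t ∷ ts) → P u a
   go (p , q) (here refl) = p
   go (p , q) (there u∈) = q u∈

  module Forcing {X₀ : Orc} (F : Forest X₀) (C : Pred ℕ 0ℓ) where

   open Forest F
   open Basics F public

   lmost : ℕ → ℕ → ℕ
   lmost m y = listCase y (λ z _ → z) (dl m y)

   lmost-sec : ∀ m → Sec T m (lmost m)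
   lmost-sec m y with dl m y in eq
   ... | z ∷ _ = ∈dl⁻ m (subst (z ∈_) (sym eq) (here refl))
   ... | [] with subst (lm T m y ∈_) eq (∈dl⁺ (lm-desc T m y))
   ... | ()

   -- The section of height m that follows an association list where it can.
   look : ℕ → List (ℕ × ℕ) → ℕ → ℕ
   look m al y = foldr (λ p r → when (em {fst p ≡ y × Desc T m y (snd p)}) (snd p) r) (lmost m y) al

   look-sec : ∀ m al → Sec T m (look m al)
   look-sec m []       y = lmost-sec m y
   look-sec m (p ∷ al) y = go em
    where
    go : ∀ (d : Dec (fst p ≡ y × Desc T m y (snd p))) → Desc T m y (when d (snd p) (look m al y))
    go (yes (_ , d)) = d
    go (no _) = look-sec m al y

   look-graph : ∀ {m t} → Sec T m t → ∀ us {y} → y ∈ us → look m (map (λ u → u , t u) us) y ≡ t y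
   look-graph {m} {t} h (u ∷ us) {y} y∈ = go em y∈
    where
    go : ∀ (d : Dec (u ≡ y × Desc T m y (t u))) → y ∈ (u ∷ us) →
     when d (t u) (look m (map (λ u → u , t u) us) y) ≡ t y
    go (yes (e , _)) _ = cong t e
    go (no ¬p)       (here refl) = ⊥-elim (¬p (refl , h y))
    go (no _)        (there y∈) = look-graph h us y∈

   -- A reservoir picks an extension of every node, at a height depending only on its level n.
   record Res : Set where
    field
     X : Orc
     up : X₀ ⊑ X
     avoid : ¬ C ≤T ⌞ X ⌟
     a : ℕ → ℕ
     s : ℕ → ℕ → ℕ
     sC : Cmp X (nat ⊗ nat) nat (λ p → s (fst p) (snd p))
     sec : ∀ n → Sec T (a n) (s n)

   -- Every node that `s′` picks is one that `s` picks at the same or a later level, so the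
   -- reservoir of `s′` is contained in that of `s`.
   Factors : (ℕ → ℕ → ℕ) → (ℕ → ℕ → ℕ) → Set
   Factors s′ s = ∀ n → ∃[ m ] ∀ x → ∃[ y ] Desc T m x y × s′ n x ≡ s (n + m) y

   factors-refl : ∀ {s} → Factors s s
   factors-refl {s} n = 0 , λ x → x , stop , cong (λ q → s q x) (sym (+-identityʳ n))

   factors-trans : ∀ {s s′ s″} → Factors s″ s′ → Factors s′ s → Factors s″ s
   factors-trans {s} f g n =
    let m , h = f n ; k , h′ = g (n + m)
    in m + k , λ x → let y , d , e = h x ; z , d′ , e′ = h′ y
     in z , desc-trans d d′ , trans e (trans e′ (cong (λ q → s q z) (+-assoc n m k)))

   module _ {X : Orc} (up : X₀ ⊑ X) where

    abstract
     lmostC : ∀ {s f g} → Cmp X s nat f → Cmp X s nat g → Cmp X s nat (λ a → lmost (f a) (g a))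
     lmostC cf cg = caseC cg (fstC (sndC idC)) (dlC up cf cg)

     lookC : ∀ {s f g h} → Cmp X s nat f → Cmp X s (list (nat ⊗ nat)) g → Cmp X s nat h →
      Cmp X s nat (λ a → look (f a) (g a) (h a))
     lookC {s} {f} {g} {h} cf cg ch = foldrC (lmostC cf ch)
      (whenC {P = λ q → fst (fst (snd q)) ≡ h (fst q) × Desc T (f (fst q)) (h (fst q)) (snd (fst (snd q)))}
       (d-and (d-≡ nat (fstC (fstC (sndC idC))) (ch ∘C fstC idC))
        (d-desc up (cf ∘C fstC idC) (ch ∘C fstC idC) (sndC (fstC (sndC idC)))))
       (sndC (fstC (sndC idC))) (sndC (sndC idC)))
      cg

   record Colouring (X : Orc) : Set where
    field
     cones : List ℕ
     distinct : Unique cones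
     k : ℕ
     φ : List ℕ → ℕ
     φC : Cmp X (list nat) nat φ
     φ< : ∀ us → φ us < k
   open Colouring

   -- The counterpart of `Homogenized` with absolute levels, and with sections computable from the
   -- oracle of the reservoir; `K` is meant as the level of the cones.
   record Homogeneous (R : Res) (K : ℕ) (ts : List (Colouring (Res.X R))) : Set where
    field
     p : ℕ
     pos : ℕ → ℕ
     pos↓ : Sec T p pos
     a′ : ℕ → ℕ
     s′ : ℕ → ℕ → ℕ
     s′C : Cmp (Res.X R) (nat ⊗ nat) nat (λ p → s′ (fst p) (snd p))
     sec′ : ∀ n → Sec T (a′ n) (s′ n)
     factor : Factors s′ (Res.s R)
     value : Colouring (Res.X R) → ℕ
     same : ∀ {t} → t ∈ ts → ∀ n {us} → Pointwise (Desc T n) (map pos (cones t)) us →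
      φ t (map (s′ (K + p + n)) us) ≡ value t

   private
    level-assoc : ∀ K p n m → K + (p + (n + m)) ≡ K + p + n + m
    level-assoc = solve-∀

   -- A homogenization exists by the Halpern–Läuchli theorem, and hence one is found by search.
   module Homogenize (R : Res) (K : ℕ) (ts : List (Colouring (Res.X R))) where
    open Res R

    toTask : Colouring X → Task T
    toTask t = task (cones t) (k t) (λ q us → φ t (map (s (K + q)) us))

    abstract
     H : Homogenized T (map toTask ts)
     H = homogenize T (map toTask ts) λ {u} u∈ → let t , _ , e = ∈-map⁻ toTask u∈ in
      subst Ready (sym e) (distinct t , (λ n us → φ< t (map (s (K + n)) us)) , levelHL (length (cones t)))

    open Homogenized H hiding (s; sec) renaming (m to mH)

    value : Colouring X → ℕ
    value t = φ t (map (s (K + (p + (0 + mH 0)))) (map (Homogenized.s H 0) (map pos (cones t))))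

    Rel : ℕ × ℕ × List (ℕ × ℕ) → Set
    Rel (n , m , al) = ∀ {t} → t ∈ ts → ∀ {us} → us ∈ tup n (map pos (cones t)) →
     φ t (map (λ u → s (K + (p + (n + m))) (look m al u)) us) ≡ value t

    abstract
     D-Rel : Deci X (nat ⊗ nat ⊗ list (nat ⊗ nat)) Rel
     D-Rel = d-tasks ts λ t → d-all {t = list nat}
      {Q = λ q → φ t (map (λ u → s (K + (p + (fst (fst q) + fst (snd (fst q)))))
       (look (fst (snd (fst q))) (snd (snd (fst q))) u)) (snd q)) ≡ value t}
      (d-≡ nat (φC t ∘C mapC (sC ∘C pairC
       (addC (constC nat K) (addC (constC nat p) (addC (fstC (fstC (fstC idC))) (fstC (sndC (fstC (fstC idC)))))))
       (lookC up (fstC (sndC (fstC (fstC idC)))) (sndC (sndC (fstC (fstC idC)))) (sndC idC)))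
       (sndC idC)) (constC nat (value t)))
      (tupC up (fstC idC) (constC (list nat) (map pos (cones t))))

     exists : ∀ n → ∃[ y ] Rel (n , y)
     -- Finitely many nodes are looked up at height `n`, so the section given by the theorem may be
     -- replaced by a finite list, for which a search is possible.
     exists n = (mH n , al) , λ {t} t∈ {us} us∈ →
      let ds = ∈tup⁻ n (map pos (cones t)) us∈ in
      trans (cong (φ t) (trans (map-cong∈ us λ {u} u∈ → cong (s (K + (p + (n + mH n)))) (look-graph (Homogenized.sec H n) all (in-all t∈ ds u∈)))
       (map-∘ us)))
       (Homogenized.same H (∈-map⁺ toTask t∈) n ds)
      where
      all : List ℕ
      all = concatMap (λ t → concatMap (dl n) (map pos (cones t))) ts
      al : List (ℕ × ℕ)
      al = map (λ u → u , Homogenized.s H n u) all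
      in-all : ∀ {t us} → t ∈ ts → Pointwise (Desc T n) (map pos (cones t)) us → ∀ {u} → u ∈ us → u ∈ all
      in-all {t} t∈ ds u∈ = let b , b∈ , d = pw-∈ʳ ds u∈ in
       ∈-concatMap {f = λ t → concatMap (dl n) (map pos (cones t))} t∈ (∈-concatMap {f = dl n} b∈ (∈dl⁺ d))

     found : Σ (ℕ → ℕ × List (ℕ × ℕ)) λ f → Cmp X nat (nat ⊗ list (nat ⊗ nat)) f × (∀ n → Rel (n , f n))
     found = search D-Rel exists

    m : ℕ → ℕ
    m q = fst (fst found (q ∸ (K + p)))

    t : ℕ → ℕ → ℕ
    t q = look (m q) (snd (fst found (q ∸ (K + p))))

    s′ : ℕ → ℕ → ℕ
    s′ q x = s (q + m q) (t q x)

    s′C : Cmp X (nat ⊗ nat) nat (λ p → s′ (fst p) (snd p))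
    s′C = sC ∘C pairC (addC (fstC idC) (fstC cf)) (lookC up (fstC cf) (sndC cf) (sndC idC))
     where
     cf : Cmp X (nat ⊗ nat) (nat ⊗ list (nat ⊗ nat)) (λ q → fst found (fst q ∸ (K + p)))
     cf = fst (snd found) ∘C subC (fstC idC) (constC nat (K + p))

    result : Homogeneous R K ts
    result = record
     { p = p ; pos = pos ; pos↓ = pos↓
     ; a′ = λ q → m q + a (q + m q) ; s′ = s′ ; s′C = s′C
     ; sec′ = λ q x → desc-trans (look-sec (m q) (snd (fst found (q ∸ (K + p)))) x) (sec _ _)
     ; factor = λ q → m q , λ x → t q x , look-sec (m q) (snd (fst found (q ∸ (K + p)))) x , refl
     ; value = value
     ; same = λ {c} c∈ n {us} ds → trans (cong (φ c) (map-cong∈ us λ {u} _ → unfold n u))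
      (snd (snd found) n c∈ (∈tup⁺ ds))
     }
     where
     unfold : ∀ n u → s′ (K + p + n) u ≡
      s (K + (p + (n + fst (fst found n)))) (look (fst (fst found n)) (snd (fst found n)) u)
     unfold n u = trans
      (cong (λ j → s (K + p + n + fst (fst found j)) (look (fst (fst found j)) (snd (fst found j)) u))
       (m+n∸m≡n (K + p) n))
      (cong (λ q → s q (look (fst (fst found n)) (snd (fst found n)) u)) (sym (level-assoc K p n _)))

   abstract
    homogeneous : ∀ R K ts → Homogeneous R K ts
    homogeneous R K ts = Homogenize.result R K ts

   -- What the reservoir `s` offers at level `n` above the cones `bs`, which sit at level `N`.
   Y : List ℕ → ℕ → (ℕ → ℕ → ℕ) → ℕ → ℕ → Set
   Y bs N s n z = ∃[ b ] b ∈ bs × ∃[ k ] ∃[ y ] N + k ≡ n × Desc T k b y × z ≡ s n y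

   Y-RE : ∀ (R : Res) bs N → RE (Res.X R) (nat ⊗ nat) (λ p → Y bs N (Res.s R) (fst p) (snd p))
   Y-RE R bs N = abstracted
    where
    open Res R
    abstract
     abstracted : RE X (nat ⊗ nat) (λ p → Y bs N s (fst p) (snd p))
     abstracted = re-iff
      {P = λ p → ∃[ w ] (fst w ∈ bs × N + fst (snd w) ≡ fst p × Desc T (fst (snd w)) (fst w) (snd (snd w)) ×
       snd p ≡ s (fst p) (snd (snd w)))}
      (λ p → (λ ((b , k , y) , b∈ , e , d , e′) → b , b∈ , k , y , e , d , e′) ,
       (λ (b , b∈ , k , y , e , d , e′) → (b , k , y) , b∈ , e , d , e′))
      (re-∃ (nat ⊗ nat ⊗ nat) (re-dec (d-and (d-∈ nat (fstC (sndC idC)) (constC (list nat) bs))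
       (d-and (d-≡ nat (addC (constC nat N) (fstC (sndC (sndC idC)))) (fstC (fstC idC)))
        (d-and (d-desc up (fstC (sndC (sndC idC))) (fstC (sndC idC)) (sndC (sndC (sndC idC))))
         (d-≡ nat (sndC (fstC idC)) (sC ∘C pairC (fstC (fstC idC)) (sndC (sndC (sndC idC))))))))))

   Y-sub : ∀ {bs N s bs′ N′ s′} → (∀ {b} → b ∈ bs → Depth N b) → (∀ {b} → b ∈ bs′ → Depth N′ b) →
    (∀ {b′} → b′ ∈ bs′ → ∃[ b ] b ∈ bs × ∃[ j ] Desc T j b b′) → Factors s′ s →
    ∀ n → ∃[ m ] ∀ {z} → Y bs′ N′ s′ n z → Y bs N s m z
   Y-sub {N = N} {N′ = N′} dep dep′ below f n =
    let m , h = f n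
    in n + m , λ { (b′ , b′∈ , k , y , refl , d , refl) →
     let b , b∈ , j , d′ = below b′∈
         y′ , d″ , e = h y
     in b , b∈ , (j + k) + m , y′ ,
      trans (sym (+-assoc N (j + k) m))
       (cong (_+ m) (trans (sym (+-assoc N j k)) (cong (_+ k) (depth-unique (depth-down (dep b∈) d′) (dep′ b′∈))))) ,
      desc-trans (desc-trans d′ d) d″ , e }

   Y-depth : ∀ {bs N s} {a : ℕ → ℕ} → (∀ n → Sec T (a n) (s n)) → (∀ {b} → b ∈ bs → Depth N b) →
    ∀ {n z} → Y bs N s n z → N ≤ z
   Y-depth {N = N} sec dep {n} (b , b∈ , k , y , refl , d , refl) =
    ≤-trans (m≤m+n N k) (≤-trans (m≤m+n (N + k) _) (depth≤ (depth-down (depth-down (dep b∈) d) (sec (N + k) y))))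

   Trivial : ℕ → ℕ → Set
   Trivial _ _ = ⊤

   -- A condition of Mathias type: finitely many levels, and a reservoir above cones `B` that extend
   -- the front. All cones lie at the one level `N`, which keeps the offers of the reservoir uniform
   -- across the trees.
   record Cond (fr₀ : Lev) : Set where
    field
     Es : List Lev
     chain : Chain Trivial fr₀ Es
     R : Res
     B : Lev
     h : ℕ
     B↓ : Above h (frontFrom fr₀ Es) B
     N : ℕ
     N↓ : ∀ {b} → b ∈ concat B → Depth N b
    open Res R public
    fr : Lev
    fr = frontFrom fr₀ Es
    In : ℕ → ℕ → Set
    In = Y (concat B) N s

   record _⊴_ {fr₀ : Lev} (r q : Cond fr₀) : Set where
    field
     E : List Lev
     Es≡ : Cond.Es r ≡ Cond.Es q ++ E
     inside : Chain (Cond.In q) (Cond.fr q) E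
     sub : ∀ n → ∃[ m ] ∀ {z} → Cond.In r n z → Cond.In q m z
     fac : Factors (Cond.s r) (Cond.s q)
     upX : Cond.X q ⊑ Cond.X r

   ⊴-refl : ∀ {fr₀} {q : Cond fr₀} → q ⊴ q
   ⊴-refl {q = q} = record { E = [] ; Es≡ = sym (++-identityʳ _) ; inside = tt ; sub = λ n → n , id ; fac = factors-refl {Cond.s q} ; upX = ⊑-refl }

   ⊴-trans : ∀ {fr₀} {p q r : Cond fr₀} → r ⊴ q → q ⊴ p → r ⊴ p
   ⊴-trans {fr₀} {p} {q} {r} a b = record
    { E = B.E ++ A.E
    ; Es≡ = trans A.Es≡ (trans (cong (_++ A.E) B.Es≡) (++-assoc (Cond.Es p) B.E A.E))
    ; inside = chain-++ (Cond.fr p) B.E A.E B.inside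
     (chain-imp B.sub _ A.E (subst (λ f → Chain (Cond.In q) f A.E)
      (trans (cong (frontFrom fr₀) B.Es≡) (frontFrom-++ fr₀ (Cond.Es p) B.E)) A.inside))
    ; sub = λ n → let m , f = A.sub n ; k , g = B.sub m in k , λ y → g (f y)
    ; fac = factors-trans {Cond.s p} {Cond.s q} {Cond.s r} A.fac B.fac
    ; upX = ⊑-trans B.upX A.upX
    }
    where
    module A = _⊴_ a
    module B = _⊴_ b

   -- Cones for an extension by a chain E: its own frontier, or the given cones if E is empty.
   chain-cones : ∀ {bs N s} (a : ℕ → ℕ) → (∀ n → Sec T (a n) (s n)) →
    ∀ fr {h B} E → Chain (Y bs N s) fr E → Above h fr B →
    (∀ {b} → b ∈ concat B → ∃[ b′ ] b′ ∈ bs × ∃[ j ] Desc T j b′ b) →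
    ∃[ h′ ] ∃[ B′ ] Above h′ (frontFrom fr E) B′ × (∀ {b} → b ∈ concat B′ → ∃[ b′ ] b′ ∈ bs × ∃[ j ] Desc T j b′ b)
   chain-cones a sec fr {h} {B} [] _ ab below = h , B , ab , below
   chain-cones {bs} {N} {s} a sec fr (L ∷ E) ((_ , n , f) , c) _ _ =
    chain-cones {bs} {N} {s} a sec (kidsL L) {0} {kidsL L} E c (pw-refl (pw-refl stop)) λ b∈ →
     let z , z∈ , κ = ∈-concatMapʳ kd L b∈
         b , b∈ , k , y , e , d , e′ = f z∈
     in b , b∈ , (k + a n) + 1 , desc-trans (desc-trans d (subst (Desc T (a n) y) (sym e′) (sec n y))) (kid κ)

   chain-depth : ∀ {P d} fr E → Chain P fr E → (∀ {x} → x ∈ concat fr → Depth d x) →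
    ∃[ d′ ] ∀ {x} → x ∈ concat (frontFrom fr E) → Depth d′ x
   chain-depth fr []      _ dep = _ , dep
   chain-depth fr (L ∷ E) (((m , ab) , _) , c) dep = chain-depth (kidsL L) E c λ x∈ →
    let z , z∈ , κ = ∈-concatMapʳ kd L x∈
        y , y∈ , d = pw-∈ʳ (pw-concat ab) z∈
    in depth-down (depth-down (dep y∈) d) (kid κ)

   chain-trivial : ∀ {P} fr E → Chain P fr E → Chain Trivial fr E
   chain-trivial fr []      _ = tt
   chain-trivial fr (L ∷ E) ((ab , n , _) , c) = (ab , n , λ _ → tt) , chain-trivial (kidsL L) E c

   above-depth : ∀ {m d fr B} → Above m fr B → (∀ {x} → x ∈ concat fr → Depth d x) → ∀ {b} → b ∈ concat B → Depth (d + m) b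
   above-depth ab dep b∈ = let x , x∈ , d = pw-∈ʳ (pw-concat ab) b∈ in depth-down (dep x∈) d

   module Extend {fr₀ : Lev} {d₀ : ℕ} (d₀↓ : ∀ {x} → x ∈ concat fr₀ → Depth d₀ x) (q : Cond fr₀)
    (R′ : Res) (fac : Factors (Res.s R′) (Cond.s q)) (upX : Cond.X q ⊑ Res.X R′)
    (E : List Lev) (c : Chain (Cond.In q) (Cond.fr q) E) where
    open Cond q

    chain′ : Chain Trivial fr₀ (Es ++ E)
    chain′ = chain-++ fr₀ Es E chain (chain-trivial fr E c)

    front′ : frontFrom fr₀ (Es ++ E) ≡ frontFrom fr E
    front′ = frontFrom-++ fr₀ Es E

    depth′ : ℕ
    depth′ = fst (chain-depth fr₀ (Es ++ E) chain′ d₀↓)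

    depth′↓ : ∀ {x} → x ∈ concat (frontFrom fr E) → Depth depth′ x
    depth′↓ x∈ = snd (chain-depth fr₀ (Es ++ E) chain′ d₀↓) (subst (λ f → _ ∈ concat f) (sym front′) x∈)

    extend-at : ∀ {h′ B′} → Above h′ (frontFrom fr E) B′ →
     (∀ {b} → b ∈ concat B′ → ∃[ b′ ] b′ ∈ concat B × ∃[ j ] Desc T j b′ b) →
     Σ (Cond fr₀) λ r → r ⊴ q × Cond.Es r ≡ Es ++ E × Cond.R r ≡ R′ × Cond.B r ≡ B′ × Cond.N r ≡ depth′ + h′
    extend-at {h′} {B′} ab below =
     let d , dep = chain-depth fr₀ (Es ++ E) chain′ d₀↓
         ab′ = subst (λ f → Above h′ f B′) (sym front′) ab
         N′↓ = above-depth ab′ dep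
     in record { Es = Es ++ E ; chain = chain′ ; R = R′ ; B = B′ ; h = h′ ; B↓ = ab′ ; N = d + h′ ; N↓ = N′↓ } ,
      record { E = E ; Es≡ = refl ; inside = c ; fac = fac ; upX = upX
       ; sub = Y-sub {concat B} {N} {s} {concat B′} {d + h′} {Res.s R′} N↓ N′↓ below fac } ,
      refl , refl , refl , refl

    -- Raising the cones to a level of at least `u` keeps codes below `u` out of all later levels,
    -- so a computation with use `u` is preserved.
    extend-by : ∀ u → Σ (Cond fr₀) λ r → r ⊴ q × Cond.Es r ≡ Es ++ E × u ≤ Cond.N r
    extend-by u =
     let h′ , B′ , ab , below = chain-cones {concat B} {N} {s} a sec fr E c B↓ (λ {b} b∈ → b , b∈ , 0 , stop)
         d , dep = chain-depth fr₀ (Es ++ E) chain′ d₀↓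
         B″ = map (map (lmost u)) B′
         ab′ : Above (h′ + u) (frontFrom fr₀ (Es ++ E)) B″
         ab′ = subst (λ f → Above (h′ + u) f B″) (sym front′) (above-trans ab (above-graph (lmost-sec u) B′))
         N′↓ = above-depth ab′ dep
         below′ : ∀ {b} → b ∈ concat B″ → ∃[ b′ ] b′ ∈ concat B × ∃[ j ] Desc T j b′ b
         below′ b∈ = let b₁ , b₁∈ , e = pw-∈ʳ (pw-concat (above-graph (lmost-sec u) B′)) b∈
                         b₂ , b₂∈ , j , e′ = below b₁∈ in b₂ , b₂∈ , j + u , desc-trans e′ e
     in record { Es = Es ++ E ; chain = chain′ ; R = R′ ; B = B″ ; h = h′ + u ; B↓ = ab′ ; N = d + (h′ + u) ; N↓ = N′↓ } ,
      record { E = E ; Es≡ = refl ; inside = c ; fac = fac ; upX = upX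
       ; sub = Y-sub {concat B} {N} {s} {concat B″} {d + (h′ + u)} {Res.s R′} N↓ N′↓ below′ fac } ,
      refl , ≤-trans (m≤n+m u h′) (m≤n+m (h′ + u) d)

   Over : List ℕ → Lev → Set
   Over βs L = Pointwise (λ β l → ∀ {x} → x ∈ l → ∃[ m ] Desc T m β x) βs L

   over-above : ∀ {βs m fr L} → Over βs fr → Above m fr L → Over βs L
   over-above []       [] = []
   over-above (o ∷ os) (ab ∷ abs) =
    (λ x∈ → let y , y∈ , d = pw-∈ʳ ab x∈ ; n , e = o y∈ in n + _ , desc-trans e d) ∷ over-above os abs

   over-kids : ∀ {βs L} → Over βs L → Over βs (kidsL L)
   over-kids [] = []
   over-kids {L = l ∷ L} (o ∷ os) =
    (λ x∈ → let y , y∈ , κ = ∈-concatMap′ {f = kd} l x∈ ; n , e = o y∈ in n + 1 , desc-trans e (kid κ)) ∷ over-kids os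

   over-front : ∀ {P βs} fr E → Over βs fr → Chain P fr E → Over βs (frontFrom fr E)
   over-front fr []      o _ = o
   over-front fr (L ∷ E) o (((_ , ab) , _) , c) = over-front (kidsL L) E (over-kids (over-above o ab)) c

   over-base : ∀ βs → Over βs (map (_∷ []) βs)
   over-base [] = []
   over-base (β ∷ βs) = (λ { (here refl) → 0 , stop }) ∷ over-base βs

   over-tuple : ∀ {βs L xs} → Over βs L → xs ∈ prod L → Pointwise (λ β x → ∃[ m ] Desc T m β x) βs xs
   over-tuple {L = L} o xs∈ = go o (∈-prod⁻ L xs∈)
    where
    go : ∀ {βs L xs} → Over βs L → Pointwise (λ l x → x ∈ l) L xs → Pointwise (λ β x → ∃[ m ] Desc T m β x) βs xs
    go []       [] = []
    go (o ∷ os) (x ∷ xs) = o x ∷ go os xs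

   over-∈ : ∀ {βs L x} → Over βs L → x ∈ concat L → ∃[ β ] β ∈ βs × ∃[ m ] Desc T m β x
   over-∈ {L = l ∷ L} (o ∷ os) x∈ with ∈-++⁻ l x∈
   ... | inj₁ x∈l = _ , here refl , o x∈l
   ... | inj₂ x∈L = let β , β∈ , h = over-∈ os x∈L in β , there β∈ , h

   same-base : ∀ {d β β′ m m′ x} → Depth d β → Depth d β′ → Desc T m β x → Desc T m′ β′ x → β ≡ β′
   same-base {d} {β′ = β′} {m} {m′} {x} db db′ e e′ = desc-unique e
    (subst (λ n → Desc T n β′ x) (+-cancelˡ-≡ d _ _ (depth-unique (depth-down db′ e′) (depth-down db e))) e′)

   -- Each `x` lies above its base and above some cone, and that cone lies above a base as well.
   -- Distinct bases of one depth have no common descendants, so the cone belongs to the coordinate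
   -- of `x`.
   locate : ∀ {βs Bs xs d} {Q : ℕ → ℕ → Set} → Unique βs → (∀ {β} → β ∈ βs → Depth d β) → Over βs Bs →
    (∀ {b x} → Q b x → ∃[ m ] Desc T m b x) →
    Pointwise (λ β x → (∃[ m ] Desc T m β x) × ∃[ b ] b ∈ concat Bs × Q b x) βs xs →
    Pointwise (λ bs x → ∃[ b ] b ∈ bs × Q b x) Bs xs
   locate []       dep []       q⇒ [] = []
   locate {βs = β ∷ βs} {bs ∷ Bs} {x ∷ xs} {d} {Q} (β∉ ∷ u) dep (o ∷ os) q⇒ (((m , e) , b , b∈ , qb) ∷ rest) =
    first (∈-++⁻ bs b∈) ∷ locate u (dep ∘ there) os q⇒ (pw-imp∈ tail-in rest)
    where
    first : b ∈ bs ⊎ b ∈ concat Bs → ∃[ b ] b ∈ bs × Q b x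
    first (inj₁ p) = b , p , qb
    first (inj₂ p) = let β′ , β′∈ , m′ , e′ = over-∈ os p ; m″ , e″ = q⇒ qb in
     ⊥-elim (All.lookup β∉ β′∈ (same-base (dep (here refl)) (dep (there β′∈)) e (desc-trans e′ e″)))
    tail-in : ∀ {β′ y} → β′ ∈ βs → (∃[ m ] Desc T m β′ y) × (∃[ b ] b ∈ concat (bs ∷ Bs) × Q b y) →
     (∃[ m ] Desc T m β′ y) × (∃[ b ] b ∈ concat Bs × Q b y)
    tail-in β′∈ ((m , e) , b , b∈ , qb) with ∈-++⁻ bs b∈
    ... | inj₂ p = (m , e) , b , p , qb
    ... | inj₁ p = let m′ , e′ = o p ; m″ , e″ = q⇒ qb in
     ⊥-elim (All.lookup β∉ β′∈ (same-base (dep (here refl)) (dep (there β′∈)) (desc-trans e′ e″) e))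

   Union : (ℕ → Lev) → ℕ → Set
   Union L z = ∃[ j ] z ∈ concat (L j)

   frL : Lev → (ℕ → Lev) → ℕ → Lev
   frL fr₀ L zero = fr₀
   frL fr₀ L (suc j) = kidsL (L j)

   seg : (ℕ → Lev) → ℕ → ℕ → List Lev
   seg L j zero = []
   seg L j (suc i) = L j ∷ seg L (suc j) i

   ∈-seg⁻ : ∀ L j i {x} → x ∈ seg L j i → ∃[ n ] n < i × x ≡ L (j + n)
   ∈-seg⁻ L j (suc i) (here refl) = 0 , s≤s z≤n , cong L (sym (+-identityʳ j))
   ∈-seg⁻ L j (suc i) (there x∈) = let n , n< , e = ∈-seg⁻ L (suc j) i x∈ in suc n , s≤s n< , trans e (cong L (sym (+-suc j n)))

   ∈-seg⁺ : ∀ L j i n → n < i → L (j + n) ∈ seg L j i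
   ∈-seg⁺ L j (suc i) zero    _ = here (cong L (+-identityʳ j))
   ∈-seg⁺ L j (suc i) (suc n) (s≤s n<) = there (subst (λ q → L q ∈ seg L (suc j) i) (sym (+-suc j n)) (∈-seg⁺ L (suc j) i n n<))

   seg-++ : ∀ L j i i′ → seg L j i ++ seg L (j + i) i′ ≡ seg L j (i + i′)
   seg-++ L j zero    i′ = cong (λ q → seg L q i′) (+-identityʳ j)
   seg-++ L j (suc i) i′ = cong (L j ∷_) (trans (cong (λ q → seg L (suc j) i ++ seg L q i′) (+-suc j i)) (seg-++ L (suc j) i i′))

   frontFrom-seg : ∀ fr₀ L j i → frontFrom (frL fr₀ L j) (seg L j i) ≡ frL fr₀ L (j + i)
   frontFrom-seg fr₀ L j zero = cong (frL fr₀ L) (sym (+-identityʳ j))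
   frontFrom-seg fr₀ L j (suc i) = trans (frontFrom-seg fr₀ L (suc j) i) (cong (frL fr₀ L) (sym (+-suc j i)))

   nodes-∈ : ∀ {E L z} → L ∈ E → z ∈ concat L → z ∈ nodes E
   nodes-∈ {E} {L} L∈ z∈ = let l , z∈l , l∈ = ∈-concat⁻′ L z∈ in ∈-concat z∈l (∈-concat l∈ L∈)

   ∈-nodes : ∀ E {z} → z ∈ nodes E → ∃[ L ] L ∈ E × z ∈ concat L
   ∈-nodes E z∈ =
    let l , z∈l , l∈ = ∈-concat⁻′ (concat E) z∈ ; L , l∈L , L∈ = ∈-concat⁻′ E l∈
    in L , L∈ , ∈-concat z∈l l∈L

   Strong : Lev → (ℕ → Lev) → Set
   Strong fr₀ L = ∀ j → ∃[ m ] Above m (frL fr₀ L j) (L j)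

   -- An infinite strong subforest compatible with `q`. Forcing is expressed by quantifying over all
   -- of these, generic or not.
   record Branch {fr₀ : Lev} (q : Cond fr₀) (L : ℕ → Lev) : Set where
    open Cond q
    field
     pfx : seg L 0 (length Es) ≡ Es
     strong : Strong fr₀ L
     later : ∀ j → length Es ≤ j → ∃[ n ] ∀ {z} → z ∈ concat (L j) → In n z

    front : fr ≡ frL fr₀ L (length Es)
    front = trans (cong (frontFrom fr₀) (sym pfx)) (frontFrom-seg fr₀ L 0 (length Es))

    chain-seg : ∀ j i → length Es ≤ j → Chain In (frL fr₀ L j) (seg L j i)
    chain-seg j zero    l≤ = tt
    chain-seg j (suc i) l≤ = (strong j , later j l≤) , chain-seg (suc j) i (m≤n⇒m≤1+n l≤)

   module Depths {fr₀ : Lev} {L : ℕ → Lev} {d₀ : ℕ} (d₀↓ : ∀ {x} → x ∈ concat fr₀ → Depth d₀ x) (st : Strong fr₀ L) where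

    fd gd : ℕ → ℕ
    fd zero = d₀
    fd (suc j) = gd j + 1
    gd j = fd j + fst (st j)

    fd↓ : ∀ j {x} → x ∈ concat (frL fr₀ L j) → Depth (fd j) x
    gd↓ : ∀ j {x} → x ∈ concat (L j) → Depth (gd j) x
    fd↓ zero    x∈ = d₀↓ x∈
    fd↓ (suc j) x∈ = let z , z∈ , κ = ∈-concatMapʳ kd (L j) x∈ in depth-down (gd↓ j z∈) (kid κ)
    gd↓ j x∈ = let y , y∈ , d = pw-∈ʳ (pw-concat (snd (st j))) x∈ in depth-down (fd↓ j y∈) d

    gd< : ∀ j → gd j < gd (suc j)
    gd< j = ≤-trans (≤-reflexive (+-comm 1 (gd j))) (m≤m+n _ _)

    j≤gd : ∀ j → j ≤ gd j
    j≤gd zero = z≤n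
    j≤gd (suc j) = ≤-trans (s≤s (j≤gd j)) (gd< j)

    climb : ∀ j i → ∃[ m ] (∀ {z} → z ∈ concat (L j) → ∃[ y ] Desc T m z y × y ∈ concat (L (i + j)))
    climb j zero = 0 , λ {z} z∈ → z , stop , z∈
    climb j (suc i) =
     let m , h = climb j i
         n , ab = st (suc (i + j))
     in m + (1 + n) , λ z∈ →
      let w , d , w∈ = h z∈
          κ , κ∈ = kd-ne w
          y , y∈ , d′ = pw-∈ˡ (pw-concat ab) (∈-concatMapʳ⁺ kd (L (i + j)) w∈ κ∈)
      in y , desc-trans d (step κ∈ d′) , y∈

    -- Every later level still offers a node above each node of the front, reached through the
    -- levels in between.
    climb-front : ∀ j i → ∃[ m ] ∃[ S ] Above m (frL fr₀ L j) S × (∀ {z} → z ∈ concat S → z ∈ concat (L (i + j)))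
    climb-front j i =
     let m , h₀ = climb j i ; n , ab = st j
         t , h = choose {_∈ concat (L j)} {λ z y → Desc T m z y × y ∈ concat (L (i + j))} h₀ in
     n + m , map (map t) (L j) , above-trans ab (go (L j) λ z∈ → fst (h z∈)) ,
     λ z∈ → let y , y∈ , e = mem (L j) z∈ in subst (_∈ concat (L (i + j))) (sym e) (snd (h y∈))
     where
     go : ∀ {m t} (L : Lev) → (∀ {z} → z ∈ concat L → Desc T m z (t z)) → Above m L (map (map t) L)
     go []       h = []
     go {m} {t} (l ∷ L) h = go′ l (λ z∈ → h (∈-++⁺ˡ z∈)) ∷ go L (λ z∈ → h (∈-++⁺ʳ l z∈))
      where
      go′ : ∀ l → (∀ {z} → z ∈ l → Desc T m z (t z)) → Pointwise (Desc T m) l (map t l)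
      go′ []      h = []
      go′ (x ∷ l) h = h (here refl) ∷ go′ l (h ∘ there)
     mem : ∀ {t : ℕ → ℕ} (L : Lev) {z} → z ∈ concat (map (map t) L) → ∃[ y ] y ∈ concat L × z ≡ t y
     mem {t} L z∈ with ∈-concat⁻′ (map (map t) L) z∈
     ... | l , z∈l , l∈ with ∈-map⁻ (map t) l∈
     ... | l′ , l′∈ , refl with ∈-map⁻ t z∈l
     ... | y , y∈ , refl = y , ∈-concat y∈ l′∈ , refl

   Computes : Rec 1 → (ℕ → Lev) → Set
   Computes e L = ∀ x → ⌞ join X₀ (oracle (Union L)) ⌟ ⊢ e ⟨ x ∷ [] ⟩⇓ χ C x

   -- Nodes of later levels have codes at least `N`, so below `M` the oracle of a branch agrees with
   -- the finite part and the wrong value is final.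
   refute : ∀ {fr₀} (r : Cond fr₀) {e x v M} → M ≤ Cond.N r →
    Sim.ev X₀ e (enc (list nat) (pre (oracle (_∈ nodes (Cond.Es r))) M)) M (x ∷ []) ≡ suc v → ¬ v ≡ χ C x →
    ∀ {L} → Branch r L → ¬ Computes e L
   refute r {e} {x} {v} {M} M≤N conv v≢ {L} br cpt = v≢ (Sim.deterministic X₀ G
    (Sim.ev-sound X₀ G {e} {pre G M} {M} {x} {v} (agree-pre G M)
     (subst (λ ρ → Sim.ev X₀ e (enc (list nat) ρ) M (x ∷ []) ≡ suc v) (pre-cong M agree) conv)) (cpt x))
    where
    open Cond r
    open Branch br
    G = oracle (Union L)
    agree : ∀ {z} → z < M → oracle (_∈ nodes Es) z ≡ G z
    agree {z} z<M = oracle-cong {_∈ nodes Es} {Union L} to from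
     where
     to : z ∈ nodes Es → Union L z
     to z∈ with ∈-nodes Es z∈
     ... | L′ , L′∈ , z∈L′ with ∈-seg⁻ L 0 (length Es) (subst (L′ ∈_) (sym pfx) L′∈)
     ... | n , _ , refl = n , z∈L′
     from : Union L z → z ∈ nodes Es
     from (j , z∈) with ≤-<-connex (length Es) j
     ... | inj₂ j< = nodes-∈ (subst (L j ∈_) pfx (∈-seg⁺ L 0 (length Es) j j<)) z∈
     ... | inj₁ l≤ = let n , f = later j l≤ in ⊥-elim (<⇒≱ z<M (≤-trans M≤N (Y-depth sec N↓ (f z∈))))

   -- Level `j` has depth, and hence codes, at least `j`; so `M` further levels determine the oracle
   -- below the use `M`.
   confirm : ∀ {fr₀ d₀} (d₀↓ : ∀ {x} → x ∈ concat fr₀ → Depth d₀ x) (r : Cond fr₀) {e x L} → Branch r L → Computes e L →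
    ∃[ i ] Good e (nodes (Cond.Es r ++ seg L (length (Cond.Es r)) i)) x (χ C x)
   confirm {fr₀} {d₀} d₀↓ r {e} {x} {L} br cpt =
    let M , h = Sim.use X₀ G (cpt x)
    in M , M , subst (λ ρ → Sim.ev X₀ e (enc (list nat) ρ) M (x ∷ []) ≡ suc (χ C x)) (pre-cong M (agree M)) (h M ≤-refl)
    where
    open Cond r
    open Branch br
    open Depths {fr₀} {L} {d₀} d₀↓ strong
    G = oracle (Union L)
    whole : ∀ M → Es ++ seg L (length Es) M ≡ seg L 0 (length Es + M)
    whole M = trans (cong (_++ seg L (length Es) M) (sym pfx)) (seg-++ L 0 (length Es) M)
    agree : ∀ M {z} → z < M → G z ≡ oracle (_∈ nodes (Es ++ seg L (length Es) M)) z
    agree M {z} z<M = oracle-cong {Union L} {_∈ nodes (Es ++ seg L (length Es) M)} to from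
     where
     from : z ∈ nodes (Es ++ seg L (length Es) M) → Union L z
     from z∈ with ∈-nodes (Es ++ seg L (length Es) M) z∈
     ... | L′ , L′∈ , z∈L′ with ∈-seg⁻ L 0 (length Es + M) (subst (L′ ∈_) (whole M) L′∈)
     ... | n , _ , refl = n , z∈L′
     to : Union L z → z ∈ nodes (Es ++ seg L (length Es) M)
     to (j , z∈) = nodes-∈ (subst (L j ∈_) (sym (whole M)) (∈-seg⁺ L 0 (length Es + M) j
      (≤-trans (s≤s (≤-trans (j≤gd j) (depth≤ (gd↓ j z∈)))) (≤-trans z<M (m≤n+m M _))))) z∈

   module Limit {fr₀ : Lev} (q : ℕ → Cond fr₀) (desc : ∀ n → q (suc n) ⊴ q n)
    (longer : ∀ n → length (Cond.Es (q n)) < length (Cond.Es (q (suc n)))) where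

    at′ : List Lev → ℕ → Lev
    at′ []       j = []
    at′ (L ∷ Ls) zero = L
    at′ (L ∷ Ls) (suc j) = at′ Ls j

    at′-++ : ∀ Ls Ls′ {j} → j < length Ls → at′ (Ls ++ Ls′) j ≡ at′ Ls j
    at′-++ (L ∷ Ls) Ls′ {zero}  _ = refl
    at′-++ (L ∷ Ls) Ls′ {suc j} (s≤s j<) = at′-++ Ls Ls′ j<

    ≥n : ∀ n → n ≤ length (Cond.Es (q n))
    ≥n zero = z≤n
    ≥n (suc n) = ≤-trans (s≤s (≥n n)) (longer n)

    lim : ℕ → Lev
    lim j = at′ (Cond.Es (q (suc j))) j

    below-⊴ : ∀ n i → q (i + n) ⊴ q n
    below-⊴ n zero = ⊴-refl
    below-⊴ n (suc i) = ⊴-trans (desc (i + n)) (below-⊴ n i)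

    at′-stable : ∀ n i {j} → j < length (Cond.Es (q n)) → at′ (Cond.Es (q (i + n))) j ≡ at′ (Cond.Es (q n)) j
    at′-stable n i j< = trans (cong (λ Ls → at′ Ls _) (_⊴_.Es≡ (below-⊴ n i))) (at′-++ (Cond.Es (q n)) _ j<)

    lim-at : ∀ n {j} → j < length (Cond.Es (q n)) → lim j ≡ at′ (Cond.Es (q n)) j
    lim-at n {j} j< = trans (sym (at′-stable (suc j) n (≥n (suc j))))
     (trans (cong (λ i → at′ (Cond.Es (q i)) j) (+-comm n (suc j))) (at′-stable n (suc j) j<))

    seg-at : ∀ Ls j (L : ℕ → Lev) → (∀ i → i < length Ls → L (j + i) ≡ at′ Ls i) → seg L j (length Ls) ≡ Ls
    seg-at []       j L h = refl
    seg-at (l ∷ Ls) j L h = cong₂ _∷_ (trans (cong L (sym (+-identityʳ j))) (h 0 (s≤s z≤n)))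
     (seg-at Ls (suc j) L λ i i< → trans (cong L (sym (+-suc j i))) (h (suc i) (s≤s i<)))

    pfx : ∀ n → seg lim 0 (length (Cond.Es (q n))) ≡ Cond.Es (q n)
    pfx n = seg-at (Cond.Es (q n)) 0 lim λ i i< → lim-at n i<

    chain-at : ∀ {P} fr j i → Chain P fr (seg lim j i) → ∀ n → n < i →
     Step P (frontFrom fr (seg lim j n) , lim (j + n))
    chain-at {P} fr j (suc i) (s , _) zero    _        =
     subst (λ q → Step P (fr , lim q)) (sym (+-identityʳ j)) s
    chain-at {P} fr j (suc i) (_ , c) (suc n) (s≤s n<) =
     subst (λ q → Step P (frontFrom (kidsL (lim j)) (seg lim (suc j) n) , lim q)) (sym (+-suc j n))
      (chain-at (kidsL (lim j)) (suc j) i c n n<)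

    strong : Strong fr₀ lim
    strong j = subst (λ fr → ∃[ m ] Above m fr (lim j)) (frontFrom-seg fr₀ lim 0 j)
     (fst (chain-at fr₀ 0 (length (Cond.Es (q (suc j))))
      (subst (Chain Trivial fr₀) (sym (pfx (suc j))) (Cond.chain (q (suc j)))) j (≥n (suc j))))

    drop-++ : ∀ {A : Set} (xs : List A) {ys zs} → xs ++ ys ≡ xs ++ zs → ys ≡ zs
    drop-++ []       e = e
    drop-++ (x ∷ xs) e = drop-++ xs (cong (λ { [] → [] ; (_ ∷ l) → l }) e)

    -- The levels added after `q n` were picked inside the reservoir of `q n`, as composing the
    -- extensions shows, and each level has been added by some stage.
    branch : ∀ n → Branch (q n) lim
    branch n = record { pfx = pfx n ; strong = strong ; later = later }
     where
     l = length (Cond.Es (q n))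
     later : ∀ j → l ≤ j → ∃[ m ] ∀ {z} → z ∈ concat (lim j) → Cond.In (q n) m z
     later j l≤ = subst (λ i → ∃[ m ] ∀ {z} → z ∈ concat (lim i) → Cond.In (q n) m z) (m+[n∸m]≡n l≤)
      (snd (chain-at (Cond.fr (q n)) l (length E) (subst (Chain (Cond.In (q n)) (Cond.fr (q n))) (sym segE) inside)
       (j ∸ l) (+-cancelˡ-< l _ _ (subst₂ _<_ (sym (m+[n∸m]≡n l≤)) lenE
        (≤-trans (≥n (suc j)) len≤)))))
      where
      open _⊴_ (below-⊴ n (suc j))
      lenE : length (Cond.Es (q (suc j + n))) ≡ l + length E
      lenE = trans (cong length Es≡) (length-++ (Cond.Es (q n)))
      len≤ : length (Cond.Es (q (suc j))) ≤ length (Cond.Es (q (suc j + n)))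
      len≤ = subst (λ i → length (Cond.Es (q (suc j))) ≤ length (Cond.Es (q i))) (+-comm n (suc j))
       (≤-trans (m≤m+n _ _) (≤-reflexive (sym (trans (cong length (_⊴_.Es≡ (below-⊴ (suc j) n))) (length-++ (Cond.Es (q (suc j))))))))
      segE : seg lim l (length E) ≡ E
      segE = drop-++ (Cond.Es (q n)) (trans (cong (_++ seg lim l (length E)) (sym (pfx n)))
       (trans (seg-++ lim 0 l (length E)) (trans (cong (seg lim 0) (sym lenE)) (trans (pfx (suc j + n)) Es≡))))

 -- Strong cone avoidance for the Halpern-Läuchli theorem

 module OneDimensional where
  open ListLemmas
  open HalpernLauchli
  open HalpernLauchliProof using (levelHL)
  open Programs
  open TypedPrograms
  open Computability
  open Simulation
  open BasisTheorem
  open Forests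
  open ForcingConditions
  open import Data.List.Relation.Binary.Pointwise.Base using (Pointwise; []; _∷_)
  open import Data.List.Relation.Unary.All using ([]; _∷_)
  open import Data.Maybe.Base using (Maybe; just; nothing)
  import Data.Vec.Base as Vec

  collect : ∀ {A B : Set} {P : A → B → Set} (xs : List A) → (∀ {a} → a ∈ xs → ∃[ b ] P a b) →
   ∃[ bs ] (∀ {a} → a ∈ xs → ∃[ b ] b ∈ bs × P a b) × (∀ {b} → b ∈ bs → ∃[ a ] a ∈ xs × P a b)
  collect []       h = [] , (λ ()) , (λ ())
  collect (x ∷ xs) h =
   let b , p = h (here refl) ; bs , f , g = collect xs (h ∘ there)
   in b ∷ bs ,
    (λ { (here refl) → b , here refl , p ; (there a∈) → let b , b∈ , p = f a∈ in b , there b∈ , p }) ,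
    (λ { (here refl) → _ , here refl , p ; (there b∈) → let a , a∈ , p = g b∈ in a , there a∈ , p })

  bits-pre : ∀ Z m → Bits (pre Z m)
  bits-pre Z zero = []
  bits-pre Z (suc m) = bit-≤ (Z m) ∷ bits-pre Z m

  encC : ∀ {X s} t {f} → Cmp X s t f → Cmp X s nat (λ a → enc t (f a))
  encC t (cmp c v e) = cmp c v e

  bit⁻ : ∀ {b} → 1 ≡ bit b → b ≡ true
  bit⁻ {true}  _ = refl

  -- The truth value that ρ records for the statement "n has colour i".
  colour-bit : List ℕ → ℕ → ℕ → ℕ
  colour-bit ρ i n = at ρ (pair i n)

  colour-bit-yes : ∀ {P : ℕ → Set} M {i n} → colour-bit (pre (oracle P) M) i n ≡ 2 → P (pair i n)
  colour-bit-yes {P} M {i} {n} e = snd (oracle-iff P (pair i n)) (bit⁻ (agree-pre (oracle P) M (pair i n) 1 e))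

  colour-bit-known : ∀ Z M {i n} → pair i n < M → Z (pair i n) ≡ true → colour-bit (pre Z M) i n ≡ 2
  colour-bit-known Z M p< e = trans (at-pre Z M p<) (cong (suc ∘ bit) e)

  -- A set is read as the relation between `n` and its admissible colours. Leaving `n` without any
  -- colour shows in a finite string, so the total relations form a Π⁰₁ class. Several colours for
  -- one `n` are allowed, and `Z-colouring` selects one.
  Uncoloured : ℕ → List ℕ → Set
  Uncoloured k ρ = ∃[ n ] ∀ {i} → i ∈ below k → colour-bit ρ i n ≡ 1

  abstract
   colour-bitC : ∀ {X s f g h} → Cmp X s (list nat) f → Cmp X s nat g → Cmp X s nat h →
    Cmp X s nat (λ a → colour-bit (f a) (g a) (h a))
   colour-bitC cf cg ch = atC cf (opC₂ v-pair cg ch)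

   re-uncoloured : ∀ {X s f} k → Cmp X s (list nat) f → RE X s (λ a → Uncoloured k (f a))
   re-uncoloured k cf = re-∃ nat (re-dec (d-all {t = nat}
    (d-≡ nat (colour-bitC (cf ∘C fstC (fstC idC)) (sndC idC) (sndC (fstC idC))) (constC nat 1))
    (constC (list nat) (below k))))

  uncoloured-pre : ∀ {P : ℕ → Set} {k} M → (∀ n → ∃[ i ] i < k × P (pair i n)) → ¬ Uncoloured k (pre (oracle P) M)
  uncoloured-pre {P} {k} M tot (n , h) =
   let i , i< , p = tot n
       e = agree-pre (oracle P) M (pair i n) 0 (h (∈-below⁺ i<))
   in 0≢1 (trans e (fst (bit-oracle P (pair i n)) p))
   where
   0≢1 : ¬ 0 ≡ 1
   0≢1 ()

  coloured-Z : ∀ {k} Z → (∀ M → ¬ Uncoloured k (pre Z M)) → ∀ n → ∃[ i ] i < k × Z (pair i n) ≡ true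
  coloured-Z {k} Z h n = by-contra em λ none →
   let M , b = bounded-∀ {P = λ i M → pair i n < M} (λ m≤n p → ≤-trans p m≤n) (below k) (λ _ → _ , ≤-refl)
   in h M (n , λ {i} i∈ → trans (at-pre Z M (b i∈)) (cong suc (zero-bit (Z (pair i n)) λ e → none (i , ∈-below⁻ i∈ , e))))
   where
   zero-bit : ∀ b → ¬ b ≡ true → bit b ≡ 0
   zero-bit true  h = ⊥-elim (h refl)
   zero-bit false h = refl

  Z-colouring : ∀ {X k} Z → (∀ n → ∃[ i ] i < k × Z (pair i n) ≡ true) →
   Σ (ℕ → ℕ) λ f → Cmp (join X Z) nat nat f × (∀ n → f n < k × Z (pair (f n) n) ≡ true)
  Z-colouring {X} {k} Z tot = search {join X Z} {nat} {nat} {λ p → snd p < k × Z (pair (snd p) (fst p)) ≡ true}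
   (d-and (d-≤ (sucC (sndC idC)) (constC nat k)) (d-up (⊑-joinʳ X Z) (d-sub d-oracle (opC₂ v-pair (sndC idC) (fstC idC)))))
   tot

  module StrongAvoidance {X₀ : Orc} (F : Forest X₀) (C : Pred ℕ 0ℓ) (C≰ : ¬ C ≤T ⌞ X₀ ⌟)
   (c : List ℕ → ℕ) (k : ℕ) (c< : ∀ xs → c xs < k) where

   open Forest F
   open Forcing F C

   base : List ℕ → Lev
   base = map (_∷ [])

   Coloured : ℕ → List Lev → Set
   Coloured i Es = ∀ {L xs} → L ∈ Es → xs ∈ prod L → c xs ≡ i

   -- `nothing` asks for a further level, and `just e` for the failure of `e` to compute `C`.
   Req : Set
   Req = Maybe (Rec 1)

   Met : ∀ {fr₀} → Req → Cond fr₀ → Cond fr₀ → Set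
   Met nothing  r q = length (Cond.Es q) < length (Cond.Es r)
   Met (just e) r q = ∀ {L} → Branch r L → ¬ Computes e L

   Meets : ∀ {fr₀} → ℕ → Req → Cond fr₀ → Set
   Meets {fr₀} i ρ q = Σ (Cond fr₀) λ r → r ⊴ q × Coloured i (Cond.Es r) × Met ρ r q

   Conclusion : Set
   Conclusion = ∃[ i ] ∃[ l ] ∃[ β ] Pointwise (Desc T l) rs β × Σ (ℕ → Lev) λ L → Strong (base β) L ×
    (∀ j {xs} → xs ∈ prod (L j) → c xs ≡ i) × ¬ C ≤T ⌞ join X₀ (oracle (Union L)) ⌟

   -- Below `q₀` all requirements can be met within colour `i`, so a generic sequence gives the
   -- conclusion. If no such pair exists, failing conditions are dense for every colour, and they
   -- are played against one another.
   record Dense : Set where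
    field
     i : ℕ
     l : ℕ
     β : List ℕ
     β↓ : Pointwise (Desc T l) rs β
     q₀ : Cond (base β)
     col : Coloured i (Cond.Es q₀)
     all : ∀ q → q ⊴ q₀ → Coloured i (Cond.Es q) → ∀ ρ → Meets i ρ q

   module FromDense (D : Dense) where
    open Dense D

    Good′ : Set
    Good′ = Σ (Cond (base β)) λ q → q ⊴ q₀ × Coloured i (Cond.Es q)

    abstract
     next : (p : Good′) (n : ℕ) → Σ Good′ λ p′ → fst p′ ⊴ fst p ×
      length (Cond.Es (fst p)) < length (Cond.Es (fst p′)) × (∀ {L} → Branch (fst p′) L → ¬ Computes (index n) L)
     next (q , q≤ , cq) n =
      let r₁ , r₁≤ , c₁ , longer = all q q≤ cq nothing
          r₂ , r₂≤ , c₂ , forced = all r₁ (⊴-trans r₁≤ q≤) c₁ (just (index n))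
      in (r₂ , ⊴-trans r₂≤ (⊴-trans r₁≤ q≤) , c₂) , ⊴-trans r₂≤ r₁≤ ,
       ≤-trans longer (≤-trans (m≤m+n _ _) (≤-reflexive (sym (trans (cong length (_⊴_.Es≡ r₂≤)) (length-++ (Cond.Es r₁)))))) ,
       λ {L} → forced {L}

    seq : ℕ → Good′
    seq zero = q₀ , ⊴-refl , col
    seq (suc n) = fst (next (seq n) n)

    open Limit (λ n → fst (seq n)) (λ n → fst (snd (next (seq n) n))) (λ n → fst (snd (snd (next (seq n) n))))

    conclusion : Conclusion
    conclusion = i , l , β , β↓ , lim , strong ,
     (λ j xs∈ → snd (snd (seq (suc j)))
      (subst (lim j ∈_) (pfx (suc j)) (∈-seg⁺ lim 0 (length (Cond.Es (fst (seq (suc j))))) j (≥n (suc j)))) xs∈) ,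
     λ C≤ → let n , e = index-onto (fst C≤) in
      snd (snd (snd (next (seq n) n))) (branch (suc n))
       (subst (λ e → Computes e lim) (sym e) (≤T⇒runs C≤))

   -- Suppose that every condition of every colour has an extension below which some
   -- requirement cannot be met.
   record Core : Set where
    field
     σ : List ℕ
     i : ℕ
     i< : i < k
     β : List ℕ
     m : ℕ
     σβ : Pointwise (Desc T m) σ β
     l : ℕ
     β↓ : Pointwise (Desc T l) rs β
     q : Cond (base β)
     col : Coloured i (Cond.Es q)
     ρ : Req
     fail : ¬ Meets i ρ q

   -- The level and the reservoir are handed from one failing condition to the next, so that in the
   -- end one reservoir is contained in those of all of them.
   record St : Set where
    field
     N : ℕ
     R : Res

   _≤ₛ_ : St → St → Set
   s′ ≤ₛ s = St.N s ≤ St.N s′ × Factors (Res.s (St.R s′)) (Res.s (St.R s)) × Res.X (St.R s) ⊑ Res.X (St.R s′)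

   ≤ₛ-refl : ∀ {s} → s ≤ₛ s
   ≤ₛ-refl {s} = ≤-refl , factors-refl {Res.s (St.R s)} , ⊑-refl

   ≤ₛ-trans : ∀ {s t u} → s ≤ₛ t → t ≤ₛ u → s ≤ₛ u
   ≤ₛ-trans {s} {t} {u} (a , f , x) (b , g , y) =
    ≤-trans b a , factors-trans {Res.s (St.R u)} {Res.s (St.R t)} {Res.s (St.R s)} f g , ⊑-trans y x

   Valid : St → Core → Set
   Valid s d = Cond.N (Core.q d) ≤ St.N s × Factors (Res.s (St.R s)) (Cond.s (Core.q d)) × Cond.X (Core.q d) ⊑ Res.X (St.R s)

   valid-≤ : ∀ {s t d} → s ≤ₛ t → Valid t d → Valid s d
   valid-≤ {s} {t} {d} (a , f , x) (b , g , y) =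
    ≤-trans b a , factors-trans {Cond.s (Core.q d)} {Res.s (St.R t)} {Res.s (St.R s)} f g , ⊑-trans y x

   module Contradiction (hyp : ∀ {i l β} → i < k → Pointwise (Desc T l) rs β → (q : Cond (base β)) → Coloured i (Cond.Es q) →
    Σ (Cond (base β)) λ q′ → q′ ⊴ q × Coloured i (Cond.Es q′) × ∃[ ρ ] ¬ Meets i ρ q′) where

    base-∈ : ∀ {β b : List ℕ} {x} → x ∈ concat (base β) → x ∈ β
    base-∈ {y ∷ β} {b} (here refl) = here refl
    base-∈ {y ∷ β} {b} (there x∈) = there (base-∈ {β} {b} x∈)

    -- The tuple is raised to the current level and made the base of a condition over the current
    -- reservoir; `hyp` then provides an extension of colour `i` with a requirement that it cannot
    -- meet.
    handle : ∀ {n σ i} → i < k → Pointwise (Desc T n) rs σ → ∀ s → n ≤ St.N s →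
     ∃[ s′ ] s′ ≤ₛ s × ∃[ d ] Core.σ d ≡ σ × Core.i d ≡ i × Valid s′ d
    handle {n} {σ} {i} i< σ↓ s n≤ =
     let β = map (lmost (St.N s ∸ n)) σ
         σβ = pw-graph (lmost-sec (St.N s ∸ n)) σ
         β↓ = subst (λ l → Pointwise (Desc T l) rs β) (m+[n∸m]≡n n≤) (pw-trans desc-trans σ↓ σβ)
         q₀ : Cond (base β)
         q₀ = record { Es = [] ; chain = tt ; R = St.R s ; B = base β ; h = 0 ; B↓ = pw-refl (pw-refl stop) ; N = St.N s
          ; N↓ = λ b∈ → let r , r∈ , d = pw-∈ʳ β↓ (base-∈ {β} {[]} b∈) in r , r∈ , d }
         q , q≤ , col , ρ , fail = hyp i< β↓ q₀ (λ ())
         s′ : St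
         s′ = record { N = St.N s ⊔ Cond.N q ; R = Cond.R q }
     in s′ , (m≤m⊔n _ _ , _⊴_.fac q≤ , _⊴_.upX q≤) ,
      record { σ = σ ; i = i ; i< = i< ; β = β ; m = St.N s ∸ n ; σβ = σβ ; l = St.N s ; β↓ = β↓ ; q = q ; col = col ; ρ = ρ ; fail = fail } ,
      refl , refl , m≤n⊔m (St.N s) (Cond.N q) , factors-refl {Cond.s q} , ⊑-refl

    items : St → List (List ℕ × ℕ)
    items s = cartesianProduct (tuples T (St.N s) rs) (upTo k)

    Handles : List ℕ × ℕ → Core → Set
    Handles (σ , i) d = Core.σ d ≡ σ × Core.i d ≡ i

    record Next (s : St) : Set where
     field
      s′ : St
      s′≤ : s′ ≤ₛ s
      ds : List Core
      valid : ∀ {d} → d ∈ ds → Valid s′ d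
      onto : ∀ {a} → a ∈ items s → ∃[ d ] d ∈ ds × Handles a d

    abstract
     step′ : ∀ s → Next s
     step′ s =
      let s′ , s′≤ , h = meet-all {_≤′_ = λ t u → t ≤ₛ u} {P = λ a t → ∃[ d ] Handles a d × Valid t d}
           (λ {t} → ≤ₛ-refl {t}) (λ {t} {u} {v} → ≤ₛ-trans {t} {u} {v})
           (λ { {a} {t} {u} t≤ (d , ha , v) → d , ha , valid-≤ {t} {u} {d} t≤ v }) (items s) s
           (λ { {σ , i} a∈ t t≤ →
            let σ∈ , i∈ = ∈-cartesianProduct⁻ (tuples T (St.N s) rs) (upTo k) a∈
                t′ , t′≤ , d , e , e′ , v = handle (∈-upTo⁻ i∈) (∈-tuples⁻ {T} (St.N s) σ∈) t (fst t≤)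
            in t′ , t′≤ , d , (e , e′) , v })
          ds , f , g = collect {P = λ a d → Handles a d × Valid s′ d} (items s) h
      in record { s′ = s′ ; s′≤ = s′≤ ; ds = ds
       ; valid = λ d∈ → let _ , _ , _ , v = g d∈ in v
       ; onto = λ a∈ → let d , d∈ , ha , _ = f a∈ in d , d∈ , ha }

     idRes : Res
     idRes = record { X = X₀ ; up = ⊑-refl ; avoid = C≰ ; a = λ _ → 0 ; s = λ _ x → x ; sC = sndC idC ; sec = λ _ _ → stop }

    st : ℕ → St
    st zero = record { N = 0 ; R = idRes }
    st (suc l) = Next.s′ (step′ (st l))

    cores : ℕ → List Core
    cores zero = []
    cores (suc l) = cores l ++ Next.ds (step′ (st l))

    valid-cores : ∀ l {d} → d ∈ cores l → Valid (st l) d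
    valid-cores (suc l) {d} d∈ with ∈-++⁻ (cores l) d∈
    ... | inj₁ p = valid-≤ {st (suc l)} {st l} {d} (Next.s′≤ (step′ (st l))) (valid-cores l p)
    ... | inj₂ p = Next.valid (step′ (st l)) p

    cores-grow : ∀ l j {d} → d ∈ cores l → d ∈ cores (l + j)
    cores-grow l zero    {d} d∈ = subst (λ i → d ∈ cores i) (sym (+-identityʳ l)) d∈
    cores-grow l (suc j) {d} d∈ = subst (λ i → d ∈ cores i) (sym (+-suc l j)) (∈-++⁺ˡ (cores-grow l j d∈))

    N : ℕ → ℕ
    N l = St.N (st l)

    N≤ : ∀ l → N l ≤ N (suc l)
    N≤ l = fst (Next.s′≤ (step′ (st l)))

    -- When `v` records the colours that a homogenization has made constant, such a section leads to
    -- cones above those of `d` on which this colour is the colour of `d`.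
    Wins : ℕ → (List ℕ → ℕ) → Core → Set
    Wins Λ v d = Σ (ℕ → ℕ) λ t → Sec T (N Λ ∸ Cond.N (Core.q d)) t × (∀ {bs} → bs ∈ prod (Cond.B (Core.q d)) → v (map t bs) ≡ Core.i d)

    p′ : ℕ → ℕ
    p′ l = N (suc l) ∸ N l

    open Tagged T p′ (λ l → descs T (p′ l)) (λ l x → lm T (p′ l) x , ∈-descs⁺ (lm-desc T (p′ l) x)) (λ {l} → ∈-descs⁻ (p′ l))

    N-gap : ∀ l n → N l + gap l n ≡ N (l + n)
    N-gap l zero = trans (+-identityʳ _) (cong N (sym (+-identityʳ l)))
    N-gap l (suc n) = trans (sym (+-assoc (N l) (p′ l) _)) (trans (cong (_+ gap (suc l) n) (m+[n∸m]≡n (N≤ l)))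
     (trans (N-gap (suc l) n) (cong N (sym (+-suc l n)))))

    core-over : ∀ d → Over (Core.β d) (Cond.B (Core.q d))
    core-over d = over-above (over-front (base β) Es (over-base β) chain) B↓
     where
     open Core d
     open Cond q

    -- Compactness: at some level every colouring of the tuples is won by some failing condition.
    some-level : ∃[ Λ ] ∀ v → (∀ bs → v bs < k) → ∃[ d ] d ∈ cores Λ × Wins Λ v d
    some-level = by-contra em λ none →
     let bad : ∀ Λ → ∃[ v ] (∀ bs → v bs < k) × (∀ {d} → d ∈ cores Λ → ¬ Wins Λ v d)
         bad Λ = by-contra em λ good → none (Λ , λ v v< → by-contra em λ lose →
          good (v , v< , λ {d} d∈ w → lose (d , d∈ , w)))
     in contra (λ Λ → fst (bad Λ)) (λ Λ → fst (snd (bad Λ))) (λ Λ → snd (snd (bad Λ)))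
     where
     contra : (v : ℕ → List ℕ → ℕ) → (∀ Λ bs → v Λ bs < k) → (∀ Λ {d} → d ∈ cores Λ → ¬ Wins Λ (v Λ) d) → ⊥
     contra v v< lose =
      -- The theorem is applied to the losing colourings on the tree collapsed along `N`. Its
      -- one-step answer at level `l` concerns a pair that is handled by a core entered between `l`
      -- and `suc l`, and the cones of this core fit into that step.
      let l , σs , i , i< , σs↓ , homs = levelHL _ tag (map (0 ,_) rs) (roots-unique rs!) refl k
           (λ n ts → v n (map snd ts)) (λ n ts → v< n _)
          m , s , hom sec col = homs 1
          σ = map snd σs
          σ↓ : Pointwise (Desc T (N l)) rs σ
          σ↓ = subst (λ n → Pointwise (Desc T n) rs σ) (N-gap 0 l) (untags-any σs↓)
          d , d∈ , eσ , ei = Next.onto (step′ (st l)) (∈-cartesianProduct⁺ (∈-tuples⁺ σ↓) (∈-upTo⁺ i<))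
          d∈′ : d ∈ cores (l + suc m)
          d∈′ = subst (λ j → d ∈ cores j) (sym (+-suc l m)) (cores-grow (suc l) m (∈-++⁺ʳ (cores l) d∈))
      in lose (l + suc m) d∈′ (win d (fst (Next.valid (step′ (st l)) d∈)) eσ ei σs↓ σ↓ s sec col)
      where
      win : ∀ {l m σs i} d → Cond.N (Core.q d) ≤ N (suc l) → Core.σ d ≡ map snd σs → Core.i d ≡ i →
       Pointwise (Desc tag l) (map (0 ,_) rs) σs → Pointwise (Desc T (N l)) rs (map snd σs) → ∀ s → Sec tag m s →
       (∀ {ts} → Pointwise (Desc tag 1) σs ts → v (l + suc m) (map snd (map s ts)) ≡ i) → Wins (l + suc m) (v (l + suc m)) d
      win {l} {m} {σs} {i} d Nq≤ eσ ei σs↓ σ↓ s sec col = t , t-sec , colour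
       where
       open Core d using (q; β; σ; σβ) renaming (m to mβ; i to i′)
       open Cond q using (B; N↓) renaming (N to Nq)
       t : ℕ → ℕ
       t b = snd (s (suc l , lmost (N (suc l) ∸ Nq) b))
       t-sec : Sec T (N (l + suc m) ∸ Nq) t
       t-sec b = desc-cast (+-cancelˡ-≡ Nq _ _ (trans (sym (+-assoc Nq _ _))
        (trans (cong (_+ gap (suc l) m) (m+[n∸m]≡n Nq≤)) (trans (N-gap (suc l) m) (trans (cong N (sym (+-suc l m)))
         (sym (m+[n∸m]≡n (≤-trans Nq≤ (≤-trans (≤-trans (m≤m+n _ _) (≤-reflexive (N-gap (suc l) m))) (≤-reflexive (cong N (sym (+-suc l m))))))))))) ))
        (desc-trans (lmost-sec (N (suc l) ∸ Nq) b) (snd (untag (sec (suc l , lmost (N (suc l) ∸ Nq) b)))))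
       colour : ∀ {bs} → bs ∈ prod B → v (l + suc m) (map t bs) ≡ i′
       colour {bs} bs∈ = trans (cong (v (l + suc m)) (trans (map-∘ bs) (cong (map snd) (map-∘ bs))))
        (trans (col (subst (λ z → Pointwise (Desc tag 1) z (map (λ b → suc l , lmost (N (suc l) ∸ Nq) b) bs)) (sym (fst (untags σs↓)))
         (pairs (subst (λ z → Pointwise (Desc T mβ) z β) eσ σβ) σ↓ id (over-tuple (core-over d) bs∈) (λ x∈ → N↓ (∈-prod-concat {L = B} bs∈ x∈)))))
         (sym ei))
        where
        pairs : ∀ {rs′ σ β bs} → Pointwise (Desc T mβ) σ β → Pointwise (Desc T (N l)) rs′ σ → (∀ {r} → r ∈ rs′ → r ∈ rs) →
         Pointwise (λ β x → ∃[ m ] Desc T m β x) β bs → (∀ {x} → x ∈ bs → Depth Nq x) →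
         Pointwise (Desc tag 1) (map (l ,_) σ) (map (λ b → suc l , lmost (N (suc l) ∸ Nq) b) bs)
        pairs []       []       r∈ []             dep = []
        pairs {σ = x ∷ _} {bs = b ∷ _} (d₁ ∷ ds₁) (d₂ ∷ ds₂) r∈ ((m′ , d₃) ∷ ds₃) dep =
         tag-kid (∈-descs⁺ (desc-cast eq (desc-trans d₁ (desc-trans d₃ (lmost-sec (N (suc l) ∸ Nq) b))))) ∷
         pairs ds₁ ds₂ (r∈ ∘ there) ds₃ (dep ∘ there)
         where
         eq : mβ + (m′ + (N (suc l) ∸ Nq)) ≡ p′ l
         eq = +-cancelˡ-≡ (N l) _ _ (trans (trans (cong (N l +_) (sym (+-assoc mβ m′ _))) (sym (+-assoc (N l) (mβ + m′) _)))
          (trans (cong (_+ (N (suc l) ∸ Nq))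
           (depth-unique (_ , r∈ (here refl) , desc-trans d₂ (desc-trans d₁ d₃)) (dep (here refl))))
           (trans (m+[n∸m]≡n Nq≤) (sym (m+[n∸m]≡n (N≤ l))))))

    module Question (Λ : ℕ) (wins : ∀ v → (∀ bs → v bs < k) → ∃[ d ] d ∈ cores Λ × Wins Λ v d) where

     R : Res
     R = St.R (st Λ)

     open Res R

     -- A request for a further level counts as converging as soon as the chain is nonempty, so both
     -- kinds of requirement fit into one question.
     Converges : Req → List Lev → List Lev → ℕ → ℕ → Set
     Converges nothing  Es E x v = ¬ E ≡ []
     Converges (just e) Es E x v = Good e (nodes (Es ++ E)) x v

     ColouredAt : List ℕ → ℕ → List Lev → Set
     ColouredAt ρ i E = ∀ {L} → L ∈ E → ∀ {xs} → xs ∈ prod L → colour-bit ρ i (enc (list nat) xs) ≡ 2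

     Extends : Core → List Lev → Set
     Extends d E = Chain (Y (concat (Cond.B (Core.q d))) (Cond.N (Core.q d)) s) (Cond.fr (Core.q d)) E

     Hits : Core → (ℕ × ℕ) × List ℕ → Set
     Hits d ((x , v) , ρ) = ∃[ E ] Extends d E × ColouredAt ρ (Core.i d) E × Converges (Core.ρ d) (Cond.Es (Core.q d)) E x v

     -- The colours are read from a string in place of `c`, which makes the question enumerable from
     -- the oracle of the reservoir although `c` may not be computable.
     Bad : (ℕ × ℕ) × List ℕ → Set
     Bad a = (∃[ d ] d ∈ cores Λ × Hits d a) ⊎ Uncoloured k (snd a)

     re-converges : ∀ ρ Es → RE X (list lev ⊗ nat ⊗ nat) (λ p → Converges ρ Es (fst p) (fst (snd p)) (snd (snd p)))
     re-converges nothing  Es = re-dec (d-not (d-≡ (list lev) (fstC idC) nilC))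
     re-converges (just e) Es = re-good up e (nodesC up (appendC (constC (list lev) Es) (fstC idC))) (fstC (sndC idC)) (sndC (sndC idC))

     re-coloured : ∀ i → RE X (list nat ⊗ list lev) (λ p → ColouredAt (fst p) i (snd p))
     re-coloured i = re-dec (d-all {t = lev} {Q = λ q → ∀ {xs} → xs ∈ prod (snd q) → colour-bit (fst (fst q)) i (enc (list nat) xs) ≡ 2}
      (d-all {t = list nat} {Q = λ q → colour-bit (fst (fst (fst q))) i (enc (list nat) (snd q)) ≡ 2}
       (d-≡ nat (colour-bitC (fstC (fstC (fstC idC))) (constC nat i) (encC (list nat) (sndC idC))) (constC nat 2))
       (prodC (sndC idC)))
      (sndC idC))

     re-hits : ∀ d → RE X ((nat ⊗ nat) ⊗ list nat) (Hits d)
     re-hits d = re-∃ (list lev) (re-and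
      (re-chain up {f = λ _ → Cond.fr (Core.q d)} {g = snd} (Y-RE R (concat (Cond.B (Core.q d))) (Cond.N (Core.q d)))
       (constC lev (Cond.fr (Core.q d))) (sndC idC))
      (re-and (re-sub {P = λ p → ColouredAt (fst p) (Core.i d) (snd p)} (re-coloured (Core.i d)) (pairC (sndC (fstC idC)) (sndC idC)))
       (re-sub {P = λ p → Converges (Core.ρ d) (Cond.Es (Core.q d)) (fst p) (fst (snd p)) (snd (snd p))}
        (re-converges (Core.ρ d) (Cond.Es (Core.q d))) (pairC (sndC idC) (fstC (fstC idC))))))

     abstract
      re-bad : RE X ((nat ⊗ nat) ⊗ list nat) Bad
      re-bad = re-or (re-union (cores Λ) {P = Hits} (λ {d} _ → re-hits d)) (re-uncoloured k (sndC idC))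

     mono : ∀ {xv b ρ} → Bad (xv , ρ) → Bad (xv , b ∷ ρ)
     mono {b = b} {ρ} (inj₁ (d , d∈ , E , ex , col , cv)) =
      inj₁ (d , d∈ , E , ex , (λ L∈ xs∈ → at-cons b ρ _ (col L∈ xs∈)) , cv)
     mono {b = b} {ρ} (inj₂ (n , h)) = inj₂ (n , λ i∈ → at-cons b ρ _ (h i∈))

     base-depth : ∀ d {x} → x ∈ concat (base (Core.β d)) → Depth (Core.l d) x
     base-depth d x∈ = let r , r∈ , e = pw-∈ʳ (Core.β↓ d) (base-∈ {Core.β d} {[]} x∈) in r , r∈ , e

     -- The colouring c itself is one of the sets over which the question quantifies.
     c-set : ℕ → Set
     c-set n = c (dec (list nat) (π₂ n)) ≡ π₁ n

     c-total : ∀ n → ∃[ i ] i < k × c-set (pair i n)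
     c-total n = c (dec (list nat) n) , c< _ ,
      trans (cong (λ z → c (dec (list nat) z)) (π₂-pair (c (dec (list nat) n)) n)) (sym (π₁-pair (c (dec (list nat) n)) n))

     -- If all colourings admit an extension with a wrong value, then so does `c`, and that
     -- extension meets a requirement which was assumed to fail.
     positive : ∀ {x v M} → ¬ v ≡ χ C x → Bad ((x , v) , pre (oracle c-set) M) → ⊥
     positive {M = M} v≢ (inj₂ u) = uncoloured-pre {c-set} {k} M c-total u
     positive {x} {v} {M} v≢ (inj₁ (d , d∈ , E , ex , col , cv)) = fail (meets ρ cv)
      where
      open Core d using (q; β; i; l; ρ; fail)
      VC = valid-cores Λ d∈
      ex′ : Chain (Cond.In q) (Cond.fr q) E
      ex′ = chain-imp (Y-sub {concat (Cond.B q)} {Cond.N q} {Cond.s q} {concat (Cond.B q)} {Cond.N q} {s} (Cond.N↓ q) (Cond.N↓ q)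
       (λ {b} b∈ → b , b∈ , 0 , stop) (fst (snd VC))) (Cond.fr q) E ex
      open Extend {base β} {l} (base-depth d) q R (fst (snd VC)) (snd (snd VC)) E ex′
      c-colour : Coloured i E
      c-colour {L} {xs} L∈ xs∈ =
       trans (cong c (sym (trans (cong (dec (list nat)) (π₂-pair i (enc (list nat) xs))) (dec-enc (list nat) xs))))
        (trans (colour-bit-yes {c-set} M {i} {enc (list nat) xs} (col L∈ xs∈)) (π₁-pair i (enc (list nat) xs)))
      both : Coloured i (Cond.Es q ++ E)
      both L∈ xs∈ with ∈-++⁻ (Cond.Es q) L∈
      ... | inj₁ p = Core.col d p xs∈
      ... | inj₂ p = c-colour p xs∈
      meets : ∀ ρ → Converges ρ (Cond.Es q) E x v → Meets i ρ q
      meets nothing E≢ =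
       let r , r≤ , e , _ = extend-by 0 in
       r , r≤ , subst (Coloured i) (sym e) both ,
       subst (λ z → length (Cond.Es q) < length z) (sym e) (subst (length (Cond.Es q) <_) (sym (length-++ (Cond.Es q))) (grows E E≢))
       where
       grows : ∀ E → ¬ E ≡ [] → length (Cond.Es q) < length (Cond.Es q) + length E
       grows []      h = ⊥-elim (h refl)
       grows (_ ∷ E) _ = m<m+n (length (Cond.Es q)) (s≤s z≤n)
      meets (just e′) (M′ , conv) =
       let r , r≤ , e , M≤ = extend-by M′ in
       r , r≤ , subst (Coloured i) (sym e) both ,
       λ {L} br → refute r {e′} {x} {v} {M′} M≤
        (subst (λ z → Sim.ev X₀ e′ (enc (list nat) (pre (oracle (_∈ nodes z)) M′)) M′ (Vec.[ x ]) ≡ suc v) (sym e) conv) v≢ br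

     -- For the colouring given by `Z` no extension yields the right value at `x`. After
     -- homogenizing the reservoir for it some core `d` wins, and above suitable cones all
     -- extensions have the colour of `d`. None of them converges to the right value, and so the
     -- requirement of `d` is met after all.
     module Negative (x : ℕ) (Z : Orc) (avoidZ : ¬ C ≤T ⌞ join X Z ⌟) (never : ∀ m → ¬ Bad ((x , χ C x) , pre Z m)) where

      totZ : ∀ n → ∃[ i ] i < k × Z (pair i n) ≡ true
      totZ = coloured-Z Z (λ M u → never M (inj₂ u))

      f : ℕ → ℕ
      f = fst (Z-colouring {X} Z totZ)

      f-spec : ∀ n → f n < k × Z (pair (f n) n) ≡ true
      f-spec = snd (snd (Z-colouring {X} Z totZ))

      RZ : Res
      RZ = record { X = join X Z ; up = ⊑-trans up (⊑-joinˡ X Z) ; avoid = avoidZ ; a = a ; s = s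
       ; sC = c-up (⊑-joinˡ X Z) sC ; sec = sec }

      φ : List ℕ → ℕ
      φ xs = f (enc (list nat) xs)

      colouring : ∀ {bs} → bs ∈ tuples T (N Λ) rs → Colouring (join X Z)
      colouring {bs} bs∈ = record
       { cones = bs ; distinct = descs-unique (∈-tuples⁻ {T} (N Λ) bs∈) rs! ; k = k ; φ = φ
       ; φC = fst (snd (Z-colouring {X} Z totZ)) ∘C encC (list nat) idC ; φ< = λ us → fst (f-spec _) }

      cols : ∃[ ts ] (∀ {bs} → bs ∈ tuples T (N Λ) rs → ∃[ t ] t ∈ ts × Colouring.cones t ≡ bs × Colouring.φ t ≡ φ) ×
       (∀ {t} → t ∈ ts → ∃[ bs ] bs ∈ tuples T (N Λ) rs × Colouring.cones t ≡ bs × Colouring.φ t ≡ φ)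
      cols = collect (tuples T (N Λ) rs) λ bs∈ → colouring bs∈ , refl , refl

      open Homogeneous (homogeneous RZ (N Λ) (fst cols)) renaming (s′ to sH)

      K : ℕ
      K = N Λ + p

      v : List ℕ → ℕ
      v bs = φ (map (sH K) (map pos bs))

      constant : ∀ {bs} → Pointwise (Desc T (N Λ)) rs bs → ∀ n {us} → Pointwise (Desc T n) (map pos bs) us →
       φ (map (sH (K + n)) us) ≡ v bs
      constant {bs} bs↓ n {us} ds =
       let t , t∈ , ec , eφ = fst (snd cols) (∈-tuples⁺ bs↓)
           at-n : ∀ n {us} → Pointwise (Desc T n) (map pos bs) us → φ (map (sH (K + n)) us) ≡ value t
           at-n n {us} ds = subst (λ g → g (map (sH (K + n)) us) ≡ value t) eφ
            (same t∈ n (subst (λ z → Pointwise (Desc T n) (map pos z) us) (sym ec) ds))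
       in trans (at-n n ds) (sym (trans (cong (λ q → φ (map (sH q) (map pos bs))) (sym (+-identityʳ K))) (at-n 0 (pw-refl stop))))

      res : Res
      res = record { X = join X Z ; up = ⊑-trans up (⊑-joinˡ X Z) ; avoid = avoidZ ; a = a′ ; s = sH ; sC = s′C ; sec = sec′ }

      module Win (d : Core) (d∈ : d ∈ cores Λ) (w : Wins Λ v d) where
       open Core d using (q; β; i; l; ρ; fail) renaming (β↓ to base↓)
       open Cond q using (Es; B; B↓; fr; chain) renaming (N to Nq; N↓ to Nq↓; s to sq; h to hq; In to Inq)
       t : ℕ → ℕ
       t = fst w
       VC = valid-cores Λ d∈
       fac : Factors sH sq
       fac = factors-trans {sq} {s} {sH} factor (fst (snd VC))
       upX : Cond.X q ⊑ join X Z
       upX = ⊑-trans (snd (snd VC)) (⊑-joinˡ X Z)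
       g : ℕ → ℕ
       g b = pos (t b)
       B′ : Lev
       B′ = map (map g) B
       lifted : Above ((N Λ ∸ Nq) + p) B B′
       lifted = above-graph (λ b → desc-trans (fst (snd w) b) (pos↓ (t b))) B

       below-B′ : ∀ {b} → b ∈ concat B′ → ∃[ b′ ] b′ ∈ concat B × ∃[ j ] Desc T j b′ b
       below-B′ b∈ = let b , b∈′ , e = pw-∈ʳ (pw-concat lifted) b∈ in b , b∈′ , _ , e

       abstract
        new : Σ (Cond (base β)) λ r → r ⊴ q × Cond.Es r ≡ Es ++ [] × Cond.R r ≡ res × Cond.B r ≡ B′
        new = let r , r≤ , e₁ , e₂ , e₃ , _ = Extend.extend-at {base β} {l} (base-depth d) q res fac upX [] tt (above-trans B↓ lifted) below-B′
         in r , r≤ , e₁ , e₂ , e₃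

       r : Cond (base β)
       r = fst new
       r≤ : r ⊴ q
       r≤ = fst (snd new)
       Es-r : Cond.Es r ≡ Es
       Es-r = trans (fst (snd (snd new))) (++-identityʳ Es)

       picked : ∀ {n z} → Cond.In r n z → Y (concat B′) K sH n z
       picked {n} {z} (b , b∈ , j , y , e , dy , ez) = b , b∈B′ , j , y ,
        trans (cong (_+ j) (depth-unique depth-K (Cond.N↓ r b∈))) e , dy ,
        trans ez (cong (λ ρ → Res.s ρ n y) (fst (snd (snd (snd new)))))
        where
        b∈B′ : b ∈ concat B′
        b∈B′ = subst (λ L → b ∈ concat L) (snd (snd (snd (snd new)))) b∈
        depth-K : Depth K b
        depth-K = let b₀ , b₀∈ , e₀ = pw-∈ʳ (pw-concat lifted) b∈B′ ; ρ , ρ∈ , e₁ = Nq↓ b₀∈ in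
         ρ , ρ∈ , desc-cast (trans (sym (+-assoc Nq _ p)) (cong (_+ p) (m+[n∸m]≡n (fst VC)))) (desc-trans e₁ e₀)

       -- All coordinates come from one level of the homogenized reservoir, above a tuple of cones
       -- that `locate` assigns coordinate by coordinate; the winning section determines the colour
       -- there.
       tuple-colour : ∀ {n L xs} → Over β L → (∀ {z} → z ∈ concat L → Cond.In r n z) → xs ∈ prod L → φ xs ≡ i
       tuple-colour {n} {L} {xs} ov inr xs∈ =
        finish (choose-bs (locate {Q = Q} (descs-unique base↓ rs!) (λ β∈ → let ρ , ρ∈ , e = pw-∈ʳ base↓ β∈ in ρ , ρ∈ , e)
         (core-over d) Q⇒ (with-in (over-tuple ov xs∈) (λ x∈ → inr (∈-prod-concat {L = L} xs∈ x∈)))))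
        where
        Q : ℕ → ℕ → Set
        Q b x = ∃[ j ] ∃[ y ] K + j ≡ n × Desc T j (g b) y × x ≡ sH n y
        Q⇒ : ∀ {b x} → Q b x → ∃[ m ] Desc T m b x
        Q⇒ {b} (j , y , e , dy , refl) = _ , desc-trans (fst (snd w) b) (desc-trans (pos↓ (t b)) (desc-trans dy (sec′ n y)))
        from-Y : ∀ {z} → Y (concat B′) K sH n z → ∃[ b ] b ∈ concat B × Q b z
        from-Y (b′ , b′∈ , j , y , e , dy , ez) =
         let bs′ , b′∈bs , bs∈ = ∈-concat⁻′ B′ b′∈
             bs , bs∈B , e₁ = ∈-map⁻ (map g) bs∈
             b , b∈bs , e₂ = ∈-map⁻ g (subst (b′ ∈_) e₁ b′∈bs)
         in b , ∈-concat b∈bs bs∈B , j , y , e , subst (λ q → Desc T j q y) e₂ dy , ez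
        with-in : ∀ {βs xs} → Pointwise (λ β x → ∃[ m ] Desc T m β x) βs xs → (∀ {x} → x ∈ xs → Cond.In r n x) →
         Pointwise (λ β x → (∃[ m ] Desc T m β x) × ∃[ b ] b ∈ concat B × Q b x) βs xs
        with-in []       h = []
        with-in (d ∷ ds) h = (d , from-Y (picked (h (here refl)))) ∷ with-in ds (h ∘ there)
        Tuple : List ℕ → Lev → Set
        Tuple xs B = ∃[ bs ] Pointwise (λ l b → b ∈ l) B bs × Pointwise Q bs xs
        choose-bs : ∀ {B xs} → Pointwise (λ l x → ∃[ b ] b ∈ l × Q b x) B xs → Tuple xs B
        choose-bs [] = [] , [] , []
        choose-bs ((b , b∈ , q) ∷ ps) = let bs , m , qs = choose-bs ps in b ∷ bs , b∈ ∷ m , q ∷ qs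
        level-j : ∀ {bs xs} → Pointwise Q bs xs → ∃[ j ] ∃[ ys ]
         Pointwise (Desc T j) (map pos (map t bs)) ys × (xs ≡ map (sH (K + j)) ys)
        level-j [] = 0 , [] , [] , refl
        level-j ((j , y , refl , dy , refl) ∷ qs) = let ys , ds , e = rest qs in j , y ∷ ys , dy ∷ ds , cong (_ ∷_) e
         where
         rest : ∀ {bs xs} → Pointwise Q bs xs → ∃[ ys ] Pointwise (Desc T j) (map pos (map t bs)) ys × (xs ≡ map (sH (K + j)) ys)
         rest [] = [] , [] , refl
         rest ((j′ , y′ , e , dy′ , e′) ∷ qs) = let ys , ds , es = rest qs in
          y′ ∷ ys , subst (λ q → Desc T q _ y′) (+-cancelˡ-≡ K _ _ e) dy′ ∷ ds , cong₂ _∷_ e′ es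
        finish : Tuple xs B → φ xs ≡ i
        finish (bs , bs∈ , qs) =
         let j , ys , ds , e = level-j qs
             bs∈′ = ∈-prod⁺ bs∈
             below = roots-below base↓ (over-tuple (core-over d) bs∈′) (λ b∈ → Nq↓ (∈-prod-concat {L = B} bs∈′ b∈)) id
         in trans (cong φ e) (trans (constant below j ds) (snd (snd w) bs∈′))
         where
         roots-below : ∀ {rs′ βs bs} → Pointwise (Desc T l) rs′ βs → Pointwise (λ β x → ∃[ m ] Desc T m β x) βs bs →
          (∀ {b} → b ∈ bs → Depth Nq b) → (∀ {r} → r ∈ rs′ → r ∈ rs) → Pointwise (Desc T (N Λ)) rs′ (map t bs)
         roots-below []       []              dep r∈ = []
         roots-below (_∷_ {x = r₀} d ds) (_∷_ {y = b} (m , e) es) dep r∈ =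
          desc-cast (trans (cong (_+ (N Λ ∸ Nq)) (depth-unique (r₀ , r∈ (here refl) , desc-trans d e) (dep (here refl)))) (m+[n∸m]≡n (fst VC)))
           (desc-trans (desc-trans d e) (fst (snd w) b)) ∷
          roots-below ds es (dep ∘ there) (r∈ ∘ there)

       coloured-late : ∀ E → Over β fr → Chain (Cond.In r) fr E → ∃[ M ] ColouredAt (pre Z M) i E
       coloured-late E ov ch =
        let M , h = bounded-∀ {P = λ xs M → pair i (enc (list nat) xs) < M} (λ m≤n p → ≤-trans p m≤n)
             (concatMap prod E) (λ _ → _ , ≤-refl)
        in M , λ {L} L∈ {xs} xs∈ → colour-bit-known Z M {i} {enc (list nat) xs} (h (∈-concatMap {f = prod} L∈ xs∈))
         (subst (λ i → Z (pair i (enc (list nat) xs)) ≡ true) (each fr E ov ch L∈ xs∈) (snd (f-spec (enc (list nat) xs))))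
        where
        each : ∀ fr E → Over β fr → Chain (Cond.In r) fr E → ∀ {L} → L ∈ E → ∀ {xs} → xs ∈ prod L → φ xs ≡ i
        each fr (L ∷ E) ov (((_ , ab) , n , inr) , ch) (here refl) xs∈ = tuple-colour {n} (over-above ov ab) inr xs∈
        each fr (L ∷ E) ov (((_ , ab) , _) , ch)       (there L∈)  xs∈ = each (kidsL L) E (over-kids (over-above ov ab)) ch L∈ xs∈

       over-fr : Over β fr
       over-fr = over-front (base β) Es (over-base β) chain

       to-extends : ∀ E → Chain (Cond.In r) fr E → Extends d E
       to-extends E = chain-imp (λ n → let m , h = Y-sub {concat B} {Nq} {s} {concat B′} {K} {sH} Nq↓ dep′ below-B′ factor n in
        m , λ y → h (picked y)) fr E
        where
        dep′ : ∀ {b} → b ∈ concat B′ → Depth K b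
        dep′ b∈ = let b₀ , b₀∈ , e₀ = pw-∈ʳ (pw-concat lifted) b∈ ; ρ , ρ∈ , e₁ = Nq↓ b₀∈ in
         ρ , ρ∈ , desc-cast (trans (sym (+-assoc Nq _ p)) (cong (_+ p) (m+[n∸m]≡n (fst VC)))) (desc-trans e₁ e₀)

       hit : ∀ E → Chain (Cond.In r) fr E → Converges ρ Es E x (χ C x) → ⊥
       hit E ch cv = let M , col = coloured-late E over-fr ch in never M (inj₁ (d , d∈ , E , to-extends E ch , col , cv))

       contra : ∀ ρ′ → ρ ≡ ρ′ → ⊥
       -- One further level of the reservoir is already an extension of the kind that `never`
       -- excludes.
       contra nothing e = hit (L ∷ []) ((((Cond.h r + Cond.a r (Cond.N r)) , ab) , (Cond.N r , inr)) , tt)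
        (subst (λ ρ → Converges ρ Es (L ∷ []) x (χ C x)) (sym e) λ ())
        where
        L : Lev
        L = map (map (Cond.s r (Cond.N r))) (Cond.B r)
        ab : Above (Cond.h r + Cond.a r (Cond.N r)) fr L
        ab = subst (λ E → Above (Cond.h r + Cond.a r (Cond.N r)) (frontFrom (base β) E) L) Es-r
         (above-trans (Cond.B↓ r) (above-graph (Cond.sec r (Cond.N r)) (Cond.B r)))
        inr : ∀ {z} → z ∈ concat L → Cond.In r (Cond.N r) z
        inr z∈ =
         let zs , z∈zs , zs∈ = ∈-concat⁻′ L z∈
             bs , bs∈ , e₁ = ∈-map⁻ (map (Cond.s r (Cond.N r))) zs∈
             b , b∈ , e₂ = ∈-map⁻ (Cond.s r (Cond.N r)) (subst (_ ∈_) e₁ z∈zs)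
         in b , ∈-concat b∈ bs∈ , 0 , b , +-identityʳ _ , stop , e₂
       -- No level is added, so colour `i` under `c` is inherited. A branch on which `e` computed
       -- `C` would contain an excluded extension, by `confirm`.
       contra (just e) eq = fail (subst (λ ρ → Meets i ρ q) (sym eq)
        (r , r≤ , (λ L∈ → Core.col d (subst (_ ∈_) Es-r L∈)) , λ {L} br cpt →
         let j , good = confirm {base β} {l} (base-depth d) r {e} {x} {L} br cpt
         in hit (seg L (length (Cond.Es r)) j)
          (subst (λ fr → Chain (Cond.In r) fr (seg L (length (Cond.Es r)) j))
           (trans (sym (Branch.front br)) (cong (frontFrom (base β)) Es-r))
           (Branch.chain-seg br (length (Cond.Es r)) j ≤-refl))
          (subst (λ ρ → Converges ρ Es (seg L (length (Cond.Es r)) j) x (χ C x)) (sym eq)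
           (subst (λ Es → Good e (nodes (Es ++ seg L (length (Cond.Es r)) j)) x (χ C x)) Es-r good))))

      contradiction : ⊥
      contradiction = let d , d∈ , w = wins v (λ bs → fst (f-spec _)) in Win.contra d d∈ w (Core.ρ d) refl

     answer : ⊥
     answer = go (Basis.dichotomy X C avoid Bad re-bad (λ {xv} {b} {ρ} → mono {xv} {b} {ρ}))
      where
      go : _ ⊎ _ → ⊥
      go (inj₁ (x , v , v≢ , M , h)) = positive {x} {v} {M} v≢ (h (pre (oracle c-set) M) (bits-pre (oracle c-set) M) (length-pre (oracle c-set) M))
      go (inj₂ (x , Z , avoidZ , never)) = Negative.contradiction x Z avoidZ never

    contradiction : ⊥
    contradiction = let Λ , wins = some-level in Question.answer Λ wins

   theorem : Conclusion
   theorem = go em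
    where
    go : Dec Dense → Conclusion
    go (yes D) = FromDense.conclusion D
    go (no ¬D) = ⊥-elim (Contradiction.contradiction λ {i} {l} {β} i< β↓ q col →
     by-contra em {Σ (Cond (base β)) λ q′ → q′ ⊴ q × Coloured i (Cond.Es q′) × ∃[ ρ ] ¬ Meets i ρ q′} λ none →
     ¬D (record { i = i ; l = l ; β = β ; β↓ = β↓ ; q₀ = q ; col = col ; all = λ q′ q′≤ col′ ρ → by-contra em λ fail →
      none (q′ , q′≤ , col′ , ρ , fail) }))

 -- Stabilizing a colouring of pairs of tuples

 module Homogenization where
  open ListLemmas
  open HalpernLauchli
  open Programs
  open TypedPrograms
  open Computability
  open Simulation
  open BasisTheorem
  open Forests
  open ForcingConditions
  open OneDimensional using (collect)
  open import Data.List.Relation.Binary.Pointwise.Base using (Pointwise; []; _∷_)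
  open import Data.List.Relation.Unary.All as All using (All; []; _∷_)
  open import Data.List.Relation.Unary.AllPairs using ([]; _∷_)
  import Data.List.Relation.Unary.Unique.Propositional.Properties as Uniq

  encs-∈ : ∀ t {x xs} → x ∈ xs → enc t x ≤ encs t xs
  encs-∈ t {xs = y ∷ xs} (here refl) = m≤n⇒m≤1+n (pair-≥ˡ (enc t y) (encs t xs))
  encs-∈ t {xs = y ∷ xs} (there x∈) = m≤n⇒m≤1+n (≤-trans (encs-∈ t x∈) (pair-≥ʳ (enc t y) (encs t xs)))

  ∈-level≤ : ∀ (L : Lev) {z} → z ∈ concat L → z ≤ enc lev L
  ∈-level≤ L z∈ = let l , z∈l , l∈ = ∈-concat⁻′ L z∈ in ≤-trans (encs-∈ nat z∈l) (encs-∈ (list nat) l∈)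

  code : List ℕ → List ℕ → ℕ
  code xs ls = enc (list nat ⊗ list nat) (xs , ls)

  module Leaves {X₀ : Orc} (F : Forest X₀) where
   open Forest F
   open Basics F

   -- The upper level of a height-2 strong subforest whose roots are `xs`.
   Leaf : List ℕ → List ℕ → Set
   Leaf xs ls = ∃[ m ] Pointwise (Desc T m) (concatMap kd xs) ls

   kids-unique : ∀ {xs} → Unique xs → Unique (concatMap kd xs)
   kids-unique [] = []
   kids-unique {x ∷ xs} (x∉ ∷ u) = Uniq.++⁺ (kd! x) (kids-unique u) λ (y∈ , y∈′) →
    let z , z∈ , y∈z = ∈-concatMap′ {f = kd} xs y∈′ in All.lookup x∉ z∈ (kd-uniq y∈ y∈z)

  module Cohesive {X₀ : Orc} (F : Forest X₀) (C : Pred ℕ 0ℓ) (C≰ : ¬ C ≤T ⌞ X₀ ⌟)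
   (f : List ℕ → List ℕ → ℕ) (k : ℕ) (f< : ∀ xs ls → f xs ls < k)
   (fC : Cmp X₀ (list nat ⊗ list nat) nat (λ p → f (fst p) (snd p))) where

   open Forest F
   open Forcing F C
   open Leaves F

   base : Lev
   base = map (_∷ []) rs

   base-depth : ∀ {x} → x ∈ concat base → Depth 0 x
   base-depth x∈ = go rs id x∈
    where
    go : ∀ rs′ → (∀ {r} → r ∈ rs′ → r ∈ rs) → ∀ {x} → x ∈ concat (map (_∷ []) rs′) → Depth 0 x
    go (r ∷ rs′) h (here refl) = r , h (here refl) , stop
    go (r ∷ rs′) h (there x∈) = go rs′ (h ∘ there) x∈

   -- The colouring carried along with a condition. It starts as `f` and is refined whenever a
   -- further colouring has to be stabilized too.
   record Pairs (X : Orc) : Set where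
    field
     k̂ : ℕ
     φ : List ℕ → List ℕ → ℕ
     φC : Cmp X (list nat ⊗ list nat) nat (λ p → φ (fst p) (snd p))
     φ< : ∀ xs ls → φ xs ls < k̂
   open Pairs

   Q₁ : Set
   Q₁ = Σ (Cond base) λ q → Pairs (Cond.X q)

   -- `stable` is the promise made when a level is added: each of its tuples sees one colour on all
   -- leaves from the new reservoir. `refine` carries promises about a finer colouring over to a
   -- coarser one.
   record _≼_ (r q : Q₁) : Set where
    field
     le : fst r ⊴ fst q
     g : ℕ → ℕ
     refine : ∀ xs ls → φ (snd q) xs ls ≡ g (φ (snd r) xs ls)
     stable : ∀ {L} → L ∈ _⊴_.E le → ∀ {xs} → xs ∈ prod L → ∃[ c ] ∀ n {ls} → Leaf xs ls →
      (∀ {z} → z ∈ ls → Cond.In (fst r) n z) → φ (snd q) xs ls ≡ c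
   open _≼_

   ≼-refl : ∀ {q} → q ≼ q
   ≼-refl = record { le = ⊴-refl ; g = id ; refine = λ _ _ → refl ; stable = λ () }

   ≼-trans : ∀ {r q p} → r ≼ q → q ≼ p → r ≼ p
   ≼-trans {r} {q} {p} a b = record
    { le = ⊴-trans (le a) (le b) ; g = g b ∘ g a
    ; refine = λ xs ls → trans (refine b xs ls) (cong (g b) (refine a xs ls))
    ; stable = λ {L} L∈ xs∈ → go (∈-++⁻ (_⊴_.E (le b)) L∈) xs∈ }
    where
    go : ∀ {L} → L ∈ _⊴_.E (le b) ⊎ L ∈ _⊴_.E (le a) → ∀ {xs} → xs ∈ prod L → ∃[ c ] ∀ n {ls} → Leaf xs ls →
     (∀ {z} → z ∈ ls → Cond.In (fst r) n z) → φ (snd p) xs ls ≡ c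
    go (inj₁ L∈) xs∈ = let c , h = stable b L∈ xs∈ in c , λ n lf inr →
     let m , sub = _⊴_.sub (le a) n in h m lf (sub ∘ inr)
    go (inj₂ L∈) xs∈ = let c , h = stable a L∈ xs∈ in g b c , λ n {ls} lf inr →
     trans (refine b _ ls) (cong (g b) (h n lf inr))

   Settles : ∀ {X} → Pairs X → ℕ → (ℕ → Lev) → Set
   Settles P l L = ∀ j → l ≤ j → ∀ {xs} → xs ∈ prod (L j) → ∃[ J ] ∃[ c ] ∀ j′ → J ≤ j′ → ∀ {ls} → Leaf xs ls →
    (∀ {z} → z ∈ ls → z ∈ concat (L j′)) → φ P xs ls ≡ c

   Forces : Rec 1 → Q₁ → Set
   Forces e r = ∀ {L} → Branch (fst r) L → Settles (snd r) (length (Cond.Es (fst r))) L → ¬ Computes e L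

   Inside : List ℕ → Lev → Set
   Inside ls sel = ∀ {z} → z ∈ ls → z ∈ concat sel

   -- `zc` predicts the colour of `xs` with leaves above the given ones. Once `sel` supplies the
   -- next cones, the colour of every tuple of `E` is therefore fixed.
   Approved : (ℕ → ℕ) → ℕ → List Lev → Lev → Set
   Approved zc M E sel = (∀ {z} → z ∈ concat sel → z < M) × (∀ {L} → L ∈ E → ∀ {xs} → xs ∈ prod L →
    ∃[ i ] ∀ {ls} → Leaf xs ls → Inside ls sel → code xs ls < M × zc (code xs ls) ≡ i)

   reach-front : ∀ {P} fr E → Chain P fr E → ∀ {κ} → κ ∈ concat fr → ∃[ y ] y ∈ concat (frontFrom fr E) × ∃[ m ] Desc T m κ y
   reach-front fr []      _ κ∈ = _ , κ∈ , 0 , stop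
   reach-front fr (L ∷ E) (((m , ab) , _) , c) κ∈ =
    let x , x∈ , d = pw-∈ˡ (pw-concat ab) κ∈
        y , y∈ = kd-ne x
        w , w∈ , n , e = reach-front (kidsL L) E c (∈-concatMapʳ⁺ kd L x∈ y∈)
    in w , w∈ , _ , desc-trans d (step y∈ e)

   level-facts : ∀ {P d} fr E → Chain P fr E → (∀ {x} → x ∈ concat fr → Depth d x) → Over rs fr → ∀ {L} → L ∈ E →
    ∃[ dL ] (∀ {x} → x ∈ concat L → Depth dL x) × Over rs L ×
     (∀ {κ} → κ ∈ concat (kidsL L) → ∃[ y ] y ∈ concat (frontFrom fr E) × ∃[ m ] Desc T m κ y)
   level-facts fr (L ∷ E) (((m , ab) , _) , c) dep ov (here refl) =
    _ , above-depth ab dep , over-above ov ab , reach-front (kidsL L) E c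
   level-facts {d = d} fr (L ∷ E) (((m , ab) , _) , c) dep ov (there L∈) = level-facts (kidsL L) E c
    (λ x∈ → let z , z∈ , κ = ∈-concatMapʳ kd L x∈ in depth-down (above-depth ab dep z∈) (kid κ))
    (over-kids (over-above ov ab)) L∈

   root-tuple : ∀ {d L xs} → (∀ {x} → x ∈ concat L → Depth d x) → Over rs L → xs ∈ prod L → Pointwise (Desc T d) rs xs
   root-tuple {d} {L} {xs} dep ov xs∈ = go id (over-tuple ov xs∈) (λ x∈ → dep (∈-prod-concat {L = L} xs∈ x∈))
    where
    go : ∀ {rs′ xs} → (∀ {r} → r ∈ rs′ → r ∈ rs) → Pointwise (λ β x → ∃[ m ] Desc T m β x) rs′ xs →
     (∀ {x} → x ∈ xs → Depth d x) → Pointwise (Desc T d) rs′ xs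
    go h []             dep = []
    go h ((m , e) ∷ es) dep = desc-cast (depth-unique (_ , h (here refl) , e) (dep (here refl))) e ∷ go (h ∘ there) es (dep ∘ there)

   -- Only the leaves at a height bounded by the code of sel matter.
   leaf-bound : ∀ sel {m κs ls} → (∀ {κ} → κ ∈ κs → ∃[ d ] Depth d κ) → Pointwise (Desc T m) κs ls → Inside ls sel →
    ∃[ m ] m ∈ below (suc (enc lev sel)) × ls ∈ tup m κs
   leaf-bound sel h []       ins = 0 , ∈-below⁺ (s≤s z≤n) , here refl
   leaf-bound sel {m} h (d ∷ ds) ins = m , ∈-below⁺ (s≤s (≤-trans
    (≤-trans (m≤n+m m _) (depth≤ (depth-down (snd (h (here refl))) d))) (∈-level≤ sel (ins (here refl))))) , ∈tup⁺ (d ∷ ds)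

   -- Below (q , P), after homogenizing all relevant pairs of tuples, approved chains may be added.
   module Stabilize (q : Cond base) (P : Pairs (Cond.X q)) (M u : ℕ) where
    open Cond q

    -- Nodes above the roots with codes below `M` have depth at most `K`, so they can all be raised
    -- to this one level.
    K : ℕ
    K = N + M + u

    unpairs : ℕ → List ℕ × List ℕ
    unpairs = dec (list nat ⊗ list nat)

    Valid : ℕ → ℕ → Set
    Valid n δ = Unique (snd (unpairs n)) × (∀ {y} → y ∈ snd (unpairs n) → Depth δ y)

    conesOf : ℕ → ℕ → List ℕ
    conesOf n δ = map (lmost (K ∸ δ)) (snd (unpairs n))

    colouring : ∀ {n δ} → Valid n δ → Colouring X
    colouring {n} {δ} (u! , _) = record
     { cones = conesOf n δ ; distinct = descs-unique (pw-graph (lmost-sec (K ∸ δ)) _) u! ; k = k̂ P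
     ; φ = φ P (fst (unpairs n))
     ; φC = φC P ∘C pairC (constC (list nat) (fst (unpairs n))) idC ; φ< = φ< P _ }

    Fits : ℕ × ℕ → Colouring X → Set
    Fits (n , δ) t = Valid n δ → Colouring.cones t ≡ conesOf n δ × Colouring.φ t ≡ φ P (fst (unpairs n))

    trivial : Colouring X
    trivial = record { cones = [] ; distinct = [] ; k = k̂ P ; φ = φ P []
     ; φC = φC P ∘C pairC (constC (list nat) []) idC ; φ< = φ< P _ }

    fit : ∀ a → ∃[ t ] Fits a t
    fit (n , δ) = go em
     where
     go : Dec (Valid n δ) → ∃[ t ] Fits (n , δ) t
     go (yes v) = colouring {n} {δ} v , λ _ → refl , refl
     go (no ¬v) = trivial , λ v → ⊥-elim (¬v v)

    tasks : ∃[ ts ] (∀ {a} → a ∈ cartesianProduct (below M) (below (suc K)) → ∃[ t ] t ∈ ts × Fits a t) ×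
     (∀ {t} → t ∈ ts → ∃[ a ] a ∈ cartesianProduct (below M) (below (suc K)) × Fits a t)
    tasks = collect (cartesianProduct (below M) (below (suc K))) λ {a} _ → fit a

    open Homogeneous (homogeneous R K (fst tasks)) renaming (s′ to sH)

    res : Res
    res = record { X = X ; up = up ; avoid = avoid ; a = a′ ; s = sH ; sC = s′C ; sec = sec′ }

    colourAt : ℕ → ℕ → ℕ
    colourAt n δ = φ P (fst (unpairs n)) (map (sH (K + p)) (map pos (conesOf n δ)))

    constant : ∀ {n δ} → n < M → δ ≤ K → Valid n δ → ∀ j {us} → Pointwise (Desc T j) (map pos (conesOf n δ)) us →
     φ P (fst (unpairs n)) (map (sH (K + p + j)) us) ≡ colourAt n δ
    constant {n} {δ} n< δ≤ v j {us} ds =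
     let t , t∈ , h = fst (snd tasks) (∈-cartesianProduct⁺ (∈-below⁺ n<) (∈-below⁺ (s≤s δ≤)))
         ec , eφ = h v
         at-j : ∀ j {us} → Pointwise (Desc T j) (map pos (conesOf n δ)) us → φ P (fst (unpairs n)) (map (sH (K + p + j)) us) ≡ value t
         at-j j {us} ds = subst (λ ψ → ψ (map (sH (K + p + j)) us) ≡ value t) eφ
          (same t∈ j (subst (λ z → Pointwise (Desc T j) (map pos z) us) (sym ec) ds))
     in trans (at-j j ds) (sym (trans (cong (λ r → φ P (fst (unpairs n)) (map (sH r) (map pos (conesOf n δ)))) (sym (+-identityʳ (K + p))))
      (at-j 0 (pw-refl stop))))

    zc′ : ∀ n → Dec (∃[ δ ] Valid n δ) → ℕ
    zc′ n (yes (δ , _)) = colourAt n δ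
    zc′ n (no _) = φ P [] []

    -- For a valid pair with code below `M`, this is the colour that its first part has, after
    -- homogenization, with all leaves from the new reservoir above the raised second part.
    zc : ℕ → ℕ
    zc n = zc′ n em

    zc< : ∀ n → zc n < k̂ P
    zc< n = go em
     where
     go : ∀ d → zc′ n d < k̂ P
     go (yes _) = φ< P _ _
     go (no _) = φ< P _ _

    zc-valid : ∀ {n δ} → Valid n δ → zc n ≡ colourAt n δ
    zc-valid {n} {δ} v = go em
     where
     same-cones : ∀ {δ′} → Valid n δ′ → conesOf n δ′ ≡ conesOf n δ
     same-cones v′ = map-cong∈ _ λ y∈ → cong (λ j → lmost (K ∸ j) _) (depth-unique (snd v′ y∈) (snd v y∈))
     go : ∀ d → zc′ n d ≡ colourAt n δ
     go (yes (δ′ , v′)) = cong (λ z → φ P (fst (unpairs n)) (map (sH (K + p)) (map pos z))) (same-cones v′)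
     go (no ¬v) = ⊥-elim (¬v (δ , v))

    settled : ∀ xs zs δ → code xs zs < M → (∀ {z} → z ∈ zs → δ ≤ K) → Unique zs → (∀ {z} → z ∈ zs → Depth δ z) →
     ∀ j {us} → Pointwise (Desc T j) (map pos (map (lmost (K ∸ δ)) zs)) us →
     φ P xs (map (sH (K + p + j)) us) ≡ zc (code xs zs)
    settled xs zs δ n< δ≤ u! dep j {us} ds = go zs δ≤ refl
     where
     e : unpairs (code xs zs) ≡ (xs , zs)
     e = dec-enc (list nat ⊗ list nat) (xs , zs)
     use : ∀ δ′ → δ′ ≤ K → (∀ {z} → z ∈ zs → Depth δ′ z) → map (lmost (K ∸ δ)) zs ≡ map (lmost (K ∸ δ′)) zs →
      φ P xs (map (sH (K + p + j)) us) ≡ zc (code xs zs)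
     use δ′ δ′≤ dep′ ec =
      trans (cong (λ a → φ P (fst a) (map (sH (K + p + j)) us)) (sym e))
       (trans (constant {code xs zs} {δ′} n< δ′≤ v j (subst (λ z → Pointwise (Desc T j) (map pos z) us)
        (trans ec (cong (λ a → map (lmost (K ∸ δ′)) (snd a)) (sym e))) ds))
        (sym (zc-valid v)))
      where
      v : Valid (code xs zs) δ′
      v = subst (λ a → Unique (snd a) × (∀ {y} → y ∈ snd a → Depth δ′ y)) (sym e) (u! , λ {y} → dep′ {y})
     go : ∀ zs′ → (∀ {z} → z ∈ zs′ → δ ≤ K) → zs ≡ zs′ → φ P xs (map (sH (K + p + j)) us) ≡ zc (code xs zs)
     -- The bound on `δ` is available only if there are nodes; the empty list has any depth, in
     -- particular 0.
     go []        _ ez = use 0 z≤n (λ z∈ → ⊥-elim (none (subst (_ ∈_) ez z∈)))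
      (trans (cong (map (lmost (K ∸ δ))) ez) (cong (map (lmost K)) (sym ez)))
      where
      none : ∀ {z : ℕ} → ¬ z ∈ []
      none ()
     go (z ∷ zs′) h ez = use δ (h (here refl)) (λ {z} → dep {z}) refl

    module Add (E : List Lev) (sel : Lev) (ch : Chain In fr E) (st : Step In (frontFrom fr E , sel)) (ok : Approved zc M E sel) where
     open Extend {base} {0} base-depth q res factor ⊑-refl E ch
     m₀ : ℕ
     m₀ = fst (fst st)
     δ : ℕ
     δ = depth′ + m₀
     g′ : ℕ → ℕ
     g′ z = pos (lmost (K ∸ δ) z)
     g′↓ : Sec T ((K ∸ δ) + p) g′
     g′↓ z = desc-trans (lmost-sec (K ∸ δ) z) (pos↓ _)
     B′ : Lev
     B′ = map (map g′) sel
     h′ : ℕ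
     h′ = m₀ + ((K ∸ δ) + p)

     sel-depth : ∀ {z} → z ∈ concat sel → Depth δ z
     sel-depth = above-depth (snd (fst st)) depth′↓

     δ≤K : ∀ {z} → z ∈ concat sel → δ ≤ K
     δ≤K z∈ = ≤-trans (depth≤ (sel-depth z∈)) (≤-trans (<⇒≤ (fst ok z∈)) (≤-trans (m≤n+m M N) (m≤m+n (N + M) u)))

     from-B′ : ∀ {b} → b ∈ concat B′ → ∃[ z ] z ∈ concat sel × b ≡ g′ z
     from-B′ {b} b∈ =
      let bs , b∈bs , bs∈ = ∈-concat⁻′ B′ b∈
          zs , zs∈ , e₁ = ∈-map⁻ (map g′) bs∈
          z , z∈ , e₂ = ∈-map⁻ g′ (subst (b ∈_) e₁ b∈bs)
      in z , ∈-concat z∈ zs∈ , e₂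

     below′ : ∀ {b} → b ∈ concat B′ → ∃[ b′ ] b′ ∈ concat B × ∃[ j ] Desc T j b′ b
     below′ {b} b∈ =
      let z , z∈ , e = from-B′ b∈
          b₀ , b₀∈ , j , y , _ , dy , ez = snd (snd st) z∈
          d₁ = desc-trans dy (subst (Desc T (a _) y) (sym ez) (sec _ y))
      in b₀ , b₀∈ , _ , desc-trans d₁ (subst (Desc T ((K ∸ δ) + p) z) (sym e) (g′↓ z))

     abstract
      new : Σ (Cond base) λ r → r ⊴ q × Cond.Es r ≡ Es ++ E × Cond.R r ≡ res × Cond.B r ≡ B′ × Cond.N r ≡ depth′ + h′
      new = extend-at (above-trans (snd (fst st)) (above-graph g′↓ sel)) below′

     r : Cond base
     r = fst new

     picked : ∀ {n z} → Cond.In r n z → ∃[ z₀ ] z₀ ∈ concat sel × ∃[ j ] ∃[ y ] K + p + j ≡ n × Desc T j (g′ z₀) y × z ≡ sH n y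
     picked {n} {z} (b , b∈ , j , y , e , dy , ez) =
      let _ , _ , eR , eB , eN = snd new
          z₀ , z₀∈ , eb = from-B′ (subst (λ L → b ∈ concat L) eB b∈)
      in z₀ , z₀∈ , j , y , trans (cong (_+ j) (sym (trans eN (level (δ≤K z₀∈))))) e ,
       subst (λ b → Desc T j b y) eb dy , trans ez (cong (λ ρ → Res.s ρ n y) eR)
      where
      level : δ ≤ K → depth′ + h′ ≡ K + p
      level δ≤ = trans (sym (+-assoc depth′ m₀ _)) (trans (sym (+-assoc δ (K ∸ δ) p)) (cong (_+ p) (m+[n∸m]≡n δ≤)))

     N≥u : u ≤ Cond.N r
     N≥u = let _ , _ , _ , _ , eN = snd new in
      subst (u ≤_) (sym eN) (≤-trans (m≤n+m u (N + M)) (≤-trans (m≤n+m∸n K δ)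
       (≤-trans (m≤m+n (δ + (K ∸ δ)) p) (≤-reflexive (trans (+-assoc δ (K ∸ δ) p) (+-assoc depth′ m₀ _))))))

     fr-over : Over rs fr
     fr-over = over-front base Es (over-base rs) chain

     module Stable {L : Lev} (L∈ : L ∈ E) {xs : List ℕ} (xs∈ : xs ∈ prod L) (n : ℕ) where
      facts = level-facts fr E ch (snd (chain-depth base Es chain base-depth)) fr-over L∈
      dL = fst facts

      κ-depth : ∀ {κ} → κ ∈ concatMap kd xs → Depth (dL + 1) κ × dL + 1 ≤ δ
      κ-depth κ∈ =
       let x , x∈ , κ∈x = ∈-concatMap′ {f = kd} xs κ∈
           x∈L = ∈-prod-concat {L = L} xs∈ x∈
           D = depth-down (fst (snd facts) x∈L) (kid κ∈x)
           y , y∈ , m , e = snd (snd (snd facts)) (∈-concatMapʳ⁺ kd L x∈L κ∈x)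
       in D , ≤-trans (m≤m+n (dL + 1) m) (≤-trans (≤-reflexive (depth-unique (depth-down D e) (depth′↓ y∈))) (m≤m+n depth′ m₀))

      Split : List ℕ → List ℕ → Set
      Split κs ls = ∃[ j ] ∃[ zs ] ∃[ ys ] Pointwise (Desc T (δ ∸ (dL + 1))) κs zs × (∀ {z} → z ∈ zs → z ∈ concat sel) ×
       Pointwise (Desc T j) (map g′ zs) ys × ls ≡ map (sH (K + p + j)) ys

      above-sel : ∀ {a κ l z₀ j y} → Depth (dL + 1) κ → dL + 1 ≤ δ → z₀ ∈ concat sel → Desc T a κ l → Desc T j (g′ z₀) y →
       l ≡ sH n y → Desc T (δ ∸ (dL + 1)) κ z₀
      above-sel {a} {κ} {l} {z₀} {j} {y} D ≤δ z₀∈ e dy el =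
       ancestor (desc-cast eq e) e′
       where
       b = ((K ∸ δ) + p) + (j + a′ n)
       e′ : Desc T b z₀ l
       e′ = desc-trans (g′↓ z₀) (desc-trans dy (subst (Desc T (a′ n) y) (sym el) (sec′ n y)))
       eq : a ≡ (δ ∸ (dL + 1)) + b
       eq = +-cancelˡ-≡ (dL + 1) _ _ (trans (depth-unique (depth-down D e) (depth-down (sel-depth z₀∈) e′))
        (trans (cong (_+ b) (sym (m+[n∸m]≡n ≤δ))) (+-assoc (dL + 1) _ b)))

      split : ∀ {a κs ls} → (∀ {κ} → κ ∈ κs → Depth (dL + 1) κ × dL + 1 ≤ δ) → Pointwise (Desc T a) κs ls →
       (∀ {z} → z ∈ ls → Cond.In r n z) → Split κs ls
      split h [] inr = 0 , [] , [] , [] , (λ ()) , [] , refl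
      split {a} {κ ∷ κs} {l ∷ ls} h (e ∷ es) inr =
       let z₀ , z₀∈ , j , y , ej , dy , el = picked (inr (here refl))
           zs , ys , as , ins , ds , els = rest j ej (h ∘ there) es (inr ∘ there)
           D , ≤δ = h (here refl)
       in j , z₀ ∷ zs , y ∷ ys , above-sel D ≤δ z₀∈ e dy el ∷ as ,
        (λ { (here refl) → z₀∈ ; (there q) → ins q }) , dy ∷ ds ,
        cong₂ _∷_ (trans el (cong (λ m → sH m y) (sym ej))) els
       where
       rest : ∀ j → K + p + j ≡ n → ∀ {κs ls} → (∀ {κ} → κ ∈ κs → Depth (dL + 1) κ × dL + 1 ≤ δ) → Pointwise (Desc T a) κs ls →
        (∀ {z} → z ∈ ls → Cond.In r n z) →
        ∃[ zs ] ∃[ ys ] Pointwise (Desc T (δ ∸ (dL + 1))) κs zs × (∀ {z} → z ∈ zs → z ∈ concat sel) ×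
         Pointwise (Desc T j) (map g′ zs) ys × ls ≡ map (sH (K + p + j)) ys
       rest j ej h [] inr = [] , [] , [] , (λ ()) , [] , refl
       rest j ej h (e ∷ es) inr =
        let z₀ , z₀∈ , j′ , y , ej′ , dy , el = picked (inr (here refl))
            zs , ys , as , ins , ds , els = rest j ej (h ∘ there) es (inr ∘ there)
            D , ≤δ = h (here refl)
        in z₀ ∷ zs , y ∷ ys , above-sel D ≤δ z₀∈ e dy el ∷ as ,
         (λ { (here refl) → z₀∈ ; (there q) → ins q }) ,
         subst (λ i → Desc T i (g′ z₀) y) (+-cancelˡ-≡ (K + p) _ _ (trans ej′ (sym ej))) dy ∷ ds ,
         cong₂ _∷_ (trans el (cong (λ m → sH m y) (sym ej))) els

      -- The leaves lie above nodes of `sel`, and these above the direct extensions of `xs`.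
      -- Homogeneity gives the leaves the colour predicted for the nodes in between, which approval
      -- makes the same for all choices.
      value≡ : ∀ {ls} → Leaf xs ls → (∀ {z} → z ∈ ls → Cond.In r n z) → φ P xs ls ≡ fst (snd ok L∈ xs∈)
      value≡ {ls} (a , ds) inr =
       let j , zs , ys , as , ins , es , e = split κ-depth ds inr
           n< , ez = snd (snd ok L∈ xs∈) (_ , as) (λ {z} → ins {z})
           u! = descs-unique as (kids-unique (descs-unique (root-tuple (fst (snd facts)) (fst (snd (snd facts))) xs∈) rs!))
       in trans (cong (φ P xs) e)
        (trans (settled xs zs δ n< (δ≤K ∘ ins) u! (sel-depth ∘ ins) j
         (subst (λ z → Pointwise (Desc T j) z ys) (map-∘ zs) es)) ez)

     transport : ∀ {R′} → R′ ≡ res → Σ (Pairs (Res.X R′)) λ P′ → φ P′ ≡ φ P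
     transport refl = P , refl

     P′ : Σ (Pairs (Cond.X r)) λ P′ → φ P′ ≡ φ P
     P′ = transport (fst (snd (snd (snd new))))

     result : Σ Q₁ λ r → r ≼ (q , P) × Cond.Es (fst r) ≡ Es ++ E × u ≤ Cond.N (fst r)
     result = (r , fst P′) , record
      { le = r≤ ; g = id ; refine = λ xs ls → cong (λ ψ → ψ xs ls) (sym (snd P′))
      ; stable = λ L∈ xs∈ → let L∈′ = subst (_ ∈_) E≡ L∈ in _ , λ n lf inr → Stable.value≡ L∈′ xs∈ n lf inr }
      , fst (snd (snd new)) , N≥u
      where
      r≤ : r ⊴ q
      r≤ = fst (snd new)
      E≡ : _⊴_.E r≤ ≡ E
      E≡ = cancel Es (trans (sym (_⊴_.Es≡ r≤)) (fst (snd (snd new))))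
       where
       cancel : ∀ {A : Set} (xs : List A) {ys zs} → xs ++ ys ≡ xs ++ zs → ys ≡ zs
       cancel []       e = e
       cancel (x ∷ xs) e = cancel xs (cong (λ { [] → [] ; (_ ∷ l) → l }) e)

   -- `sel` has a single node above each direct extension, so each tuple of `L` has only one tuple
   -- of leaves inside `sel`, and approval is automatic for large `M`.
   lengthen : ∀ (q₁ : Q₁) → Σ Q₁ λ r → r ≼ q₁ × length (Cond.Es (fst q₁)) < length (Cond.Es (fst r))
   lengthen (q , P) =
    let r , r≼ , e , _ = Stabilize.Add.result q P M 0 (L ∷ []) sel (stL , tt) stS (sel< , ok)
    in r , r≼ , subst (λ z → length Es < length z) (sym e) (subst (length Es <_) (sym (length-++ Es)) (m<m+n (length Es) (s≤s z≤n)))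
    where
    open Cond q
    L sel : Lev
    n₁ : ℕ
    L = map (map (s N)) B
    n₁ = N + a N + 1
    sel = map (map (s n₁)) (kidsL L)
    abL : Above (h + a N) fr L
    abL = above-trans B↓ (above-graph (sec N) B)
    image : ∀ {t : ℕ → ℕ} (L : Lev) {z} → z ∈ concat (map (map t) L) → ∃[ y ] y ∈ concat L × z ≡ t y
    image {t} L {z} z∈ =
     let l , z∈l , l∈ = ∈-concat⁻′ (map (map t) L) z∈
         l′ , l′∈ , e = ∈-map⁻ (map t) l∈
         y , y∈ , e′ = ∈-map⁻ t (subst (z ∈_) e z∈l)
     in y , ∈-concat y∈ l′∈ , e′
    L-in : ∀ {z} → z ∈ concat L → In N z
    L-in z∈ = let b , b∈ , e = image B z∈ in b , b∈ , 0 , b , +-identityʳ N , stop , e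
    κ-in : ∀ {κ} → κ ∈ concat (kidsL L) → ∃[ b ] b ∈ concat B × Desc T (a N + 1) b κ
    κ-in κ∈ = let x , x∈ , κx = ∈-concatMapʳ kd L κ∈ ; b , b∈ , e = image B x∈
     in b , b∈ , desc-trans (subst (Desc T (a N) b) (sym e) (sec N b)) (kid κx)
    stL : Step In (fr , L)
    stL = (_ , abL) , N , L-in
    stS : Step In (frontFrom fr (L ∷ []) , sel)
    stS = (_ , above-graph (sec n₁) (kidsL L)) , n₁ , λ z∈ →
     let κ , κ∈ , e = image (kidsL L) z∈ ; b , b∈ , d = κ-in κ∈ in b , b∈ , a N + 1 , κ , sym (+-assoc N (a N) 1) , d , e
    ls₀ : List ℕ → List ℕ
    ls₀ xs = map (s n₁) (concatMap kd xs)
    bound : ∃[ M ] ∀ {xs} → xs ∈ prod L → code xs (ls₀ xs) < M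
    bound = bounded-∀ {P = λ xs M → code xs (ls₀ xs) < M} (λ m≤n p → ≤-trans p m≤n) (prod L) (λ _ → _ , ≤-refl)
    bound′ : ∃[ M ] ∀ {z} → z ∈ concat sel → z < M
    bound′ = bounded-∀ {P = λ z M → z < M} (λ m≤n p → ≤-trans p m≤n) (concat sel) (λ _ → _ , ≤-refl)
    M : ℕ
    M = fst bound ⊔ fst bound′
    sel< : ∀ {z} → z ∈ concat sel → z < M
    sel< z∈ = ≤-trans (snd bound′ z∈) (m≤n⊔m (fst bound) _)
    κ-depth : ∀ {κ} → κ ∈ concat (kidsL L) → Depth n₁ κ
    κ-depth κ∈ = let b , b∈ , d = κ-in κ∈ ; ρ , ρ∈ , e = N↓ b∈ in ρ , ρ∈ , desc-cast (sym (+-assoc N (a N) 1)) (desc-trans e d)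
    only : ∀ {m κs ls} → (∀ {κ} → κ ∈ κs → κ ∈ concat (kidsL L)) → Pointwise (Desc T m) κs ls → Inside ls sel → ls ≡ map (s n₁) κs
    only h [] ins = refl
    only h (e ∷ es) ins =
     let κ′ , κ′∈ , el = image (kidsL L) (ins (here refl))
         eq = same-base (κ-depth (h (here refl))) (κ-depth κ′∈) e (subst (Desc T (a n₁) κ′) (sym el) (sec n₁ κ′))
     in cong₂ _∷_ (trans el (cong (s n₁) (sym eq))) (only (h ∘ there) es (ins ∘ there))
    ok : ∀ {L′} → L′ ∈ (L ∷ []) → ∀ {xs} → xs ∈ prod L′ → ∃[ i ] ∀ {ls} → Leaf xs ls → Inside ls sel →
     code xs ls < M × Stabilize.zc q P M 0 (code xs ls) ≡ i
    ok (here refl) {xs} xs∈ = Stabilize.zc q P M 0 (code xs (ls₀ xs)) , λ {ls} (m , ds) ins →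
     let e = only (λ κ∈ → let x , x∈ , κx = ∈-concatMap′ {f = kd} xs κ∈ in ∈-concatMapʳ⁺ kd L (∈-prod-concat {L = L} xs∈ x∈) κx) ds ins
     in subst (λ l → code xs l < M) (sym e) (≤-trans (snd bound xs∈) (m≤m⊔n _ (fst bound′))) ,
      cong (λ l → Stabilize.zc q P M 0 (code xs l)) e

 -- Strong subforests with eventually constant colours

 module CohesiveSubforest where
  open ListLemmas
  open HalpernLauchli
  open Programs
  open TypedPrograms
  open Computability
  open Simulation
  open BasisTheorem
  open Forests
  open ForcingConditions
  open OneDimensional
   using (bits-pre; encC; colour-bit; colour-bit-yes; colour-bit-known; Uncoloured; colour-bitC;
    re-uncoloured; uncoloured-pre; coloured-Z; Z-colouring)
  open Homogenization
  open import Data.List.Relation.Binary.Pointwise.Base using ([]; _∷_)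
  import Data.Vec.Base as Vec

  module CohesiveForcing {X₀ : Orc} (F : Forest X₀) (C : Pred ℕ 0ℓ) (C≰ : ¬ C ≤T ⌞ X₀ ⌟)
   (f : List ℕ → List ℕ → ℕ) (k : ℕ) (f< : ∀ xs ls → f xs ls < k)
   (fC : Cmp X₀ (list nat ⊗ list nat) nat (λ p → f (fst p) (snd p))) where

   open Forest F
   open Forcing F C
   open Leaves F
   open Cohesive F C C≰ f k f< fC
   open Pairs
   open _≼_

   unsnoc : ∀ {P} fr E sel → Chain P fr (E ++ sel ∷ []) → Chain P fr E × Step P (frontFrom fr E , sel)
   unsnoc fr []      sel (s , _) = tt , s
   unsnoc fr (L ∷ E) sel (s , c) = let c′ , s′ = unsnoc (kidsL L) E sel c in (s , c′) , s′

   module Force (q : Cond base) (P : Pairs (Cond.X q)) (e : Rec 1) where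
    open Cond q

    Query : Ty
    Query = ((nat ⊗ nat) ⊗ list nat) ⊗ list lev ⊗ lev

    -- Approval with a string in place of the colouring and its length in place of `M`. The height
    -- of the leaves is bounded as in `leaf-bound`, which keeps this decidable.
    ApprovedAt : List ℕ → List Lev → Lev → Set
    ApprovedAt ρ E sel = (∀ {z} → z ∈ concat sel → suc z ≤ length ρ) × (∀ {L} → L ∈ E → ∀ {xs} → xs ∈ prod L →
     ∃[ i ] i ∈ below (k̂ P) × (∀ {m} → m ∈ below (suc (enc lev sel)) → ∀ {ls} → ls ∈ tup m (concatMap kd xs) →
      (∀ {z} → z ∈ ls → z ∈ concat sel) → colour-bit ρ i (code xs ls) ≡ 2))

    Γ : Ty
    Γ = ((Query ⊗ lev) ⊗ list nat) ⊗ nat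
    selOf : El Γ → Lev
    selOf q = snd (snd (fst (fst (fst q))))
    selC : Cmp X Γ lev selOf
    selC = sndC (sndC (fstC (fstC (fstC idC))))
    rhoC : Cmp X Γ (list nat) (λ q → snd (fst (fst (fst (fst q)))))
    rhoC = sndC (fstC (fstC (fstC (fstC idC))))
    Q₃ : El ((Γ ⊗ nat) ⊗ list nat) → Set
    Q₃ ((γ , m) , ls) = (∀ {z} → z ∈ ls → z ∈ concat (selOf γ)) →
     colour-bit (snd (fst (fst (fst (fst γ))))) (snd γ) (code (snd (fst γ)) ls) ≡ 2
    Q₂ : El (Γ ⊗ nat) → Set
    Q₂ (γ , m) = ∀ {ls} → ls ∈ tup m (concatMap kd (snd (fst γ))) → Q₃ ((γ , m) , ls)
    Q₁′ : El ((Query ⊗ lev) ⊗ list nat) → Set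
    Q₁′ q = ∃[ i ] i ∈ below (k̂ P) × (∀ {m} → m ∈ below (suc (enc lev (selOf (q , i)))) → Q₂ ((q , i) , m))

    abstract
     d-approved : Deci X Query (λ a → ApprovedAt (snd (fst a)) (fst (snd a)) (snd (snd a)))
     d-approved = d-and
      (d-all {t = nat} {Q = λ q → suc (snd q) ≤ length (snd (fst (fst q)))}
       (d-≤ (sucC (sndC idC)) (lengthC {t = nat} (sndC (fstC (fstC idC))))) (concatC (sndC (sndC idC))))
      (d-all {t = lev} {Q = λ q → ∀ {xs} → xs ∈ prod (snd q) → Q₁′ (q , xs)}
       (d-all {t = list nat} {Q = Q₁′}
        (d-any {t = nat} {Q = λ q → ∀ {m} → m ∈ below (suc (enc lev (selOf q))) → Q₂ (q , m)}
         (d-all {t = nat} {Q = Q₂}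
          (d-all {t = list nat} {Q = Q₃}
           (d-imp
            (d-all {t = nat} {Q = λ q → snd q ∈ concat (selOf (fst (fst (fst q))))}
             (d-∈ nat (sndC idC) (concatC (selC ∘C fstC (fstC (fstC idC))))) (sndC idC))
            (d-≡ nat (colour-bitC (rhoC ∘C fstC (fstC idC)) (sndC (fstC (fstC idC)))
             (encC (list nat ⊗ list nat) (pairC (sndC (fstC (fstC (fstC idC)))) (sndC idC)))) (constC nat 2)))
           (tupC up (sndC idC) (concatMapC (c-up up kdC ∘C sndC idC) (sndC (fstC (fstC idC))))))
          (belowC (sucC (encC lev selC))))
         (constC (list nat) (below (k̂ P))))
        (prodC (sndC idC)))
       (fstC (sndC idC)))

    Hits : (ℕ × ℕ) × List ℕ → Set
    Hits ((x , v) , ρ) = ∃[ w ] Chain In fr (fst w ++ snd w ∷ []) × ApprovedAt ρ (fst w) (snd w) ×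
     Good e (nodes (Es ++ fst w)) x v

    Bad : (ℕ × ℕ) × List ℕ → Set
    Bad a = Hits a ⊎ Uncoloured (k̂ P) (snd a)

    abstract
     re-bad : RE X ((nat ⊗ nat) ⊗ list nat) Bad
     re-bad = re-or
      (re-∃ (list lev ⊗ lev) (re-and
       (re-chain up {f = λ _ → fr} {g = λ a → fst (snd a) ++ snd (snd a) ∷ []} (Y-RE R (concat B) N)
        (constC lev fr) (appendC (fstC (sndC idC)) (consC (sndC (sndC idC)) nilC)))
       (re-and (re-dec d-approved)
        (re-good up e (nodesC up (appendC (constC (list lev) Es) (fstC (sndC idC)))) (fstC (fstC (fstC idC))) (sndC (fstC (fstC idC)))))))
      (re-uncoloured (k̂ P) (sndC idC))

    mono : ∀ {xv b ρ} → Bad (xv , ρ) → Bad (xv , b ∷ ρ)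
    mono {b = b} {ρ} (inj₁ (w , ch , (lt , ap) , g)) = inj₁ (w , ch ,
     ((λ z∈ → m≤n⇒m≤1+n (lt z∈)) , λ L∈ {xs} xs∈ → let i , i∈ , h = ap L∈ xs∈ in
      i , i∈ , λ m∈ {ls} ls∈ ins → at-cons b ρ (pair i (code xs ls)) (h m∈ ls∈ ins)) , g)
    mono {b = b} {ρ} (inj₂ (n , h)) = inj₂ (n , λ {i} i∈ → at-cons b ρ (pair i n) (h i∈))

    fr-over : Over rs fr
    fr-over = over-front base Es (over-base rs) chain

    bounded-leaf : ∀ {E L xs ls sel} → Chain In fr E → L ∈ E → xs ∈ prod L → Leaf xs ls → Inside ls sel →
     ∃[ m ] m ∈ below (suc (enc lev sel)) × ls ∈ tup m (concatMap kd xs)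
    bounded-leaf {E} {L} {xs} {ls} {sel} ch L∈ xs∈ (m , ds) ins =
     leaf-bound sel (λ κ∈ → let x , x∈ , κx = ∈-concatMap′ {f = kd} xs κ∈ in
      dL + 1 , depth-down (dep (∈-prod-concat {L = L} xs∈ x∈)) (kid κx)) ds ins
     where
     facts = level-facts fr E ch (snd (chain-depth base Es chain base-depth)) fr-over L∈
     dL = fst facts
     dep : ∀ {x} → x ∈ concat L → Depth dL x
     dep = fst (snd facts)

    -- The length `M` is known before the homogenization, which is needed only for codes below `M`.
    -- The resulting `zc` is one of the colourings to which the answer applies, so the chain found
    -- for it may be added.
    positive : ∀ {x v M} → ¬ v ≡ χ C x → Bad ((x , v) , pre (oracle (λ n → Stabilize.zc q P M 0 (π₂ n) ≡ π₁ n)) M) →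
     Σ Q₁ λ r → r ≼ (q , P) × Forces e r
    positive {x} {v} {M} v≢ (inj₂ u) = ⊥-elim (uncoloured-pre {Zs} {k̂ P} M (λ n → zc n , zc< n ,
     trans (cong zc (π₂-pair (zc n) n)) (sym (π₁-pair (zc n) n))) u)
     where
     open Stabilize q P M 0
     Zs : ℕ → Set
     Zs n = zc (π₂ n) ≡ π₁ n
    positive {x} {v} {M} v≢ (inj₁ ((E , sel) , ch , (lt , ap) , M′ , conv)) =
     (r′ , snd r) , ≼-trans r′≼ r≼ , λ {L} br _ →
      refute r′ {e} {x} {v} {M′} N≥ (subst (λ z → Sim.ev X₀ e (enc (list nat) (pre (oracle (_∈ nodes z)) M′)) M′ Vec.[ x ] ≡ suc v)
       (sym (trans (fst (snd (snd raised))) (trans (++-identityʳ _) Es≡))) conv) v≢ br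
     where
     open Stabilize q P M 0 using (zc; module Add)
     Zs : ℕ → Set
     Zs n = zc (π₂ n) ≡ π₁ n
     cs = unsnoc {In} fr E sel ch
     ok : Approved zc M E sel
     ok = (λ z∈ → subst (_ ≤_) (length-pre (oracle Zs) M) (lt z∈)) , λ {L} L∈ {xs} xs∈ →
      let i , _ , h = ap L∈ xs∈ in i , λ {ls} lf ins →
       let m , m∈ , ls∈ = bounded-leaf {sel = sel} (fst cs) L∈ xs∈ lf (λ {z} → ins {z})
           b = h m∈ ls∈ ins
           z : Zs (pair i (code xs ls))
           z = colour-bit-yes {Zs} M {i} {code xs ls} b
       in ≤-trans (s≤s (pair-≥ʳ i (code xs ls))) (subst (pair i (code xs ls) <_) (length-pre (oracle Zs) M) (at< (pre (oracle Zs) M) _ b)) ,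
        trans (sym (cong zc (π₂-pair i (code xs ls)))) (trans z (π₁-pair i (code xs ls)))
     res₁ = Add.result E sel (fst cs) (snd cs) ok
     r : Q₁
     r = fst res₁
     r≼ : r ≼ (q , P)
     r≼ = fst (snd res₁)
     Es≡ : Cond.Es (fst r) ≡ Es ++ E
     Es≡ = fst (snd (snd res₁))
     -- The cones are raised beyond the use `M′`, so that the wrong value persists.
     raised = Extend.extend-by {base} {0} base-depth (fst r) (Cond.R (fst r)) (factors-refl {Cond.s (fst r)}) ⊑-refl [] tt M′
     r′ : Cond base
     r′ = fst raised
     N≥ : M′ ≤ Cond.N r′
     N≥ = snd (snd (snd raised))
     r′≼ : (r′ , snd r) ≼ r
     r′≼ = record { le = fst (snd raised) ; g = id ; refine = λ _ _ → refl ; stable = λ () }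

    module Negative (x : ℕ) (Z : Orc) (avoidZ : ¬ C ≤T ⌞ join X Z ⌟) (never : ∀ m → ¬ Bad ((x , χ C x) , pre Z m)) where

     totZ : ∀ n → ∃[ i ] i < k̂ P × Z (pair i n) ≡ true
     totZ = coloured-Z Z (λ M u → never M (inj₂ u))

     zf : ℕ → ℕ
     zf = fst (Z-colouring {X} Z totZ)

     zf-spec : ∀ n → zf n < k̂ P × Z (pair (zf n) n) ≡ true
     zf-spec = snd (snd (Z-colouring {X} Z totZ))

     RZ : Res
     RZ = record { X = join X Z ; up = ⊑-trans up (⊑-joinˡ X Z) ; avoid = avoidZ ; a = a ; s = s
      ; sC = c-up (⊑-joinˡ X Z) sC ; sec = sec }

     r : Cond base
     r = record { Es = Es ; chain = chain ; R = RZ ; B = B ; h = h ; B↓ = B↓ ; N = N ; N↓ = N↓ }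

     bound : ∃[ K ] ∀ {a} → a ∈ cartesianProduct (below (k̂ P)) (below (k̂ P)) → pair (fst a) (snd a) < K
     bound = bounded-∀ {P = λ a K → pair (fst a) (snd a) < K} (λ m≤n p → ≤-trans p m≤n) _ (λ _ → _ , ≤-refl)

     -- The colouring is paired with the one selected from `Z`, so stabilizing it along a branch
     -- stabilizes the latter as well.
     P̂ : Pairs (join X Z)
     P̂ = record
      { k̂ = fst bound
      ; φ = λ xs ls → pair (φ P xs ls) (zf (code xs ls))
      ; φC = opC₂ v-pair (c-up (⊑-joinˡ X Z) (φC P)) (fst (snd (Z-colouring {X} Z totZ)) ∘C encC (list nat ⊗ list nat) idC)
      ; φ< = λ xs ls → snd bound (∈-cartesianProduct⁺ (∈-below⁺ (φ< P xs ls)) (∈-below⁺ (fst (zf-spec _))))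
      }

     r≼ : (r , P̂) ≼ (q , P)
     r≼ = record
      { le = record { E = [] ; Es≡ = sym (++-identityʳ Es) ; inside = tt ; sub = λ n → n , id ; fac = factors-refl {s} ; upX = ⊑-joinˡ X Z }
      ; g = π₁ ; refine = λ xs ls → sym (π₁-pair (φ P xs ls) _) ; stable = λ () }

     -- Suppose that the refined colouring settles along a branch on which `e` computes `C`. Leaves
     -- from a late level are then approved by the colouring from `Z`, and with the finite part that
     -- fixes the computation they form a hit at the right value.
     forces : Forces e (r , P̂)
     forces {L} br settles cpt = never M (inj₁ ((E , sel) , chain-snoc , (sel< , approve) , good))
      where
      open Branch br hiding (front)
      open Depths {base} {L} {0} base-depth strong using (climb-front)
      cf = confirm {base} {0} base-depth r {e} {x} {L} br cpt
      j₀ i₀ : ℕ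
      j₀ = length Es
      i₀ = fst cf
      E : List Lev
      E = seg L j₀ i₀
      good : Good e (nodes (Es ++ E)) x (χ C x)
      good = snd cf
      Late : List ℕ → ℕ → Set
      Late xs J = ∃[ c ] ∀ j′ → J ≤ j′ → ∀ {ls} → Leaf xs ls → (∀ {z} → z ∈ ls → z ∈ concat (L j′)) → φ P̂ xs ls ≡ c
      late : ∃[ J ] ∀ {xs} → xs ∈ concatMap prod E → Late xs J
      late = bounded-∀ {P = Late} (λ { m≤n (c , h) → c , λ j′ n≤ → h j′ (≤-trans m≤n n≤) }) (concatMap prod E) λ {xs} xs∈ →
       let L′ , L′∈ , xs∈′ = ∈-concatMap′ {f = prod} E xs∈
           n , _ , eL = ∈-seg⁻ L j₀ i₀ L′∈
           J , c , h = settles (j₀ + n) (m≤m+n j₀ n) (subst (λ l → xs ∈ prod l) eL xs∈′)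
       in J , c , h
      J : ℕ
      J = fst late
      cl = climb-front (j₀ + i₀) J
      sel : Lev
      sel = fst (snd cl)
      sel∈ : ∀ {z} → z ∈ concat sel → z ∈ concat (L (J + (j₀ + i₀)))
      sel∈ = snd (snd (snd cl))
      fr≡ : fr ≡ frL base L j₀
      fr≡ = Branch.front br
      ch : Chain In fr E
      ch = subst (λ f → Chain In f E) (sym fr≡) (chain-seg j₀ i₀ ≤-refl)
      front≡ : frontFrom fr E ≡ frL base L (j₀ + i₀)
      front≡ = trans (cong (λ f → frontFrom f E) fr≡) (frontFrom-seg base L j₀ i₀)
      chain-snoc : Chain In fr (E ++ sel ∷ [])
      chain-snoc = chain-++ fr E (sel ∷ []) ch
       (((fst cl , subst (λ f → Above (fst cl) f sel) (sym front≡) (fst (snd (snd cl)))) ,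
        (let n , inn = later (J + (j₀ + i₀)) (≤-trans (m≤m+n j₀ i₀) (m≤n+m _ J)) in n , λ z∈ → inn (sel∈ z∈))) , tt)
      pairs : List (List ℕ × List ℕ)
      pairs = concatMap (λ xs → concatMap (λ m → map (xs ,_) (tup m (concatMap kd xs))) (below (suc (enc lev sel)))) (concatMap prod E)
      M₁ : ∃[ M ] ∀ {a} → a ∈ pairs → pair (zf (code (fst a) (snd a))) (code (fst a) (snd a)) < M
      M₁ = bounded-∀ {P = λ a M → pair (zf (code (fst a) (snd a))) (code (fst a) (snd a)) < M} (λ m≤n p → ≤-trans p m≤n) pairs (λ _ → _ , ≤-refl)
      M₂ : ∃[ M ] ∀ {z} → z ∈ concat sel → z < M
      M₂ = bounded-∀ {P = λ z M → z < M} (λ m≤n p → ≤-trans p m≤n) (concat sel) (λ _ → _ , ≤-refl)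
      M : ℕ
      M = fst M₁ ⊔ fst M₂
      sel< : ∀ {z} → z ∈ concat sel → suc z ≤ length (pre Z M)
      sel< z∈ = subst (_ ≤_) (sym (length-pre Z M)) (≤-trans (snd M₂ z∈) (m≤n⊔m (fst M₁) _))
      approve : ∀ {L′} → L′ ∈ E → ∀ {xs} → xs ∈ prod L′ → ∃[ i ] i ∈ below (k̂ P) ×
       (∀ {m} → m ∈ below (suc (enc lev sel)) → ∀ {ls} → ls ∈ tup m (concatMap kd xs) →
        (∀ {z} → z ∈ ls → z ∈ concat sel) → colour-bit (pre Z M) i (code xs ls) ≡ 2)
      approve {L′} L′∈ {xs} xs∈ = go em
       where
       xs∈E : xs ∈ concatMap prod E
       xs∈E = ∈-concatMap {f = prod} L′∈ xs∈
       Some : Set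
       Some = ∃[ ls ] Leaf xs ls × (∀ {z} → z ∈ ls → z ∈ concat sel)
       Goal : Set
       Goal = ∃[ i ] i ∈ below (k̂ P) × (∀ {m} → m ∈ below (suc (enc lev sel)) → ∀ {ls} → ls ∈ tup m (concatMap kd xs) →
        (∀ {z} → z ∈ ls → z ∈ concat sel) → colour-bit (pre Z M) i (code xs ls) ≡ 2)
       zf≡ : ∀ {ls} → Leaf xs ls → (∀ {z} → z ∈ ls → z ∈ concat sel) → zf (code xs ls) ≡ π₂ (fst (snd late xs∈E))
       zf≡ {ls} lf ins = trans (sym (π₂-pair (φ P xs ls) (zf (code xs ls))))
        (cong π₂ (snd (snd late xs∈E) (J + (j₀ + i₀)) (m≤m+n J _) lf (λ z∈ → sel∈ (ins z∈))))
       go : Dec Some → Goal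
       -- There are no leaves inside `sel`, so approval is vacuous and any colour below `k̂` serves.
       go (no none) = φ P [] [] , ∈-below⁺ (φ< P [] []) , λ {m} _ {ls} ls∈ ins → ⊥-elim (none (ls , (m , ∈tup⁻ m _ ls∈) , λ {z} → ins {z}))
       go (yes (ls₀ , lf₀ , ins₀)) = zf (code xs ls₀) , ∈-below⁺ (fst (zf-spec _)) , λ {m} m∈ {ls} ls∈ ins →
        subst (λ i → colour-bit (pre Z M) i (code xs ls) ≡ 2)
         (trans (zf≡ (m , ∈tup⁻ m _ ls∈) (λ {z} → ins {z})) (sym (zf≡ lf₀ (λ {z} → ins₀ {z}))))
         (colour-bit-known Z M {zf (code xs ls)} {code xs ls}
          (≤-trans (snd M₁ (∈-concatMap {f = λ xs → concatMap (λ m → map (xs ,_) (tup m (concatMap kd xs))) (below (suc (enc lev sel)))} xs∈E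
           (∈-concatMap {f = λ m → map (xs ,_) (tup m (concatMap kd xs))} m∈ (∈-map⁺ (xs ,_) ls∈))))
           (m≤m⊔n (fst M₁) _))
          (snd (zf-spec (code xs ls))))

    force : Σ Q₁ λ r → r ≼ (q , P) × Forces e r
    force = go (Basis.dichotomy X C avoid Bad re-bad (λ {xv} {b} {ρ} → mono {xv} {b} {ρ}))
     where
     go : _ ⊎ _ → Σ Q₁ λ r → r ≼ (q , P) × Forces e r
     go (inj₁ (x , v , v≢ , M , h)) =
      let Zo = oracle (λ n → Stabilize.zc q P M 0 (π₂ n) ≡ π₁ n) in
      positive {x} {v} {M} v≢ (h (pre Zo M) (bits-pre Zo M) (length-pre Zo M))
     go (inj₂ (x , Z , avoidZ , never)) =
      (Negative.r x Z avoidZ never , Negative.P̂ x Z avoidZ never) , Negative.r≼ x Z avoidZ never ,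
      λ {L} → Negative.forces x Z avoidZ never {L}

   abstract
    next : (p : Q₁) (n : ℕ) → Σ Q₁ λ p′ → p′ ≼ p × length (Cond.Es (fst p)) < length (Cond.Es (fst p′)) × Forces (index n) p′
    next p n =
     let r₁ , r₁≼ , longer = lengthen p
         r₂ , r₂≼ , forced = Force.force (fst r₁) (snd r₁) (index n)
     in r₂ , ≼-trans r₂≼ r₁≼ ,
      ≤-trans longer (≤-trans (m≤m+n _ _) (≤-reflexive (sym (trans (cong length (_⊴_.Es≡ (le r₂≼))) (length-++ (Cond.Es (fst r₁))))))) ,
      λ {L} → forced {L}

   start : Q₁
   start = record { Es = [] ; chain = tt ; B = base ; h = 0 ; B↓ = pw-refl (pw-refl stop) ; N = 0 ; N↓ = base-depth
    ; R = record { X = X₀ ; up = ⊑-refl ; avoid = C≰ ; a = λ _ → 0 ; s = λ _ x → x ; sC = sndC idC ; sec = λ _ _ → stop } } ,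
    record { k̂ = k ; φ = f ; φC = fC ; φ< = f< }

   seq : ℕ → Q₁
   seq zero = start
   seq (suc n) = fst (next (seq n) n)

   open Limit (λ n → fst (seq n)) (λ n → le (fst (snd (next (seq n) n)))) (λ n → fst (snd (snd (next (seq n) n))))

   descend : ∀ n i → seq (i + n) ≼ seq n
   descend n zero = ≼-refl
   descend n (suc i) = ≼-trans (fst (snd (next (seq (i + n)) (i + n)))) (descend n i)

   -- By stage `suc j + n` level `j` has been added, and its tuples are stable over the reservoir of
   -- that stage, from which all later levels are picked.
   settles : ∀ n → Settles (snd (seq n)) (length (Cond.Es (fst (seq n)))) lim
   settles n j l≤ {xs} xs∈ =
    let c , h = stable (descend n (suc j)) lim∈ xs∈ in
    length (Cond.Es (fst (seq (suc j + n)))) , c , λ j′ J≤ {ls} lf ins →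
     let m , inn = Branch.later (branch (suc j + n)) j′ J≤ in h m lf (λ z∈ → inn (ins z∈))
    where
    open _⊴_ (le (descend n (suc j)))
    l = length (Cond.Es (fst (seq n)))
    segE : seg lim l (length E) ≡ E
    segE = drop-++ (Cond.Es (fst (seq n))) (trans (cong (_++ seg lim l (length E)) (sym (pfx n)))
     (trans (seg-++ lim 0 l (length E)) (trans (cong (seg lim 0) (sym (trans (cong length Es≡) (length-++ (Cond.Es (fst (seq n)))))))
      (trans (pfx (suc j + n)) Es≡))))
    longE : j < l + length E
    longE = ≤-trans (s≤s (m≤m+n j n)) (≤-trans (≥n (suc j + n)) (≤-reflexive (trans (cong length Es≡) (length-++ (Cond.Es (fst (seq n)))))))
    lim∈ : lim j ∈ E
    lim∈ = subst₂ (λ i F → lim i ∈ F) (m+[n∸m]≡n l≤) segE (∈-seg⁺ lim l (length E) (j ∸ l)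
     (+-cancelˡ-< l _ _ (subst (_< l + length E) (sym (m+[n∸m]≡n l≤)) longE)))

   theorem : Σ (ℕ → Lev) λ L → Strong base L × ¬ C ≤T ⌞ join X₀ (oracle (Union L)) ⌟ ×
    (∀ j {xs} → xs ∈ prod (L j) → ∃[ J ] ∃[ c ] ∀ j′ → J ≤ j′ → ∀ {ls} → Leaf xs ls → (∀ {z} → z ∈ ls → z ∈ concat (L j′)) → f xs ls ≡ c)
   theorem = lim , strong ,
    (λ C≤ → let n , e = index-onto (fst C≤) in
     snd (snd (snd (next (seq n) n))) (branch (suc n)) (settles (suc n))
      (subst (λ e → Computes e lim) (sym e) (≤T⇒runs C≤))) ,
    λ j xs∈ → settles 0 j z≤n xs∈

 -- From eventual constancy to a homogeneous subforest

 module HomogeneousSubforest where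
  open ListLemmas
  open HalpernLauchli
  open Programs
  open TypedPrograms
  open Computability
  open Forests
  open ForcingConditions
  open Homogenization
  open CohesiveSubforest
  open OneDimensional using (encC; module StrongAvoidance)
  open import Data.List.Relation.Binary.Pointwise.Base using (Pointwise; []; _∷_)
  open import Data.List.Relation.Unary.All as All using (All; []; _∷_)
  open import Data.List.Relation.Unary.AllPairs using ([]; _∷_)

  when-yes : ∀ {P A : Set} (d : Dec P) {a b : A} → P → when d a b ≡ a
  when-yes (yes _) p = refl
  when-yes (no ¬p) p = ⊥-elim (¬p p)

  when-no : ∀ {P A : Set} (d : Dec P) {a b : A} → ¬ P → when d a b ≡ b
  when-no (yes p) ¬p = ⊥-elim (¬p p)
  when-no (no _)  ¬p = refl

  map-unique : ∀ {A B : Set} {f : A → B} {xs} → (∀ {x y} → x ∈ xs → y ∈ xs → f x ≡ f y → x ≡ y) → Unique xs → Unique (map f xs)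
  map-unique         inj [] = []
  map-unique {f = f} inj (x∉ ∷ u) =
   All.tabulate (λ y∈ e → let z , z∈ , e′ = ∈-map⁻ f y∈ in All.lookup x∉ z∈ (inj (here refl) (there z∈) (trans e e′)))
   ∷ map-unique (λ p q → inj (there p) (there q)) u

  pw-and : ∀ {A B : Set} {R : A → B → Set} {Q : B → Set} {xs ys} → Pointwise R xs ys → (∀ {y} → y ∈ ys → Q y) →
   Pointwise (λ x y → R x y × Q y) xs ys
  pw-and []       h = []
  pw-and (r ∷ rs) h = (r , h (here refl)) ∷ pw-and rs (h ∘ there)

  pw-nested : ∀ {A B : Set} {R S : A → B → Set} {xss yss} → (∀ {x y} → x ∈ concat xss → R x y → S x y) →
   Pointwise (Pointwise R) xss yss → Pointwise (Pointwise S) xss yss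
  pw-nested h = pw-imp∈ λ xs∈ → pw-imp∈ λ x∈ → h (∈-concat x∈ xs∈)

  module Relocation {X₀ : Orc} (F : Forest X₀) (C : Pred ℕ 0ℓ) (C≰ : ¬ C ≤T ⌞ X₀ ⌟)
   (f : List ℕ → List ℕ → ℕ) (k : ℕ) (f< : ∀ xs ls → f xs ls < k)
   (fC : Cmp X₀ (list nat ⊗ list nat) nat (λ p → f (fst p) (snd p)))
   (L : ℕ → Lev) (st : Forcing.Strong F C (map (_∷ []) (Forest.rs F)) L) where

   open Forest F
   open Forcing F C
   open Leaves F
   open Cohesive F C C≰ f k f< fC using (base; base-depth; root-tuple)
   open Depths {base} {L} {0} base-depth st

   G : ℕ → Set
   G = Union L

   X₁ : Orc
   X₁ = join X₀ (oracle G)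

   up₁ : X₀ ⊑ X₁
   up₁ = ⊑-joinˡ X₀ (oracle G)

   abstract
    dG : Deci X₁ nat G
    dG = ≤T⇒deci (≤T-trans ≤T-oracle (⊑-joinʳ X₀ (oracle G)))

   over : ∀ j → Over rs (L j)
   over zero = over-above (over-base rs) (snd (st 0))
   over (suc j) = over-above (over-kids (over j)) (snd (st (suc j)))

   -- The root below a node determines its coordinate, so membership in the flattened level is
   -- enough.
   relocate : ∀ {p xs} → Pointwise (λ r x → ∃[ m ] Desc T m r x) rs xs → (∀ {x} → x ∈ xs → x ∈ concat (L p)) → xs ∈ prod (L p)
   relocate {p} ds h = ∈-prod⁺ (pw-imp (λ { (_ , b∈ , refl) → b∈ })
    (locate {Q = _≡_} rs! (λ r∈ → _ , r∈ , stop) (over p) (λ { refl → 0 , stop })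
     (pw-imp (λ { (d , x∈) → d , _ , x∈ , refl }) (pw-and ds h))))

   gd-mono : ∀ {i j} → i ≤ j → gd i ≤ gd j
   gd-mono {i} {zero}  z≤n = ≤-refl
   gd-mono {i} {suc j} i≤ with m≤n⇒m<n∨m≡n i≤
   ... | inj₁ i< = ≤-trans (gd-mono (≤-pred i<)) (<⇒≤ (gd< j))
   ... | inj₂ refl = ≤-refl

   gd-<⁻ : ∀ {i j} → gd i < gd j → i < j
   gd-<⁻ {i} {j} lt = ≰⇒> λ j≤i → <⇒≱ lt (gd-mono j≤i)

   gd-inj : ∀ {i j} → gd i ≡ gd j → i ≡ j
   gd-inj {i} {j} e = ≤-antisym (le e) (le (sym e))
    where
    le : ∀ {i j} → gd i ≡ gd j → i ≤ j
    le {i} {j} e = ≮⇒≥ λ j<i → <-irrefl (sym e) (≤-trans (gd< j) (gd-mono j<i))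

   same-level : ∀ {z i j} → z ∈ concat (L i) → z ∈ concat (L j) → i ≡ j
   same-level {i = i} {j} z∈ z∈′ = gd-inj (depth-unique (gd↓ i z∈) (gd↓ j z∈′))

   hop : ℕ → ℕ
   hop j = fst (st (suc j))

   next-node : ∀ {j z κ} → z ∈ concat (L j) → κ ∈ kd z → ∃[ y ] y ∈ concat (L (suc j)) × Desc T (hop j) κ y
   next-node {j} z∈ κ∈ = pw-∈ˡ (pw-concat (snd (st (suc j)))) (∈-concatMapʳ⁺ kd (L j) z∈ κ∈)

   kid< : ∀ {j z κ} → z ∈ concat (L j) → κ ∈ kd z → z < κ
   kid< {j} z∈ κ∈ = let r , r∈ , d = gd↓ j z∈ in grow r∈ d κ∈

   desc-at : ∀ {i j z y m} → z ∈ concat (L j) → Desc T m z y → y ∈ concat (L i) → Desc T (gd i ∸ gd j) z y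
   desc-at {i} {j} {m = m} z∈ d y∈ = desc-cast
    (trans (sym (m+n∸m≡n (gd j) m)) (cong (_∸ gd j) (depth-unique (depth-down (gd↓ j z∈) d) (gd↓ i y∈)))) d

  -- The strong subforest formed by the levels L, as a forest computable from its set of nodes.
  module Subforest {X₀ : Orc} (F : Forest X₀) (C : Pred ℕ 0ℓ) (C≰ : ¬ C ≤T ⌞ X₀ ⌟)
   (f : List ℕ → List ℕ → ℕ) (k : ℕ) (f< : ∀ xs ls → f xs ls < k)
   (fC : Cmp X₀ (list nat ⊗ list nat) nat (λ p → f (fst p) (snd p)))
   (L : ℕ → Lev) (st : Forcing.Strong F C (map (_∷ []) (Forest.rs F)) L) where

   open Forest F
   open Forcing F C
   open Leaves F
   open Cohesive F C C≰ f k f< fC using (base; base-depth; root-tuple)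
   open Depths {base} {L} {0} base-depth st
   open Relocation F C C≰ f k f< fC L st

   Dom : ℕ → Set
   Dom κ = ∃[ x ] x < κ × (G x × κ ∈ kd x)

   -- Selects the nearest node of `G` above `κ`. For a direct extension of a node of `G` it lies on
   -- the very next level, because depth increases with the index of the level.
   First : ℕ × ℕ → Set
   First (κ , y) = ∃[ m ] m < suc y × ((Desc T m κ y × G y) × (∀ {n} → n ∈ below m → ∀ {w} → w ∈ dl n κ → ¬ G w))

   abstract
    d-first : Deci X₁ (nat ⊗ nat) (λ a → Dom (fst a) → First a)
    d-first = d-imp
     (d-∃< {Q = λ q → G (snd q) × fst (fst q) ∈ kd (snd q)}
      (d-and (d-sub dG (sndC idC)) (d-∈ nat (fstC (fstC idC)) (c-up up₁ kdC ∘C sndC idC))) (fstC idC))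
     (d-∃< {Q = λ q → (Desc T (snd q) (fst (fst q)) (snd (fst q)) × G (snd (fst q))) ×
      (∀ {n} → n ∈ below (snd q) → ∀ {w} → w ∈ dl n (fst (fst q)) → ¬ G w)}
      (d-and (d-and (d-desc up₁ (sndC idC) (fstC (fstC idC)) (sndC (fstC idC))) (d-sub dG (sndC (fstC idC))))
       (d-all {t = nat} {Q = λ q → ∀ {w} → w ∈ dl (snd q) (fst (fst (fst q))) → ¬ G w}
        (d-all {t = nat} {Q = λ q → ¬ G (snd q)} (d-not (d-sub dG (sndC idC)))
         (dlC up₁ (sndC idC) (fstC (fstC (fstC idC)))))
        (belowC (sndC idC))))
      (sucC (sndC idC)))

   first-exists : ∀ κ → ∃[ y ] (Dom κ → First (κ , y))
   first-exists κ = go em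
    where
    go : Dec (Dom κ) → ∃[ y ] (Dom κ → First (κ , y))
    go (no ¬p) = 0 , λ p → ⊥-elim (¬p p)
    go (yes (x , _ , (j , x∈) , κ∈)) = earliest (least (hop j , at-hop (next-node {j} x∈ κ∈)))
     where
     Hit : ℕ → Set
     Hit m = ∃[ w ] Desc T m κ w × G w
     at-hop : (∃[ w ] w ∈ concat (L (suc j)) × Desc T (hop j) κ w) → Hit (hop j)
     at-hop (w , w∈ , d) = w , d , suc j , w∈
     earliest : (∃[ m ] Hit m × (∀ {n} → n < m → ¬ Hit n)) → ∃[ y ] (Dom κ → First (κ , y))
     earliest (m , (y , e , g) , min) =
      y , λ _ → m , s≤s (≤-trans (m≤n+m m _) (depth≤ (depth-down (depth-down (gd↓ j x∈) (kid κ∈)) e))) , (e , g) ,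
      λ {n} n∈ {w} w∈ gw → min (∈-below⁻ n∈) (w , ∈dl⁻ n w∈ , gw)

   abstract
    searched : Σ (ℕ → ℕ) λ up → Cmp X₁ nat nat up × (∀ κ → Dom κ → First (κ , up κ))
    searched = search {X₁} {nat} {nat} {λ a → Dom (fst a) → First a} d-first first-exists

   up : ℕ → ℕ
   up = fst searched

   up-spec : ∀ {j z κ} → z ∈ concat (L j) → κ ∈ kd z → up κ ∈ concat (L (suc j)) × Desc T (hop j) κ (up κ)
   up-spec {j} {z} {κ} z∈ κ∈ = go (snd (snd searched) κ (z , kid< {j} z∈ κ∈ , (j , z∈) , κ∈))
    where
    go : First (κ , up κ) → up κ ∈ concat (L (suc j)) × Desc T (hop j) κ (up κ)
    go (m , _ , (d , i , y∈) , min) = subst (λ i → up κ ∈ concat (L i)) i≡ y∈ , desc-cast m≡ d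
     where
     w = next-node {j} z∈ κ∈
     e : (gd j + 1) + m ≡ gd i
     e = depth-unique (depth-down (depth-down (gd↓ j z∈) (kid κ∈)) d) (gd↓ i y∈)
     m≤ : m ≤ hop j
     m≤ = ≮⇒≥ λ lt → min (∈-below⁺ lt) (∈dl⁺ (snd (snd w))) (suc j , fst (snd w))
     j<i : j < i
     j<i = gd-<⁻ (≤-trans (≤-reflexive (+-comm 1 (gd j))) (≤-trans (m≤m+n (gd j + 1) m) (≤-reflexive e)))
     i≡ : i ≡ suc j
     i≡ = gd-inj (≤-antisym (≤-trans (≤-reflexive (sym e)) (+-monoʳ-≤ (gd j + 1) m≤)) (gd-mono j<i))
     m≡ : m ≡ hop j
     m≡ = +-cancelˡ-≡ (gd j + 1) _ _ (trans e (cong gd i≡))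

   up-inj : ∀ {i j x y κ κ′} → x ∈ concat (L i) → κ ∈ kd x → y ∈ concat (L j) → κ′ ∈ kd y → up κ ≡ up κ′ → κ ≡ κ′
   up-inj {i} {j} {κ = κ} {κ′} x∈ κ∈ y∈ κ′∈ e =
    let u , d = up-spec {i} x∈ κ∈ ; u′ , d′ = up-spec {j} y∈ κ′∈
        i≡j = suc-injective (same-level {i = suc i} {suc j} u (subst (λ z → z ∈ concat (L (suc j))) (sym e) u′))
    in desc-unique d (subst₂ (λ i z → Desc T (hop i) κ′ z) (sym i≡j) (sym e) d′)

   -- A node outside `G` becomes its own only direct extension, which keeps the structure leafless
   -- and its parents unique.
   kd₁ : ℕ → List ℕ
   kd₁ x = when (em {G x}) (map up (kd x)) (x ∷ [])

   kd₁-in : ∀ {x} → G x → kd₁ x ≡ map up (kd x)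
   kd₁-in = when-yes em

   kd₁-out : ∀ {x} → ¬ G x → kd₁ x ≡ x ∷ []
   kd₁-out = when-no em

   kd₁⁻ : ∀ {j x y} → x ∈ concat (L j) → y ∈ kd₁ x → ∃[ κ ] κ ∈ kd x × y ≡ up κ
   kd₁⁻ {j} {x} {y} x∈ y∈ = ∈-map⁻ up (subst (y ∈_) (kd₁-in (j , x∈)) y∈)

   kd₁-self : ∀ {x y} → ¬ G x → y ∈ kd₁ x → y ≡ x
   kd₁-self {x} {y} ¬g y∈ = go (subst (y ∈_) (kd₁-out ¬g) y∈)
    where
    go : y ∈ x ∷ [] → y ≡ x
    go (here e) = e

   kd₁-level : ∀ {j x y} → x ∈ concat (L j) → y ∈ kd₁ x → y ∈ concat (L (suc j))
   kd₁-level {j} x∈ y∈ = let κ , κ∈ , e = kd₁⁻ {j} x∈ y∈ in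
    subst (_∈ concat (L (suc j))) (sym e) (fst (up-spec {j} x∈ κ∈))

   tree₁ : Tree
   tree₁ = record
    { X = ℕ
    ; kids = kd₁
    ; ne = λ x → ne x em
    ; uniq = λ {x} {y} {z} p q → uq em em p q
    }
    where
    ne : ∀ x → Dec (G x) → ∃[ y ] y ∈ kd₁ x
    ne x (yes g) = let κ , κ∈ = kd-ne x in up κ , subst (up κ ∈_) (sym (kd₁-in g)) (∈-map⁺ up κ∈)
    ne x (no ¬g) = x , subst (x ∈_) (sym (kd₁-out ¬g)) (here refl)
    uq : ∀ {x y z} → Dec (G x) → Dec (G y) → z ∈ kd₁ x → z ∈ kd₁ y → x ≡ y
    uq (yes (i , x∈)) (yes (j , y∈)) p q =
     let κ , κ∈ , e = kd₁⁻ {i} x∈ p ; κ′ , κ′∈ , e′ = kd₁⁻ {j} y∈ q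
         κ≡ = up-inj {i} {j} x∈ κ∈ y∈ κ′∈ (trans (sym e) e′)
     in kd-uniq κ∈ (subst (_∈ kd _) (sym κ≡) κ′∈)
    uq (yes (i , x∈)) (no ¬g) p q =
     ⊥-elim (¬g (suc i , subst (_∈ concat (L (suc i))) (kd₁-self ¬g q) (kd₁-level {i} x∈ p)))
    uq (no ¬g) (yes (j , y∈)) p q =
     ⊥-elim (¬g (suc j , subst (_∈ concat (L (suc j))) (kd₁-self ¬g p) (kd₁-level {j} y∈ q)))
    uq (no ¬g) (no ¬g′) p q = trans (sym (kd₁-self ¬g p)) (kd₁-self ¬g′ q)

   desc₁ : ∀ {n j z y} → z ∈ concat (L j) → Desc tree₁ n z y → y ∈ concat (L (n + j)) × ∃[ m ] Desc T m z y
   desc₁ z∈ stop = z∈ , 0 , stop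
   desc₁ {suc n} {j} {z} {y} z∈ (step {y = w} w∈ d) =
    let κ , κ∈ , e = kd₁⁻ {j} z∈ w∈
        y∈ , m , d′ = desc₁ {n} {suc j} (kd₁-level {j} z∈ w∈) d
    in subst (λ i → y ∈ concat (L i)) (+-suc n j) y∈ , suc (hop j + m) ,
     step κ∈ (desc-trans (snd (up-spec {j} z∈ κ∈)) (subst (λ w → Desc T m w y) e d′))

   desc₁-at : ∀ {n j z y} → z ∈ concat (L j) → Desc tree₁ n z y → Desc T (gd (n + j) ∸ gd j) z y
   desc₁-at {n} {j} z∈ d = let y∈ , m , d′ = desc₁ {n} {j} z∈ d in desc-at {n + j} {j} z∈ d′ y∈

   roots-above : Pointwise (Desc T (fst (st 0))) rs (concat (L 0))
   roots-above = subst (λ z → Pointwise (Desc T (fst (st 0))) z (concat (L 0))) (concat-map-[ rs ]) (pw-concat (snd (st 0)))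

   abstract
    kd₁C : Cmp X₁ nat (list nat) kd₁
    kd₁C = whenC dG (mapC (fst (snd searched) ∘C sndC idC) (c-up up₁ kdC)) (consC idC nilC)

   subforest : Forest X₁
   subforest = record
    { kd = kd₁
    ; kd-ne = Tree.ne tree₁
    ; kd-uniq = Tree.uniq tree₁
    ; kd! = λ x → un x em
    ; kdC = kd₁C
    ; rs = concat (L 0)
    ; rs! = descs-unique roots-above rs!
    ; orphan = λ {r} {x} → orph em
    ; grow = λ {r} {n} r∈ d y∈ → climbs {n + 0} (fst (desc₁ {n} {0} r∈ d)) y∈
    }
    where
    rise : ∀ {n m x y} → Depth n x → Desc T m x y → x ≤ y
    rise dep stop = ≤-refl
    rise dep@(r , r∈ , e) (step {y = w} w∈ d) = ≤-trans (<⇒≤ (grow r∈ e w∈)) (rise (depth-down dep (kid w∈)) d)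
    climbs : ∀ {j x y} → x ∈ concat (L j) → y ∈ kd₁ x → x < y
    climbs {j} {x} x∈ y∈ = let κ , κ∈ , e = kd₁⁻ {j} x∈ y∈ in subst (x <_) (sym e)
     (≤-trans (kid< {j} x∈ κ∈) (rise (depth-down (gd↓ j x∈) (kid κ∈)) (snd (up-spec {j} x∈ κ∈))))
    un : ∀ x → Dec (G x) → Unique (kd₁ x)
    un x (yes (j , x∈)) = subst Unique (sym (kd₁-in (j , x∈))) (map-unique (λ p q → up-inj {j} {j} x∈ p x∈ q) (kd! x))
    un x (no ¬g) = subst Unique (sym (kd₁-out ¬g)) ([] ∷ [])
    orph : ∀ {r x} → Dec (G x) → r ∈ concat (L 0) → ¬ r ∈ kd₁ x
    orph (yes (j , x∈)) r∈ p = 0≢1+n (same-level {i = 0} {suc j} r∈ (kd₁-level {j} x∈ p))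
    orph {r} (no ¬g) r∈ p = ¬g (0 , subst (_∈ concat (L 0)) (kd₁-self ¬g p) r∈)

   module _ (avoid : ¬ C ≤T ⌞ X₁ ⌟) where

    private module S = Forcing subforest C

    above₁ : ∀ {j n fr L′} → (∀ {x} → x ∈ concat fr → x ∈ concat (L j)) → S.Above n fr L′ → Above (gd (n + j) ∸ gd j) fr L′
    above₁ {j} {n} h = pw-nested λ x∈ d → desc₁-at {n} {j} (h x∈) d

    hops : ∀ {p l} → (∀ {x} → x ∈ l → x ∈ concat (L p)) → Pointwise (Desc T (hop p)) (concatMap kd l) (concatMap kd₁ l)
    hops {p} {l} h = pw-concat (go l h)
     where
     each : ∀ {x} → x ∈ concat (L p) → ∀ κs → (∀ {κ} → κ ∈ κs → κ ∈ kd x) → Pointwise (Desc T (hop p)) κs (map up κs)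
     each x∈ []       h = []
     each x∈ (κ ∷ κs) h = snd (up-spec {p} x∈ (h (here refl))) ∷ each x∈ κs (h ∘ there)
     go : ∀ l → (∀ {x} → x ∈ l → x ∈ concat (L p)) → Pointwise (Pointwise (Desc T (hop p))) (map kd l) (map kd₁ l)
     go []      h = []
     go (x ∷ l) h = subst (Pointwise _ (kd x)) (sym (kd₁-in (p , h (here refl)))) (each (h (here refl)) (kd x) id) ∷ go l (h ∘ there)

    -- Descents in the subforest run through its levels, and the depth of a level in the original
    -- forest depends only on its index, so uniform heights remain uniform.
    lift-strong : ∀ {l β H} → Pointwise (Desc tree₁ l) (concat (L 0)) β → S.Strong (map (_∷ []) β) H →
     Strong base H × (∀ j → ∃[ p ] j ≤ p × (∀ {x} → x ∈ concat (H j) → x ∈ concat (L p)))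
    lift-strong {l} {β} {H} β↓ stH = strong , λ j → SD.gd j , SD.j≤gd j , inL j
     where
     base₁-depth : ∀ {x} → x ∈ concat (map (_∷ []) β) → S.Depth l x
     base₁-depth {x} x∈ = let r , r∈ , d = pw-∈ʳ β↓ (subst (x ∈_) (concat-map-[ β ]) x∈) in r , r∈ , d
     module SD = S.Depths {map (_∷ []) β} {H} {l} base₁-depth stH
     levels : ∀ {n x} → S.Depth n x → x ∈ concat (L n)
     levels {n} {x} (r , r∈ , d) = subst (λ i → x ∈ concat (L i)) (+-identityʳ n) (fst (desc₁ {n} {0} r∈ d))
     inL : ∀ j {x} → x ∈ concat (H j) → x ∈ concat (L (SD.gd j))
     inL j x∈ = levels (SD.gd↓ j x∈)
     β-above : Pointwise (Desc T (fst (st 0) + (gd (l + 0) ∸ gd 0))) rs β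
     β-above = pw-trans desc-trans roots-above (pw-imp∈ (λ r∈ d → desc₁-at {l} {0} r∈ d) β↓)
     strong : Strong base H
     strong zero = _ , above-trans (pw-map (_∷ []) β-above)
      (above₁ {l} {fst (stH 0)} (λ x∈ → levels (base₁-depth x∈)) (snd (stH 0)))
     strong (suc j) = _ , above-trans (go (H j) (inL j))
      (above₁ {suc (SD.gd j)} {fst (stH (suc j))}
       (λ x∈ → let z , z∈ , y∈ = ∈-concatMapʳ kd₁ (H j) x∈ in kd₁-level {SD.gd j} (inL j z∈) y∈) (snd (stH (suc j))))
      where
      go : ∀ Hj → (∀ {x} → x ∈ concat Hj → x ∈ concat (L (SD.gd j))) → Above (hop (SD.gd j)) (kidsL Hj) (S.kidsL Hj)
      go []       h = []
      go (l ∷ Hj) h = hops {SD.gd j} {l} (λ x∈ → h (∈-concat {xs = l} {xss = l ∷ Hj} x∈ (here refl))) ∷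
       go Hj (λ x∈ → let ys , x∈ys , ys∈ = ∈-concat⁻′ Hj x∈ in h (∈-concat x∈ys (there ys∈)))

  module EventuallyConstant {X₀ : Orc} (F : Forest X₀) (C : Pred ℕ 0ℓ) (C≰ : ¬ C ≤T ⌞ X₀ ⌟)
   (f : List ℕ → List ℕ → ℕ) (k : ℕ) (f< : ∀ xs ls → f xs ls < k)
   (fC : Cmp X₀ (list nat ⊗ list nat) nat (λ p → f (fst p) (snd p))) where

   open Forest F
   open Forcing F C
   open Leaves F
   open Cohesive F C C≰ f k f< fC using (base; base-depth; root-tuple)

   Limit-is : (ℕ → Lev) → List ℕ → ℕ → Set
   Limit-is L xs c = ∃[ J ] ∀ j → J ≤ j → ∀ {ls} → Leaf xs ls → (∀ {z} → z ∈ ls → z ∈ concat (L j)) → f xs ls ≡ c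

   Conclusion : Set
   Conclusion = Σ (ℕ → Lev) λ H → Strong base H × ¬ C ≤T ⌞ join X₀ (oracle (Union H)) ⌟ ×
    ∃[ i ] ∀ j {xs} → xs ∈ prod (H j) → Limit-is H xs i

   private
    module Go (L : ℕ → Lev) (st : Strong base L) (avoid : ¬ C ≤T ⌞ join X₀ (oracle (Union L)) ⌟)
     (lim : ∀ j {xs} → xs ∈ prod (L j) → ∃[ c ] Limit-is L xs c) where
     open Relocation F C C≰ f k f< fC L st
     open Subforest F C C≰ f k f< fC L st

     pick : ∀ {xs} → Dec (∃[ c ] c < k × Limit-is L xs c) → ℕ
     pick (yes (c , _)) = c
     pick (no _) = 0

     c : List ℕ → ℕ
     c xs = pick {xs} em

     c< : ∀ xs → c xs < k
     c< xs = go em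
      where
      go : (d : Dec (∃[ c ] c < k × Limit-is L xs c)) → pick d < k
      go (yes (_ , c< , _)) = c<
      go (no _) = ≤-trans (s≤s z≤n) (f< [] [])

     -- A limit colour that is not below k is a vacuous one.
     limit : ∀ j {xs} → xs ∈ prod (L j) → Limit-is L xs (c xs)
     limit j {xs} xs∈ = go em
      where
      small : Dec (∃[ c ] c < k × Limit-is L xs c) → ∃[ c ] c < k × Limit-is L xs c
      small (yes p) = p
      small (no ¬p) = let c , J , h = lim j xs∈ in 0 , ≤-trans (s≤s z≤n) (f< [] []) , J , λ j′ J≤ lf ins →
       ⊥-elim (¬p (c , subst (_< k) (h j′ J≤ lf ins) (f< xs _) , J , h))
      go : (d : Dec (∃[ c ] c < k × Limit-is L xs c)) → Limit-is L xs (pick d)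
      go (yes (_ , _ , l)) = l
      go (no ¬p) = ⊥-elim (¬p (small em))

     -- Tuples of `H` are tuples of levels of `L`, so the limit colour that strong cone avoidance
     -- makes constant on `H` is the eventual colour along `L`, and hence along `H`.
     conclusion : Conclusion
     conclusion =
      let i , l , β , β↓ , H , stH , mono , av = StrongAvoidance.theorem subforest C avoid c k c<
          stH′ , inL = lift-strong avoid β↓ stH
      in H , stH′ ,
       (λ C≤ → av (≤T-trans C≤ (⊑-join (⊑-trans up₁ (⊑-joinˡ X₁ (oracle (Union H)))) (⊑-joinʳ X₁ (oracle (Union H)))))) ,
       i , λ j {xs} xs∈ →
        let p , _ , h = inL j
            xs∈L = relocate {p} (over-tuple (Relocation.over F C C≰ f k f< fC H stH′ j) xs∈) (λ x∈ → h (∈-prod-concat {L = H j} xs∈ x∈))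
            J , hJ = subst (Limit-is L xs) (mono j xs∈) (limit p xs∈L)
        in J , λ j′ J≤ lf ins → let q , j′≤ , h′ = inL j′ in hJ q (≤-trans J≤ j′≤) lf (λ z∈ → h′ (ins z∈))

   abstract
    theorem : Conclusion
    theorem =
     let L , st , avoid , lim = CohesiveForcing.theorem F C C≰ f k f< fC in
     Go.conclusion L st avoid λ j xs∈ → let J , c , h = lim j xs∈ in c , J , h

  -- A computable selection of levels along which the eventual colour is attained at once.
  module Thinning {X₀ : Orc} (F : Forest X₀) (C : Pred ℕ 0ℓ) (C≰ : ¬ C ≤T ⌞ X₀ ⌟)
   (f : List ℕ → List ℕ → ℕ) (k : ℕ) (f< : ∀ xs ls → f xs ls < k)
   (fC : Cmp X₀ (list nat ⊗ list nat) nat (λ p → f (fst p) (snd p)))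
   (L : ℕ → Lev) (st : Forcing.Strong F C (map (_∷ []) (Forest.rs F)) L) (i : ℕ)
   (lim : ∀ j {xs} → xs ∈ prod (L j) → EventuallyConstant.Limit-is F C C≰ f k f< fC L xs i) where

   open Forest F
   open Forcing F C
   open Leaves F
   open Cohesive F C C≰ f k f< fC using (base; base-depth; root-tuple; leaf-bound)
   open Depths {base} {L} {0} base-depth st
   open Relocation F C C≰ f k f< fC L st

   entry state target : Ty
   entry = nat ⊗ lev
   state = entry ⊗ list entry
   target = nat ⊗ lev

   -- A decidable substitute for lying on one level of `L`: only the union of the levels is
   -- computable, but membership in it and equal depth determine the index.
   Guard : El entry → Set
   Guard (d , L′) = ∀ {x} → x ∈ concat L′ → x ∈ concatMap (dl d) rs × G x

   Rooted : ℕ × List ℕ → Set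
   Rooted (d , xs) = xs ∈ tup d rs × (∀ {x} → x ∈ xs → G x)

   Stable : List ℕ × Lev → Set
   Stable (xs , sel) = ∀ {n} → n ∈ below (suc (enc lev sel)) → ∀ {ls} → ls ∈ tup n (concatMap kd xs) →
    (∀ {z} → z ∈ ls → z ∈ concat sel) → f xs ls ≡ i

   -- `E` lists the levels chosen so far, and `sel` is to show the eventual colour with all their
   -- tuples. Finitely many tuples have reached that colour by some level, so `sel` exists, and it
   -- is found by search.
   Next : El state × El target → Set
   Next (((d , L′) , E) , m , sel) = Above m (kidsL L′) sel × (∀ {z} → z ∈ concat sel → G z) ×
    (∀ {p} → p ∈ E → ∀ {xs} → xs ∈ prod (snd p) → Rooted (fst p , xs) → Stable (xs , sel))

   private
    Q₁ : (El (list nat ⊗ lev) × ℕ) × List ℕ → Set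
    Q₁ (((xs , sel) , n) , ls) = (∀ {z} → z ∈ ls → z ∈ concat sel) → f xs ls ≡ i

   abstract
    d-guard : Deci X₁ entry Guard
    d-guard = d-all {t = nat} {Q = λ q → snd q ∈ concatMap (dl (fst (fst q))) rs × G (snd q)}
     (d-and (d-∈ nat (sndC idC) (concatMapC (dlC up₁ (fstC (fstC (fstC idC))) (sndC idC)) (constC (list nat) rs)))
      (d-sub dG (sndC idC)))
     (concatC (sndC idC))

    d-rooted : Deci X₁ (nat ⊗ list nat) Rooted
    d-rooted = d-and (d-∈ (list nat) (sndC idC) (tupC up₁ (fstC idC) (constC (list nat) rs)))
     (d-all {t = nat} {Q = λ q → G (snd q)} (d-sub dG (sndC idC)) (sndC idC))

    d-stable : Deci X₁ (list nat ⊗ lev) Stable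
    d-stable = d-all {t = nat} {Q = λ q → ∀ {ls} → ls ∈ tup (snd q) (concatMap kd (fst (fst q))) → Q₁ (q , ls)}
     (d-all {t = list nat} {Q = Q₁}
      (d-imp
       (d-all {t = nat} {Q = λ q → snd q ∈ concat (snd (fst (fst (fst q))))}
        (d-∈ nat (sndC idC) (concatC (sndC (fstC (fstC (fstC idC)))))) (sndC idC))
       (d-≡ nat (c-up up₁ fC ∘C pairC (fstC (fstC (fstC idC))) (sndC idC)) (constC nat i)))
      (tupC up₁ (sndC idC) (concatMapC (c-up up₁ kdC ∘C sndC idC) (fstC (fstC idC)))))
     (belowC (sucC (encC lev (sndC idC))))

    d-next : Deci X₁ (state ⊗ target) (λ q → Guard (fst (fst q)) → Next q)
    d-next = d-imp (d-sub d-guard (fstC (fstC idC)))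
     (d-and (d-above up₁ (fstC (sndC idC)) (kidsLC up₁ (sndC (fstC (fstC idC)))) (sndC (sndC idC)))
     (d-and (d-all {t = nat} {Q = λ q → G (snd q)} (d-sub dG (sndC idC)) (concatC (sndC (sndC idC))))
      (d-all {t = entry} {Q = λ q → ∀ {xs} → xs ∈ prod (snd (snd q)) → Rooted (fst (snd q) , xs) → Stable (xs , snd (snd (fst q)))}
       (d-all {t = list nat} {Q = λ q → Rooted (fst (snd (fst q)) , snd q) → Stable (snd q , snd (snd (fst (fst q))))}
        (d-imp (d-sub d-rooted (pairC (fstC (sndC (fstC idC))) (sndC idC)))
         (d-sub d-stable (pairC (sndC idC) (sndC (sndC (fstC (fstC idC)))))))
        (prodC (sndC (sndC idC))))
       (sndC (fstC idC)))))

   depth-dl : ∀ {d x} → x ∈ concatMap (dl d) rs → Depth d x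
   depth-dl {d} x∈ = let r , r∈ , x∈r = ∈-concatMap′ {f = dl d} rs x∈ in r , r∈ , ∈dl⁻ d x∈r

   one-level : ∀ p → Guard p → ∃[ j ] ∀ {x} → x ∈ concat (snd p) → x ∈ concat (L j)
   one-level (d , L′) g = go (concat L′) g
    where
    go : ∀ l → (∀ {x} → x ∈ l → x ∈ concatMap (dl d) rs × G x) → ∃[ j ] ∀ {x} → x ∈ l → x ∈ concat (L j)
    go []      h = 0 , λ ()
    go (x ∷ l) h =
     let x∈ , j , x∈j = h (here refl) in j , λ {y} y∈ →
     let y∈d , j′ , y∈j = h y∈ in
     subst (λ j → y ∈ concat (L j)) (gd-inj (trans (depth-unique (gd↓ j′ y∈j) (depth-dl {d} y∈d))
      (depth-unique (depth-dl {d} x∈) (gd↓ j x∈j)))) y∈j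

   next-exists : ∀ s → ∃[ t ] (Guard (fst s) → Next (s , t))
   next-exists ((d , L′) , E) = go em
    where
    Goal : Set
    Goal = ∃[ t ] (Guard (d , L′) → Next (((d , L′) , E) , t))
    go : Dec (Guard (d , L′)) → Goal
    go (no ¬g) = (0 , []) , λ g → ⊥-elim (¬g λ {x} → g {x})
    go (yes g) = (fst (st (suc j)) + fst (climb (suc j) J) , map (map t) (kidsL L′)) ,
     λ _ → pw-nested (λ _ → fst) chosen ,
     (λ z∈ → let y , _ , _ , h = pw-∈ʳ (pw-concat chosen) z∈ in J + suc j , h) ,
     λ {p} p∈ {xs} xs∈ r {n} n∈ {ls} ls∈ ins →
      snd late (∈-concatMap {f = λ p → map (p ,_) (prod (snd p))} p∈ (∈-map⁺ (p ,_) xs∈)) r (J + suc j) (m≤m+n J _)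
       (n , ∈tup⁻ n _ ls∈) (λ z∈ → let y , _ , _ , h = pw-∈ʳ (pw-concat chosen) (ins z∈) in h)
     where
     j : ℕ
     j = fst (one-level (d , L′) g)
     Late : El entry × List ℕ → ℕ → Set
     Late (p , xs) J = Rooted (fst p , xs) → ∀ j′ → J ≤ j′ → ∀ {ls} → Leaf xs ls → (∀ {z} → z ∈ ls → z ∈ concat (L j′)) → f xs ls ≡ i
     late-at : ∀ {a} → Dec (Rooted (fst (fst a) , snd a)) → ∃[ J ] Late a J
     late-at (no ¬r) = 0 , λ r → ⊥-elim (¬r r)
     late-at {(d′ , _) , xs} (yes (xs∈ , inG)) =
      let q , h = one-level (d′ , xs ∷ []) (λ x∈ → tup-dl x∈ , inG (un x∈))
          K , l = lim q {xs} (relocate {q} (pw-imp (λ e → _ , e) (∈tup⁻ d′ rs xs∈)) (λ x∈ → h (nu x∈)))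
      in K , λ _ → l
      where
      un : ∀ {x} → x ∈ concat (xs ∷ []) → x ∈ xs
      un {x} = subst (x ∈_) (++-identityʳ xs)

      nu : ∀ {x} → x ∈ xs → x ∈ concat (xs ∷ [])
      nu {x} = subst (x ∈_) (sym (++-identityʳ xs))
      tup-dl : ∀ {x} → x ∈ concat (xs ∷ []) → x ∈ concatMap (dl d′) rs
      tup-dl x∈ = let r , r∈ , e = pw-∈ʳ (∈tup⁻ d′ rs xs∈) (un x∈) in ∈-concatMap {f = dl d′} r∈ (∈dl⁺ e)
     late : ∃[ J ] ∀ {a} → a ∈ concatMap (λ p → map (p ,_) (prod (snd p))) E → Late a J
     late = bounded-∀ {P = Late} (λ m≤n h r j′ n≤ → h r j′ (≤-trans m≤n n≤)) _ (λ {a} _ → late-at {a} em)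
     J : ℕ
     J = fst late
     reach : ∀ {κ} → κ ∈ concat (kidsL L′) → ∃[ y ] Desc T (fst (st (suc j)) + fst (climb (suc j) J)) κ y × y ∈ concat (L (J + suc j))
     reach κ∈ =
      let z , z∈ , κz = ∈-concatMapʳ kd L′ κ∈
          w , w∈ , d₁ = next-node {j} (snd (one-level (d , L′) g) z∈) κz
          y , d₂ , y∈ = snd (climb (suc j) J) w∈
      in y , desc-trans d₁ d₂ , y∈
     R : ℕ → ℕ → Set
     R κ y = Desc T (fst (st (suc j)) + fst (climb (suc j) J)) κ y × y ∈ concat (L (J + suc j))
     choice : Σ (ℕ → ℕ) λ t → ∀ {κ} → κ ∈ concat (kidsL L′) → R κ (t κ)
     choice = choose {_∈ concat (kidsL L′)} {R} reach
     t : ℕ → ℕ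
     t = fst choice
     chosen : Pointwise (Pointwise R) (kidsL L′) (map (map t) (kidsL L′))
     chosen = pw-nested (λ {x} x∈ e → subst (R x) e (snd choice x∈)) (pw-graph (pw-graph {R = λ x y → t x ≡ y} (λ _ → refl)) (kidsL L′))

   abstract
    searched : Σ (El state → El target) λ F → Cmp X₁ state target F × (∀ s → Guard (fst s) → Next (s , F s))
    searched = search {X₁} {state} {target} {λ q → Guard (fst (fst q)) → Next q} d-next next-exists

   module Run (searched : Σ (El state → El target) λ F → Cmp X₁ state target F × (∀ s → Guard (fst s) → Next (s , F s))) where

    next : El state → El state
    next s = let t = fst searched s ; p = (fst (fst s) + 1) + fst t , snd t in p , p ∷ snd s

    states : ℕ → El state
    states n = nrec ((gd 0 , L 0) , (gd 0 , L 0) ∷ []) (λ _ s → next s) n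

    L′ : ℕ → Lev
    L′ n = snd (fst (states n))

    dep : ℕ → ℕ
    dep n = fst (fst (states n))

    guard : ∀ n → Guard (fst (states n))
    moves : ∀ n → Next (states n , fst searched (states n))
    guard zero x∈ = let r , r∈ , d = gd↓ 0 x∈ in ∈-concatMap {f = dl (gd 0)} r∈ (∈dl⁺ d) , 0 , x∈
    guard (suc n) x∈ =
     let ab , inG , _ = moves n
         κ , κ∈ , d = pw-∈ʳ (pw-concat ab) x∈
         z , z∈ , κz = ∈-concatMapʳ kd (L′ n) κ∈
         r , r∈ , e = depth-down (depth-down (depth-dl {dep n} (fst (guard n z∈))) (kid κz)) d
     in ∈-concatMap {f = dl (dep (suc n))} r∈ (∈dl⁺ e) , inG x∈
    moves n = snd (snd searched) (states n) (guard n)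

    strong′ : Strong base L′
    strong′ zero = st 0
    strong′ (suc n) = _ , fst (moves n)

    recorded : ∀ {j n} → j ≤ n → (dep j , L′ j) ∈ snd (states n)
    recorded {zero}  {zero}  z≤n = here refl
    recorded {j}     {suc n} j≤ with m≤n⇒m<n∨m≡n j≤
    ... | inj₁ j< = there (recorded (≤-pred j<))
    ... | inj₂ refl = here refl

    constant : ∀ {j n} → j < n → ∀ {xs} → xs ∈ prod (L′ j) → ∀ {ls} → Leaf xs ls → (∀ {z} → z ∈ ls → z ∈ concat (L′ n)) → f xs ls ≡ i
    constant {j} {suc n} (s≤s j≤n) {xs} xs∈ {ls} (m , ds) ins =
     let m′ , m′∈ , ls∈ = leaf-bound (L′ (suc n)) (λ κ∈ → let x , x∈ , κx = ∈-concatMap′ {f = kd} xs κ∈ in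
          _ , depth-down (at-depth (∈-prod-concat {L = L′ j} xs∈ x∈)) (kid κx)) ds ins
     in snd (snd (moves n)) (recorded j≤n) xs∈
      (∈tup⁺ (root-tuple at-depth (Relocation.over F C C≰ f k f< fC L′ strong′ j) xs∈) ,
       λ x∈ → snd (guard j (∈-prod-concat {L = L′ j} xs∈ x∈)))
      m′∈ ls∈ ins
     where
     at-depth : ∀ {x} → x ∈ concat (L′ j) → Depth (dep j) x
     at-depth x∈ = depth-dl {dep j} (fst (guard j x∈))

    abstract
     L′C : Cmp X₁ nat lev L′
     L′C = sndC (fstC (nrecC {t = state} (constC state ((gd 0 , L 0) , (gd 0 , L 0) ∷ []))
      (nextC ∘C sndC (sndC idC)) idC))
      where
      nextC : Cmp X₁ state state next
      nextC = pairC pC (consC pC (sndC idC))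
       where
       tC : Cmp X₁ state target (fst searched)
       tC = fst (snd searched)
       pC : Cmp X₁ state entry (λ s → (fst (fst s) + 1) + fst (fst searched s) , snd (fst searched s))
       pC = pairC (addC (addC (fstC (fstC idC)) (constC nat 1)) (fstC tC)) (sndC tC)

    -- The level with index `j` has depth at least `j`, so only levels with index up to `z` can
    -- contain `z`.
    union-computable : oracle (Union L′) ⊑ X₁
    union-computable = ≤T-trans oracle-≤T (deci⇒≤T (d-iff
     (λ z → (λ { (n , _ , z∈) → n , z∈ }) , λ { (n , z∈) → n , s≤s (≤-trans (D.j≤gd n) (depth≤ (D.gd↓ n z∈))) , z∈ })
     (d-∃< {Q = λ q → fst q ∈ concat (L′ (snd q))} (d-∈ nat (fstC idC) (concatC (L′C ∘C sndC idC))) (sucC idC))))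
     where module D = Depths {base} {L′} {0} base-depth strong′

  module Homogeneous {X₀ : Orc} (F : Forest X₀) (C : Pred ℕ 0ℓ) (C≰ : ¬ C ≤T ⌞ X₀ ⌟)
   (f : List ℕ → List ℕ → ℕ) (k : ℕ) (f< : ∀ xs ls → f xs ls < k)
   (fC : Cmp X₀ (list nat ⊗ list nat) nat (λ p → f (fst p) (snd p))) where

   open Forest F
   open Forcing F C
   open Leaves F

   private
    module Th (L : ℕ → Lev) (st : Strong (map (_∷ []) rs) L) (i : ℕ)
     (lim : ∀ j {xs} → xs ∈ prod (L j) → EventuallyConstant.Limit-is F C C≰ f k f< fC L xs i) =
     Thinning.Run F C C≰ f k f< fC L st i lim (Thinning.searched F C C≰ f k f< fC L st i lim)

   abstract
    theorem : Σ (ℕ → Lev) λ L → Strong (map (_∷ []) rs) L × ¬ C ≤T ⌞ join X₀ (oracle (Union L)) ⌟ ×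
     ∃[ i ] ∀ {j n} → j < n → ∀ {xs} → xs ∈ prod (L j) → ∀ {ls} → Leaf xs ls → (∀ {z} → z ∈ ls → z ∈ concat (L n)) → f xs ls ≡ i
    theorem =
     let L , st , avoid , i , lim = EventuallyConstant.theorem F C C≰ f k f< fC
     in Th.L′ L st i lim , Th.strong′ L st i lim ,
      (λ C≤ → avoid (≤T-trans C≤ (⊑-join (⊑-joinˡ X₀ (oracle (Union L))) (Th.union-computable L st i lim)))) ,
      i , Th.constant L st i lim

 -- Strong subtrees from level sets, and strong subtrees of height 2

 module StrongSubtrees where
  open ListLemmas
  open Computability using (least)
  open import Data.Bool.Base using (T)
  import Data.List.Membership.Propositional as List
  open import Data.List.Relation.Binary.Pointwise.Base using (Pointwise; []; _∷_)
  open import Data.List.Relation.Binary.Prefix.Heterogeneous using ([]; _∷_)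
  open import Data.List.Relation.Unary.All as All using (All; []; _∷_)
  open import Data.List.Relation.Unary.AllPairs using ([]; _∷_)
  open import Function.Bundles using (mk⇔; Equivalence)
  open import Relation.Nullary.Construct.Add.Supremum using ([_]; ⊤⁺)
  open import Relation.Binary.Construct.Add.Supremum.Strict _<_ using (_<⁺_; [_]; [_]<⊤⁺)
  open import Relation.Binary.Construct.Add.Supremum.NonStrict _≤_ using (_≤⁺_; [_]; _≤⊤⁺)

  ⪯-refl : ∀ {σ} → σ ⪯ σ
  ⪯-refl {[]} = []
  ⪯-refl {x ∷ σ} = refl ∷ ⪯-refl

  ⪯-trans : ∀ {σ τ υ} → σ ⪯ τ → τ ⪯ υ → σ ⪯ υ
  ⪯-trans []         q = []
  ⪯-trans (refl ∷ p) (refl ∷ q) = refl ∷ ⪯-trans p q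

  ⪯-antisym : ∀ {σ τ} → σ ⪯ τ → τ ⪯ σ → σ ≡ τ
  ⪯-antisym []         [] = refl
  ⪯-antisym (refl ∷ p) (_ ∷ q) = cong (_ ∷_) (⪯-antisym p q)

  ⪯-comparable : ∀ {σ τ υ} → σ ⪯ υ → τ ⪯ υ → σ ⪯ τ ⊎ τ ⪯ σ
  ⪯-comparable []         q = inj₁ []
  ⪯-comparable (e ∷ p)    [] = inj₂ []
  ⪯-comparable (refl ∷ p) (refl ∷ q) = [ inj₁ ∘ (refl ∷_) , inj₂ ∘ (refl ∷_) ]′ (⪯-comparable p q)

  ≺-length : ∀ {σ τ} → σ ≺ τ → length σ < length τ
  ≺-length {τ = []}    ([] , ne) = ⊥-elim (ne refl)
  ≺-length {τ = _ ∷ _} ([] , ne) = s≤s z≤n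
  ≺-length             (refl ∷ p , ne) = s≤s (≺-length (p , λ e → ne (cong (_ ∷_) e)))

  ⪯-cases : ∀ {σ τ} → σ ⪯ τ → σ ≡ τ ⊎ σ ≺ τ
  ⪯-cases {σ} {τ} p = go em
   where
   go : Dec (σ ≡ τ) → σ ≡ τ ⊎ σ ≺ τ
   go (yes e) = inj₁ e
   go (no ne) = inj₂ (p , ne)

  ≺-⪯-trans : ∀ {σ τ υ} → σ ≺ τ → τ ⪯ υ → σ ≺ υ
  ≺-⪯-trans (p , ne) q = ⪯-trans p q , λ { refl → ne (⪯-antisym p q) }

  ≺-irrefl : ∀ {σ τ} → σ ≺ τ → ¬ τ ⪯ σ
  ≺-irrefl (p , ne) q = ne (⪯-antisym p q)

  ∧-⪯ˡ : ∀ σ τ → σ ∧ τ ⪯ σ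
  ∧-⪯ˡ []      τ = []
  ∧-⪯ˡ (x ∷ σ) [] = []
  ∧-⪯ˡ (x ∷ σ) (y ∷ τ) with x ≡ᵇ y
  ... | true = refl ∷ ∧-⪯ˡ σ τ
  ... | false = []

  ∧-⪯ʳ : ∀ σ τ → σ ∧ τ ⪯ τ
  ∧-⪯ʳ []      τ = []
  ∧-⪯ʳ (x ∷ σ) [] = []
  ∧-⪯ʳ (x ∷ σ) (y ∷ τ) with x ≡ᵇ y in eq
  ... | true = ≡ᵇ⇒≡ x y (subst T (sym eq) _) ∷ ∧-⪯ʳ σ τ
  ... | false = []

  ∧-glb : ∀ {σ τ υ} → υ ⪯ σ → υ ⪯ τ → υ ⪯ σ ∧ τ
  ∧-glb []                   q = []
  ∧-glb {x ∷ σ} (refl ∷ p) (refl ∷ q) with x ≡ᵇ x in eq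
  ... | true = refl ∷ ∧-glb p q
  ... | false = ⊥-elim (subst T eq (≡⇒≡ᵇ x x refl))

  ∧-least : ∀ {σ τ} → σ ⪯ τ → σ ∧ τ ≡ σ
  ∧-least {σ} {τ} p = ⪯-antisym (∧-⪯ˡ σ τ) (∧-glb ⪯-refl p)

  prefixes : Str → List Str
  prefixes [] = [] ∷ []
  prefixes (x ∷ σ) = [] ∷ map (x ∷_) (prefixes σ)

  ∈-prefixes : ∀ {τ σ} → τ ⪯ σ → τ List.∈ prefixes σ
  ∈-prefixes {σ = []}    [] = here refl
  ∈-prefixes {σ = x ∷ σ} [] = here refl
  ∈-prefixes             (refl ∷ p) = there (∈-map⁺ (_ ∷_) (∈-prefixes p))

  unique-⊆ : ∀ {A : Set} {xs ys : List A} → Unique xs → (∀ {x} → x List.∈ xs → x List.∈ ys) → length xs ≤ length ys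
  unique-⊆ []                   h = z≤n
  unique-⊆ {xs = x ∷ xs} (x∉ ∷ u) h with ∈-∃++ (h (here refl))
  ... | as , bs , refl = subst (suc (length xs) ≤_)
   (trans (cong suc (length-++ as)) (sym (trans (length-++ as) (+-suc (length as) (length bs)))))
   (s≤s (unique-⊆ u λ {y} y∈ → drop (∈-++⁻ as (h (there y∈))) λ { refl → All.lookup x∉ y∈ refl }))
   where
   drop : ∀ {y} → y List.∈ as ⊎ y List.∈ (x ∷ bs) → ¬ y ≡ x → y List.∈ (as ++ bs)
   drop (inj₁ p)         ne = ∈-++⁺ˡ p
   drop (inj₂ (here e))  ne = ⊥-elim (ne e)
   drop (inj₂ (there p)) ne = ∈-++⁺ʳ as p

  fresh : ∀ {A : Set} {x : A} {xs} → ¬ x List.∈ xs → Unique xs → Unique (x ∷ xs)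
  fresh {xs = xs} x∉ u = All.tabulate (λ y∈ e → x∉ (subst (List._∈ xs) (sym e) y∈)) ∷ u

  pigeonhole-⊇ : ∀ {A : Set} {xs ys : List A} → Unique xs → (∀ {x} → x List.∈ xs → x List.∈ ys) → length ys ≤ length xs →
   ∀ {y} → y List.∈ ys → y List.∈ xs
  pigeonhole-⊇ u h le y∈ = by-contra em λ y∉ →
   <⇒≱ (unique-⊆ (fresh y∉ u) λ { (here refl) → y∈ ; (there x∈) → h x∈ }) le

  pw-unique : ∀ {A B : Set} {R : A → B → Set} {xs ys} → Unique xs → Pointwise R xs ys →
   (∀ {x x′ y} → x List.∈ xs → x′ List.∈ xs → R x y → R x′ y → x ≡ x′) → Unique ys
  pw-unique []       []       inj = []
  pw-unique (x∉ ∷ u) (r ∷ rs) inj =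
   All.tabulate (λ { y∈ refl → let x , x∈ , r′ = pw-∈ʳ rs y∈ in All.lookup x∉ x∈ (inj (here refl) (there x∈) r r′) })
   ∷ pw-unique u rs λ p q → inj (there p) (there q)

  enumerate : ∀ (X : Pred Str 0ℓ) σs → ∃[ τs ] Unique τs × (∀ {σ} → σ List.∈ τs → X σ × σ List.∈ σs) ×
   (∀ {σ} → σ List.∈ σs → X σ → σ List.∈ τs)
  enumerate X [] = [] , [] , (λ ()) , λ ()
  enumerate X (σ ∷ σs) = go em (enumerate X σs)
   where
   Result : List Str → Set
   Result σs = ∃[ τs ] Unique τs × (∀ {σ} → σ List.∈ τs → X σ × σ List.∈ σs) × (∀ {σ} → σ List.∈ σs → X σ → σ List.∈ τs)
   go : Dec (X σ) → Result σs → Result (σ ∷ σs)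
   go (no ¬x) (τs , u , f , g) = τs , u , (λ p → fst (f p) , there (snd (f p))) ,
    λ { (here refl) x → ⊥-elim (¬x x) ; (there p) x → g p x }
   go (yes x) (τs , u , f , g) = add em
    where
    add : Dec (σ List.∈ τs) → Result (σ ∷ σs)
    add (yes σ∈) = τs , u , (λ p → fst (f p) , there (snd (f p))) , λ { (here refl) _ → σ∈ ; (there p) x → g p x }
    add (no σ∉) = σ ∷ τs , fresh σ∉ u ,
     (λ { (here refl) → x , here refl ; (there p) → fst (f p) , there (snd (f p)) }) ,
     λ { (here refl) _ → here refl ; (there p) x → there (g p x) }

  finite-size : ∀ {X} → Finite X → ∃[ k ] HasSize k X
  finite-size {X} (σs , h) = let τs , u , f , g = enumerate X σs in
   length τs , τs , u , refl , (λ x → g (h x) x) , λ p → fst (f p)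

  size-≤ : ∀ {X Y : Pred Str 0ℓ} {m n} → (∀ {σ} → X σ → Y σ) → HasSize m X → HasSize n Y → m ≤ n
  size-≤ h (xs , u , refl , _ , q) (ys , _ , refl , p , _) = unique-⊆ u (λ x∈ → p (h (q x∈)))

  size-unique : ∀ {X m n} → HasSize m X → HasSize n X → m ≡ n
  size-unique p q = ≤-antisym (size-≤ id p q) (size-≤ id q p)

  size-add : ∀ {X Y : Pred Str 0ℓ} {m x} → ¬ X x → Y x → (∀ {σ} → X σ → Y σ) → (∀ {σ} → Y σ → σ ≡ x ⊎ X σ) →
   HasSize m X → HasSize (suc m) Y
  size-add ¬x y h k (xs , u , refl , p , q) = _ ∷ xs , fresh (¬x ∘ q) u , refl ,
   (λ yσ → [ (λ { refl → here refl }) , (λ xσ → there (p xσ)) ]′ (k yσ)) , λ { (here refl) → y ; (there σ∈) → h (q σ∈) }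

  size-transfer : ∀ {X Y : Pred Str 0ℓ} {k} (R : Str → Str → Set) →
   (∀ {x} → X x → ∃[ y ] Y y × R x y) → (∀ {y} → Y y → ∃[ x ] X x × R x y) →
   (∀ {x y y′} → X x → Y y → Y y′ → R x y → R x y′ → y ≡ y′) → (∀ {x x′ y} → X x → X x′ → Y y → R x y → R x′ y → x ≡ x′) →
   HasSize k X → HasSize k Y
  size-transfer {X} {Y} R f g func inj (xs , u , refl , p , q) =
   let ys , rs = images xs q in
   ys , pw-unique u rs (λ x∈ x′∈ (y , r) (_ , r′) → inj (q x∈) (q x′∈) y r r′) , sym (pw-length rs) ,
   (λ y → let x , xX , r = g y ; y′ , y′∈ , y′Y , r′ = pw-∈ˡ rs (p xX) in subst (List._∈ ys) (func xX y′Y y r′ r) y′∈) ,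
   λ y∈ → let _ , _ , y , _ = pw-∈ʳ rs y∈ in y
   where
   images : ∀ xs → (∀ {x} → x List.∈ xs → X x) → ∃[ ys ] Pointwise (λ x y → Y y × R x y) xs ys
   images []       h = [] , []
   images (x ∷ xs) h = let y , r = f (h (here refl)) ; ys , rs = images xs (h ∘ there) in y ∷ ys , r ∷ rs

  module TreeFacts {T : Pred Str 0ℓ} (t : IsTree T) where
   open IsTree t

   abstract
    level : ∀ σ → ∃[ m ] HasSize m (λ τ → T τ × τ ≺ σ)
    level σ = finite-size (prefixes σ , λ (_ , τ≺) → ∈-prefixes (fst τ≺))

    level-< : ∀ {σ τ m n} → σ ≺ τ → AtLevel T m σ → AtLevel T n τ → m < n
    level-< {σ} {τ} σ≺ (σ∈ , s) (_ , s′) = size-≤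
     {X = λ υ → (T υ × υ ≺ σ) ⊎ υ ≡ σ} (λ { (inj₁ (υ∈ , υ≺)) → υ∈ , ≺-⪯-trans υ≺ (fst σ≺) ; (inj₂ refl) → σ∈ , σ≺ })
     (size-add (λ (_ , σ≺σ) → ≺-irrefl σ≺σ ⪯-refl) (inj₂ refl) inj₁ (λ { (inj₁ p) → inj₂ p ; (inj₂ e) → inj₁ e }) s) s′

    level-≤ : ∀ {σ τ m n} → σ ⪯ τ → AtLevel T m σ → AtLevel T n τ → m ≤ n
    level-≤ σ⪯ l l′ with ⪯-cases σ⪯
    ... | inj₁ refl = ≤-reflexive (size-unique (snd l) (snd l′))
    ... | inj₂ σ≺ = <⇒≤ (level-< σ≺ l l′)

    level-≡ : ∀ {σ τ n} → σ ⪯ τ → AtLevel T n σ → AtLevel T n τ → σ ≡ τ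
    level-≡ σ⪯ l l′ with ⪯-cases σ⪯
    ... | inj₁ e = e
    ... | inj₂ σ≺ = ⊥-elim (<-irrefl refl (level-< σ≺ l l′))

    root-level : AtLevel T 0 root
    root-level = root∈ , [] , [] , refl , (λ (τ∈ , τ≺) → ⊥-elim (≺-irrefl τ≺ (root⪯ τ∈))) , λ ()

    kid-level : ∀ {σ κ m} → AtLevel T m σ → DirectExtensions T σ κ → AtLevel T (suc m) κ
    kid-level {σ} {κ} (σ∈ , s) (κ∈ , σ≺ , direct) = κ∈ , size-add (λ (_ , σ≺σ) → ≺-irrefl σ≺σ ⪯-refl) (σ∈ , σ≺)
     (λ (υ∈ , υ≺) → υ∈ , ≺-⪯-trans υ≺ (fst σ≺)) (λ (υ∈ , υ≺) → cases υ∈ υ≺ (⪯-comparable (fst υ≺) (fst σ≺))) s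
     where
     cases : ∀ {υ} → T υ → υ ≺ κ → υ ⪯ σ ⊎ σ ⪯ υ → υ ≡ σ ⊎ (T υ × υ ≺ σ)
     cases υ∈ υ≺ (inj₁ p) = [ inj₁ , (λ q → inj₂ (υ∈ , q)) ]′ (⪯-cases p)
     cases υ∈ υ≺ (inj₂ p) = [ inj₁ ∘ sym , (λ q → ⊥-elim (direct υ∈ q υ≺)) ]′ (⪯-cases p)

    direct-⪯ : ∀ {σ κ υ l} → DirectExtensions T σ κ → T υ → σ ≺ υ → κ ⪯ l → υ ⪯ l → κ ⪯ υ
    direct-⪯ (_ , _ , direct) υ∈ σ≺ κ⪯ υ⪯ with ⪯-comparable κ⪯ υ⪯
    ... | inj₁ p = p
    ... | inj₂ p with ⪯-cases p
    ...   | inj₁ refl = ⪯-refl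
    ...   | inj₂ q = ⊥-elim (direct υ∈ σ≺ q)

    direct-unique : ∀ {σ κ κ′ l} → DirectExtensions T σ κ → DirectExtensions T σ κ′ → κ ⪯ l → κ′ ⪯ l → κ ≡ κ′
    direct-unique d@(κ∈ , σ≺ , _) d′@(κ′∈ , σ≺′ , _) p q = ⪯-antisym (direct-⪯ d κ′∈ σ≺′ p q) (direct-⪯ d′ κ∈ σ≺ q p)

    parent-unique : ∀ {σ σ′ κ} → T σ → T σ′ → DirectExtensions T σ κ → DirectExtensions T σ′ κ → σ ≡ σ′
    parent-unique σ∈ σ′∈ (_ , σ≺ , d) (_ , σ′≺ , d′) with ⪯-comparable (fst σ≺) (fst σ′≺)
    ... | inj₁ p = [ id , (λ q → ⊥-elim (d σ′∈ q σ′≺)) ]′ (⪯-cases p)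
    ... | inj₂ p = [ sym , (λ q → ⊥-elim (d′ σ∈ q σ≺)) ]′ (⪯-cases p)

    first-kid : ∀ {σ τ} → T τ → σ ≺ τ → ∃[ κ ] DirectExtensions T σ κ × κ ⪯ τ
    first-kid {σ} {τ} τ∈ σ≺ = go (least (length τ , τ , refl , τ∈ , σ≺ , ⪯-refl))
     where
     P : ℕ → Set
     P n = ∃[ κ ] length κ ≡ n × T κ × σ ≺ κ × κ ⪯ τ
     go : (∃[ n ] P n × (∀ {m} → m < n → ¬ P m)) → ∃[ κ ] DirectExtensions T σ κ × κ ⪯ τ
     go (_ , (κ , refl , κ∈ , σ≺κ , κ⪯) , min) = κ , (κ∈ , σ≺κ , λ υ∈ σ≺υ υ≺ →
      min (≺-length υ≺) (_ , refl , υ∈ , σ≺υ , ⪯-trans (fst υ≺) κ⪯)) , κ⪯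

    -- Among the proper predecessors of `τ` in `T` above `σ`, the one closest to `τ` is taken, by
    -- minimizing the difference of lengths.
    parent : ∀ {σ τ} → T σ → T τ → σ ≺ τ → ∃[ π ] T π × DirectExtensions T π τ × σ ⪯ π
    parent {σ} {τ} σ∈ τ∈ σ≺ = go (least (length τ ∸ length σ , σ , σ∈ , σ≺ , ⪯-refl , m+[n∸m]≡n (<⇒≤ (≺-length σ≺))))
     where
     P : ℕ → Set
     P n = ∃[ π ] T π × π ≺ τ × σ ⪯ π × length π + n ≡ length τ
     go : (∃[ n ] P n × (∀ {m} → m < n → ¬ P m)) → ∃[ π ] T π × DirectExtensions T π τ × σ ⪯ π
     go (n , (π , π∈ , π≺ , σ⪯ , e) , min) = π , π∈ , (τ∈ , π≺ , λ {υ} υ∈ π≺υ υ≺ →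
      min (closer (≺-length π≺υ) (m+[n∸m]≡n (<⇒≤ (≺-length υ≺)))) (υ , υ∈ , υ≺ , ⪯-trans σ⪯ (fst π≺υ) , m+[n∸m]≡n (<⇒≤ (≺-length υ≺)))) , σ⪯
      where
      closer : ∀ {l m} → length π < l → l + m ≡ length τ → m < n
      closer {l} {m} lt e′ = ≰⇒> λ n≤m → <-irrefl (trans e (sym e′)) (+-mono-<-≤ lt n≤m)

  -- Strong subtrees are built from level sets: above each direct extension in T of a node of one level
  -- there is exactly one node of the next.
  module Build {T : Pred Str 0ℓ} (t : IsTree T) (leafless : ∀ {σ} → T σ → ∃[ κ ] DirectExtensions T σ κ)
   (α : Height) (0<α : [ 0 ] <⁺ α) (g : ℕ → ℕ) (g< : ∀ {n} → [ suc n ] <⁺ α → g n < g (suc n))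
   (Lv : ℕ → Pred Str 0ℓ) (ρ : Str) (ρ∈ : Lv 0 ρ) (ρ! : ∀ {σ} → Lv 0 σ → σ ≡ ρ)
   (lv : ∀ {n σ} → [ n ] <⁺ α → Lv n σ → AtLevel T (g n) σ)
   (up : ∀ {n σ κ} → [ suc n ] <⁺ α → Lv n σ → DirectExtensions T σ κ → ∃[ l ] Lv (suc n) l × κ ⪯ l)
   (up! : ∀ {n σ κ l l′} → [ suc n ] <⁺ α → Lv n σ → DirectExtensions T σ κ → Lv (suc n) l → Lv (suc n) l′ →
    κ ⪯ l → κ ⪯ l′ → l ≡ l′)
   (down : ∀ {n l} → [ suc n ] <⁺ α → Lv (suc n) l → ∃[ σ ] ∃[ κ ] Lv n σ × DirectExtensions T σ κ × κ ⪯ l)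
   where

   open IsTree t
   open TreeFacts t

   S : Pred Str 0ℓ
   S σ = ∃[ n ] [ n ] <⁺ α × Lv n σ

   <⁺-down : ∀ {n β} → [ suc n ] <⁺ β → [ n ] <⁺ β
   <⁺-down [ p ] = [ <⇒≤ p ]
   <⁺-down [ _ ]<⊤⁺ = [ _ ]<⊤⁺

   <⁺-next : ∀ {n β} → [ n ] <⁺ β → [ suc n ] ≢ β → [ suc n ] <⁺ β
   <⁺-next [ p ]        ne = [ ≤∧≢⇒< p (λ e → ne (cong [_] e)) ]
   <⁺-next [ _ ]<⊤⁺ ne = [ _ ]<⊤⁺

   g-mono : ∀ {m n} → m < n → [ n ] <⁺ α → g m < g n
   g-mono {m} {suc n} m< n<α with m≤n⇒m<n∨m≡n (≤-pred m<)
   ... | inj₁ lt = <-trans (g-mono lt (<⁺-down n<α)) (g< n<α)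
   ... | inj₂ refl = g< n<α

   lower : ∀ {m n σ τ} → [ m ] <⁺ α → Lv m σ → [ n ] <⁺ α → Lv n τ → σ ⪯ τ → m ≤ n
   lower m<α σ∈ n<α τ∈ p = ≮⇒≥ λ n<m → <⇒≱ (g-mono n<m m<α) (level-≤ p (lv m<α σ∈) (lv n<α τ∈))

   equal : ∀ {n σ τ} → [ n ] <⁺ α → Lv n σ → Lv n τ → σ ⪯ τ → σ ≡ τ
   equal n<α σ∈ τ∈ p = level-≡ p (lv n<α σ∈) (lv n<α τ∈)

   below-of : ∀ {m n σ τ l} → m ≤ n → [ n ] <⁺ α → Lv m σ → Lv n τ → [ m ] <⁺ α → σ ⪯ l → τ ⪯ l → σ ⪯ τ
   below-of m≤n n<α σ∈ τ∈ m<α p q with ⪯-comparable p q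
   ... | inj₁ r = r
   ... | inj₂ r with ≤-antisym m≤n (lower n<α τ∈ m<α σ∈ r)
   ...   | refl = subst (_ ⪯_) (sym (equal n<α τ∈ σ∈ r)) ⪯-refl

   ancestor : ∀ {i n l} → i ≤ n → [ n ] <⁺ α → Lv n l → ∃[ a ] Lv i a × a ⪯ l
   ancestor {i} {n} i≤n n<α l∈ with m≤n⇒m<n∨m≡n i≤n
   ... | inj₂ refl = _ , l∈ , ⪯-refl
   ancestor {i} {suc n} i≤n n<α l∈ | inj₁ (s≤s i≤) =
    let σ , κ , σ∈ , (_ , σ≺ , _) , κ⪯ = down n<α l∈
        a , a∈ , a⪯ = ancestor i≤ (<⁺-down n<α) σ∈
    in a , a∈ , ⪯-trans a⪯ (⪯-trans (fst σ≺) κ⪯)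

   -- `g` is increasing, so a predecessor of `l` has index at most `n` and is `σ` or lies below `σ`,
   -- the node from which `l` arises; the count goes up by one for `σ` itself.
   line : ∀ n {l} → [ n ] <⁺ α → Lv n l → HasSize n (λ τ → S τ × τ ≺ l)
   line zero n<α l∈ = [] , [] , refl ,
    (λ ((m , m<α , τ∈) , τ≺) → ⊥-elim (snd τ≺ (equal n<α (subst (λ m → Lv m _) (n≤0⇒n≡0 (lower m<α τ∈ n<α l∈ (fst τ≺))) τ∈) l∈ (fst τ≺)))) , λ ()
   line (suc n) {l} n<α l∈ =
    let σ , κ , σ∈ , (_ , σ≺κ , _) , κ⪯ = down n<α l∈
        σ≺ = ≺-⪯-trans σ≺κ κ⪯
        n<α′ = <⁺-down n<α
    in size-add {X = λ τ → S τ × τ ≺ σ} {Y = λ τ → S τ × τ ≺ l} (λ (_ , r) → ≺-irrefl r ⪯-refl) ((n , n<α′ , σ∈) , σ≺) (λ (s , r) → s , ≺-⪯-trans r (fst σ≺))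
     (λ ((m , m<α , τ∈) , τ≺) → cases m<α τ∈ n<α′ σ∈ (below-of
      (≤-pred (≤∧≢⇒< (lower m<α τ∈ n<α l∈ (fst τ≺)) λ { refl → snd τ≺ (equal n<α τ∈ l∈ (fst τ≺)) }))
      n<α′ τ∈ σ∈ m<α (fst τ≺) (fst σ≺)))
     (line n n<α′ σ∈)
    where
    cases : ∀ {m τ σ} → [ m ] <⁺ α → Lv m τ → [ n ] <⁺ α → Lv n σ → τ ⪯ σ → τ ≡ σ ⊎ (S τ × τ ≺ σ)
    cases m<α τ∈ n<α σ∈ p = [ inj₁ , (λ q → inj₂ ((_ , m<α , τ∈) , q)) ]′ (⪯-cases p)

   at-level : ∀ {m σ} → AtLevel S m σ → [ m ] <⁺ α × Lv m σ
   at-level ((n , n<α , σ∈) , s) with size-unique s (line n n<α σ∈)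
   ... | refl = n<α , σ∈

   -- Induction on the level of `l`, which arises from `σ` through the direct extension `κ`. If `σ`
   -- is not below `l′`, the meet is that of `σ` and `l′`. If `σ` is but `κ` is not, the meet is
   -- `σ`. If `κ` is, uniqueness above `κ` puts `l` itself below `l′`.
   meets : ∀ m {n l l′} → [ m ] <⁺ α → Lv m l → [ n ] <⁺ α → Lv n l′ → S (l ∧ l′)
   meets zero {n} {l} {l′} m<α l∈ n<α l′∈ =
    let a , a∈ , a⪯ = ancestor z≤n n<α l′∈ in
    subst S (sym (∧-least (subst (_⪯ l′) (trans (ρ! a∈) (sym (ρ! l∈))) a⪯))) (0 , m<α , l∈)
   meets (suc m) {n} {l} {l′} m<α l∈ n<α l′∈ = go em em
    where
    d = down m<α l∈
    σ = fst d
    κ = fst (snd d)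
    σ∈ : Lv m σ
    σ∈ = fst (snd (snd d))
    κd : DirectExtensions T σ κ
    κd = fst (snd (snd (snd d)))
    κ⪯ : κ ⪯ l
    κ⪯ = snd (snd (snd (snd d)))
    σ⪯ : σ ⪯ l
    σ⪯ = ⪯-trans (fst (fst (snd κd))) κ⪯
    m<α′ = <⁺-down m<α
    go : Dec (σ ⪯ l′) → Dec (κ ⪯ l′) → S (l ∧ l′)
    go (no σ⋠) _ = subst S (⪯-antisym (∧-glb (⪯-trans (∧-⪯ˡ σ l′) σ⪯) (∧-⪯ʳ σ l′))
     (∧-glb (short (⪯-comparable (∧-⪯ˡ l l′) σ⪯)) (∧-⪯ʳ l l′))) (meets m m<α′ σ∈ n<α l′∈)
     where
     short : l ∧ l′ ⪯ σ ⊎ σ ⪯ l ∧ l′ → l ∧ l′ ⪯ σ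
     short (inj₁ p) = p
     short (inj₂ p) = ⊥-elim (σ⋠ (⪯-trans p (∧-⪯ʳ l l′)))
    go (yes σ⪯′) (no κ⋠) = subst S (at-σ (⪯-cases (∧-glb σ⪯ σ⪯′))) (m , m<α′ , σ∈)
     where
     at-σ : σ ≡ l ∧ l′ ⊎ σ ≺ l ∧ l′ → σ ≡ l ∧ l′
     at-σ (inj₁ e) = e
     at-σ (inj₂ σ≺) = ⊥-elim (κ⋠ (⪯-trans (direct-⪯ κd (meet-closed (fst (lv m<α l∈)) (fst (lv n<α l′∈))) σ≺ κ⪯ (∧-⪯ˡ l l′)) (∧-⪯ʳ l l′)))
    go (yes σ⪯′) (yes κ⪯′) =
     let m<n : m < n
         m<n = ≤∧≢⇒< (lower m<α′ σ∈ n<α l′∈ σ⪯′) λ { refl → ≺-irrefl (fst (snd κd)) (subst (κ ⪯_) (sym (equal n<α σ∈ l′∈ σ⪯′)) κ⪯′) }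
         a , a∈ , a⪯ = ancestor m<n n<α l′∈
         σ⪯a = below-of (n≤1+n m) m<α σ∈ a∈ m<α′ σ⪯′ a⪯
         σ≺a = σ⪯a , λ e → <-irrefl (size-unique (snd (lv m<α′ σ∈)) (subst (λ z → HasSize (g (suc m)) (λ τ → T τ × τ ≺ z)) (sym e) (snd (lv m<α a∈)))) (g< m<α)
         κ⪯a = direct-⪯ κd (fst (lv m<α a∈)) σ≺a κ⪯′ a⪯
     in subst S (sym (∧-least (subst (_⪯ l′) (up! m<α σ∈ κd a∈ l∈ κ⪯a κ⪯) a⪯))) (suc m , m<α , l∈)

   direct⁻ : ∀ {n σ l} → [ n ] <⁺ α → Lv n σ → DirectExtensions S σ l →
    [ suc n ] <⁺ α × Lv (suc n) l × ∃[ κ ] DirectExtensions T σ κ × κ ⪯ l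
   direct⁻ {n} {σ} {l} n<α σ∈ ((j , j<α , l∈) , σ≺ , direct) = go j j<α l∈
    (≤∧≢⇒< (lower n<α σ∈ j<α l∈ (fst σ≺)) λ { refl → snd σ≺ (equal n<α σ∈ l∈ (fst σ≺)) })
    where
    go : ∀ j → [ j ] <⁺ α → Lv j l → n < j → [ suc n ] <⁺ α × Lv (suc n) l × ∃[ κ ] DirectExtensions T σ κ × κ ⪯ l
    go (suc j) j<α l∈ (s≤s n≤j) with down j<α l∈
    ... | σ′ , κ , σ′∈ , κd , κ⪯ = finish (m≤n⇒m<n∨m≡n n≤j)
     where
     j<α′ = <⁺-down j<α
     σ⪯′ : σ ⪯ σ′
     σ⪯′ = below-of n≤j j<α′ σ∈ σ′∈ n<α (fst σ≺) (⪯-trans (fst (fst (snd κd))) κ⪯)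
     finish : n < j ⊎ n ≡ j → [ suc n ] <⁺ α × Lv (suc n) l × ∃[ κ ] DirectExtensions T σ κ × κ ⪯ l
     finish (inj₁ n<j) = ⊥-elim (direct (j , j<α′ , σ′∈)
      (σ⪯′ , λ { refl → <⇒≱ n<j (lower j<α′ σ′∈ n<α σ∈ ⪯-refl) }) (≺-⪯-trans (fst (snd κd)) κ⪯))
     finish (inj₂ refl) = j<α , l∈ , κ , subst (λ z → DirectExtensions T z κ) (sym (equal n<α σ∈ σ′∈ σ⪯′)) κd , κ⪯

   direct⁺ : ∀ {n σ κ l} → [ suc n ] <⁺ α → Lv n σ → DirectExtensions T σ κ → Lv (suc n) l → κ ⪯ l → DirectExtensions S σ l
   direct⁺ {n} n<α σ∈ (_ , σ≺ , _) l∈ κ⪯ = (_ , n<α , l∈) , ≺-⪯-trans σ≺ κ⪯ , λ (j , j<α , υ∈) σ≺υ υ≺l →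
    let n<j = ≤∧≢⇒< (lower (<⁺-down n<α) σ∈ j<α υ∈ (fst σ≺υ)) λ { refl → snd σ≺υ (equal j<α σ∈ υ∈ (fst σ≺υ)) }
        j< = ≤∧≢⇒< (lower j<α υ∈ n<α l∈ (fst υ≺l)) λ { refl → snd υ≺l (equal j<α υ∈ l∈ (fst υ≺l)) }
    in <⇒≱ n<j (≤-pred j<)

   nonempty : ∀ n → [ n ] <⁺ α → ∃[ σ ] Lv n σ
   nonempty zero    _ = ρ , ρ∈
   nonempty (suc n) n<α =
    let σ , σ∈ = nonempty n (<⁺-down n<α)
        κ , κd = leafless (fst (lv (<⁺-down n<α) σ∈))
        l , l∈ , _ = up n<α σ∈ κd
    in l , l∈

   least-height : ∀ {β} → ExceedsLevels S β → α ≤⁺ β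
   least-height = go α (λ n n<α → let σ , σ∈ = nonempty n n<α in σ , (n , n<α , σ∈) , line n n<α σ∈)
    where
    go : ∀ α′ → (∀ n → [ n ] <⁺ α′ → ∃[ σ ] AtLevel S n σ) → ∀ {β} → ExceedsLevels S β → α′ ≤⁺ β
    go _           _ {⊤⁺}    _ = _ ≤⊤⁺
    go ⊤⁺          h {[ b ]} e with e (snd (h b [ b ]<⊤⁺))
    ... | [ p ] = ⊥-elim (<-irrefl refl p)
    go [ zero ]    h {[ b ]} e = [ z≤n ]
    go [ suc a ]   h {[ b ]} e with e (snd (h a [ ≤-refl ]))
    ... | [ p ] = [ p ]

   branching⁻ : ∀ {n σ k} → [ suc n ] <⁺ α → Lv n σ → Branching k S σ → Branching k T σ
   branching⁻ n<α σ∈ = size-transfer (λ l κ → κ ⪯ l)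
    (λ l → let _ , _ , κ , κd , κ⪯ = direct⁻ (<⁺-down n<α) σ∈ l in κ , κd , κ⪯)
    (λ κd → let l , l∈ , κ⪯ = up n<α σ∈ κd in l , direct⁺ n<α σ∈ κd l∈ κ⪯ , κ⪯)
    (λ _ κd κd′ p q → direct-unique κd κd′ p q)
    (λ l l′ κd p q → up! n<α σ∈ κd (fst (snd (direct⁻ (<⁺-down n<α) σ∈ l))) (fst (snd (direct⁻ (<⁺-down n<α) σ∈ l′))) p q)

   branching⁺ : ∀ {n σ k} → [ suc n ] <⁺ α → Lv n σ → Branching k T σ → Branching k S σ
   branching⁺ n<α σ∈ = size-transfer _⪯_
    (λ κd → let l , l∈ , κ⪯ = up n<α σ∈ κd in l , direct⁺ n<α σ∈ κd l∈ κ⪯ , κ⪯)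
    (λ l → let _ , _ , κ , κd , κ⪯ = direct⁻ (<⁺-down n<α) σ∈ l in κ , κd , κ⪯)
    (λ κd l l′ p q → up! n<α σ∈ κd (fst (snd (direct⁻ (<⁺-down n<α) σ∈ l))) (fst (snd (direct⁻ (<⁺-down n<α) σ∈ l′))) p q)
    (λ κd κd′ _ p q → direct-unique κd κd′ p q)

   abstract
    strong : IsStrongSubtree α g S T
    strong = record
     { isTree = record
      { root = ρ
      ; root∈ = 0 , 0<α , ρ∈
      ; root⪯ = λ (n , n<α , σ∈) → let a , a∈ , a⪯ = ancestor z≤n n<α σ∈ in subst (_⪯ _) (ρ! a∈) a⪯
      ; meet-closed = λ (m , m<α , l∈) (n , n<α , l′∈) → meets m m<α l∈ n<α l′∈
      ; finite-ext = λ (n , n<α , σ∈) → fin n<α σ∈ em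
      }
     ; height = (λ σ∈ → fst (at-level σ∈)) , least-height
     ; ⊆T = λ (n , n<α , σ∈) → fst (lv n<α σ∈)
     ; levels = λ _ σ∈ → let m<α , σ∈′ = at-level σ∈ in lv m<α σ∈′
     ; branching = λ σ∈ ne k → let m<α , σ∈′ = at-level σ∈ ; n<α = <⁺-next m<α ne in
      mk⇔ (branching⁻ n<α σ∈′) (branching⁺ n<α σ∈′)
     }
     where
     fin : ∀ {n σ} → [ n ] <⁺ α → Lv n σ → Dec ([ suc n ] <⁺ α) → Finite (DirectExtensions S σ)
     fin n<α σ∈ (no ¬p) = [] , λ l → ⊥-elim (¬p (fst (direct⁻ n<α σ∈ l)))
     fin n<α σ∈ (yes n<α′) = let k , s = finite-size (finite-ext (fst (lv n<α σ∈)))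
                                 ls , _ , _ , h , _ = branching⁺ n<α′ σ∈ s in ls , h

  -- A strong subtree of height 2 has, besides its root, one node above each direct extension of the root.
  module Height2 {T U : Pred Str 0ℓ} (t : IsTree T) {g : ℕ → ℕ} (u : IsStrongSubtree [ 2 ] g U T) where
   private
    module T = IsTree t
    module U = IsStrongSubtree u
    module UT = IsTree U.isTree
    module UF = TreeFacts U.isTree
   open TreeFacts t

   abstract
    ρ : Str
    ρ = UT.root

    ρ∈ : U ρ
    ρ∈ = UT.root∈

    ρ⪯ : ∀ {σ} → U σ → ρ ⪯ σ
    ρ⪯ = UT.root⪯

    ρ-level : AtLevel T (g 0) ρ
    ρ-level = U.levels [ s≤s z≤n ] UF.root-level

    others : ∀ {σ} → U σ → ¬ ρ ≡ σ → AtLevel U 1 σ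
    others {σ} σ∈ ne = go (UF.level σ)
     where
     go : (∃[ m ] HasSize m (λ τ → U τ × τ ≺ σ)) → AtLevel U 1 σ
     go (m , s) with fst U.height (σ∈ , s)
     ... | [ m<2 ] with ≤-antisym (≤-pred m<2) (UF.level-< (ρ⪯ σ∈ , ne) UF.root-level (σ∈ , s))
     ...   | refl = σ∈ , s

    leaf-direct : ∀ {σ} → U σ → ¬ ρ ≡ σ → DirectExtensions U ρ σ
    leaf-direct σ∈ ne = σ∈ , (ρ⪯ σ∈ , ne) , λ υ∈ ρ≺ υ≺ →
     <-irrefl refl (UF.level-< υ≺ (others υ∈ (snd ρ≺)) (others σ∈ ne))

    leaf-level : ∀ {σ} → U σ → ¬ ρ ≡ σ → AtLevel T (g 1) σ
    leaf-level σ∈ ne = U.levels [ s≤s (s≤s z≤n) ] (others σ∈ ne)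

    leaf-kid : ∀ {σ} → U σ → ¬ ρ ≡ σ → ∃[ κ ] DirectExtensions T ρ κ × κ ⪯ σ
    leaf-kid σ∈ ne = first-kid (U.⊆T σ∈) (ρ⪯ σ∈ , ne)

    -- The meet of the two nodes belongs to `U` and lies strictly above the root, while no node of
    -- `U` lies strictly between the root and a leaf.
    leaf-unique : ∀ {κ σ τ} → ρ ≺ κ → U σ → U τ → κ ⪯ σ → κ ⪯ τ → σ ≡ τ
    leaf-unique {κ} {σ} {τ} ρ≺ σ∈ τ∈ p q = go (⪯-cases (∧-⪯ˡ σ τ)) (⪯-cases (∧-⪯ʳ σ τ))
     where
     ρ≺∧ : ρ ≺ σ ∧ τ
     ρ≺∧ = ≺-⪯-trans ρ≺ (∧-glb p q)
     ne : ∀ {υ} → κ ⪯ υ → ¬ ρ ≡ υ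
     ne r = snd (≺-⪯-trans ρ≺ r)
     go : σ ∧ τ ≡ σ ⊎ σ ∧ τ ≺ σ → σ ∧ τ ≡ τ ⊎ σ ∧ τ ≺ τ → σ ≡ τ
     go (inj₂ r) _ = ⊥-elim (snd (snd (leaf-direct σ∈ (ne p))) (UT.meet-closed σ∈ τ∈) ρ≺∧ r)
     go _        (inj₂ r) = ⊥-elim (snd (snd (leaf-direct τ∈ (ne q))) (UT.meet-closed σ∈ τ∈) ρ≺∧ r)
     go (inj₁ e) (inj₁ e′) = trans (sym e) e′

    -- Counting: the root has equally many direct extensions in `U` and in `T`, and sending a leaf
    -- to the direct extension in `T` below it is injective, hence onto.
    leaf : ∀ {κ} → DirectExtensions T ρ κ → ∃[ σ ] U σ × κ ⪯ σ
    leaf {κ} κd = go (finite-size (T.finite-ext (fst ρ-level)))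
     where
     R : Str → Str → Set
     R l κ = κ ⪯ l
     images : ∀ xs → (∀ {x} → x List.∈ xs → DirectExtensions U ρ x) → ∃[ ys ] Pointwise (λ l κ → DirectExtensions T ρ κ × κ ⪯ l) xs ys
     images []       h = [] , []
     images (x ∷ xs) h =
      let x∈ , (p , ne) , _ = h (here refl) ; y , r = leaf-kid x∈ ne ; ys , rs = images xs (h ∘ there) in y ∷ ys , r ∷ rs
     go : (∃[ k ] Branching k T ρ) → ∃[ σ ] U σ × κ ⪯ σ
     go (k , b@(κs , _ , lenκ , fκ , gκ)) with Equivalence.from (U.branching UF.root-level (λ ()) k) b
     ... | us , uu , lenu , fu , gu =
      let ys , rs = images us gu
          y∈ = pigeonhole-⊇ (pw-unique uu rs (λ { x∈ x′∈ ((_ , ρ≺ , _) , p) (_ , q) → leaf-unique ρ≺ (fst (gu x∈)) (fst (gu x′∈)) p q }))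
           (λ y∈ → let _ , _ , d , _ = pw-∈ʳ rs y∈ in fκ d) (≤-reflexive (trans lenκ (trans (sym lenu) (pw-length rs)))) (fκ κd)
          x , x∈ , _ , p = pw-∈ʳ rs y∈
      in x , fst (gu x∈) , p

 -- An instance as a computable forest

 module InstanceForests where
  open ListLemmas
  open HalpernLauchli
  open Programs
  open TypedPrograms
  open Computability
  open Forests
  open ForcingConditions using (when; whenC)
  open HomogeneousSubforest using (when-yes; when-no)
  open OneDimensional using (encC)
  open StrongSubtrees
  open import Data.Fin.Base as Fin using (Fin; toℕ)
  open import Data.Fin.Properties using (toℕ-injective)
  import Data.List.Membership.Propositional as List
  open import Data.List.Relation.Binary.Prefix.Heterogeneous using ([]; _∷_)
  open import Data.List.Relation.Unary.All as All using (All; []; _∷_)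
  open import Data.List.Relation.Unary.AllPairs using ([]; _∷_)
  import Data.List.Relation.Unary.Unique.Propositional.Properties as Uniq
  open import Data.Nat.Divisibility using (divides)
  open import Data.Nat.DivMod
  open import Data.Vec.Base as Vec using (Vec; toList; tabulate; lookup)
  open import Data.Vec.Properties using (lookup∘tabulate)
  open import Function.Bundles using (mk⇔; Func; Equivalence)
  open import Relation.Nullary.Construct.Add.Supremum using ([_])
  open import Relation.Binary.Construct.Add.Supremum.Strict _<_ using (_<⁺_; [_])

  nrec-shift : ∀ {A : Set} (h : A → A) z n → nrec (h z) (λ _ → h) n ≡ h (nrec z (λ _ → h) n)
  nrec-shift h z zero = refl
  nrec-shift h z (suc n) = cong h (nrec-shift h z n)

  -- Binary digits and canonical indices

  half≡/2 : ∀ n → half n ≡ n / 2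
  half≡/2 n with parity n
  ... | inj₁ (_ , e) = sym (trans (cong (_/ 2) (trans e (*-comm 2 (half n)))) (m*n/n≡m (half n) 2))
  ... | inj₂ (_ , e) = sym (trans (cong (_/ 2) (trans e (cong suc (*-comm 2 (half n)))))
   (trans (+-distrib-/-∣ʳ 1 {half n * 2} {2} (divides (half n) refl)) (m*n/n≡m (half n) 2)))

  par≡%2 : ∀ n → par n ≡ n % 2
  par≡%2 n with parity n
  ... | inj₁ (p , e) = trans p (sym (trans (cong (_% 2) (trans e (*-comm 2 (half n)))) ([m+kn]%n≡m%n 0 (half n) 2)))
  ... | inj₂ (p , e) = trans p (sym (trans (cong (_% 2) (trans e (cong suc (*-comm 2 (half n))))) ([m+kn]%n≡m%n 1 (half n) 2)))

  -- Replaces the quotient and remainder in `finiteSet` by iterated halving, which is visibly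
  -- computable.
  digit : ℕ → ℕ → ℕ
  digit u e = par (nrec u (λ _ → half) e)

  shifted : ∀ u e → nrec u (λ _ → half) e ≡ _/_ u (2 ^ e) {{m^n≢0 2 e}}
  shifted u zero = sym (n/1≡n u)
  shifted u (suc e) = trans (half≡/2 (nrec u (λ _ → half) e)) (trans (cong (_/ 2) (shifted u e))
   (trans (m/n/o≡m/[n*o] u (2 ^ e) 2 {{m^n≢0 2 e}} {{_}} {{m*n≢0 (2 ^ e) 2 {{m^n≢0 2 e}}}})
    (/-congʳ {m = u} {{m*n≢0 (2 ^ e) 2 {{m^n≢0 2 e}}}} {{m^n≢0 2 (suc e)}} (*-comm (2 ^ e) 2))))

  digit-set : ∀ u σ → (finiteSet u σ → digit u (encode σ) ≡ 1) × (digit u (encode σ) ≡ 1 → finiteSet u σ)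
  digit-set u σ = trans e , trans (sym e)
   where
   e : digit u (encode σ) ≡ (_/_ u (2 ^ encode σ) {{m^n≢0 2 (encode σ)}}) % 2
   e = trans (par≡%2 (nrec u (λ _ → half) (encode σ))) (cong (_% 2) (shifted u (encode σ)))

  half≤ : ∀ n → half n ≤ n ∸ 1
  half≤ zero = z≤n
  half≤ (suc n) = lem (parity n)
   where
   lem : _ → half n + par n ≤ n
   lem (inj₁ (p , e)) = ≤-trans (≤-reflexive (trans (cong (half n +_) p) (+-identityʳ _))) (≤-trans (m≤m+n (half n) _) (≤-reflexive (sym e)))
   lem (inj₂ (p , e)) = ≤-trans (≤-reflexive (trans (cong (half n +_) p) (+-comm (half n) 1))) (≤-trans (s≤s (m≤m+n (half n) _)) (≤-reflexive (sym e)))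

  digit< : ∀ u e → digit u e ≡ 1 → e < u
  digit< u e d = m∸n≢0⇒n<m (λ z → absurd (n≤0⇒n≡0 (≤-trans (small e) (≤-reflexive z))))
   where
   small : ∀ e → nrec u (λ _ → half) e ≤ u ∸ e
   small zero = ≤-refl
   small (suc e) = ≤-trans (half≤ (nrec u (λ _ → half) e)) (≤-trans (∸-monoˡ-≤ 1 (small e)) (≤-reflexive (trans (∸-+-assoc u e 1) (cong (u ∸_) (+-comm e 1)))))
   absurd : ¬ nrec u (λ _ → half) e ≡ 0
   absurd z with trans (sym d) (cong par z)
   ... | ()

  canonical : ∀ N (P : ℕ → Set) → (∀ {e} → P e → e < N) → ∃[ u ] ∀ e → (P e → digit u e ≡ 1) × (digit u e ≡ 1 → P e)
  canonical zero    P b = 0 , λ e → (λ p → ⊥-elim (n≮0 (b p))) , λ d → ⊥-elim (n≮0 (digit< 0 e d))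
  canonical (suc N) P b = go em (canonical N (P ∘ suc) (≤-pred ∘ b))
   where
   deeper : ∀ u e → digit u (suc e) ≡ digit (half u) e
   deeper u e = cong par (sym (nrec-shift half u e))
   go : Dec (P 0) → (∃[ u ] ∀ e → (P (suc e) → digit u e ≡ 1) × (digit u e ≡ 1 → P (suc e))) →
    ∃[ u ] ∀ e → (P e → digit u e ≡ 1) × (digit u e ≡ 1 → P e)
   go (yes p) (u , h) = suc (2 * u) , λ
    { zero → (λ _ → fst (par-half-odd u)) , λ _ → p
    ; (suc e) → let q = trans (deeper (suc (2 * u)) e) (cong (λ z → digit z e) (snd (par-half-odd u))) in
     (λ x → trans q (fst (h e) x)) , λ d → snd (h e) (trans (sym q) d) }
   go (no ¬p) (u , h) = 2 * u , λ
    { zero → (λ p → ⊥-elim (¬p p)) , λ d → ⊥-elim (0≢1+n (trans (sym (fst (par-half-even u))) d))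
    ; (suc e) → let q = trans (deeper (2 * u) e) (cong (λ z → digit z e) (snd (par-half-even u))) in
     (λ x → trans q (fst (h e) x)) , λ d → snd (h e) (trans (sym q) d) }

  -- Codes of strings

  pair-mono : ∀ x {y y′} → y < y′ → pair x y < pair x y′
  pair-mono x {y} {y′} lt = +-mono-≤-< (/-monoˡ-≤ 2 (*-mono-≤ x+≤ (s≤s x+≤))) lt
   where
   x+≤ : x + y ≤ x + y′
   x+≤ = +-monoʳ-≤ x (<⇒≤ lt)

  encode-< : ∀ {σ τ} → σ ≺ τ → encode σ < encode τ
  encode-< {τ = []}    ([] , ne) = ⊥-elim (ne refl)
  encode-< {τ = _ ∷ _} ([] , ne) = s≤s z≤n
  encode-< {x ∷ σ} (refl ∷ p , ne) = s≤s (pair-mono x (encode-< (p , λ e → ne (cong (_ ∷_) e))))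

  encode-≤ : ∀ {σ τ} → σ ⪯ τ → encode σ ≤ encode τ
  encode-≤ p = [ (λ { refl → ≤-refl }) , (λ q → <⇒≤ (encode-< q)) ]′ (⪯-cases p)

  str : ℕ → Str
  str = dec (list nat)

  str-encode : ∀ σ → str (encode σ) ≡ σ
  str-encode σ = trans (cong str (encode≡encs σ)) (dec-enc (list nat) σ)

  encode-str : ∀ n → encode (str n) ≡ n
  encode-str n = trans (encode≡encs (str n)) (enc-dec (list nat) n)

  encode-inj : ∀ {σ τ} → encode σ ≡ encode τ → σ ≡ τ
  encode-inj {σ} {τ} e = trans (sym (str-encode σ)) (trans (cong str e) (str-encode τ))

  ∈-prefixes⁻ : ∀ {τ} σ → τ List.∈ prefixes σ → τ ⪯ σ
  ∈-prefixes⁻ []      (here refl) = []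
  ∈-prefixes⁻ (x ∷ σ) (here refl) = []
  ∈-prefixes⁻ (x ∷ σ) (there τ∈) with ∈-map⁻ (x ∷_) τ∈
  ... | υ , υ∈ , refl = refl ∷ ∈-prefixes⁻ σ υ∈

  nth : List ℕ → ℕ → ℕ
  nth us i = listCase 0 (λ x _ → x) (nrec us (λ _ → listCase [] (λ _ l → l)) i)

  nth-toList : ∀ {n} (v : Vec ℕ n) i → nth (toList v) (toℕ i) ≡ lookup v i
  nth-toList (x Vec.∷ v) Fin.zero = refl
  nth-toList (x Vec.∷ v) (Fin.suc i) = trans
   (cong (listCase 0 (λ x _ → x)) (sym (nrec-shift (listCase [] (λ _ l → l)) (x ∷ toList v) (toℕ i)))) (nth-toList v i)

  sift : (ℕ → Set) → List ℕ → List ℕ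
  sift P = concatMap λ e → when (em {P e}) (e ∷ []) []

  ∈-sift⁺ : ∀ {P : ℕ → Set} {xs e} → e List.∈ xs → P e → e List.∈ sift P xs
  ∈-sift⁺ {P} {xs} {e} e∈ p = ∈-concatMap {f = λ e → when (em {P e}) (e ∷ []) []} e∈ (subst (e List.∈_) (sym (when-yes em p)) (here refl))

  sift-unit : ∀ {P : ℕ → Set} {e x} (d : Dec (P e)) → x List.∈ when d (e ∷ []) [] → x ≡ e × P e
  sift-unit (yes p) (here e) = e , p

  ∈-sift⁻ : ∀ {P : ℕ → Set} xs {e} → e List.∈ sift P xs → e List.∈ xs × P e
  ∈-sift⁻ {P} xs e∈ with ∈-concatMap′ {f = λ e → when (em {P e}) (e ∷ []) []} xs e∈
  ... | x , x∈ , e∈′ with sift-unit {P} em e∈′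
  ...   | refl , p = x∈ , p

  sift! : ∀ {P : ℕ → Set} xs → Unique xs → Unique (sift P xs)
  sift! []           _ = []
  sift! {P} (x ∷ xs) (x∉ ∷ u) = go em
   where
   go : (d : Dec (P x)) → Unique (when d (x ∷ []) [] ++ sift P xs)
   go (yes _) = fresh (λ x∈ → All.lookup x∉ (fst (∈-sift⁻ {P} xs x∈)) refl) (sift! xs u)
   go (no _) = sift! xs u

  below! : ∀ n → Unique (below n)
  below! zero = []
  below! (suc n) = fresh (λ n∈ → <-irrefl refl (∈-below⁻ n∈)) (below! n)

  module _ {X : Orc} where

   abstract
    decC : ∀ t → Cmp X nat t (dec t)
    decC t = cmp (λ n → n) (mk1 v0) λ n → sym (enc-dec t n)

    digitC : ∀ {s f g} → Cmp X s nat f → Cmp X s nat g → Cmp X s nat (λ a → digit (f a) (g a))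
    digitC cf cg = parC (nrecC cf (halfC (sndC (sndC idC))) cg)

    encodeC : ∀ {s f} → Cmp X s (list nat) f → Cmp X s nat (λ a → encode (f a))
    encodeC {f = f} cf = c-cast (λ a → sym (encode≡encs (f a))) (encC (list nat) cf)

    prefixesC : ∀ {s f} → Cmp X s (list nat) f → Cmp X s (list (list nat)) (λ a → prefixes (f a))
    prefixesC {f = f} cf = c-cast (λ a → lem (f a))
     (foldrC {z = λ _ → [] ∷ []} {s = λ q → [] ∷ map (fst (snd q) ∷_) (snd (snd q))} (constC (list (list nat)) ([] ∷ []))
      (consC nilC (mapC (consC (fstC (sndC (fstC idC))) (sndC idC)) (sndC (sndC idC)))) cf)
     where
     lem : ∀ l → foldr (λ x y → [] ∷ map (x ∷_) y) ([] ∷ []) l ≡ prefixes l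
     lem [] = refl
     lem (x ∷ l) = cong (λ y → [] ∷ map (x ∷_) y) (lem l)

    d-⪯ : ∀ {s f g} → Cmp X s (list nat) f → Cmp X s (list nat) g → Deci X s (λ a → f a ⪯ g a)
    d-⪯ {g = g} cf cg = d-iff (λ a → ∈-prefixes⁻ (g a) , ∈-prefixes) (d-∈ (list nat) cf (prefixesC cg))

    d-≺ : ∀ {s f g} → Cmp X s (list nat) f → Cmp X s (list nat) g → Deci X s (λ a → f a ≺ g a)
    d-≺ cf cg = d-and (d-⪯ cf cg) (d-not (d-≡ (list nat) cf cg))

    nthC : ∀ {s f g} → Cmp X s (list nat) f → Cmp X s nat g → Cmp X s nat (λ a → nth (f a) (g a))
    nthC cf cg = caseC (constC nat 0) (fstC (sndC idC))
     (nrecC cf (caseC {t = nat} {u = list nat} nilC (sndC (sndC idC)) (sndC (sndC idC))) cg)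

    siftC : ∀ {s} {P : El (s ⊗ nat) → Set} {l} → Deci X (s ⊗ nat) P → Cmp X s (list nat) l →
     Cmp X s (list nat) (λ a → sift (λ e → P (a , e)) (l a))
    siftC dP cl = concatMapC (whenC dP (consC (sndC idC) nilC) nilC) cl

  -- The instance, its trees and its colouring

  size-resp : ∀ {X Y k} → X ≐ Y → HasSize k X → HasSize k Y
  size-resp (f , g) (xs , u , l , p , q) = xs , u , l , (λ y → p (g y)) , λ x∈ → f (q x∈)

  strong-resp : ∀ {X Y T α g} → X ≐ Y → IsStrongSubtree α g X T → IsStrongSubtree α g Y T
  strong-resp {X} {Y} {α = α} (f , g) s = record
   { isTree = record
    { root = I.root ; root∈ = f I.root∈ ; root⪯ = λ y → I.root⪯ (g y)
    ; meet-closed = λ y y′ → f (I.meet-closed (g y) (g y′))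
    ; finite-ext = λ y → let xs , h = I.finite-ext (g y) in xs , λ d → h (snd direct d) }
   ; height = (λ l → fst S.height (back l)) , λ e → snd S.height (λ l → e (forth l))
   ; ⊆T = λ y → S.⊆T (g y)
   ; levels = λ m< l → S.levels m< (back l)
   ; branching = λ l ne k → mk⇔ (λ b → Equivalence.to (S.branching (back l) ne k) (size-resp (snd direct , fst direct) b))
    (λ b → size-resp direct (Equivalence.from (S.branching (back l) ne k) b))
   }
   where
   module S = IsStrongSubtree s
   module I = IsTree S.isTree
   direct : ∀ {σ} → DirectExtensions X σ ≐ DirectExtensions Y σ
   direct = (λ (x , p , h) → f x , p , λ y → h (g y)) , λ (y , p , h) → g y , p , λ x → h (f x)
   forth : ∀ {m σ} → AtLevel X m σ → AtLevel Y m σ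
   forth (x , s) = f x , size-resp ((λ (x , p) → f x , p) , λ (y , p) → g y , p) s
   back : ∀ {m σ} → AtLevel Y m σ → AtLevel X m σ
   back (y , s) = g y , size-resp ((λ (y , p) → g y , p) , λ (x , p) → f x , p) s

  ⊕-even : ∀ {P Q : Pred ℕ 0ℓ} y → (P y → (P ⊕ Q) (2 * y)) × ((P ⊕ Q) (2 * y) → P y)
  ⊕-even {P} y = (λ p → inj₁ (y , refl , p)) ,
   λ { (inj₁ (z , e , p)) → subst P (*-cancelˡ-≡ z y 2 (sym e)) p ; (inj₂ (z , e , _)) → ⊥-elim (even≢odd y z e) }

  ⊕-odd : ∀ {P Q : Pred ℕ 0ℓ} y → (Q y → (P ⊕ Q) (suc (2 * y))) × ((P ⊕ Q) (suc (2 * y)) → Q y)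
  ⊕-odd {Q = Q} y = (λ q → inj₂ (y , refl , q)) ,
   λ { (inj₁ (z , e , _)) → ⊥-elim (even≢odd z y (sym e)) ; (inj₂ (z , e , q)) → subst Q (*-cancelˡ-≡ z y 2 (sym (suc-injective e))) q }

  module InstanceForest (A : Pred ℕ 0ℓ) (I : Instance 2) (code≤ : codeInstance I ≤T A) where
   open Instance I
   private module Tr (i : Fin d) = IsTree (isTree i)
   private module TF (i : Fin d) = TreeFacts (isTree i)

   Ab : Orc
   Ab = oracle A

   abstract
    dInstance : Deci Ab nat (codeInstance I)
    dInstance = ≤T⇒deci (≤T-trans code≤ ≤T-oracle)

    dTrees : Deci Ab nat (codeTrees T)
    dTrees = d-iff
     (λ x → (λ h → snd (⊕-odd x) (snd (⊕-even (suc (2 * x))) (snd (⊕-even (2 * suc (2 * x))) h))) ,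
      (λ h → fst (⊕-even (2 * suc (2 * x))) (fst (⊕-even (suc (2 * x))) (fst (⊕-odd x) h))))
     (d-sub dInstance (doubleC (doubleC (sucC (doubleC idC)))))

    dColoring : Deci Ab nat (codeColoring f)
    dColoring = d-iff (λ x → snd (⊕-odd x) , fst (⊕-odd x)) (d-sub dInstance (sucC (doubleC idC)))

   node : Fin d → Str → ℕ
   node i σ = pair (toℕ i) (encode σ)

   node-inj : ∀ {i j σ τ} → node i σ ≡ node j τ → i ≡ j × σ ≡ τ
   node-inj e = let p , q = pair-inj e in toℕ-injective p , encode-inj q

   trees⁻ : ∀ {i σ} → codeTrees T (node i σ) → T i σ
   trees⁻ {i} (j , τ , τ∈ , e) with node-inj {i} {j} e
   ... | refl , refl = τ∈

   abstract
    leafless′ : ∀ i {σ} → T i σ → ∃[ κ ] DirectExtensions (T i) σ κ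
    leafless′ i σ∈ = by-contra em λ none → leafless i σ∈ ([] , [] , refl , (λ {κ} κd → ⊥-elim (none (κ , κd))) , λ ())

   -- Being a direct extension concerns only the prefixes of a string, which makes it decidable from
   -- membership in the trees.
   K : ℕ × ℕ → Set
   K (x , e) = codeTrees T (pair (π₁ x) e) × str (π₂ x) ≺ str e ×
    (∀ {p} → p List.∈ prefixes (str e) → codeTrees T (pair (π₁ x) (encode p)) → str (π₂ x) ≺ p → p ≡ str e)

   K⁺ : ∀ {i σ κ} → DirectExtensions (T i) σ κ → K (node i σ , encode κ)
   K⁺ {i} {σ} {κ} (κ∈ , σ≺ , direct)
    rewrite π₁-pair (toℕ i) (encode σ) | π₂-pair (toℕ i) (encode σ) | str-encode σ | str-encode κ =
    (i , κ , κ∈ , refl) , σ≺ , λ {p} p∈ v σ≺p → [ id , (λ p≺ → ⊥-elim (direct (trees⁻ v) σ≺p p≺)) ]′ (⪯-cases (∈-prefixes⁻ κ p∈))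

   K⁻ : ∀ {i σ e} → K (node i σ , e) → DirectExtensions (T i) σ (str e)
   K⁻ {i} {σ} {e} k rewrite π₁-pair (toℕ i) (encode σ) | π₂-pair (toℕ i) (encode σ) | str-encode σ =
    let v , σ≺ , h = k in
    trees⁻ (subst (λ z → codeTrees T (pair (toℕ i) z)) (sym (encode-str e)) v) , σ≺ ,
    λ {υ} υ∈ σ≺υ υ≺ → snd υ≺ (h (∈-prefixes (fst υ≺)) (i , υ , υ∈ , refl) σ≺υ)

   -- Membership in a tree does not bound the direct extensions of a node. An index from the domain
   -- of `f` in which the node is the root of its component does: every direct extension has a node
   -- of that finite set above it, whose code is smaller than the index.
   Cert : ℕ × (List ℕ × ℕ) → Set
   Cert (x , us , v) = codeColoring f (pair (encode us) v) × digit (nth us (π₁ x)) (π₂ x) ≡ 1 ×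
    (∀ {e} → e List.∈ below (nth us (π₁ x)) → digit (nth us (π₁ x)) e ≡ 1 → str (π₂ x) ⪯ str e)

   abstract
    dK : Deci Ab (nat ⊗ nat) K
    dK = d-and (d-sub dTrees (opC₂ v-pair (opC₁ v-π₁ (fstC idC)) (sndC idC)))
     (d-and (d-≺ xC eC)
      (d-all {t = list nat} {Q = λ q → codeTrees T (pair (π₁ (fst (fst q))) (encode (snd q))) →
       str (π₂ (fst (fst q))) ≺ snd q → snd q ≡ str (snd (fst q))}
       (d-imp (d-sub dTrees (opC₂ v-pair (opC₁ v-π₁ (fstC (fstC idC))) (encodeC (sndC idC))))
        (d-imp (d-≺ (xC ∘C fstC idC) (sndC idC)) (d-≡ (list nat) (sndC idC) (eC ∘C fstC idC))))
       (prefixesC eC)))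
     where
     xC : Cmp Ab (nat ⊗ nat) (list nat) (λ q → str (π₂ (fst q)))
     xC = decC (list nat) ∘C opC₁ v-π₂ (fstC idC)
     eC : Cmp Ab (nat ⊗ nat) (list nat) (λ q → str (snd q))
     eC = decC (list nat) ∘C sndC idC

    dCert : Deci Ab (nat ⊗ list nat ⊗ nat) (λ q → codeTrees T (fst q) → Cert q)
    dCert = d-imp (d-sub dTrees (fstC idC))
     (d-and (d-sub dColoring (opC₂ v-pair (encodeC (fstC (sndC idC))) (sndC (sndC idC))))
     (d-and (d-≡ nat (digitC uC (opC₁ v-π₂ (fstC idC))) (constC nat 1))
      (d-all {t = nat} {Q = λ q → digit (nth (fst (snd (fst q))) (π₁ (fst (fst q)))) (snd q) ≡ 1 →
       str (π₂ (fst (fst q))) ⪯ str (snd q)}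
       (d-imp (d-≡ nat (digitC (uC ∘C fstC idC) (sndC idC)) (constC nat 1))
        (d-⪯ (decC (list nat) ∘C opC₁ v-π₂ (fstC (fstC idC))) (decC (list nat) ∘C sndC idC)))
       (belowC uC))))
     where
     uC : Cmp Ab (nat ⊗ list nat ⊗ nat) nat (λ q → nth (fst (snd q)) (π₁ (fst q)))
     uC = nthC (fstC (sndC idC)) (opC₁ v-π₁ (fstC idC))

   abstract
    -- A tuple of height-2 strong subtrees, each with finitely many nodes, is in the domain of f under its canonical index.
    indexed : ∀ (U : Trees d) → (∀ i → Finite (U i)) → AreStrongSubtrees [ 2 ] T U →
     ∃[ us ] ∃[ v ] codeColoring f (pair (encode us) v) × (∀ i σ → (U i σ → digit (nth us (toℕ i)) (encode σ) ≡ 1) ×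
      (digit (nth us (toℕ i)) (encode σ) ≡ 1 → U i σ))
    indexed U fin (g , s) = toList us , toℕ (Func.to f (finiteTrees us , p)) , (us , p , refl) , λ i σ →
     (λ x → subst (λ u → digit u (encode σ) ≡ 1) (sym (nth-toList us i)) (fst (digit-set (lookup us i) σ) (fst (eq i) x))) ,
     (λ x → snd (eq i) (snd (digit-set (lookup us i) σ) (subst (λ u → digit u (encode σ) ≡ 1) (nth-toList us i) x)))
     where
     ind : ∀ i → ∃[ u ] ∀ e → (U i (str e) → digit u e ≡ 1) × (digit u e ≡ 1 → U i (str e))
     ind i =
      let σs , h = fin i
          N , b = bounded-∀ {P = λ σ N → encode σ < N} (λ m≤n p → ≤-trans p m≤n) σs (λ _ → _ , ≤-refl)
      in canonical N (U i ∘ str) (λ {e} x → subst (_< N) (encode-str e) (b (h x)))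
     us : Vec ℕ d
     us = tabulate (λ i → fst (ind i))
     eq : ∀ i → U i ≐ finiteTrees us i
     eq i = (λ {σ} x → subst (λ u → finiteSet u σ) (sym (lookup∘tabulate _ i))
      (snd (digit-set _ σ) (fst (snd (ind i) (encode σ)) (subst (U i) (sym (str-encode σ)) x)))) ,
      λ {σ} x → subst (U i) (str-encode σ) (snd (snd (ind i) (encode σ))
       (fst (digit-set _ σ) (subst (λ u → finiteSet u σ) (lookup∘tabulate _ i) x)))
     p : AreStrongSubtrees [ 2 ] T (finiteTrees us)
     p = g , λ i → strong-resp (eq i) (s i)

    coloring⁻ : ∀ {us v} → codeColoring f (pair (encode us) v) →
     Σ (Vec ℕ d) λ w → Σ (AreStrongSubtrees [ 2 ] T (finiteTrees w)) λ p → us ≡ toList w × v ≡ toℕ (Func.to f (finiteTrees w , p))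
    coloring⁻ (w , p , e) = let e₁ , e₂ = pair-inj e in w , p , encode-inj e₁ , e₂

    inhabited : ∀ i m → ∃[ σ ] AtLevel (T i) m σ
    inhabited i zero = _ , TF.root-level i
    inhabited i (suc m) = let σ , l = inhabited i m ; κ , κd = leafless′ i (fst l) in κ , TF.kid-level i l κd

   -- The node with all its direct extensions is a strong subtree of height 2; it is completed by
   -- the same construction at some node on the same level of each other tree.
   certified : ∀ x → ∃[ c ] (codeTrees T x → Cert (x , c))
   certified x = go em
    where
    go : Dec (codeTrees T x) → ∃[ c ] (codeTrees T x → Cert (x , c))
    go (no ¬v) = ([] , 0) , λ v → ⊥-elim (¬v v)
    go (yes (i , σ , σ∈ , refl)) =
     let us , v , c , h = indexed U fin (gl , λ j → B.strong j)
         π≡ : ∀ e → digit (nth us (toℕ i)) (encode (str e)) ≡ 1 → σ ⪯ str e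
         π≡ e dg = σ-least (snd (h i (str e)) dg)
     in (us , v) , λ _ → c ,
      subst₂ (λ a b → digit (nth us a) b ≡ 1) (sym (π₁-pair (toℕ i) (encode σ))) (sym (π₂-pair (toℕ i) (encode σ)))
       (fst (h i σ) σ∈U) ,
      λ {e} _ dg → subst (_⪯ str e) (sym (trans (cong str (π₂-pair (toℕ i) (encode σ))) (str-encode σ)))
       (π≡ e (subst₂ (λ a b → digit (nth us a) b ≡ 1) (π₁-pair (toℕ i) (encode σ)) (sym (encode-str e)) dg))
     where
     m : ℕ
     m = fst (TF.level i σ)
     pick : ∀ j → Dec (i ≡ j) → ∃[ τ ] AtLevel (T j) m τ × (i ≡ j → τ ≡ σ)
     pick j (yes refl) = σ , (σ∈ , snd (TF.level i σ)) , λ _ → refl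
     pick j (no ne) = let τ , l = inhabited j m in τ , l , λ e → ⊥-elim (ne e)
     τ : Fin d → Str
     τ j = fst (pick j em)
     τ-level : ∀ j → AtLevel (T j) m (τ j)
     τ-level j = fst (snd (pick j em))
     gl : ℕ → ℕ
     gl n = m + n
     Lv : Fin d → ℕ → Pred Str 0ℓ
     Lv j zero          υ = υ ≡ τ j
     Lv j (suc zero)    υ = DirectExtensions (T j) (τ j) υ
     Lv j (suc (suc _)) υ = ⊥
     lvl : ∀ j {n υ} → [ n ] <⁺ [ 2 ] → Lv j n υ → AtLevel (T j) (gl n) υ
     lvl j {zero}  {υ} _ refl = subst (λ m → AtLevel (T j) m υ) (sym (+-identityʳ m)) (τ-level j)
     lvl j {suc zero} {υ} _ κd = subst (λ m → AtLevel (T j) m υ) (+-comm 1 m) (TF.kid-level j (τ-level j) κd)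
     up : ∀ j {n υ κ} → [ suc n ] <⁺ [ 2 ] → Lv j n υ → DirectExtensions (T j) υ κ → ∃[ l ] Lv j (suc n) l × κ ⪯ l
     up j {zero}  _ refl κd = _ , κd , ⪯-refl
     up j {suc n} [ s≤s (s≤s ()) ]
     up! : ∀ j {n υ κ l l′} → [ suc n ] <⁺ [ 2 ] → Lv j n υ → DirectExtensions (T j) υ κ → Lv j (suc n) l → Lv j (suc n) l′ →
      κ ⪯ l → κ ⪯ l′ → l ≡ l′
     up! j {zero}  _ refl κd ld l′d p q = trans (sym (TF.direct-unique j κd ld p ⪯-refl)) (TF.direct-unique j κd l′d q ⪯-refl)
     up! j {suc n} [ s≤s (s≤s ()) ]
     down : ∀ j {n l} → [ suc n ] <⁺ [ 2 ] → Lv j (suc n) l → ∃[ υ ] ∃[ κ ] Lv j n υ × DirectExtensions (T j) υ κ × κ ⪯ l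
     down j {zero}  _ ld = _ , _ , refl , ld , ⪯-refl
     down j {suc n} [ s≤s (s≤s ()) ]
     module B (j : Fin d) = Build (isTree j) (leafless′ j) [ 2 ] [ s≤s z≤n ] gl (λ {n} _ → +-monoʳ-< m (n<1+n n))
      (Lv j) (τ j) refl id (λ {n} → lvl j {n}) (λ {n} → up j {n}) (λ {n} → up! j {n}) (λ {n} → down j {n})
     U : Trees d
     U j = B.S j
     fin : ∀ j → Finite (U j)
     fin j = let κs , h = Tr.finite-ext j (fst (τ-level j)) in τ j ∷ κs , λ
      { (zero , _ , refl) → here refl ; (suc zero , _ , κd) → there (h κd) ; (suc (suc _) , _ , ()) }
     σ∈U : U i σ
     σ∈U = 0 , [ s≤s z≤n ] , sym (snd (snd (pick i em)) refl)
     σ-least : ∀ {υ} → U i υ → σ ⪯ υ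
     σ-least (zero , _ , e) = subst (σ ⪯_) (trans (sym (snd (snd (pick i em)) refl)) (sym e)) ⪯-refl
     σ-least (suc zero , _ , _ , p , _) = subst (_⪯ _) (snd (snd (pick i em)) refl) (fst p)
     σ-least (suc (suc _) , _ , ())

   abstract
    certificates : Σ (ℕ → List ℕ × ℕ) λ F → Cmp Ab nat (list nat ⊗ nat) F × (∀ x → codeTrees T x → Cert (x , F x))
    certificates = search {Ab} {nat} {list nat ⊗ nat} {λ q → codeTrees T (fst q) → Cert q} dCert certified

   module Run (certificates : Σ (ℕ → List ℕ × ℕ) λ F → Cmp Ab nat (list nat ⊗ nat) F × (∀ x → codeTrees T x → Cert (x , F x))) where

    bound : ℕ → ℕ
    bound x = nth (fst (fst certificates x)) (π₁ x)

    kidsOf : ℕ → List ℕ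
    kidsOf x = map (pair (π₁ x)) (sift (λ e → K (x , e)) (below (bound x)))

    -- Numbers that code no node become their own direct extension, so that no leaves arise.
    kd : ℕ → List ℕ
    kd x = when (em {codeTrees T x}) (kidsOf x) (x ∷ [])

    kd-in : ∀ {x} → codeTrees T x → kd x ≡ kidsOf x
    kd-in = when-yes em

    kd-out : ∀ {x y} → ¬ codeTrees T x → y List.∈ kd x → y ≡ x
    kd-out {x} {y} ¬v y∈ = go (subst (y List.∈_) (when-no em ¬v) y∈)
     where
     go : y List.∈ x ∷ [] → y ≡ x
     go (here e) = e

    abstract
     kd⁻ : ∀ {i σ y} → T i σ → y List.∈ kd (node i σ) → ∃[ κ ] y ≡ node i κ × DirectExtensions (T i) σ κ
     kd⁻ {i} {σ} {y} σ∈ y∈ =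
      let e , e∈ , y≡ = ∈-map⁻ (pair (π₁ (node i σ))) (subst (y List.∈_) (kd-in (i , σ , σ∈ , refl)) y∈)
          _ , k = ∈-sift⁻ {λ e → K (node i σ , e)} (below (bound (node i σ))) e∈
      in str e , trans y≡ (cong₂ pair (π₁-pair (toℕ i) (encode σ)) (sym (encode-str e))) , K⁻ {i} {σ} {e} k

     kd⁺ : ∀ {i σ κ} → T i σ → DirectExtensions (T i) σ κ → node i κ List.∈ kd (node i σ)
     kd⁺ {i} {σ} {κ} σ∈ κd = subst (node i κ List.∈_) (sym (kd-in v)) (subst (λ z → pair z (encode κ) List.∈ kidsOf x) (π₁-pair (toℕ i) (encode σ))
      (∈-map⁺ (pair (π₁ x)) (∈-sift⁺ {λ e → K (x , e)} (∈-below⁺ (κ< (snd (snd certificates) x v))) (K⁺ κd))))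
      where
      x : ℕ
      x = node i σ
      v : codeTrees T x
      v = i , σ , σ∈ , refl
      us : List ℕ
      us = fst (fst certificates x)
      κ< : Cert (x , fst certificates x) → encode κ < bound x
      κ< (col , dg , above) = go (coloring⁻ col)
       where
       dg′ : digit (nth us (toℕ i)) (encode σ) ≡ 1
       dg′ = subst₂ (λ a b → digit (nth us a) b ≡ 1) (π₁-pair (toℕ i) (encode σ)) (π₂-pair (toℕ i) (encode σ)) dg
       above′ : ∀ τ → digit (nth us (toℕ i)) (encode τ) ≡ 1 → σ ⪯ τ
       above′ τ dτ = subst₂ _⪯_ (trans (cong str (π₂-pair (toℕ i) (encode σ))) (str-encode σ)) (str-encode τ)
        (above {encode τ} (∈-below⁺ (digit< _ _ dτ′)) dτ′)
        where
        dτ′ : digit (nth us (π₁ x)) (encode τ) ≡ 1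
        dτ′ = subst (λ a → digit (nth us a) (encode τ) ≡ 1) (sym (π₁-pair (toℕ i) (encode σ))) dτ
       go : (Σ (Vec ℕ d) λ w → Σ (AreStrongSubtrees [ 2 ] T (finiteTrees w)) λ p → us ≡ toList w × snd (fst certificates x) ≡ toℕ (Func.to f (finiteTrees w , p))) → encode κ < bound x
       go (w , (g , s) , us≡ , _) =
        let l , l∈ , κ⪯ = H.leaf (subst (λ z → DirectExtensions (T i) z κ) (sym ρ≡) κd)
        in ≤-trans (s≤s (encode-≤ κ⪯)) (subst (λ a → encode l < nth us a) (sym (π₁-pair (toℕ i) (encode σ))) (digit< _ _ (dig l l∈)))
        where
        module H = Height2 (isTree i) (s i)
        u≡ : nth us (toℕ i) ≡ lookup w i
        u≡ = trans (cong (λ z → nth z (toℕ i)) us≡) (nth-toList w i)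
        dig : ∀ τ → finiteSet (lookup w i) τ → digit (nth us (toℕ i)) (encode τ) ≡ 1
        dig τ τ∈ = subst (λ u → digit u (encode τ) ≡ 1) (sym u≡) (fst (digit-set _ τ) τ∈)
        ρ≡ : H.ρ ≡ σ
        ρ≡ = ⪯-antisym (H.ρ⪯ (snd (digit-set _ σ) (subst (λ u → digit u (encode σ) ≡ 1) u≡ dg′))) (above′ H.ρ (dig H.ρ H.ρ∈))

    tree : Tree
    tree = record
     { X = ℕ ; kids = kd
     ; ne = λ x → ne em
     ; uniq = λ {x} {y} p q → uq em em p q
     }
     where
     ne : ∀ {x} → Dec (codeTrees T x) → ∃[ y ] y List.∈ kd x
     ne (yes (i , σ , σ∈ , refl)) = let κ , κd = leafless′ i σ∈ in node i κ , kd⁺ σ∈ κd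
     ne {x} (no ¬v) = x , subst (x List.∈_) (sym (when-no em ¬v)) (here refl)
     valid : ∀ {i σ y} → T i σ → y List.∈ kd (node i σ) → codeTrees T y
     valid {i} σ∈ y∈ = let κ , e , κd = kd⁻ {i} σ∈ y∈ in i , κ , fst κd , e
     uq : ∀ {x y z} → Dec (codeTrees T x) → Dec (codeTrees T y) → z List.∈ kd x → z List.∈ kd y → x ≡ y
     uq (yes (i , σ , σ∈ , refl)) (yes (j , τ , τ∈ , refl)) p q =
      let κ , e , κd = kd⁻ {i} σ∈ p ; κ′ , e′ , κ′d = kd⁻ {j} τ∈ q
          i≡ , κ≡ = node-inj {i} {j} (trans (sym e) e′)
      in same i≡ κ≡ σ∈ τ∈ κd κ′d
      where
      same : ∀ {i j σ τ κ κ′} → i ≡ j → κ ≡ κ′ → T i σ → T j τ → DirectExtensions (T i) σ κ → DirectExtensions (T j) τ κ′ → node i σ ≡ node j τ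
      same {i} refl refl σ∈ τ∈ κd κ′d = cong (node i) (TF.parent-unique i σ∈ τ∈ κd κ′d)
     uq (yes (i , σ , σ∈ , refl)) (no ¬v) p q = ⊥-elim (¬v (subst (codeTrees T) (kd-out ¬v q) (valid {i} σ∈ p)))
     uq (no ¬v) (yes (j , τ , τ∈ , refl)) p q = ⊥-elim (¬v (subst (codeTrees T) (kd-out ¬v p) (valid {j} τ∈ q)))
     uq (no ¬v) (no ¬v′) p q = trans (sym (kd-out ¬v p)) (kd-out ¬v′ q)

    abstract
     desc⁻ : ∀ {i σ n y} → T i σ → Desc tree n (node i σ) y →
      ∃[ τ ] y ≡ node i τ × T i τ × σ ⪯ τ × (∀ {m} → AtLevel (T i) m σ → AtLevel (T i) (m + n) τ)
     desc⁻ {i} {σ} σ∈ stop = σ , refl , σ∈ , ⪯-refl , λ {m} l → subst (λ m → AtLevel (T i) m σ) (sym (+-identityʳ m)) l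
     desc⁻ {i} {σ} {suc n} {y} σ∈ (step {y = z} z∈ ds) =
      let κ , e , κd = kd⁻ {i} σ∈ z∈
          τ , e′ , τ∈ , κ⪯ , l = desc⁻ {i} {κ} {n} (fst κd) (subst (λ z → Desc tree n z y) e ds)
      in τ , e′ , τ∈ , ⪯-trans (fst (fst (snd κd))) κ⪯ ,
       λ {m} lσ → subst (λ m → AtLevel (T i) m τ) (sym (+-suc m n)) (l (TF.kid-level i lσ κd))

     desc⁺ : ∀ {i σ τ} → T i σ → T i τ → σ ⪯ τ → ∃[ n ] Desc tree n (node i σ) (node i τ)
     desc⁺ {i} {σ} {τ} σ∈ τ∈ p = go (suc (length τ)) τ∈ p ≤-refl
      where
      go : ∀ b {τ} → T i τ → σ ⪯ τ → length τ < b → ∃[ n ] Desc tree n (node i σ) (node i τ)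
      go (suc b) {τ} τ∈ p (s≤s lt) = cases (⪯-cases p)
       where
       cases : σ ≡ τ ⊎ σ ≺ τ → ∃[ n ] Desc tree n (node i σ) (node i τ)
       cases (inj₁ refl) = 0 , stop
       cases (inj₂ σ≺) =
        let π , π∈ , πd , σ⪯π = TF.parent i σ∈ τ∈ σ≺
            n , e = go b π∈ σ⪯π (≤-trans (≺-length (fst (snd πd))) lt)
        in n + 1 , desc-trans e (kid (kd⁺ π∈ πd))

    rs : List ℕ
    rs = map (λ i → node i (Tr.root i)) (allFin d)

    ∈-rs : ∀ i → node i (Tr.root i) List.∈ rs
    ∈-rs i = ∈-map⁺ (λ i → node i (Tr.root i)) (∈-allFin i)

    abstract
     kdC : Cmp Ab nat (list nat) kd
     kdC = whenC dTrees
      (mapC (opC₂ v-pair (opC₁ v-π₁ (fstC idC)) (sndC idC))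
       (siftC {P = K} dK (belowC (nthC (fstC (fst (snd certificates))) (opC₁ v-π₁ idC)))))
      (consC idC nilC)

    forest : Forest Ab
    forest = record
     { kd = kd ; kd-ne = Tree.ne tree ; kd-uniq = Tree.uniq tree ; kd! = λ x → un x em ; kdC = kdC
     ; rs = rs
     ; rs! = Uniq.map⁺ (λ {i} {j} e → fst (node-inj {i} {j} e)) (Uniq.allFin⁺ d)
     ; orphan = λ {r} {x} r∈ → orph (∈-map⁻ (λ i → node i (Tr.root i)) r∈) em
     ; grow = λ r∈ ds y∈ → larger (∈-map⁻ (λ i → node i (Tr.root i)) r∈) ds y∈
     }
     where
     un : ∀ x → Dec (codeTrees T x) → Unique (kd x)
     un x (yes v) = subst Unique (sym (kd-in v)) (Uniq.map⁺ (λ {a} {b} e → snd (pair-inj {x = π₁ x} {y = a} {x′ = π₁ x} {y′ = b} e)) (sift! {λ e → K (x , e)} (below (bound x)) (below! (bound x))))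
     un x (no ¬v) = subst Unique (sym (when-no em ¬v)) ([] ∷ [])
     orph : ∀ {r x} → (∃[ i ] i List.∈ allFin d × r ≡ node i (Tr.root i)) → Dec (codeTrees T x) → ¬ r List.∈ kd x
     orph (i , _ , refl) (no ¬v) r∈ = ¬v (subst (codeTrees T) (kd-out ¬v r∈) (i , _ , Tr.root∈ i , refl))
     orph (i , _ , refl) (yes (j , σ , σ∈ , refl)) r∈ = bad (kd⁻ {j} σ∈ r∈)
      where
      bad : ¬ (∃[ κ ] node i (Tr.root i) ≡ node j κ × DirectExtensions (T j) σ κ)
      bad (κ , e , κd) with node-inj {i} {j} e
      ... | refl , refl = ≺-irrefl (fst (snd κd)) (Tr.root⪯ i σ∈)
     larger : ∀ {r n x y} → (∃[ i ] i List.∈ allFin d × r ≡ node i (Tr.root i)) → Desc tree n r x → y List.∈ kd x → x < y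
     larger {n = n} (i , _ , refl) ds y∈ = go (desc⁻ {i} {Tr.root i} {n} (Tr.root∈ i) ds) y∈
      where
      go : ∀ {x y} → (∃[ τ ] x ≡ node i τ × T i τ × _) → y List.∈ kd x → x < y
      go (τ , refl , τ∈ , _) y∈ = let κ , e , κd = kd⁻ {i} τ∈ y∈ in
       subst (node i τ <_) (sym e) (pair-mono (toℕ i) (encode-< (fst (snd κd))))

 -- Transfer to the product version of Milliken's theorem

 module ConeAvoidance where
  open ListLemmas
  open HalpernLauchli
  open Programs
  open TypedPrograms
  open Computability
  open Forests
  open ForcingConditions using (when; whenC; choose; module Forcing)
  open HomogeneousSubforest using (when-yes; module Relocation; module Homogeneous)
  open InstanceForests
  open OneDimensional using (encC)
  open Homogenization using (encs-∈; module Leaves)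
  open StrongSubtrees
  open import Data.Fin.Base as Fin using (Fin; toℕ)
  open import Data.Fin.Properties using (toℕ-injective; toℕ<n; toℕ-fromℕ<)
  import Data.List.Membership.Propositional as List
  open import Data.List.Relation.Binary.Pointwise.Base using (Pointwise; []; _∷_)
  open import Data.List.Relation.Unary.All as All using (All; []; _∷_)
  open import Data.List.Relation.Unary.AllPairs using ([]; _∷_)
  open import Data.Vec.Base using (lookup)
  open import Function.Bundles using (Func)
  open import Relation.Nullary.Construct.Add.Supremum using ([_])
  open import Relation.Binary.Construct.Add.Supremum.Strict _<_ using (_<⁺_; [_]; [_]<⊤⁺)

  pw-same : ∀ {A B : Set} {R : A → B → Set} {xs ys} → Unique xs → Pointwise R xs ys → ∀ {y y′} → y List.∈ ys → y′ List.∈ ys →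
   (∀ {x x′} → x List.∈ xs → x′ List.∈ xs → R x y → R x′ y′ → x ≡ x′) → y ≡ y′
  pw-same (x∉ ∷ u) (r ∷ rs) (here refl) (here refl) h = refl
  pw-same (x∉ ∷ u) (r ∷ rs) (here refl) (there q)   h =
   let x , x∈ , r′ = pw-∈ʳ rs q in ⊥-elim (All.lookup x∉ x∈ (h (here refl) (there x∈) r r′))
  pw-same (x∉ ∷ u) (r ∷ rs) (there p)   (here refl) h =
   let x , x∈ , r′ = pw-∈ʳ rs p in ⊥-elim (All.lookup x∉ x∈ (sym (h (there x∈) (here refl) r′ r)))
  pw-same (x∉ ∷ u) (r ∷ rs) (there p)   (there q)   h = pw-same u rs p q λ x∈ x′∈ → h (there x∈) (there x′∈)

  concat-concatMap : ∀ (f : ℕ → List ℕ) L → concat (map (concatMap f) L) ≡ concatMap f (concat L)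
  concat-concatMap f [] = refl
  concat-concatMap f (l ∷ L) = trans (cong (concatMap f l ++_) (concat-concatMap f L)) (sym (concatMap-++ f l (concat L)))

  ⊕-≤T : ∀ {P Q : Pred ℕ 0ℓ} → (P ⊕ Q) ≤T ⌞ join (oracle P) (oracle Q) ⌟
  ⊕-≤T {P} {Q} = ≤T-iff λ n →
   (λ { (inj₁ (y , e , p)) → snd (join-iff (oracle P) (oracle Q) n) (inj₁ (y , e , fst (oracle-iff P y) p))
    ; (inj₂ (y , e , q)) → snd (join-iff (oracle P) (oracle Q) n) (inj₂ (y , e , fst (oracle-iff Q y) q)) }) ,
   λ h → back n (fst (join-iff (oracle P) (oracle Q) n) h)
   where
   back : ∀ n → (⌞ oracle P ⌟ ⊕ ⌞ oracle Q ⌟) n → (P ⊕ Q) n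
   back n (inj₁ (y , e , p)) = inj₁ (y , e , snd (oracle-iff P y) p)
   back n (inj₂ (y , e , q)) = inj₂ (y , e , snd (oracle-iff Q y) q)

  module Transfer (A : Pred ℕ 0ℓ) (I : Instance 2) (code≤ : codeInstance I ≤T A)
   (certificates : Σ (ℕ → List ℕ × ℕ) λ F → Cmp (oracle A) nat (list nat ⊗ nat) F ×
    (∀ x → codeTrees (Instance.T I) x → InstanceForest.Cert A I code≤ (x , F x))) where

   open Instance I
   open InstanceForest A I code≤ hiding (module Run; certificates)
   open InstanceForest.Run A I code≤ certificates
   open Basics forest using (Depth; depth-down; depth≤; tup; ∈tup⁺; ∈tup⁻; tupC)
   open Leaves forest
   private module Tr (i : Fin d) = IsTree (isTree i)
   private module TF (i : Fin d) = TreeFacts (isTree i)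

   root⁻ : ∀ {r} → r List.∈ rs → ∃[ i ] r ≡ node i (Tr.root i)
   root⁻ r∈ = let i , _ , e = ∈-map⁻ (λ i → node i (Tr.root i)) r∈ in i , e

   -- Flat levels of a strong subforest are the levels of a tuple of strong subtrees.
   module FromLevels (α : Height) (0<α : [ 0 ] <⁺ α) (xs : ℕ → List ℕ) (m : ℕ → ℕ)
    (base : Pointwise (Desc tree (m 0)) rs (xs 0))
    (next : ∀ n → [ suc n ] <⁺ α → Pointwise (Desc tree (m (suc n))) (concatMap kd (xs n)) (xs (suc n))) where

    g : ℕ → ℕ
    g zero = m 0
    g (suc n) = suc (g n) + m (suc n)

    g< : ∀ n → g n < g (suc n)
    g< n = m≤m+n (suc (g n)) (m (suc n))

    down-α : ∀ {n β} → [ suc n ] <⁺ β → [ n ] <⁺ β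
    down-α [ p ] = [ <⇒≤ p ]
    down-α [ _ ]<⊤⁺ = [ _ ]<⊤⁺

    Node : ℕ → ℕ → Set
    Node n x = ∃[ i ] ∃[ σ ] x ≡ node i σ × AtLevel (T i) (g n) σ

    node-of : ∀ n {x} → [ n ] <⁺ α → x List.∈ xs n → Node n x
    kid-of : ∀ n {x} → [ n ] <⁺ α → x List.∈ concatMap kd (xs n) →
     ∃[ i ] ∃[ σ ] ∃[ κ ] x ≡ node i κ × node i σ List.∈ xs n × AtLevel (T i) (g n) σ × DirectExtensions (T i) σ κ
    node-of zero _ x∈ = go (pw-∈ʳ base x∈)
     where
     go : ∀ {x} → (∃[ r ] r List.∈ rs × Desc tree (m 0) r x) → Node 0 x
     go (r , r∈ , ds) with root⁻ r∈
     ... | i , refl = let τ , e , _ , _ , l = desc⁻ {i} {Tr.root i} {m 0} (Tr.root∈ i) ds in i , τ , e , l (TF.root-level i)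
    node-of (suc n) n<α x∈ = go (pw-∈ʳ (next n n<α) x∈)
     where
     go : ∀ {x} → (∃[ κ ] κ List.∈ concatMap kd (xs n) × Desc tree (m (suc n)) κ x) → Node (suc n) x
     go (_ , κ∈ , ds) with kid-of n (down-α n<α) κ∈
     ... | i , σ , κ , refl , _ , lσ , κd =
      let τ , e , _ , _ , l = desc⁻ {i} {κ} {m (suc n)} (fst κd) ds in i , τ , e , l (TF.kid-level i lσ κd)
    kid-of n n<α x∈ = go (∈-concatMap′ {f = kd} (xs n) x∈)
     where
     go : ∀ {x} → (∃[ y ] y List.∈ xs n × x List.∈ kd y) → _
     go (y , y∈ , x∈y) with node-of n n<α y∈
     ... | i , σ , refl , lσ = let κ , e , κd = kd⁻ {i} (fst lσ) x∈y in i , σ , κ , e , y∈ , lσ , κd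

    lv : ∀ {i n σ} → [ n ] <⁺ α → node i σ List.∈ xs n → AtLevel (T i) (g n) σ
    lv {i} {n} {σ} n<α σ∈ = go (node-of n n<α σ∈)
     where
     go : Node n (node i σ) → AtLevel (T i) (g n) σ
     go (j , τ , e , l) with node-inj {i} {j} e
     ... | refl , refl = l

    unique : ∀ n → [ n ] <⁺ α → Unique (xs n)
    unique zero    _ = descs-unique base (Forest.rs! forest)
    unique (suc n) n<α = descs-unique (next n n<α) (kids-unique (unique n (down-α n<α)))

    from-root : ∀ {i σ r} → r List.∈ rs → Desc tree (m 0) r (node i σ) → r ≡ node i (Tr.root i)
    from-root {i} r∈ ds with root⁻ r∈
    ... | j , refl with desc⁻ {j} {Tr.root j} {m 0} (Tr.root∈ j) ds
    ...   | τ , e , _ with node-inj {i} {j} e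
    ...     | refl , _ = refl

    from-kid : ∀ {n i l x} → [ suc n ] <⁺ α → x List.∈ concatMap kd (xs n) → Desc tree (m (suc n)) x (node i l) →
     ∃[ σ ] ∃[ κ ] x ≡ node i κ × node i σ List.∈ xs n × DirectExtensions (T i) σ κ × κ ⪯ l × AtLevel (T i) (suc (g n)) κ
    from-kid {n} {i} n<α x∈ ds with kid-of n (down-α n<α) x∈
    ... | j , σ , κ , refl , σ∈ , lσ , κd with desc⁻ {j} {κ} {m (suc n)} (fst κd) ds
    ...   | τ , e , _ , κ⪯ , _ with node-inj {i} {j} e
    ...     | refl , refl = σ , κ , refl , σ∈ , κd , κ⪯ , TF.kid-level j lσ κd

    ρ : ∀ i → ∃[ σ ] node i σ List.∈ xs 0
    ρ i with pw-∈ˡ base (∈-rs i)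
    ... | y , y∈ , ds with desc⁻ {i} {Tr.root i} {m 0} (Tr.root∈ i) ds
    ...   | τ , refl , _ = τ , y∈

    ρ! : ∀ i {σ} → node i σ List.∈ xs 0 → σ ≡ fst (ρ i)
    ρ! i {σ} σ∈ = snd (node-inj {i} {i} (pw-same (Forest.rs! forest) base σ∈ (snd (ρ i))
     λ r∈ r′∈ ds ds′ → trans (from-root {i} r∈ ds) (sym (from-root {i} r′∈ ds′))))

    up : ∀ i {n σ κ} → [ suc n ] <⁺ α → node i σ List.∈ xs n → DirectExtensions (T i) σ κ → ∃[ l ] node i l List.∈ xs (suc n) × κ ⪯ l
    up i {n} {σ} {κ} n<α σ∈ κd = go (pw-∈ˡ (next n n<α) (∈-concatMap {f = kd} {xs = xs n} σ∈ (kd⁺ {i} {σ} {κ} (fst (lv {i} {n} (down-α n<α) σ∈)) κd)))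
     where
     go : (∃[ y ] y List.∈ xs (suc n) × Desc tree (m (suc n)) (node i κ) y) → ∃[ l ] node i l List.∈ xs (suc n) × κ ⪯ l
     go (y , y∈ , ds) with desc⁻ {i} {κ} {m (suc n)} (fst κd) ds
     ... | τ , refl , _ , κ⪯ , _ = τ , y∈ , κ⪯

    -- The direct extensions through which `l` and `l′` entered their level have the same level as
    -- `κ` and are comparable with it, so both are `κ`.
    up! : ∀ i {n σ κ l l′} → [ suc n ] <⁺ α → node i σ List.∈ xs n → DirectExtensions (T i) σ κ →
     node i l List.∈ xs (suc n) → node i l′ List.∈ xs (suc n) → κ ⪯ l → κ ⪯ l′ → l ≡ l′
    up! i {n} {σ} {κ} n<α σ∈ κd l∈ l′∈ p q = snd (node-inj {i} {i} (pw-same (kids-unique (unique n (down-α n<α))) (next n n<α) l∈ l′∈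
     λ x∈ x′∈ ds ds′ → trans (is-κ p (from-kid {n} {i} n<α x∈ ds)) (sym (is-κ q (from-kid {n} {i} n<α x′∈ ds′)))))
     where
     κ-level : AtLevel (T i) (suc (g n)) κ
     κ-level = TF.kid-level i (lv {i} {n} (down-α n<α) σ∈) κd
     is-κ : ∀ {l x} → κ ⪯ l → (∃[ σ′ ] ∃[ κ′ ] x ≡ node i κ′ × node i σ′ List.∈ xs n × DirectExtensions (T i) σ′ κ′ × κ′ ⪯ l ×
      AtLevel (T i) (suc (g n)) κ′) → x ≡ node i κ
     is-κ p (_ , κ′ , e , _ , _ , p′ , l′) = trans e (cong (node i)
      ([ (λ r → TF.level-≡ i r l′ κ-level) , (λ r → sym (TF.level-≡ i r κ-level l′)) ]′ (⪯-comparable p′ p)))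

    down : ∀ i {n l} → [ suc n ] <⁺ α → node i l List.∈ xs (suc n) → ∃[ σ ] ∃[ κ ] node i σ List.∈ xs n × DirectExtensions (T i) σ κ × κ ⪯ l
    down i {n} n<α l∈ =
     let x , x∈ , ds = pw-∈ʳ (next n n<α) l∈ ; σ , κ , _ , σ∈ , κd , κ⪯ , _ = from-kid {n} {i} n<α x∈ ds in σ , κ , σ∈ , κd , κ⪯

    module B (i : Fin d) = Build (isTree i) (leafless′ i) α 0<α g (λ {n} _ → g< n) (λ n σ → node i σ List.∈ xs n)
     (fst (ρ i)) (snd (ρ i)) (ρ! i) (λ {n} → lv {i} {n}) (λ {n} → up i {n}) (λ {n} → up! i {n}) (λ {n} → down i {n})

    S : Trees d
    S i = B.S i

    strong : AreStrongSubtrees α T S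
    strong = g , λ i → B.strong i

   -- Describes the two levels of a height-2 strong subforest. Depths and heights above the roots
   -- are at most codes, which justifies the bounds on `n` and `m` and makes the predicate
   -- decidable.
   Guard : List ℕ × List ℕ → Set
   Guard (xs , ls) = (∃[ n ] n < suc (enc (list nat) xs) × xs List.∈ tup n rs) ×
    (∃[ m ] m < suc (enc (list nat) ls) × ls List.∈ tup m (concatMap kd xs))

   -- us are the canonical indices of the trees with nodes xs ++ ls, and v is their colour.
   Value : (List ℕ × List ℕ) × List ℕ × ℕ → Set
   Value ((xs , ls) , us , v) = codeColoring f (pair (encode us) v) ×
    (∀ {i} → i List.∈ below d → ∀ {e} → e List.∈ below (nth us i) → digit (nth us i) e ≡ 1 → pair i e List.∈ xs ++ ls) ×
    (∀ {n} → n List.∈ xs ++ ls → digit (nth us (π₁ n)) (π₂ n) ≡ 1)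

   abstract
    dGuard : Deci Ab (list nat ⊗ list nat) Guard
    dGuard = d-and
     (d-∃< {Q = λ q → fst (fst q) List.∈ tup (snd q) rs}
      (d-∈ (list nat) (fstC (fstC idC)) (tupC ⊑-refl (sndC idC) (constC (list nat) rs))) (sucC (encC (list nat) (fstC idC))))
     (d-∃< {Q = λ q → snd (fst q) List.∈ tup (snd q) (concatMap kd (fst (fst q)))}
      (d-∈ (list nat) (sndC (fstC idC)) (tupC ⊑-refl (sndC idC) (concatMapC (kdC ∘C sndC idC) (fstC (fstC idC)))))
      (sucC (encC (list nat) (sndC idC))))

    dValue : Deci Ab ((list nat ⊗ list nat) ⊗ (list nat ⊗ nat)) (λ q → Guard (fst q) → Value q)
    dValue = d-imp (d-sub dGuard (fstC idC))
     (d-and (d-sub dColoring (opC₂ v-pair (encodeC (fstC (sndC idC))) (sndC (sndC idC))))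
     (d-and
      (d-all {t = nat} {Q = λ q → ∀ {e} → e List.∈ below (nth (fst (snd (fst q))) (snd q)) →
       digit (nth (fst (snd (fst q))) (snd q)) e ≡ 1 → pair (snd q) e List.∈ fst (fst (fst q)) ++ snd (fst (fst q))}
       (d-all {t = nat} {Q = λ q → digit (nth (fst (snd (fst (fst q)))) (snd (fst q))) (snd q) ≡ 1 →
        pair (snd (fst q)) (snd q) List.∈ fst (fst (fst (fst q))) ++ snd (fst (fst (fst q)))}
        (d-imp (d-≡ nat (digitC (nthC (fstC (sndC (fstC (fstC idC)))) (sndC (fstC idC))) (sndC idC)) (constC nat 1))
         (d-∈ nat (opC₂ v-pair (sndC (fstC idC)) (sndC idC))
          (appendC (fstC (fstC (fstC (fstC idC)))) (sndC (fstC (fstC (fstC idC)))))))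
        (belowC (nthC (fstC (sndC (fstC idC))) (sndC idC))))
       (constC (list nat) (below d)))
      (d-all {t = nat} {Q = λ q → digit (nth (fst (snd (fst q))) (π₁ (snd q))) (π₂ (snd q)) ≡ 1}
       (d-≡ nat (digitC (nthC (fstC (sndC (fstC idC))) (opC₁ v-π₁ (sndC idC))) (opC₁ v-π₂ (sndC idC))) (constC nat 1))
       (appendC (fstC (fstC idC)) (sndC (fstC idC))))))

   module Pair (xs ls : List ℕ) (n m : ℕ) (xs∈ : xs List.∈ tup n rs) (ls∈ : ls List.∈ tup m (concatMap kd xs)) where
    levels : ℕ → List ℕ
    levels zero = xs
    levels (suc zero) = ls
    levels (suc (suc _)) = []

    heights : ℕ → ℕ
    heights zero = n
    heights (suc _) = m

    above : ∀ j → [ suc j ] <⁺ [ 2 ] → Pointwise (Desc tree (heights (suc j))) (concatMap kd (levels j)) (levels (suc j))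
    above zero    _ = ∈tup⁻ m (concatMap kd xs) ls∈
    above (suc j) [ s≤s (s≤s ()) ]

    open FromLevels [ 2 ] [ s≤s z≤n ] levels heights (∈tup⁻ n rs xs∈) above public

    members⁻ : ∀ {i σ} → S i σ → node i σ List.∈ xs ++ ls
    members⁻ (zero , _ , σ∈) = ∈-++⁺ˡ σ∈
    members⁻ (suc zero , _ , σ∈) = ∈-++⁺ʳ xs σ∈
    members⁻ (suc (suc _) , _ , ())

    members⁺ : ∀ {i σ} → node i σ List.∈ xs ++ ls → S i σ
    members⁺ σ∈ = [ (λ p → 0 , [ s≤s z≤n ] , p) , (λ p → 1 , [ s≤s (s≤s z≤n) ] , p) ]′ (∈-++⁻ xs σ∈)

    decoded : ∀ {x} → x List.∈ xs ++ ls → ∃[ i ] ∃[ σ ] x ≡ node i σ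
    decoded x∈ = go (∈-++⁻ xs x∈)
     where
     go : ∀ {x} → x List.∈ xs ⊎ x List.∈ ls → ∃[ i ] ∃[ σ ] x ≡ node i σ
     go (inj₁ p) = let i , σ , e , _ = node-of 0 [ s≤s z≤n ] p in i , σ , e
     go (inj₂ p) = let i , σ , e , _ = node-of 1 [ s≤s (s≤s z≤n) ] p in i , σ , e

    finite : ∀ i → Finite (S i)
    finite i = map (str ∘ π₂) (xs ++ ls) , λ {σ} σ∈ → subst (List._∈ map (str ∘ π₂) (xs ++ ls))
     (trans (cong str (π₂-pair (toℕ i) (encode σ))) (str-encode σ)) (∈-map⁺ (str ∘ π₂) (members⁻ {i} {σ} σ∈))

    valued : ∃[ w ] Value ((xs , ls) , w)
    valued =
     let us , v , c , h = indexed S finite strong in (us , v) , c ,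
     (λ {i} i∈ {e} _ dg → subst₂ (λ a b → pair a b List.∈ xs ++ ls) (toℕ-fromℕ< (∈-below⁻ i∈)) (encode-str e)
      (members⁻ {Fin.fromℕ< (∈-below⁻ i∈)} {str e} (snd (h (Fin.fromℕ< (∈-below⁻ i∈)) (str e))
       (subst₂ (λ a b → digit (nth us a) b ≡ 1) (sym (toℕ-fromℕ< (∈-below⁻ i∈))) (sym (encode-str e)) dg)))) ,
     λ {x} x∈ → let i , σ , e = decoded x∈ in subst (λ x → digit (nth us (π₁ x)) (π₂ x) ≡ 1) (sym e)
      (subst₂ (λ a b → digit (nth us a) b ≡ 1) (sym (π₁-pair (toℕ i) (encode σ))) (sym (π₂-pair (toℕ i) (encode σ)))
       (fst (h i σ) (members⁺ {i} {σ} (subst (List._∈ xs ++ ls) e x∈))))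

   value-exists : ∀ a → ∃[ w ] (Guard a → Value (a , w))
   value-exists a = go a em
    where
    go : ∀ a → Dec (Guard a) → ∃[ w ] (Guard a → Value (a , w))
    go a (no ¬g) = ([] , 0) , λ g → ⊥-elim (¬g g)
    go (xs , ls) (yes ((n , _ , xs∈) , (m , _ , ls∈))) = let w , h = Pair.valued xs ls n m xs∈ ls∈ in w , λ _ → h

   abstract
    values : Σ (List ℕ × List ℕ → List ℕ × ℕ) λ F → Cmp Ab (list nat ⊗ list nat) (list nat ⊗ nat) F × (∀ a → Guard a → Value (a , F a))
    values = search {Ab} {list nat ⊗ list nat} {list nat ⊗ nat} {λ q → Guard (fst q) → Value q} dValue value-exists

   module Colour (values : Σ (List ℕ × List ℕ → List ℕ × ℕ) λ F → Cmp Ab (list nat ⊗ list nat) (list nat ⊗ nat) F × (∀ a → Guard a → Value (a , F a))) where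

    -- Presents `f` as a computable function of the two levels. The default 0 is a colour because
    -- `1 ≤ k`.
    colour : List ℕ → List ℕ → ℕ
    colour xs ls = when (em {Guard (xs , ls)}) (snd (fst values (xs , ls))) 0

    abstract
     colourC : Cmp Ab (list nat ⊗ list nat) nat (λ p → colour (fst p) (snd p))
     colourC = whenC dGuard (sndC (fst (snd values))) (constC nat 0)

    colour< : ∀ xs ls → colour xs ls < k
    colour< xs ls = go em
     where
     go : (g : Dec (Guard (xs , ls))) → when g (snd (fst values (xs , ls))) 0 < k
     go (no _) = 1≤k
     go (yes g) = let w , p , _ , e = coloring⁻ {fst (fst values (xs , ls))} {snd (fst values (xs , ls))} (fst (snd (snd values) (xs , ls) g)) in
      subst (_< k) (sym e) (toℕ<n (Func.to f (finiteTrees w , p)))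

    -- `f` respects equality of sets, so its value at `U` is its value at the finite sets that have
    -- the same nodes and are given by canonical indices.
    colour-value : ∀ {xs ls} → Guard (xs , ls) → ∀ {U} (p : AreStrongSubtrees [ 2 ] T U) →
     (∀ i {σ} → U i σ → node i σ List.∈ xs ++ ls) → (∀ i {σ} → node i σ List.∈ xs ++ ls → U i σ) →
     toℕ (Func.to f (U , p)) ≡ colour xs ls
    colour-value {xs} {ls} g {U} p sub sup = sym (trans (when-yes em g) (go (snd (snd values) (xs , ls) g)))
     where
     us : List ℕ
     us = fst (fst values (xs , ls))
     go : Value ((xs , ls) , fst values (xs , ls)) → snd (fst values (xs , ls)) ≡ toℕ (Func.to f (U , p))
     go (col , inside , all) with coloring⁻ {us} {snd (fst values (xs , ls))} col
     ... | w , q , us≡ , v≡ = trans v≡ (cong toℕ (Func.cong f λ i → (λ {σ} σ∈ → sup i (fwd i σ σ∈)) , λ {σ} σ∈ → bwd i σ (sub i σ∈)))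
      where
      nth≡ : ∀ i → nth us (toℕ i) ≡ lookup w i
      nth≡ i = trans (cong (λ z → nth z (toℕ i)) us≡) (nth-toList w i)
      fwd : ∀ i σ → finiteTrees w i σ → node i σ List.∈ xs ++ ls
      fwd i σ σ∈ = inside (∈-below⁺ (toℕ<n i)) (∈-below⁺ (digit< _ _ dg)) dg
       where
       dg : digit (nth us (toℕ i)) (encode σ) ≡ 1
       dg = subst (λ u → digit u (encode σ) ≡ 1) (sym (nth≡ i)) (fst (digit-set _ σ) σ∈)
      bwd : ∀ i σ → node i σ List.∈ xs ++ ls → finiteTrees w i σ
      bwd i σ σ∈ = snd (digit-set _ σ) (subst (λ u → digit u (encode σ) ≡ 1) (nth≡ i)
       (subst₂ (λ a b → digit (nth us a) b ≡ 1) (π₁-pair (toℕ i) (encode σ)) (π₂-pair (toℕ i) (encode σ)) (all σ∈)))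

   desc-levels : ∀ i {σ τ a b} → σ ⪯ τ → AtLevel (T i) a σ → AtLevel (T i) b τ → Desc tree (b ∸ a) (node i σ) (node i τ)
   desc-levels i {σ} {τ} {a} {b} p lσ lτ = go (desc⁺ {i} (fst lσ) (fst lτ) p)
    where
    go : (∃[ n ] Desc tree n (node i σ) (node i τ)) → Desc tree (b ∸ a) (node i σ) (node i τ)
    go (n , ds) with desc⁻ {i} {σ} {n} (fst lσ) ds
    ... | τ′ , e , _ , _ , l with node-inj {i} {i} e
    ...   | _ , refl = desc-cast (trans (sym (m+n∸m≡n a n)) (cong (_∸ a) (size-unique (snd (l lσ)) (snd lτ)))) ds

   module Solve (C : Pred ℕ 0ℓ) (C≰ : ¬ C ≤T A) (c : List ℕ → List ℕ → ℕ) (c< : ∀ xs ls → c xs ls < k)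
    (cC : Cmp Ab (list nat ⊗ list nat) nat (λ p → c (fst p) (snd p)))
    (c-value : ∀ {xs ls} → Guard (xs , ls) → ∀ {U} (p : AreStrongSubtrees [ 2 ] T U) →
     (∀ i {σ} → U i σ → node i σ List.∈ xs ++ ls) → (∀ i {σ} → node i σ List.∈ xs ++ ls → U i σ) →
     toℕ (Func.to f (U , p)) ≡ c xs ls) where

    open Forcing forest C using (Union; Strong)

    C≰Ab : ¬ C ≤T ⌞ Ab ⌟
    C≰Ab C≤ = C≰ (≤T-trans C≤ oracle-≤T)

    module WithLevels (L : ℕ → Lev) (st : Strong (map (_∷ []) rs) L) (avoid : ¬ C ≤T ⌞ join Ab (oracle (Union L)) ⌟) (i₁ : ℕ)
     (constant : ∀ {j n} → j < n → ∀ {xs} → xs List.∈ prod (L j) → ∀ {ls} → Leaf xs ls → (∀ {z} → z List.∈ ls → z List.∈ concat (L n)) → c xs ls ≡ i₁) where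

     hs : ℕ → ℕ
     hs n = fst (st n)

     open FromLevels ω [ 0 ]<⊤⁺ (λ n → concat (L n)) hs
      (subst (λ z → Pointwise (Desc tree (hs 0)) z (concat (L 0))) (concat-map-[ rs ]) (pw-concat (snd (st 0))))
      (λ n _ → subst (λ z → Pointwise (Desc tree (hs (suc n))) z (concat (L (suc n)))) (concat-concatMap kd (L n)) (pw-concat (snd (st (suc n)))))

     g-mono : ∀ {m n} → m < n → g m < g n
     g-mono {m} {suc n} m< with m≤n⇒m<n∨m≡n (≤-pred m<)
     ... | inj₁ lt = <-trans (g-mono lt) (g< n)
     ... | inj₂ refl = g< n

     g-<⁻ : ∀ {m n} → g m < g n → m < n
     g-<⁻ {m} {n} lt = ≰⇒> λ n≤m → [ (λ q → <-asym lt (g-mono q)) , (λ { refl → <-irrefl refl lt }) ]′ (m≤n⇒m<n∨m≡n n≤m)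

     g-inj : ∀ {m n} → g m ≡ g n → m ≡ n
     g-inj {m} {n} e = ≤-antisym (≮⇒≥ λ lt → <-irrefl (sym e) (g-mono lt)) (≮⇒≥ λ lt → <-irrefl e (g-mono lt))

     abstract
      found : ∀ {i σ l} → S i σ → AtLevel (T i) l σ → ∃[ n ] g n ≡ l × node i σ List.∈ concat (L n)
      found {i} (n , n<α , σ∈) lσ = n , size-unique (snd (lv {i} {n} n<α σ∈)) (snd lσ) , σ∈

      -- `g` is injective, so the level of a node in `T i` determines its index in `L`, in the same
      -- way for all trees.
      at-index : ∀ {i σ l n} → S i σ → AtLevel (T i) l σ → g n ≡ l → node i σ List.∈ concat (L n)
      at-index {i} {σ} σ∈ lσ e = let n , e′ , p = found {i} σ∈ lσ in
       subst (λ n → node i σ List.∈ concat (L n)) (g-inj (trans e′ (sym e))) p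

     -- That `i₁` is below `k` follows only from a colour that is attained, so a default is supplied
     -- for the other case; `picked` excludes it whenever there is something to colour.
     pickColour : Dec (i₁ < k) → Fin k
     pickColour (yes p) = Fin.fromℕ< p
     pickColour (no _) = Fin.fromℕ< 1≤k

     picked : (x : Fin k) (q : Dec (i₁ < k)) → toℕ x ≡ i₁ → x ≡ pickColour q
     picked x (yes p) e = toℕ-injective (trans e (sym (toℕ-fromℕ< p)))
     picked x (no ¬p) e = ⊥-elim (¬p (subst (_< k) e (toℕ<n x)))

     module Member (U : Trees d) (g′ : ℕ → ℕ) (s : ∀ i → IsStrongSubtree [ 2 ] g′ (U i) (T i)) (sub : ∀ i {σ} → U i σ → S i σ) where
      module H (i : Fin d) = Height2 (isTree i) (s i)

      -- One tree determines the indices `n₀` and `n₁`; the common level function of `U` then puts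
      -- the roots and the leaves of all trees on these two levels.
      i₀ : Fin d
      i₀ = Fin.fromℕ< 1≤d

      xs : List ℕ
      xs = map (λ i → node i (H.ρ i)) (allFin d)

      below-roots : Pointwise (Desc tree (g′ 0)) rs xs
      below-roots = go (allFin d)
       where
       go : ∀ is → Pointwise (Desc tree (g′ 0)) (map (λ i → node i (Tr.root i)) is) (map (λ i → node i (H.ρ i)) is)
       go [] = []
       go (i ∷ is) = desc-levels i (Tr.root⪯ i (fst (H.ρ-level i))) (TF.root-level i) (H.ρ-level i) ∷ go is

      ρ∈xs : ∀ i → node i (H.ρ i) List.∈ xs
      ρ∈xs i = ∈-map⁺ (λ i → node i (H.ρ i)) (∈-allFin i)

      abstract
       κ₀ : ∃[ κ ] DirectExtensions (T i₀) (H.ρ i₀) κ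
       κ₀ = leafless′ i₀ (fst (H.ρ-level i₀))

       l₀ : ∃[ l ] U i₀ l × fst κ₀ ⪯ l
       l₀ = H.leaf i₀ (snd κ₀)

      ρ≢ : ∀ i {κ l} → DirectExtensions (T i) (H.ρ i) κ → κ ⪯ l → ¬ H.ρ i ≡ l
      ρ≢ i κd p = snd (≺-⪯-trans (fst (snd κd)) p)

      l₀-level : AtLevel (T i₀) (g′ 1) (fst l₀)
      l₀-level = H.leaf-level i₀ (fst (snd l₀)) (ρ≢ i₀ (snd κ₀) (snd (snd l₀)))

      abstract
       at₀ : ∃[ n ] g n ≡ g′ 0 × node i₀ (H.ρ i₀) List.∈ concat (L n)
       at₀ = found {i₀} (sub i₀ (H.ρ∈ i₀)) (H.ρ-level i₀)

       at₁ : ∃[ n ] g n ≡ g′ 1 × node i₀ (fst l₀) List.∈ concat (L n)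
       at₁ = found {i₀} (sub i₀ (fst (snd l₀))) l₀-level

      n₀ n₁ : ℕ
      n₀ = fst at₀
      n₁ = fst at₁

      n₀<n₁ : n₀ < n₁
      n₀<n₁ = g-<⁻ (subst₂ _<_ (sym (fst (snd at₀))) (sym (fst (snd at₁)))
       (TF.level-< i₀ (≺-⪯-trans (fst (snd (snd κ₀))) (snd (snd l₀))) (H.ρ-level i₀) l₀-level))

      xs⊆ : ∀ {x} → x List.∈ xs → x List.∈ concat (L n₀)
      xs⊆ x∈ = let i , _ , e = ∈-map⁻ (λ i → node i (H.ρ i)) x∈ in
       subst (List._∈ concat (L n₀)) (sym e) (at-index {i} {n = n₀} (sub i (H.ρ∈ i)) (H.ρ-level i) (fst (snd at₀)))

      h : ℕ
      h = g′ 1 ∸ suc (g′ 0)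

      LeafOf : ℕ → ℕ → Set
      LeafOf x y = Desc tree h x y × y List.∈ concat (L n₁) × ∃[ i ] ∃[ σ ] y ≡ node i σ × U i σ

      kid-node : ∀ {x} → x List.∈ concatMap kd xs → ∃[ i ] ∃[ κ ] x ≡ node i κ × DirectExtensions (T i) (H.ρ i) κ
      kid-node x∈ = go (∈-concatMap′ {f = kd} xs x∈)
       where
       go : ∀ {x} → (∃[ y ] y List.∈ xs × x List.∈ kd y) → ∃[ i ] ∃[ κ ] x ≡ node i κ × DirectExtensions (T i) (H.ρ i) κ
       go (y , y∈ , x∈y) with ∈-map⁻ (λ i → node i (H.ρ i)) y∈
       ... | i , _ , refl = let κ , e , κd = kd⁻ {i} (fst (H.ρ-level i)) x∈y in i , κ , e , κd

      abstract
       leaf-above : ∀ i {κ} → DirectExtensions (T i) (H.ρ i) κ → ∃[ l ] LeafOf (node i κ) (node i l)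
       leaf-above i {κ} κd = go (H.leaf i κd)
        where
        go : (∃[ l ] U i l × κ ⪯ l) → ∃[ l ] LeafOf (node i κ) (node i l)
        go (l , l∈ , p) = l , desc-levels i p (TF.kid-level i (H.ρ-level i) κd) (H.leaf-level i l∈ (ρ≢ i κd p)) ,
         at-index {i} {l} {g′ 1} {n₁} (sub i l∈) (H.leaf-level i l∈ (ρ≢ i κd p)) (fst (snd at₁)) , i , l , refl , l∈

       leaf-exists : ∀ {x} → x List.∈ concatMap kd xs → ∃[ y ] LeafOf x y
       leaf-exists {x} x∈ =
        let i , κ , e , κd = kid-node x∈ ; l , h = leaf-above i κd in node i l , subst (λ x → LeafOf x (node i l)) (sym e) h

      chosen : Σ (ℕ → ℕ) λ t → ∀ {x} → x List.∈ concatMap kd xs → LeafOf x (t x)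
      chosen = choose {List._∈ concatMap kd xs} {LeafOf} leaf-exists

      module Leaves′ (t : ℕ → ℕ) (t-leaf : ∀ {x} → x List.∈ concatMap kd xs → LeafOf x (t x)) where
       ls : List ℕ
       ls = map t (concatMap kd xs)

       leaves : Pointwise LeafOf (concatMap kd xs) ls
       leaves = pw-imp∈ (λ {x} x∈ e → subst (LeafOf x) e (t-leaf x∈)) (pw-graph {R = λ x y → t x ≡ y} (λ _ → refl) (concatMap kd xs))

       leaf-descs : Pointwise (Desc tree h) (concatMap kd xs) ls
       leaf-descs = pw-imp fst leaves

       kid∈ : ∀ i {κ} → DirectExtensions (T i) (H.ρ i) κ → node i κ List.∈ concatMap kd xs
       kid∈ i κd = ∈-concatMap {f = kd} {xs = xs} (ρ∈xs i) (kd⁺ {i} (fst (H.ρ-level i)) κd)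

       guard : Guard (xs , ls)
       guard =
        (g′ 0 , s≤s (≤-trans (depth≤ root-depth) (encs-∈ nat (ρ∈xs i₀))) , ∈tup⁺ below-roots) ,
        (let y , y∈ , ds , _ = pw-∈ˡ leaves (kid∈ i₀ (snd κ₀)) in
         h , s≤s (≤-trans (≤-trans (m≤n+m h _) (depth≤ (depth-down (depth-down root-depth (kid (kd⁺ {i₀} (fst (H.ρ-level i₀)) (snd κ₀)))) ds)))
          (encs-∈ nat y∈)) , ∈tup⁺ leaf-descs)
        where
        root-depth : Depth (g′ 0) (node i₀ (H.ρ i₀))
        root-depth = let r , r∈ , ds = pw-∈ʳ below-roots (ρ∈xs i₀) in r , r∈ , ds

       U⊆ : ∀ i {σ} → U i σ → node i σ List.∈ xs ++ ls
       U⊆ i {σ} σ∈ = go em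
        where
        go : Dec (H.ρ i ≡ σ) → node i σ List.∈ xs ++ ls
        go (yes refl) = ∈-++⁺ˡ (ρ∈xs i)
        go (no ne) = leaf-of (H.leaf-kid i σ∈ ne)
         where
         leaf-of : (∃[ κ ] DirectExtensions (T i) (H.ρ i) κ × κ ⪯ σ) → node i σ List.∈ xs ++ ls
         leaf-of (κ , κd , p) = above-κ (pw-∈ˡ leaves (kid∈ i κd))
          where
          above-κ : (∃[ y ] y List.∈ ls × LeafOf (node i κ) y) → node i σ List.∈ xs ++ ls
          above-κ (y , y∈ , ds , _ , j , τ , refl , τ∈) with desc⁻ {i} {κ} {h} (fst κd) ds
          ... | τ′ , e , _ , q , _ with node-inj {j} {i} e
          ...   | refl , refl = ∈-++⁺ʳ xs (subst (λ z → node i z List.∈ ls) (H.leaf-unique i (fst (snd κd)) τ∈ σ∈ q p) y∈)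

       ⊆U : ∀ i {σ} → node i σ List.∈ xs ++ ls → U i σ
       ⊆U i {σ} x∈ = go (∈-++⁻ xs x∈)
        where
        go : node i σ List.∈ xs ⊎ node i σ List.∈ ls → U i σ
        go (inj₁ p) with ∈-map⁻ (λ i → node i (H.ρ i)) p
        ... | j , _ , e with node-inj {i} {j} e
        ...   | refl , refl = H.ρ∈ i
        go (inj₂ p) with pw-∈ʳ leaves p
        ... | _ , _ , _ , _ , j , τ , e , τ∈ with node-inj {i} {j} e
        ...   | refl , refl = τ∈

       -- The roots form a tuple of level `n₀`, and the leaves above their direct extensions belong
       -- to level `n₁`, which is the situation that `constant` covers.
       coloured : toℕ (Func.to f (U , g′ , s)) ≡ i₁
       coloured = trans (c-value guard (g′ , s) U⊆ ⊆U)
        (constant n₀<n₁ (Relocation.relocate forest C C≰Ab c k c< cC L st {n₀} (pw-imp (λ ds → _ , ds) below-roots) xs⊆)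
         (h , leaf-descs) (λ z∈ → let _ , _ , _ , in₁ , _ = pw-∈ʳ leaves z∈ in in₁))

      coloured : toℕ (Func.to f (U , g′ , s)) ≡ i₁
      coloured = Leaves′.coloured (fst chosen) (snd chosen)

     solution : Solution I
     solution = record
      { S = S , strong
      ; color = pickColour em
      ; constant = λ U → picked _ em
       (Member.coloured (fst U) (fst (snd (include (S , strong) U))) (snd (snd (include (S , strong) U)))
        (λ i → IsStrongSubtree.⊆T (snd (snd U) i)))
      }

     -- The solution and the union of the levels have the same nodes, so the code of the solution is
     -- computable from an oracle that does not compute `C`.
     solution-avoids : ¬ C ≤T (A ⊕ codeSolution solution)
     solution-avoids C≤ = avoid (≤T-trans C≤ (≤T-trans ⊕-≤T (⊑-join (⊑-joinˡ Ab (oracle (Union L)))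
      (≤T-trans oracle-≤T (≤T-trans (≤T-iff λ x →
       (λ { (i , σ , (n , _ , σ∈) , refl) → n , σ∈ }) ,
       λ { (n , x∈) → let i , σ , e , _ = node-of n [ n ]<⊤⁺ x∈ in i , σ , (n , [ n ]<⊤⁺ , subst (List._∈ concat (L n)) e x∈) , e })
       (≤T-trans ≤T-oracle (⊑-joinʳ Ab (oracle (Union L)))))))))

    theorem : Σ (Solution I) λ Y → ¬ C ≤T (A ⊕ codeSolution Y)
    theorem =
     let L , st , avoid , i₁ , const = Homogeneous.theorem forest C C≰Ab c k c< cC
     in WithLevels.solution L st avoid i₁ const , WithLevels.solution-avoids L st avoid i₁ const

  cone-avoidance : (A C : Pred ℕ 0ℓ) → ¬ C ≤T A → (I : Instance 2) → codeInstance I ≤T A →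
   Σ (Solution I) λ Y → ¬ C ≤T (A ⊕ codeSolution Y)
  cone-avoidance A C C≰ I code≤ = Tf.Solve.theorem C C≰ Co.colour Co.colour< Co.colourC Co.colour-value
   where
   module Tf = Transfer A I code≤ (InstanceForest.certificates A I code≤)
   module Co = Tf.Colour Tf.values

theorem4p15 : ExcludedMiddle 0ℓ →
  (A C : Pred ℕ 0ℓ) → ¬ (C ≤T A) →
  (I : Instance 2) → codeInstance I ≤T A →
  Σ (Solution I) (λ Y → ¬ (C ≤T (A ⊕ codeSolution Y)))
theorem4p15 em A C C≰A I I≤A = Classical.ConeAvoidance.cone-avoidance em A C C≰A I I≤A
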